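{- Fix an integer $p\ge3$. The generating function $F(z,u)$ of $p$-valent forested maps is D-algebraic with respect to $z$: there exist $k\ge1$ and a nonzero polynomial $P$ with coefficients in $\mathbb{Q}(u)$ such that $P\big(z,F,\partial_zF,\dots,\partial_z^kF\big)=0$. The same holds for the generating function $G(z,u)$ of quasi-$p$-valent forested maps (when $p$ is odd) and for the generating function $H(z,u)$ of $p$-valent forested maps whose root edge is not in the forest.
   Context: A planar map is a proper embedding of a connected graph (loops and multiple edges allowed) in the oriented sphere, up to continuous deformation; faces are the components of the complement. A corner is a pair of half-edges at a common vertex, the second immediately following the first counterclockwise; rooted maps have a marked corner; the root vertex is the vertex of that corner, the root half-edge is the second half-edge of the corner, and the root edge is the edge containing it. A map is $p$-valent if all vertices have degree $p$. A forested map is a rooted map $M$ together with a spanning forest $F$ (a subset of edges without cycles; its components, including isolated vertices, are trees); the root component is the component containing the root vertex. $F(z,u)=\sum z^{\mathrm{f}(M)}u^{\mathrm{c}(F)-1}$ over $p$-valent forested maps, $\mathrm{f}$ = number of faces, $\mathrm{c}$ = number of components. A map is quasi-$p$-valent if all vertices have degree $p$ except one vertex of degree 1 (such maps exist only for $p$ odd); it is rooted at the unique corner of that degree-1 vertex. $G(z,u)=\sum z^{\mathrm{f}(M)}u^{\mathrm{c}(F)-1}$ over quasi-$p$-valent forested maps. $H(z,u)$ is the same sum as $F$ restricted to $p$-valent forested maps whose root edge does not belong to $F$. -}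

module Defs where

open import Data.Nat as ℕ using (ℕ; zero; suc; _+_; _*_; _∸_; _≤_; _≤ᵇ_; _!)
open import Data.Nat.Properties using (_!≢0)
open import Data.Nat.DivMod using (_/_)
open import Data.Integer as ℤ using (ℤ)
open import Data.Fin as Fin using (Fin; toℕ)
open import Data.Bool using (Bool; true; false; _∧_; _∨_; not)
open import Data.List as List using (List; []; _∷_; upTo; allFin; concatMap)
open import Data.Vec.Functional as VF using (Vector)
open import Data.Product using (_×_; _,_; ∃; ∃-syntax)
open import Relation.Nullary.Decidable using (⌊_⌋)
open import Relation.Binary.PropositionalEquality using (_≡_; _≢_)

_=ᶠ_ : ∀ {n} → Fin n → Fin n → Bool
g =ᶠ h = ⌊ g Fin.≟ h ⌋

allF : (n : ℕ) → (Fin n → Bool) → Bool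
allF zero    P = true
allF (suc n) P = P Fin.zero ∧ allF n (λ i → P (Fin.suc i))

anyF : (n : ℕ) → (Fin n → Bool) → Bool
anyF zero    P = false
anyF (suc n) P = P Fin.zero ∨ anyF n (λ i → P (Fin.suc i))

countL : ∀ {A : Set} → (A → Bool) → List A → ℕ
countL P []       = 0
countL P (x ∷ xs) = (if P x then 1 else 0) + countL P xs
  where open import Data.Bool using (if_then_else_)

allL : ∀ {A : Set} → (A → Bool) → List A → Bool
allL P []       = true
allL P (x ∷ xs) = P x ∧ allL P xs

sumℕ : List ℕ → ℕ
sumℕ = List.foldr _+_ 0

countF : (n : ℕ) → (Fin n → Bool) → ℕ
countF n P = countL P (allFin n)

funs : ∀ {X : Set} (k : ℕ) → List X → List (Fin k → X)
funs zero    xs = (λ ()) ∷ []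
funs (suc k) xs = concatMap (λ x → List.map (λ g → x VF.∷ g) (funs k xs)) xs

iter : ∀ {n} → (Fin n → Fin n) → ℕ → Fin n → Fin n
iter π zero    h = h
iter π (suc j) h = π (iter π j h)

closure : ∀ {n} → (Fin n → Fin n → Bool) → ℕ → (Fin n → Bool) → (Fin n → Bool)
closure adj zero    S = S
closure {n} adj (suc k) S =
  closure adj k (λ h → S h ∨ anyF n (λ g → S g ∧ adj g h))

reach : ∀ {n} → (Fin n → Fin n → Bool) → Fin n → Fin n → Bool
reach {n} adj g h = closure adj n (λ x → x =ᶠ g) h

-- Combinatorial maps on half-edges Fin n:
--   σ : rotation (counterclockwise order of half-edges around vertices),
--   α : fixed-point-free involution (edges),
--   faces = cycles of σ ∘ α.

isPerm : ∀ {n} → (Fin n → Fin n) → Bool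
isPerm {n} σ = allF n (λ g → allF n (λ h → not (σ g =ᶠ σ h) ∨ (g =ᶠ h)))

isFPFInvolution : ∀ {n} → (Fin n → Fin n) → Bool
isFPFInvolution {n} α = allF n (λ h → (α (α h) =ᶠ h) ∧ not (α h =ᶠ h))

-- number of cycles of a permutation: count elements minimal in their cycle
numCycles : ∀ {n} → (Fin n → Fin n) → ℕ
numCycles {n} π = countF n (λ h → allL (λ j → toℕ h ≤ᵇ toℕ (iter π j h)) (upTo n))

-- the vertex (σ-cycle) containing h has degree exactly d (d ≥ 1)
hasDeg : ∀ {n} → (Fin n → Fin n) → ℕ → Fin n → Bool
hasDeg σ d h = (iter σ d h =ᶠ h)
             ∧ allL (λ j → not (iter σ (suc j) h =ᶠ h)) (upTo (d ∸ 1))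

isConnected : ∀ {n} → (Fin n → Fin n) → (Fin n → Fin n) → Fin n → Bool
isConnected {n} σ α r = allF n (reach (λ g h → (σ g =ᶠ h) ∨ (α g =ᶠ h)) r)

-- genus 0 (Euler's formula  V - E + F = 2, with E = n/2)
isPlanar : ∀ {n} → (Fin n → Fin n) → (Fin n → Fin n) → Bool
isPlanar {n} σ α = ⌊ (2 * numCycles σ + 2 * numCycles (λ h → σ (α h))) ℕ.≟ (n + 4) ⌋

-- Edge subsets, encoded as α-invariant subsets of half-edges

isEdgeSubset : ∀ {n} → (Fin n → Fin n) → (Fin n → Bool) → Bool
isEdgeSubset {n} α S = allF n (λ h → ⌊ S h Data.Bool.≟ S (α h) ⌋)
  where import Data.Bool

adjSub : ∀ {n} → (Fin n → Fin n) → (Fin n → Fin n) → (Fin n → Bool) → Fin n → Fin n → Bool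
adjSub σ α S g h = (σ g =ᶠ h) ∨ (S g ∧ (α g =ᶠ h))

-- S has no cycle: for every edge {h, α h} of S, its two endpoints are not
-- connected in S minus that edge (covers loops and multiple edges)
isForest : ∀ {n} → (Fin n → Fin n) → (Fin n → Fin n) → (Fin n → Bool) → Bool
isForest {n} σ α S =
  allF n (λ h → not (S h) ∨
    not (reach (adjSub σ α (λ g → S g ∧ not (g =ᶠ h) ∧ not (g =ᶠ α h))) h (α h)))

-- number of connected components of the spanning subgraph (including
-- isolated vertices): half-edges minimal in their component
numComponents : ∀ {n} → (Fin n → Fin n) → (Fin n → Fin n) → (Fin n → Bool) → ℕ
numComponents {n} σ α S =
  countF n (λ h → allF n (λ g → not (reach (adjSub σ α S) h g) ∨ (toℕ h ≤ᵇ toℕ g)))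

-- Labelled forested maps: (σ, α, root half-edge, forest)

Labelled : ℕ → Set
Labelled n = (Fin n → Fin n) × (Fin n → Fin n) × Fin n × (Fin n → Bool)

allLabelled : (n : ℕ) → List (Labelled n)
allLabelled n =
  concatMap (λ σ → concatMap (λ α → concatMap (λ r → List.map (λ S → (σ , α , r , S))
    (funs n (false ∷ true ∷ []))) (allFin n)) (funs n (allFin n))) (funs n (allFin n))

data Family : Set where
  pValent      : Family
  quasiPValent : Family
  rootNotInF   : Family

degreeCond : Family → (p : ℕ) → ∀ {n} → (Fin n → Fin n) → Fin n → Bool
degreeCond pValent      p {n} σ r = allF n (hasDeg σ p)
degreeCond quasiPValent p {n} σ r = hasDeg σ 1 r ∧ allF n (λ h → (h =ᶠ r) ∨ hasDeg σ p h)
degreeCond rootNotInF   p {n} σ r = allF n (hasDeg σ p)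

extraCond : Family → ∀ {n} → Fin n → (Fin n → Bool) → Bool
extraCond rootNotInF r S = not (S r)
extraCond _          r S = true

valid : Family → (p : ℕ) → (f m : ℕ) → ∀ {n} → Labelled n → Bool
valid fam p f m {n} (σ , α , r , S) =
  isPerm σ ∧ isFPFInvolution α ∧ isConnected σ α r ∧ isPlanar σ α
  ∧ degreeCond fam p σ r ∧ extraCond fam r S
  ∧ isEdgeSubset α S ∧ isForest σ α S
  ∧ ⌊ numCycles (λ h → σ (α h)) ℕ.≟ f ⌋
  ∧ ⌊ numComponents σ α S ℕ.≟ suc m ⌋

-- number of rooted forested maps (up to isomorphism) with n half-edges:
-- relabellings act freely on rooted connected labelled maps, so it is the
-- labelled count divided by n!
countRooted : Family → (p f m n : ℕ) → ℕ
countRooted fam p f m n = (countL (valid fam p f m) (allLabelled n) / (n !)) {{n !≢0}}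

-- Formal power series in z with coefficients in ℤ[u]:
-- S a m = coefficient of z^a u^m

Ser : Set
Ser = ℕ → ℕ → ℤ

-- Generating function  Σ z^{faces} u^{components - 1}.
-- For p ≥ 3 a map in any of the families with f faces has at most
-- 2 p f + 1 half-edges (Euler's formula), so the sum over n is complete.
GF : Family → ℕ → Ser
GF fam p f m = ℤ.+ sumℕ (List.map (countRooted fam p f m) (upTo (suc (2 * p * f + 1))))

Fgf Ggf Hgf : ℕ → Ser
Fgf = GF pValent
Ggf = GF quasiPValent
Hgf = GF rootNotInF

sumℤ : List ℤ → ℤ
sumℤ = List.foldr ℤ._+_ (ℤ.+ 0)

0ₛ 1ₛ : Ser
0ₛ a m = ℤ.+ 0
1ₛ zero zero = ℤ.+ 1
1ₛ _    _    = ℤ.+ 0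

_+ₛ_ : Ser → Ser → Ser
(A +ₛ B) a m = A a m ℤ.+ B a m

_*ₛ_ : Ser → Ser → Ser
(A *ₛ B) a m = sumℤ (List.map (λ i → sumℤ (List.map (λ j →
  A i j ℤ.* B (a ∸ i) (m ∸ j)) (upTo (suc m)))) (upTo (suc a)))

mono : ℤ → ℕ → ℕ → Ser
mono c a m a' m' = if (a ℕ.≡ᵇ a') ∧ (m ℕ.≡ᵇ m') then c else ℤ.+ 0
  where open import Data.Bool using (if_then_else_)

powₛ : Ser → ℕ → Ser
powₛ A zero    = 1ₛ
powₛ A (suc j) = A *ₛ powₛ A j

∂z : Ser → Ser
∂z A a m = ℤ.+ (suc a) ℤ.* A (suc a) m

∂z^ : ℕ → Ser → Ser
∂z^ zero    A = A
∂z^ (suc i) A = ∂z (∂z^ i A)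

prodF : (k : ℕ) → (Fin k → Ser) → Ser
prodF zero    T = 1ₛ
prodF (suc k) T = T Fin.zero *ₛ prodF k (λ i → T (Fin.suc i))

sumₛ : List Ser → Ser
sumₛ = List.foldr _+ₛ_ 0ₛ

-- A polynomial P(z, y₀, …, y_k) with coefficients in ℤ[u], all exponents
-- (of z, of the yᵢ and of u) at most D:
-- coef a e m = coefficient of u^m z^a y₀^{e 0} ⋯ y_k^{e k}.
PolyCoeffs : ℕ → ℕ → Set
PolyCoeffs k D = Fin (suc D) → (Fin (suc k) → Fin (suc D)) → Fin (suc D) → ℤ

evalP : (k D : ℕ) → PolyCoeffs k D → Ser → Ser
evalP k D c A = sumₛ (List.map (λ a → sumₛ (List.map (λ e → sumₛ (List.map (λ m →
    mono (c a e m) (toℕ a) (toℕ m) *ₛ prodF (suc k) (λ i → powₛ (∂z^ (toℕ i) A) (toℕ (e i))))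
  (allFin (suc D)))) (funs (suc k) (allFin (suc D))))) (allFin (suc D)))

-- D-algebraic in z over ℚ(u) (denominators cleared: coefficients in ℤ[u])
DAlgebraic : Ser → Set
DAlgebraic A =
  ∃[ k ] (1 ≤ k) × ∃[ D ] ∃[ c ]
    (∃[ a ] ∃[ e ] ∃[ m ] (c a e m ≢ ℤ.+ 0))
    × (∀ n m → evalP k D c A n m ≡ ℤ.+ 0)

-- Explore a map from its root, deciding for one half-edge of the current tree at a time whether it belongs to the
-- forest (a new vertex then joins the tree), meets an earlier or later half-edge of the same tree, or leads to a new
-- tree. This gives a recursion that determines the generating functions, and the recursion is solved by constant terms.
-- Let X = t + S + ρ with t ρ = R, let T = X + T^(p-1) be the series of trees, Y = T^(p-1), and let CT be the constant
-- term in t; then S = u CT Y, R = z + u CT (t Y), and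
--   ∂F/∂z = CT (T^p),  ∂G/∂z = CT T,  ∂H/∂z = CT (Y X).
-- With e = dT/dX, every further z-derivative is a rational expression in u, z, R, S and the moments CT (T^i e^l), the
-- bound on l growing by 2 each time. For a fixed bound, integration by parts in t (the constant term of t d/dt of a
-- series vanishes) reduces the moments to CT (T^i e^l) with i < 3p - 4 for the largest l, and one exceptional i: their
-- number does not depend on the bound. So all derivatives lie in fields generated by n elements with n fixed, and
-- u, ∂F, …, ∂^n F are algebraically dependent over ℤ by counting monomials.

module Submission where

open import Data.Bool as Bool using (Bool; true; false; if_then_else_)
open import Data.Empty using (⊥; ⊥-elim)
open import Data.Fin as Fin using (Fin; zero; suc; toℕ)
open import Data.Fin.Properties using (toℕ-injective; toℕ<n; toℕ-fromℕ<)
open import Data.Integer as ℤ using (ℤ)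
import Data.Integer.Properties as ℤP
import Data.Integer.Solver
open import Data.List as List using (List; []; _∷_; _++_; length; allFin; upTo; concatMap)
import Data.List.Properties as ListP
open import Data.List.Membership.Propositional using (_∈_)
open import Data.List.Relation.Unary.All as All using (All; []; _∷_)
open import Data.List.Relation.Unary.AllPairs as AllPairs using (AllPairs; []; _∷_)
open import Data.List.Relation.Unary.Any as Any using (Any; here; there)
open import Data.List.Relation.Unary.Unique.Propositional using (Unique)
import Data.List.Relation.Unary.Unique.Propositional.Properties as UniqueP
open import Data.Nat as ℕ using (ℕ; zero; suc; _≤_; _<_; z≤n; s≤s)
import Data.Nat.Properties as ℕP
open import Data.Nat.Solver using (module +-*-Solver)
open import Data.Product using (_,_; proj₁; proj₂; ∃; Σ)
open import Data.Sum using (_⊎_; inj₁; inj₂)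
import Data.Vec.Functional as VF
open import Function using (_∘_; id)
open import Relation.Nullary using (¬_; Dec; yes; no)
open import Relation.Nullary.Decidable using (⌊_⌋)
open import Relation.Binary.PropositionalEquality as ≡ using (_≡_; _≢_)
import Relation.Binary.Reasoning.Setoid as SetoidReasoning

-- The term that splits a word makes the recursion quadratic, a loop equation. It is solved by
-- residues: with ω the part of V = X - u Y with negative powers of t and ω̃ the part with positive
-- ones, the series `w j k` = CT (T^j X^k y ω), where y = t dX/dt, satisfy it. For X ω = ω² + ω̃ ω +
-- u Y ω, the residues of ω² are convolutions of those of ω, and the mixed term contributes nothing.
-- The equations for S and R are what makes V free of a constant term and `w 0 0` equal to z. The
-- Jacobian of X and ω with respect to log t and log z is the scalar z, so ω disappears on
-- differentiation; this is why ∂F and not F is a constant term in T. The combinatorial side fixes a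
-- rotation and reveals the gluing and the forest one half-edge at a time. A new vertex can be
-- entered through any undiscovered half-edge, so a labelled count is a coefficient times `choices`,
-- and the number of rotations completes this factor to n!. Planarity becomes an invariant on the
-- cycles of σ α: a new vertex merges two of them, every other edge has to split one.

module Recursions where

 open import Data.Nat using (_+_; _*_)
 open import Data.Integer using (+_)
 open import Data.Nat.ListAction using (sum)

 splitSum : (ℕ → ℕ → ℤ) → ℕ → ℕ → ℤ
 splitSum F i zero    = + 0
 splitSum F i (suc j) = F i j ℤ.+ splitSum F (suc i) j

 delay : (ℕ → ℤ) → ℕ → ℤ
 delay F zero    = + 0
 delay F (suc m) = F m

 -- N j k st is the generating function of the ways to complete an exploration, in the variables
 -- z (faces, index a) and u (trees met later, index m).
 record SeriesRecursion (p' : ℕ) (N : ℕ → ℕ → List ℕ → ℕ → ℕ → ℤ) : Set where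
  field
   undecided : ∀ j k st a m → N (suc j) k st a m ≡ N j (suc k) st a m ℤ.+ N (suc (suc p') + j) k st a m
   -- `splitSum F 0 k` runs over i + l = k - 1: the half-edge meets another one of its word and cuts
   -- the word in two. Otherwise it enters a vertex of a new tree, with p - 1 = `suc (suc p')`
   -- further half-edges; `delay` is the factor u.
   decided   : ∀ k st a m → N 0 (suc k) st a m ≡ splitSum (λ i l → N 0 i (l ∷ st) a m) 0 k ℤ.+ delay (N (suc (suc p')) k st a) m
   pop       : ∀ k st a m → N 0 0 (k ∷ st) (suc a) m ≡ N 0 k st a m
   end       : N 0 0 [] 1 0 ≡ + 1
   end'      : ∀ m → N 0 0 [] 1 (suc m) ≡ + 0
   end''     : ∀ a m → N 0 0 [] (suc (suc a)) m ≡ + 0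
   -- Euler's relation: if w vertices and e edges are still to come, then 2 e = j + k + sum st + w p
   -- and a + w = 1 + length st + e. Eliminating e leaves this equation, with p - 2 = `suc p'`.
   vanish    : ∀ j k st a m → (∀ w → a + a ≢ 2 + (length st + length st) + (j + k + sum st) + w * suc p') → N j k st a m ≡ + 0

-- Power series over a commutative ring.

module PowerSeries where

 open import Level using (0ℓ)
 open import Algebra.Bundles using (CommutativeRing)
 open import Data.Integer using (+_; -[1+_])
 open import Data.Maybe using (Maybe; just; nothing)
 import Algebra.Properties.Ring
 import Algebra.Properties.Semiring.Mult
 import Algebra.Solver.Ring
 import Algebra.Solver.Ring.AlmostCommutativeRing as ACR

 CRing : Set₁
 CRing = CommutativeRing 0ℓ 0ℓ

 -- A ring solver with integer coefficients for an arbitrary commutative ring.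
 module IntegerSolver (R : CRing) where
  open CommutativeRing R
  open Algebra.Properties.Ring ring
  open Algebra.Properties.Semiring.Mult semiring
  open SetoidReasoning setoid

  int : ℤ → Carrier
  int (+ n)    = n × 1#
  int -[1+ n ] = - (suc n × 1#)

  private
   neg-sum : ∀ x y → - (x + y) ≈ - x + - y
   neg-sum x y = trans (-‿cong (+-comm x y)) (-‿anti-homo-+ y x)

   cancel : ∀ a x y → (a + x) + - (a + y) ≈ x + - y
   cancel a x y = begin
    (a + x) + - (a + y)     ≈⟨ +-cong (+-comm a x) (neg-sum a y) ⟩
    (x + a) + (- a + - y)   ≈⟨ +-assoc x a _ ⟩
    x + (a + (- a + - y))   ≈⟨ +-congˡ (sym (+-assoc a (- a) (- y))) ⟩
    x + ((a + - a) + - y)   ≈⟨ +-congˡ (trans (+-congʳ (-‿inverseʳ a)) (+-identityˡ (- y))) ⟩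
    x + - y ∎

   int-⊖ : ∀ m n → int (m ℤ.⊖ n) ≈ m × 1# + - (n × 1#)
   int-⊖ zero    zero    = sym (trans (+-congˡ -0#≈0#) (+-identityʳ 0#))
   int-⊖ zero    (suc n) = sym (+-identityˡ _)
   int-⊖ (suc m) zero    = sym (trans (+-congˡ -0#≈0#) (+-identityʳ _))
   int-⊖ (suc m) (suc n) = trans (reflexive (≡.cong int (ℤP.[1+m]⊖[1+n]≡m⊖n m n))) (trans (int-⊖ m n) (sym (cancel 1# (m × 1#) (n × 1#))))

  int-+ : ∀ a b → int (a ℤ.+ b) ≈ int a + int b
  int-+ (+ m)    (+ n)    = ×-homo-+ 1# m n
  int-+ (+ m)    -[1+ n ] = int-⊖ m (suc n)
  int-+ -[1+ m ] (+ n)    = trans (int-⊖ n (suc m)) (+-comm _ _)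
  int-+ -[1+ m ] -[1+ n ] = begin
   - (suc (suc (m ℕ.+ n)) × 1#) ≈⟨ -‿cong (reflexive (≡.cong (λ k → suc k × 1#) (≡.sym (ℕP.+-suc m n)))) ⟩
   - ((suc m ℕ.+ suc n) × 1#) ≈⟨ -‿cong (×-homo-+ 1# (suc m) (suc n)) ⟩
   - (suc m × 1# + suc n × 1#) ≈⟨ neg-sum _ _ ⟩
   - (suc m × 1#) + - (suc n × 1#) ∎

  int-neg : ∀ a → int (ℤ.- a) ≈ - int a
  int-neg (+ zero)    = sym -0#≈0#
  int-neg (+ (suc n)) = refl
  int-neg -[1+ n ]    = sym (-‿involutive _)

  private
   nat-* : ∀ m n → (m ℕ.* n) × 1# ≈ m × 1# * n × 1#
   nat-* m n = begin
    (m ℕ.* n) × 1# ≈⟨ sym (×-assocˡ 1# m n) ⟩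
    m × (n × 1#) ≈⟨ ×-congʳ m (sym (*-identityˡ (n × 1#))) ⟩
    m × (1# * n × 1#) ≈⟨ sym (×-assoc-* m 1# (n × 1#)) ⟩
    m × 1# * n × 1# ∎

  int-* : ∀ a b → int (a ℤ.* b) ≈ int a * int b
  int-* (+ m)    (+ n)    = trans (reflexive (≡.cong int (≡.sym (ℤP.pos-* m n)))) (nat-* m n)
  int-* (+ m)    -[1+ n ] = begin
   int (+ m ℤ.* -[1+ n ]) ≈⟨ reflexive (≡.cong int (≡.trans (≡.sym (ℤP.neg-distribʳ-* (+ m) (+ suc n))) (≡.cong ℤ.-_ (≡.sym (ℤP.pos-* m (suc n)))))) ⟩
   int (ℤ.- (+ (m ℕ.* suc n))) ≈⟨ int-neg (+ (m ℕ.* suc n)) ⟩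
   - ((m ℕ.* suc n) × 1#) ≈⟨ -‿cong (nat-* m (suc n)) ⟩
   - (m × 1# * suc n × 1#) ≈⟨ -‿distribʳ-* _ _ ⟩
   m × 1# * - (suc n × 1#) ∎
  int-* -[1+ m ] (+ n) = begin
   int (-[1+ m ] ℤ.* + n) ≈⟨ reflexive (≡.cong int (≡.trans (≡.sym (ℤP.neg-distribˡ-* (+ suc m) (+ n))) (≡.cong ℤ.-_ (≡.sym (ℤP.pos-* (suc m) n))))) ⟩
   int (ℤ.- (+ (suc m ℕ.* n))) ≈⟨ int-neg (+ (suc m ℕ.* n)) ⟩
   - ((suc m ℕ.* n) × 1#) ≈⟨ -‿cong (nat-* (suc m) n) ⟩
   - (suc m × 1# * n × 1#) ≈⟨ -‿distribˡ-* _ _ ⟩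
   - (suc m × 1#) * n × 1# ∎
  int-* -[1+ m ] -[1+ n ] = begin
   (suc m ℕ.* suc n) × 1# ≈⟨ nat-* (suc m) (suc n) ⟩
   suc m × 1# * suc n × 1# ≈⟨ sym (-‿involutive _) ⟩
   - - (suc m × 1# * suc n × 1#) ≈⟨ -‿cong (-‿distribˡ-* _ _) ⟩
   - (- (suc m × 1#) * suc n × 1#) ≈⟨ -‿distribʳ-* _ _ ⟩
   - (suc m × 1#) * - (suc n × 1#) ∎

  private
   morphism : ℤ.+-*-rawRing ACR.-Raw-AlmostCommutative⟶ ACR.fromCommutativeRing R
   morphism = record { ⟦_⟧ = int ; +-homo = int-+ ; *-homo = int-* ; -‿homo = int-neg
            ; 0-homo = refl ; 1-homo = +-identityʳ 1# }

   dec : ∀ a b → Maybe (int a ≈ int b)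
   dec a b with a ℤP.≟ b
   ... | yes e = just (reflexive (≡.cong int e))
   ... | no _  = nothing

  open Algebra.Solver.Ring ℤ.+-*-rawRing (ACR.fromCommutativeRing R) morphism dec public
   using (solve; _:=_; _:+_; _:*_; :-_; _:-_; con; _:^_)

 module Series (R : CRing) where
  open CommutativeRing R
  open Algebra.Properties.Ring ring using (-0#≈0#)
  open SetoidReasoning setoid

  Ser' : Set
  Ser' = ℕ → Carrier

  mul : Ser' → Ser' → Ser'
  mul f g zero    = f 0 * g 0
  mul f g (suc n) = f 0 * g (suc n) + mul (f ∘ suc) g n

  one : Ser'
  one zero    = 1#
  one (suc _) = 0#

  mul-cong : ∀ {f f' g g'} → (∀ n → f n ≈ f' n) → (∀ n → g n ≈ g' n) → ∀ n → mul f g n ≈ mul f' g' n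
  mul-cong p q zero    = *-cong (p 0) (q 0)
  mul-cong p q (suc n) = +-cong (*-cong (p 0) (q (suc n))) (mul-cong (p ∘ suc) q n)

  private
   swap4 : ∀ a b c d → (a + b) + (c + d) ≈ (a + c) + (b + d)
   swap4 a b c d = begin
    (a + b) + (c + d) ≈⟨ +-assoc a b _ ⟩
    a + (b + (c + d)) ≈⟨ +-congˡ (trans (sym (+-assoc b c d)) (trans (+-congʳ (+-comm b c)) (+-assoc c b d))) ⟩
    a + (c + (b + d)) ≈⟨ sym (+-assoc a c _) ⟩
    (a + c) + (b + d) ∎

  mul-distribʳ : ∀ f g h n → mul (λ i → f i + g i) h n ≈ mul f h n + mul g h n
  mul-distribʳ f g h zero    = distribʳ _ _ _
  mul-distribʳ f g h (suc n) = trans (+-cong (distribʳ _ _ _) (mul-distribʳ (f ∘ suc) (g ∘ suc) h n)) (swap4 _ _ _ _)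

  mul-scale : ∀ c f g n → mul (λ i → c * f i) g n ≈ c * mul f g n
  mul-scale c f g zero    = *-assoc _ _ _
  mul-scale c f g (suc n) = trans (+-cong (*-assoc _ _ _) (mul-scale c (f ∘ suc) g n)) (sym (distribˡ _ _ _))

  mul-zeroˡ : ∀ {f} g → (∀ n → f n ≈ 0#) → ∀ n → mul f g n ≈ 0#
  mul-zeroˡ g q zero    = trans (*-congʳ (q 0)) (zeroˡ _)
  mul-zeroˡ g q (suc n) = trans (+-cong (trans (*-congʳ (q 0)) (zeroˡ _)) (mul-zeroˡ g (q ∘ suc) n)) (+-identityʳ 0#)

  mul-last : ∀ f g n → mul f g (suc n) ≈ f (suc n) * g 0 + mul f (g ∘ suc) n
  mul-last f g zero    = +-comm _ _
  mul-last f g (suc n) = begin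
   f 0 * g (suc (suc n)) + mul (f ∘ suc) g (suc n) ≈⟨ +-congˡ (mul-last (f ∘ suc) g n) ⟩
   f 0 * g (suc (suc n)) + (f (suc (suc n)) * g 0 + mul (f ∘ suc) (g ∘ suc) n)
    ≈⟨ trans (sym (+-assoc _ _ _)) (trans (+-congʳ (+-comm _ _)) (+-assoc _ _ _)) ⟩
   f (suc (suc n)) * g 0 + (f 0 * g (suc (suc n)) + mul (f ∘ suc) (g ∘ suc) n) ∎

  mul-comm : ∀ f g n → mul f g n ≈ mul g f n
  mul-comm f g zero    = *-comm _ _
  mul-comm f g (suc n) = trans (mul-last f g n) (+-cong (*-comm _ _) (mul-comm f (g ∘ suc) n))

  mul-assoc : ∀ f g h n → mul (mul f g) h n ≈ mul f (mul g h) n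
  mul-assoc f g h zero    = *-assoc _ _ _
  mul-assoc f g h (suc n) = begin
   (f 0 * g 0) * h (suc n) + mul (λ i → f 0 * g (suc i) + mul (f ∘ suc) g i) h n
    ≈⟨ +-congˡ (mul-distribʳ (λ i → f 0 * g (suc i)) (mul (f ∘ suc) g) h n) ⟩
   (f 0 * g 0) * h (suc n) + (mul (λ i → f 0 * g (suc i)) h n + mul (mul (f ∘ suc) g) h n)
    ≈⟨ +-cong (*-assoc _ _ _) (+-cong (mul-scale (f 0) (g ∘ suc) h n) (mul-assoc (f ∘ suc) g h n)) ⟩
   f 0 * (g 0 * h (suc n)) + (f 0 * mul (g ∘ suc) h n + mul (f ∘ suc) (mul g h) n) ≈⟨ sym (+-assoc _ _ _) ⟩
   f 0 * (g 0 * h (suc n)) + f 0 * mul (g ∘ suc) h n + mul (f ∘ suc) (mul g h) n ≈⟨ +-congʳ (sym (distribˡ _ _ _)) ⟩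
   f 0 * (g 0 * h (suc n) + mul (g ∘ suc) h n) + mul (f ∘ suc) (mul g h) n ∎

  mul-identityˡ : ∀ f n → mul one f n ≈ f n
  mul-identityˡ f zero    = *-identityˡ _
  mul-identityˡ f (suc n) = trans (+-cong (*-identityˡ _) (mul-zeroˡ f (λ _ → refl) n)) (+-identityʳ _)

  series : CRing
  series = record
   { Carrier = Ser' ; _≈_ = λ f g → ∀ n → f n ≈ g n
   ; _+_ = λ f g n → f n + g n ; _*_ = mul ; -_ = λ f n → - f n ; 0# = λ _ → 0# ; 1# = one
   ; isCommutativeRing = record
    { isRing = record
     { +-isAbelianGroup = record
      { isGroup = record
       { isMonoid = record
        { isSemigroup = record
         { isMagma = record
          { isEquivalence = record { refl = λ _ → refl ; sym = λ p n → sym (p n) ; trans = λ p q n → trans (p n) (q n) }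
          ; ∙-cong = λ p q n → +-cong (p n) (q n) }
         ; assoc = λ f g h n → +-assoc _ _ _ }
        ; identity = (λ f n → +-identityˡ _) , (λ f n → +-identityʳ _) }
       ; inverse = (λ f n → -‿inverseˡ _) , (λ f n → -‿inverseʳ _)
       ; ⁻¹-cong = λ p n → -‿cong (p n) }
      ; comm = λ f g n → +-comm _ _ }
     ; *-cong = λ {f} {f'} {g} {g'} → mul-cong {f} {f'} {g} {g'}
     ; *-assoc = mul-assoc
     ; *-identity = mul-identityˡ , (λ f n → trans (mul-comm f one n) (mul-identityˡ f n))
     ; distrib = (λ f g h n → trans (mul-comm f _ n) (trans (mul-distribʳ g h f n) (+-cong (mul-comm g f n) (mul-comm h f n))))
          , (λ f g h n → mul-distribʳ g h f n) }
    ; *-comm = mul-comm } }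

  -- Nothing is decidable about the coefficients of a general ring, so vanishing is carried as one
  -- side of an alternative: a single term of the convolution that yields `W` settles the matter,
  -- and otherwise `Z` passes to the sum.
  mul-case : ∀ (Z : Carrier → Set) → (∀ {x y} → Z x → Z y → Z (x + y)) → (W : Set) → ∀ n f g →
   (∀ i k → i ℕ.+ k ≡ n → W ⊎ Z (f i * g k)) → W ⊎ Z (mul f g n)
  mul-case Z add W zero    f g q = q 0 0 ≡.refl
  mul-case Z add W (suc n) f g q with q 0 (suc n) ≡.refl | mul-case Z add W n (f ∘ suc) g (λ i k e → q (suc i) k (≡.cong suc e))
  ... | inj₁ w | _      = inj₁ w
  ... | inj₂ _ | inj₁ w = inj₁ w
  ... | inj₂ a | inj₂ b = inj₂ (add a b)

  variable-series : Ser'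
  variable-series zero          = 0#
  variable-series (suc zero)    = 1#
  variable-series (suc (suc _)) = 0#

  mul-variable-zero : ∀ f → mul variable-series f 0 ≈ 0#
  mul-variable-zero f = zeroˡ _

  mul-variable-suc : ∀ f n → mul variable-series f (suc n) ≈ f n
  mul-variable-suc f n = trans (+-cong (zeroˡ _) (trans (mul-cong {variable-series ∘ suc} {one} {f} {f} shift (λ _ → refl) n)
    (mul-identityˡ f n))) (+-identityˡ _)
   where
   shift : ∀ n → variable-series (suc n) ≈ one n
   shift zero    = refl
   shift (suc _) = refl

  constant : Carrier → Ser'
  constant c zero    = c
  constant c (suc _) = 0#

  mul-constant : ∀ c f n → mul (constant c) f n ≈ c * f n
  mul-constant c f zero    = refl
  mul-constant c f (suc n) = trans (+-congˡ (mul-zeroˡ f (λ _ → refl) n)) (+-identityʳ _)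

  open Algebra.Properties.Semiring.Mult semiring

  euler : Ser' → Ser'
  euler f n = n × f n

  private
   ×-left : ∀ k x y → k × (x * y) ≈ (k × x) * y
   ×-left k x y = sym (×-assoc-* k x y)
   ×-right : ∀ k x y → k × (x * y) ≈ x * (k × y)
   ×-right k x y = sym (×-comm-* k x y)

   -- `mul` recurses by shifting its first factor, which offsets the exponents there; the Leibniz
   -- rule is therefore proved with exponents of the first factor counted from k.
   euler-shifted : ∀ k f g n → (k ℕ.+ n) × mul f g n ≈ mul (λ i → (k ℕ.+ i) × f i) g n + mul f (euler g) n
   euler-shifted k f g zero = trans (×-left (k ℕ.+ 0) _ _) (sym (trans (+-congˡ (zeroʳ _)) (+-identityʳ _)))
   euler-shifted k f g (suc n) = begin
    (k ℕ.+ suc n) × (f 0 * g (suc n) + mul (f ∘ suc) g n) ≈⟨ ×-distrib (k ℕ.+ suc n) _ _ ⟩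
    (k ℕ.+ suc n) × (f 0 * g (suc n)) + (k ℕ.+ suc n) × mul (f ∘ suc) g n ≈⟨ +-cong (trans (×-homo-+ _ k (suc n)) (+-cong
        (trans (×-left k _ _) (*-congʳ (×-congˡ (≡.sym (ℕP.+-identityʳ k))))) (×-right (suc n) _ _)))
        (trans (×-congˡ (ℕP.+-suc k n)) (trans (euler-shifted (suc k) (f ∘ suc) g n)
         (+-congʳ (mul-cong {g = g} (λ i → ×-congˡ (≡.sym (ℕP.+-suc k i))) (λ _ → refl) n)))) ⟩
    ((k ℕ.+ 0) × f 0 * g (suc n) + f 0 * suc n × g (suc n)) +
     (mul (λ i → (k ℕ.+ suc i) × f (suc i)) g n + mul (f ∘ suc) (euler g) n) ≈⟨ swap4 _ _ _ _ ⟩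
    ((k ℕ.+ 0) × f 0 * g (suc n) + mul (λ i → (k ℕ.+ suc i) × f (suc i)) g n) + (f 0 * suc n × g (suc n) + mul (f ∘ suc) (euler g) n) ∎
    where
    ×-distrib : ∀ k x y → k × (x + y) ≈ k × x + k × y
    ×-distrib zero    x y = sym (+-identityʳ 0#)
    ×-distrib (suc k) x y = trans (+-congˡ (×-distrib k x y)) (swap4 _ _ _ _)

  euler-* : ∀ f g n → euler (mul f g) n ≈ mul (euler f) g n + mul f (euler g) n
  euler-* f g n = euler-shifted 0 f g n

  lift-* : (d : Carrier → Carrier) → (∀ x y → d (x + y) ≈ d x + d y) → (∀ x y → d (x * y) ≈ d x * y + x * d y) →
   ∀ f g n → d (mul f g n) ≈ mul (d ∘ f) g n + mul f (d ∘ g) n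
  lift-* d d+ d* f g zero    = d* _ _
  lift-* d d+ d* f g (suc n) = trans (d+ _ _) (trans (+-cong (d* _ _) (lift-* d d+ d* (f ∘ suc) g n)) (swap4 _ _ _ _))

-- Derivations, residues, and the solution of the loop equation in an abstract setting.

module Residues where

 open PowerSeries
 open import Algebra.Bundles using (CommutativeRing)
 open import Data.Integer using (+_; -[1+_])
 open import Data.Product using (_×_)
 import Algebra.Properties.Ring
 import Algebra.Properties.Semiring.Mult
 import Algebra.Properties.CommutativeMonoid.Mult

 record IsDerivation (R : CRing) (d : CommutativeRing.Carrier R → CommutativeRing.Carrier R) : Set where
  open CommutativeRing R
  field
   d-cong : ∀ {f g} → f ≈ g → d f ≈ d g
   d-+    : ∀ f g → d (f + g) ≈ d f + d g
   d-*    : ∀ f g → d (f * g) ≈ d f * g + f * d g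

 module Powers (R : CRing) where
  open CommutativeRing R
  open Algebra.Properties.Ring ring
  open IntegerSolver R public

  infixr 8 _^_
  _^_ : Carrier → ℕ → Carrier
  x ^ zero  = 1#
  x ^ suc n = x * x ^ n

  ^-cong : ∀ {x y} n → x ≈ y → x ^ n ≈ y ^ n
  ^-cong zero    q = refl
  ^-cong (suc n) q = *-cong q (^-cong n q)

  ^-+ : ∀ x m n → x ^ (m ℕ.+ n) ≈ x ^ m * x ^ n
  ^-+ x zero    n = sym (*-identityˡ _)
  ^-+ x (suc m) n = trans (*-congˡ (^-+ x m n)) (sym (*-assoc x _ _))

  int-1 : int (+ 1) ≈ 1#
  int-1 = +-identityʳ 1#

  neg-unique : ∀ {x y} → x + y ≈ 0# → y ≈ - x
  neg-unique {x} {y} e = trans (trans (sym (+-identityˡ y)) (trans (+-congʳ (sym (-‿inverseˡ x)))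
   (trans (+-assoc _ _ _) (+-congˡ e)))) (+-identityʳ _)

  idem-zero : ∀ {x} → x + x ≈ x → x ≈ 0#
  idem-zero {x} e = trans (sym (+-identityˡ x)) (trans (+-congʳ (sym (-‿inverseˡ x))) (trans (+-assoc _ _ _) (trans (+-congˡ e) (-‿inverseˡ x))))

  move : ∀ {x y z} → x ≈ y + z → x - z ≈ y
  move {x} {y} {z} e = trans (+-congʳ e) (trans (+-assoc _ _ _) (trans (+-congˡ (-‿inverseʳ z)) (+-identityʳ y)))

  difference-zero : ∀ {x y} → x - y ≈ 0# → x ≈ y
  difference-zero {x} {y} e = trans (sym (trans (+-congˡ (-‿inverseˡ y)) (+-identityʳ x)))
   (trans (sym (+-assoc _ _ _)) (trans (+-congʳ e) (+-identityˡ y)))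

 module Derivation (R : CRing) {d : CommutativeRing.Carrier R → CommutativeRing.Carrier R} (der : IsDerivation R d) where
  open CommutativeRing R
  open Powers R
  open IsDerivation der public
  open SetoidReasoning setoid

  d-0 : d 0# ≈ 0#
  d-0 = idem-zero (trans (sym (d-+ 0# 0#)) (d-cong (+-identityʳ 0#)))

  d-1 : d 1# ≈ 0#
  d-1 = idem-zero (trans (sym (+-cong (*-identityʳ (d 1#)) (*-identityˡ (d 1#)))) (trans (sym (d-* 1# 1#)) (d-cong (*-identityʳ 1#))))

  d-neg : ∀ f → d (- f) ≈ - d f
  d-neg f = neg-unique (trans (sym (d-+ f (- f))) (trans (d-cong (-‿inverseʳ f)) d-0))

  private
   d-nat : ∀ n → d (int (+ n)) ≈ 0#
   d-nat zero    = d-0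
   d-nat (suc n) = trans (d-+ _ _) (trans (+-cong d-1 (d-nat n)) (+-identityʳ 0#))

  d-int : ∀ c → d (int c) ≈ 0#
  d-int (+ n)    = d-nat n
  d-int -[1+ n ] = trans (d-neg _) (trans (-‿cong (d-nat (suc n))) -0#≈0#)
   where open Algebra.Properties.Ring ring

  d-int* : ∀ c f → d (int c * f) ≈ int c * d f
  d-int* c f = trans (d-* _ _) (trans (+-congʳ (trans (*-congʳ (d-int c)) (zeroˡ f))) (+-identityˡ _))

  d-- : ∀ f g → d (f - g) ≈ d f - d g
  d-- f g = trans (d-+ f (- g)) (+-congˡ (d-neg g))

  d-^ : ∀ f n → d (f ^ suc n) ≈ int (+ suc n) * f ^ n * d f
  d-^ f zero    = begin
   d (f * 1#) ≈⟨ d-cong (*-identityʳ f) ⟩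
   d f ≈⟨ solve 1 (λ x → x := con (+ 1) :* con (+ 1) :* x) refl (d f) ⟩
   int (+ 1) * int (+ 1) * d f ≈⟨ *-congʳ (*-congˡ int-1) ⟩
   int (+ 1) * 1# * d f ∎
  d-^ f (suc n) = begin
   d (f * f ^ suc n) ≈⟨ d-* f (f ^ suc n) ⟩
   d f * f ^ suc n + f * d (f ^ suc n) ≈⟨ +-congˡ (*-congˡ (d-^ f n)) ⟩
   d f * (f * f ^ n) + f * (int (+ suc n) * f ^ n * d f)
    ≈⟨ solve 4 (λ a x b c → a :* (x :* b) :+ x :* (c :* b :* a) := (con (+ 1) :+ c) :* (x :* b) :* a) refl (d f) f (f ^ n) (int (+ suc n)) ⟩
   (int (+ 1) + int (+ suc n)) * f ^ suc n * d f ≈⟨ *-congʳ (*-congʳ (+-congʳ int-1)) ⟩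
   int (+ suc (suc n)) * f ^ suc n * d f ∎

 module Derivations (R : CRing) where
  open CommutativeRing R
  open Algebra.Properties.Semiring.Mult semiring using (×-congʳ)
  open Algebra.Properties.CommutativeMonoid.Mult +-commutativeMonoid using (×-distrib-+)

  euler-derivation : IsDerivation (Series.series R) (Series.euler R)
  euler-derivation = record { d-cong = λ q n → ×-congʳ n (q n) ; d-+ = λ f g n → ×-distrib-+ (f n) (g n) n ; d-* = Series.euler-* R }

  lift-derivation : ∀ {d} → IsDerivation R d → IsDerivation (Series.series R) (λ f n → d (f n))
  lift-derivation {d} der = record { d-cong = λ q n → d-cong (q n) ; d-+ = λ f g n → d-+ _ _ ; d-* = Series.lift-* R d d-+ d-* }
   where open IsDerivation der

  difference-derivation : ∀ {d d'} → IsDerivation R d → IsDerivation R d' → IsDerivation R (λ f → d f - d' f)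
  difference-derivation {d} {d'} p q = record
   { d-cong = λ e → +-cong (P.d-cong e) (-‿cong (Q.d-cong e))
   ; d-+ = λ f g → trans (+-cong (P.d-+ f g) (-‿cong (Q.d-+ f g)))
     (solve 4 (λ a b c d → (a :+ b) :- (c :+ d) := (a :- c) :+ (b :- d)) refl (d f) (d g) (d' f) (d' g))
   ; d-* = λ f g → trans (+-cong (P.d-* f g) (-‿cong (Q.d-* f g)))
     (solve 6 (λ a b c d f g → (a :* g :+ f :* b) :- (c :* g :+ f :* d) := (a :- c) :* g :+ f :* (b :- d)) refl (d f) (d g) (d' f) (d' g) f g) }
   where
   module P = IsDerivation p
   module Q = IsDerivation q
   open IntegerSolver R using (solve; _:=_; _:+_; _:*_; _:-_)

 -- The condition d₂ x · d₁ f = d₁ x · d₂ f says that f is, infinitesimally, a function of x.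
 module Wedge (R : CRing) {d₁ d₂ : CommutativeRing.Carrier R → CommutativeRing.Carrier R}
  (der₁ : IsDerivation R d₁) (der₂ : IsDerivation R d₂) (x : CommutativeRing.Carrier R) where
  open CommutativeRing R
  open Powers R
  open SetoidReasoning setoid
  private
   module D₁ = Derivation R der₁
   module D₂ = Derivation R der₂

  Dependent : Carrier → Set
  Dependent f = d₂ x * d₁ f ≈ d₁ x * d₂ f

  dependent-x : Dependent x
  dependent-x = *-comm _ _

  dependent-constant : ∀ {f} → d₁ f ≈ 0# → d₂ f ≈ 0# → Dependent f
  dependent-constant p q = trans (*-congˡ p) (trans (zeroʳ _) (sym (trans (*-congˡ q) (zeroʳ _))))

  dependent-- : ∀ {f g} → Dependent f → Dependent g → Dependent (f - g)
  dependent-- {f} {g} a b = begin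
   d₂ x * d₁ (f - g) ≈⟨ *-congˡ (D₁.d-- f g) ⟩
   d₂ x * (d₁ f - d₁ g) ≈⟨ solve 3 (λ y a b → y :* (a :- b) := y :* a :- y :* b) refl (d₂ x) (d₁ f) (d₁ g) ⟩
   d₂ x * d₁ f - d₂ x * d₁ g ≈⟨ +-cong a (-‿cong b) ⟩
   d₁ x * d₂ f - d₁ x * d₂ g ≈⟨ solve 3 (λ y a b → y :* a :- y :* b := y :* (a :- b)) refl (d₁ x) (d₂ f) (d₂ g) ⟩
   d₁ x * (d₂ f - d₂ g) ≈⟨ *-congˡ (sym (D₂.d-- f g)) ⟩
   d₁ x * d₂ (f - g) ∎

  dependent-* : ∀ {f g} → Dependent f → Dependent g → Dependent (f * g)
  dependent-* {f} {g} a b = begin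
   d₂ x * d₁ (f * g) ≈⟨ *-congˡ (D₁.d-* f g) ⟩
   d₂ x * (d₁ f * g + f * d₁ g) ≈⟨ solve 5 (λ y a g f b → y :* (a :* g :+ f :* b) := (y :* a) :* g :+ f :* (y :* b)) refl (d₂ x) (d₁ f) g f (d₁ g) ⟩
   d₂ x * d₁ f * g + f * (d₂ x * d₁ g) ≈⟨ +-cong (*-congʳ a) (*-congˡ b) ⟩
   d₁ x * d₂ f * g + f * (d₁ x * d₂ g) ≈⟨ solve 5 (λ y a g f b → (y :* a) :* g :+ f :* (y :* b) := y :* (a :* g :+ f :* b)) refl (d₁ x) (d₂ f) g f (d₂ g) ⟩
   d₁ x * (d₂ f * g + f * d₂ g) ≈⟨ *-congˡ (sym (D₂.d-* f g)) ⟩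
   d₁ x * d₂ (f * g) ∎

  dependent-^ : ∀ {f} k → Dependent f → Dependent (f ^ k)
  dependent-^ zero    a = dependent-constant D₁.d-1 D₂.d-1
  dependent-^ (suc k) a = dependent-* a (dependent-^ k a)

 module TreeSeries (R : CRing) (p' : ℕ) where
  open CommutativeRing R
  open Powers R
  open SetoidReasoning setoid

  module _ {T X e : Carrier} (T-eq : T ≈ X + T ^ suc (suc p')) (e-E : e * (int (+ 1) - int (+ suc (suc p')) * T ^ suc p') ≈ 1#) where
   private
    m = int (+ suc (suc p'))
    E = int (+ 1) - m * T ^ suc p'

   -- Differentiating T = X + T^(p-1) gives (1 - (p-1) T^(p-2)) dT = dX. As any derivation may be
   -- used, T behaves as a function of X for all of them at once, with e as dT/dX.
   E-derivative : ∀ {d} → IsDerivation R d → E * d T ≈ d X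
   E-derivative {d} der = begin
    E * d T ≈⟨ solve 3 (λ c x w → (con (+ 1) :- c :* x) :* w := w :- c :* x :* w) refl m (T ^ suc p') (d T) ⟩
    d T - m * T ^ suc p' * d T ≈⟨ move dT ⟩
    d X ∎
    where
    open Derivation R der
    dT : d T ≈ d X + m * T ^ suc p' * d T
    dT = trans (d-cong T-eq) (trans (d-+ X _) (+-congˡ (d-^ T (suc p'))))

   e-cancel : ∀ {f g} → E * f ≈ g → f ≈ e * g
   e-cancel {f} {g} q = trans (sym (*-identityˡ f)) (trans (*-congʳ (sym e-E)) (trans (*-assoc e E f) (*-congˡ q)))

   derivative : ∀ {d} → IsDerivation R d → d T ≈ e * d X
   derivative der = e-cancel (E-derivative der)

   T-dependent : ∀ {d₁ d₂} (der₁ : IsDerivation R d₁) (der₂ : IsDerivation R d₂) → Wedge.Dependent R der₁ der₂ X T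
   T-dependent {d₁} {d₂} der₁ der₂ = trans (*-congˡ (derivative der₁)) (trans
    (solve 3 (λ y e x → y :* (e :* x) := x :* (e :* y)) refl (d₂ X) e (d₁ X)) (*-congˡ (sym (derivative der₂))))

 -- Polynomial identities, proved over an abstract ring so that concrete rings are not unfolded.
 module Identities (R : CRing) where
  open CommutativeRing R
  open Powers R

  id-minus-one : ∀ x k → k - (x + k) ≈ - x
  id-minus-one = solve 2 (λ x k → k :- (x :+ k) := :- x) refl

  id-cancel : ∀ x → int (+ 0) + x + int (+ 0) - x ≈ int (+ 0)
  id-cancel = solve 1 (λ x → con (+ 0) :+ x :+ con (+ 0) :- x := con (+ 0)) refl

  id-power-difference : ∀ f g x y → (f - g) * x + g * (x - y) ≈ f * x - g * y
  id-power-difference = solve 4 (λ f g x y → (f :- g) :* x :+ g :* (x :- y) := f :* x :- g :* y) refl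

  id-up : ∀ t σ r a → (t + σ + r) * a ≈ (t - r) * a + (σ + (r + r)) * a
  id-up = solve 4 (λ t σ r a → (t :+ σ :+ r) :* a := (t :- r) :* a :+ (σ :+ (r :+ r)) :* a) refl

  id-down : ∀ t σ r a → (t + σ + r) * a ≈ (σ + (t + t)) * a - (t - r) * a
  id-down = solve 4 (λ t σ r a → (t :+ σ :+ r) :* a := (σ :+ (t :+ t)) :* a :- (t :- r) :* a) refl

  id-negate : ∀ x → - x ≈ - 1# * x
  id-negate x = trans (solve 1 (λ x → :- x := :- (con (+ 1)) :* x) refl x) (*-congʳ (-‿cong int-1))

  id-affine : ∀ o g a b → g * (a - b) ≈ (o + g * a) - (o + g * b)
  id-affine = solve 4 (λ o g a b → g :* (a :- b) := (o :+ g :* a) :- (o :+ g :* b)) refl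

  id-affine₀ : ∀ o g → g * o ≈ (o + g * o) - o
  id-affine₀ = solve 2 (λ o g → g :* o := (o :+ g :* o) :- o) refl

  id-inverse : ∀ e g → e * (int (+ 1) - g) ≈ e - g * e
  id-inverse = solve 2 (λ e g → e :* (con (+ 1) :- g) := e :- g :* e) refl

  id-tV : ∀ t σ r u y → t * (t + σ + r - u * y) ≈ t * t + σ * t + t * r - u * (t * y)
  id-tV = solve 5 (λ t σ r u y → t :* (t :+ σ :+ r :- u :* y) := t :* t :+ σ :* t :+ t :* r :- u :* (t :* y)) refl

  id-residue : ∀ z w → int (+ 0) + int (+ 0) + (z + w) - w ≈ z
  id-residue = solve 2 (λ z w → con (+ 0) :+ con (+ 0) :+ (z :+ w) :- w := z) refl

  id-distrib : ∀ t r w → (t - r) * w ≈ t * w - r * w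
  id-distrib = solve 3 (λ t r w → (t :- r) :* w := t :* w :- r :* w) refl

  id-minus-0 : ∀ z → z - int (+ 0) ≈ z
  id-minus-0 = solve 1 (λ z → z :- con (+ 0) := z) refl

  id-minus-00 : ∀ z → z - int (+ 0) - int (+ 0) ≈ z
  id-minus-00 = solve 1 (λ z → z :- con (+ 0) :- con (+ 0) := z) refl

  id-plus-minus-0 : ∀ z → z + int (+ 0) - int (+ 0) ≈ z
  id-plus-minus-0 = solve 1 (λ z → z :+ con (+ 0) :- con (+ 0) := z) refl

  id-regular : ∀ K z u b a → (K * z + u * b) * a ≈ z * (K * a) + u * (b * a)
  id-regular = solve 5 (λ K z u b a → (K :* z :+ u :* b) :* a := z :* (K :* a) :+ u :* (b :* a)) refl

  id-regroup : ∀ K z u c b → K * z + u * (K * c + b) ≈ K * (z + u * c) + u * b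
  id-regroup = solve 5 (λ K z u c b → K :* z :+ u :* (K :* c :+ b) := K :* (z :+ u :* c) :+ u :* b) refl

  id-bracket-sum : ∀ y a b x c d → (y * a - x * c) + (y * b - x * d) ≈ y * (a + b) - x * (c + d)
  id-bracket-sum = solve 6 (λ y a b x c d → (y :* a :- x :* c) :+ (y :* b :- x :* d) := y :* (a :+ b) :- x :* (c :+ d)) refl

  id-bracket : ∀ t r w x c → (t - r) * w - x * c ≈ t * w - r * w - x * c
  id-bracket = solve 5 (λ t r w x c → (t :- r) :* w :- x :* c := t :* w :- r :* w :- x :* c) refl

 -- `B` stands for Laurent series in t over the ring `A` of series in z and u, and `ι` includes the
 -- scalars. The derivations are ϑ = t d/dt, D = z d/dz at fixed t, and δ = z d/dz on scalars. With
 -- abstract rings the algebra below never unfolds coefficients.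
 record Ambient : Set₁ where
  field
   A B : CRing
  module A = CommutativeRing A
  module B = CommutativeRing B
  module PA = Powers A
  module PB = Powers B
  open B using (_≈_; _+_; _*_; _-_; -_; 1#)
  open PB using (_^_; int)
  field
   ι      : A.Carrier → B.Carrier
   ι-cong : ∀ {a b} → a A.≈ b → ι a ≈ ι b
   ι-+    : ∀ a b → ι (a A.+ b) ≈ ι a + ι b
   ι-*    : ∀ a b → ι (a A.* b) ≈ ι a * ι b
   ι-1    : ι A.1# ≈ 1#
   CT      : B.Carrier → A.Carrier
   CT-cong : ∀ {f g} → f ≈ g → CT f A.≈ CT g
   CT-+    : ∀ f g → CT (f + g) A.≈ CT f A.+ CT g
   CT-ι*   : ∀ a f → CT (ι a * f) A.≈ a A.* CT f
   ϑ D : B.Carrier → B.Carrier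
   δ   : A.Carrier → A.Carrier
   ϑ-der : IsDerivation B ϑ
   D-der : IsDerivation B D
   δ-der : IsDerivation A δ
   CT-ϑ : ∀ f → CT (ϑ f) A.≈ A.0#
   CT-D : ∀ f → CT (D f) A.≈ δ (CT f)
   ϑ-ι  : ∀ a → ϑ (ι a) ≈ B.0#
   D-ι  : ∀ a → D (ι a) ≈ ι (δ a)
   ϑ-D  : ∀ f → ϑ (D f) ≈ D (ϑ f)
   torsion-free : ∀ k a → PA.int (+ suc k) A.* a A.≈ A.0# → a A.≈ A.0#
   u z : A.Carrier
   δ-u : δ u A.≈ A.0#
   δ-z : δ z A.≈ z
   t ρ T : B.Carrier
   S R : A.Carrier

 -- In terms of loop equations, `V` is the derivative of the potential. Since `y` is ϑ X, the
 -- constant term of `y * f` is the residue of f dX. `E` is dX/dT.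
 module Elements (p' : ℕ) (𝔸 : Ambient) where
  open Ambient 𝔸 public
  open B using (_≈_; _+_; _*_; _-_; -_; 1#)
  open PB using (_^_; int)
  X Y y V E : B.Carrier
  X = t + ι S + ρ
  Y = T ^ suc (suc p')
  y = t - ρ
  V = X - ι u * Y
  E = int (+ 1) - int (+ suc (suc p')) * T ^ suc p'

 record Setting (p' : ℕ) : Set₁ where
  field
   ambient : Ambient
  open Elements p' ambient public
  open B using (_≈_; _+_; _*_; _-_; -_; 1#)
  open PB using (_^_; int)
  field
   T-eq : T ≈ X + Y
   tρ   : t * ρ ≈ ι R
   ϑ-t  : ϑ t ≈ t
   ϑ-ρ  : ϑ ρ ≈ - ρ
   D-t  : D t ≈ B.0#
   ω ω̃ : B.Carrier
   V-eq : V ≈ ω + ω̃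
   Neg Pos  : B.Carrier → Set
   neg-ω    : Neg ω
   pos-ω̃    : Pos ω̃
   -- With only negative powers of t in a, the product X a has no positive powers, and its constant
   -- term comes from the summand t of X; hence it is that of y a. On the positive side it comes
   -- from ρ, which has the opposite sign in y.
   neg-step : ∀ {a} → Neg a → Σ B.Carrier λ a₁ → Neg a₁ × X * a ≈ ι (A.1# A.* CT (y * a)) + a₁
   pos-step : ∀ {a} → Pos a → Σ B.Carrier λ a₁ → Pos a₁ × X * a ≈ ι (A.- A.1# A.* CT (y * a)) + a₁
   neg-orth : ∀ {a b} → Neg a → Neg b → CT (y * a * b) A.≈ A.0#
   pos-orth : ∀ {a b} → Pos a → Pos b → CT (y * a * b) A.≈ A.0#
   -- The Jacobian of X and ω in the coordinates log t and log z. It measures how far ω is from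
   -- being a function of X.
   jacobian : y * D ω - D X * ϑ ω ≈ ι z
   CT-yω    : CT (y * ω) A.≈ z
   S-eq : S A.≈ u A.* CT Y
   R-eq : R A.≈ z A.+ u A.* CT (t * Y)
   e    : B.Carrier
   e-E  : e * E ≈ 1#
   -- A filtration by orders: T^k f contributes to order k at least, and only zero is small to every
   -- order. It ends the infinite descent in `CT-Teϑ`.
   Small       : ℕ → A.Carrier → Set
   small-cong  : ∀ {n a b} → a A.≈ b → Small n a → Small n b
   small-zero  : ∀ {a} → (∀ n → Small n a) → a A.≈ A.0#
   small-scale : ∀ {n a} c → Small n a → Small n (c A.* a)
   small-CT    : ∀ k f → Small k (CT (T ^ k * f))
   -- Modulo u such an x is a positive multiple of R, hence of z, and so it can be cancelled.
   regular     : ∀ k x b → x A.≈ PA.int (+ suc k) A.* R A.+ u A.* b → ∀ a → x A.* a A.≈ A.0# → a A.≈ A.0#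

 module Analysis {p' : ℕ} (𝕊 : Setting p') where
  open Setting 𝕊 public
  open B using (_≈_; _+_; _*_; _-_; -_; 0#; 1#; refl; sym; trans; +-cong; +-congˡ; +-congʳ; *-cong; *-congˡ; *-congʳ; -‿cong)
  open PB using (_^_; int; solve; _:=_; _:+_; _:*_; :-_; _:-_; con; ^-cong; ^-+)
  module Dϑ = Derivation B ϑ-der
  module DD = Derivation B D-der
  module Dδ = Derivation A δ-der
  module ≈B = SetoidReasoning B.setoid
  module ≈A = SetoidReasoning A.setoid

  ι-0 : ι A.0# ≈ 0#
  ι-0 = PB.idem-zero (trans (sym (ι-+ A.0# A.0#)) (ι-cong (A.+-identityʳ A.0#)))

  ι-neg : ∀ a → ι (A.- a) ≈ - ι a
  ι-neg a = PB.neg-unique (trans (sym (ι-+ a (A.- a))) (trans (ι-cong (A.-‿inverseʳ a)) ι-0))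

  private
   ι-nat : ∀ n → ι (PA.int (+ n)) ≈ int (+ n)
   ι-nat zero    = ι-0
   ι-nat (suc n) = trans (ι-+ _ _) (+-cong ι-1 (ι-nat n))

  ι-int : ∀ c → ι (PA.int c) ≈ int c
  ι-int (+ n)    = ι-nat n
  ι-int -[1+ n ] = trans (ι-neg _) (-‿cong (ι-nat (suc n)))

  CT-0 : CT 0# A.≈ A.0#
  CT-0 = PA.idem-zero (A.trans (A.sym (CT-+ 0# 0#)) (CT-cong (B.+-identityʳ 0#)))

  CT-neg : ∀ f → CT (- f) A.≈ A.- CT f
  CT-neg f = PA.neg-unique (A.trans (A.sym (CT-+ f (- f))) (A.trans (CT-cong (B.-‿inverseʳ f)) CT-0))

  CT-- : ∀ f g → CT (f - g) A.≈ CT f A.- CT g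
  CT-- f g = A.trans (CT-+ f (- g)) (A.+-congˡ (CT-neg g))

  CT-int* : ∀ c f → CT (int c * f) A.≈ PA.int c A.* CT f
  CT-int* c f = A.trans (CT-cong (*-congʳ (sym (ι-int c)))) (CT-ι* (PA.int c) f)

  ϑ-X : ϑ X ≈ y
  ϑ-X = trans (Dϑ.d-+ _ _) (trans (+-cong (trans (Dϑ.d-+ _ _) (+-cong ϑ-t (ϑ-ι S))) ϑ-ρ) (+-congʳ (B.+-identityʳ t)))

  ϑ-y : ϑ y ≈ X - ι S
  ϑ-y = trans (Dϑ.d-- t ρ) (trans (+-cong ϑ-t (-‿cong ϑ-ρ)) (solve 3 (λ t s r → t :- (:- r) := t :+ s :+ r :- s) refl t (ι S) ρ))

  module TS = TreeSeries B p'

  ϑ-T : E * ϑ T ≈ y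
  ϑ-T = trans (TS.E-derivative {T} {X} {e} T-eq e-E ϑ-der) ϑ-X

  -- Residues of T^k e^l dT vanish: for l = 0 this is exactness, and E = 1 - (p-1) T^(p-2) reduces
  -- l to l - 1 up to terms of higher order in T.
  CT-Tϑ : ∀ k → CT (T ^ k * ϑ T) A.≈ A.0#
  CT-Tϑ k = torsion-free k _ (A.trans (A.sym (CT-int* (+ suc k) _)) (A.trans (CT-cong (trans (sym (B.*-assoc _ _ _)) (sym (Dϑ.d-^ T k)))) (CT-ϑ _)))

  m : B.Carrier
  m = int (+ suc (suc p'))

  e-unfold : e ≈ 1# + m * T ^ suc p' * e
  e-unfold = begin
   e ≈⟨ solve 2 (λ e x → e := e :* (con (+ 1) :- x) :+ x :* e) refl e (m * T ^ suc p') ⟩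
   e * E + m * T ^ suc p' * e ≈⟨ +-congʳ e-E ⟩
   1# + m * T ^ suc p' * e ∎
   where open ≈B

  CT-Teϑ : ∀ l k → CT (T ^ k * e ^ l * ϑ T) A.≈ A.0#
  CT-Teϑ zero    k = A.trans (CT-cong (*-congʳ (B.*-identityʳ _))) (CT-Tϑ k)
  CT-Teϑ (suc l) k = small-zero (λ n → vanish n k)
   where
   q = suc p'
   descend : ∀ k → CT (T ^ k * e ^ suc l * ϑ T) A.≈ PA.int (+ suc q) A.* CT (T ^ (k ℕ.+ q) * e ^ suc l * ϑ T)
   descend k = ≈A.begin
    CT (T ^ k * e ^ suc l * ϑ T) ≈A.≈⟨ CT-cong expand ⟩
    CT (T ^ k * e ^ l * ϑ T + m * (T ^ (k ℕ.+ q) * e ^ suc l * ϑ T)) ≈A.≈⟨ CT-+ _ _ ⟩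
    CT (T ^ k * e ^ l * ϑ T) A.+ CT (m * (T ^ (k ℕ.+ q) * e ^ suc l * ϑ T)) ≈A.≈⟨ A.+-cong (CT-Teϑ l k) (CT-int* (+ suc q) _) ⟩
    A.0# A.+ PA.int (+ suc q) A.* CT (T ^ (k ℕ.+ q) * e ^ suc l * ϑ T) ≈A.≈⟨ A.+-identityˡ _ ⟩
    PA.int (+ suc q) A.* CT (T ^ (k ℕ.+ q) * e ^ suc l * ϑ T) ≈A.∎
    where
    expand : T ^ k * e ^ suc l * ϑ T ≈ T ^ k * e ^ l * ϑ T + m * (T ^ (k ℕ.+ q) * e ^ suc l * ϑ T)
    expand = begin
     T ^ k * (e * e ^ l) * ϑ T ≈⟨ *-congʳ (*-congˡ (*-congʳ e-unfold)) ⟩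
     T ^ k * ((1# + m * T ^ q * e) * e ^ l) * ϑ T
      ≈⟨ solve 7 (λ a m b e f w o → a :* ((o :+ m :* b :* e) :* f) :* w := a :* (o :* f) :* w :+ m :* (a :* b :* (e :* f) :* w)) refl
         (T ^ k) m (T ^ q) e (e ^ l) (ϑ T) 1# ⟩
     T ^ k * (1# * e ^ l) * ϑ T + m * (T ^ k * T ^ q * e ^ suc l * ϑ T)
      ≈⟨ +-cong (*-congʳ (*-congˡ (B.*-identityˡ _))) (*-congˡ (*-congʳ (*-congʳ (sym (^-+ T k q))))) ⟩
     T ^ k * e ^ l * ϑ T + m * (T ^ (k ℕ.+ q) * e ^ suc l * ϑ T) ∎
     where open ≈B
   -- Each `descend` raises the exponent of T by `suc p'`, which is at least 1, so j steps bring it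
   -- to at least k + j.
   chain : ∀ n j k → n ℕ.≤ k ℕ.+ j → Small n (CT (T ^ k * e ^ suc l * ϑ T))
   chain n zero k le = small-cong (CT-cong (sym factor)) (small-CT n (T ^ (k ℕ.∸ n) * (e ^ suc l * ϑ T)))
    where
    factor : T ^ k * e ^ suc l * ϑ T ≈ T ^ n * (T ^ (k ℕ.∸ n) * (e ^ suc l * ϑ T))
    factor = trans (B.*-assoc _ _ _) (trans (*-congʳ (trans (B.reflexive (≡.cong (T ^_) (≡.sym
     (ℕP.m+[n∸m]≡n (ℕP.≤-trans le (ℕP.≤-reflexive (ℕP.+-identityʳ k))))))) (^-+ T n (k ℕ.∸ n)))) (B.*-assoc _ _ _))
   chain n (suc j) k le = small-cong (A.sym (descend k)) (small-scale _ (chain n j (k ℕ.+ q)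
    (ℕP.≤-trans le (ℕP.≤-trans (ℕP.≤-reflexive (ℕP.+-suc k j)) (ℕP.≤-trans (ℕP.≤-reflexive (≡.sym (ℕP.+-suc k j)))
     (ℕP.≤-trans (ℕP.+-monoʳ-≤ k (ℕ.s≤s (ℕP.m≤n+m j p'))) (ℕP.≤-reflexive (≡.sym (ℕP.+-assoc k q j)))))))))
   vanish : ∀ n k → Small n (CT (T ^ k * e ^ suc l * ϑ T))
   vanish n k = chain n n k (ℕP.m≤n+m n k)

  CT-Tey : ∀ l k → CT (T ^ k * e ^ l * y) A.≈ A.0#
  CT-Tey l k = A.trans (CT-cong (begin
    T ^ k * e ^ l * y ≈⟨ *-congˡ (sym ϑ-T) ⟩
    T ^ k * e ^ l * (E * ϑ T)
     ≈⟨ solve 5 (λ a b w x m → a :* b :* ((con (+ 1) :- m :* x) :* w) := a :* b :* w :- m :* (a :* x :* b :* w)) refl (T ^ k) (e ^ l) (ϑ T) (T ^ suc p') m ⟩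
    T ^ k * e ^ l * ϑ T - m * (T ^ k * T ^ suc p' * e ^ l * ϑ T) ≈⟨ +-congˡ (-‿cong (*-congˡ (*-congʳ (*-congʳ (sym (^-+ T k (suc p'))))))) ⟩
    T ^ k * e ^ l * ϑ T - m * (T ^ (k ℕ.+ suc p') * e ^ l * ϑ T) ∎))
   (A.trans (CT-- _ _) (A.trans (A.+-cong (CT-Teϑ l k) (A.-‿cong (A.trans (CT-int* (+ suc (suc p')) _) (A.trans (A.*-congˡ (CT-Teϑ l (k ℕ.+ suc p'))) (A.zeroʳ _)))))
    (A.-‿inverseʳ A.0#)))
   where open ≈B

  -- The polynomials in T with scalar coefficients, X and V among them, are the series whose
  -- residues against dX are known to vanish (`CT-poly-y`).
  data Poly : B.Carrier → Set where
   mono : ∀ a k {f} → f ≈ ι a * T ^ k → Poly f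
   plus : ∀ {f g h} → Poly f → Poly g → h ≈ f + g → Poly h

  poly-cong : ∀ {f g} → g ≈ f → Poly f → Poly g
  poly-cong q (mono a k r)    = mono a k (trans q r)
  poly-cong q (plus pf pg r) = plus pf pg (trans q r)

  poly-* : ∀ {f g} → Poly f → Poly g → Poly (f * g)
  poly-* (mono a k q) (mono b l r) = mono (a A.* b) (k ℕ.+ l) (trans (*-cong q r) (trans
   (solve 4 (λ a x b y → a :* x :* (b :* y) := a :* b :* (x :* y)) refl (ι a) (T ^ k) (ι b) (T ^ l)) (*-cong (sym (ι-* a b)) (sym (^-+ T k l)))))
  poly-* pf@(mono _ _ _) (plus pg ph r) = plus (poly-* pf pg) (poly-* pf ph) (trans (*-congˡ r) (B.distribˡ _ _ _))
  poly-* (plus pf pg q) ph = plus (poly-* pf ph) (poly-* pg ph) (trans (*-congʳ q) (B.distribʳ _ _ _))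

  poly-ι : ∀ a → Poly (ι a)
  poly-ι a = mono a 0 (sym (B.*-identityʳ _))

  poly-T^ : ∀ k → Poly (T ^ k)
  poly-T^ k = mono A.1# k (trans (sym (B.*-identityˡ _)) (*-congʳ (sym ι-1)))

  poly-T : Poly T
  poly-T = poly-cong (sym (B.*-identityʳ T)) (poly-T^ 1)

  poly-+ : ∀ {f g} → Poly f → Poly g → Poly (f + g)
  poly-+ pf pg = plus pf pg refl

  poly-neg : ∀ {f} → Poly f → Poly (- f)
  poly-neg pf = poly-cong (trans (solve 1 (λ x → :- x := con -[1+ 0 ] :* x) refl _) (*-congʳ (sym (ι-int -[1+ 0 ]))))
   (poly-* (poly-ι (PA.int -[1+ 0 ])) pf)

  poly-^ : ∀ {f} n → Poly f → Poly (f ^ n)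
  poly-^ zero    pf = poly-T^ 0
  poly-^ (suc n) pf = poly-* pf (poly-^ n pf)

  X≈ : X ≈ T - Y
  X≈ = sym (PB.move T-eq)

  poly-X : Poly X
  poly-X = poly-cong X≈ (poly-+ poly-T (poly-neg (poly-T^ (suc (suc p')))))

  poly-V : Poly V
  poly-V = poly-+ poly-X (poly-neg (poly-* (poly-ι u) (poly-T^ (suc (suc p')))))

  CT-poly-ey : ∀ l {f} → Poly f → CT (f * e ^ l * y) A.≈ A.0#
  CT-poly-ey l (mono a k q) = A.trans (CT-cong (trans (*-congʳ (*-congʳ q)) (trans (*-congʳ (B.*-assoc _ _ _)) (B.*-assoc _ _ _))))
   (A.trans (CT-ι* a _) (A.trans (A.*-congˡ (CT-Tey l k)) (A.zeroʳ a)))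
  CT-poly-ey l (plus pf pg q) = A.trans (CT-cong (trans (*-congʳ (trans (*-congʳ q) (B.distribʳ _ _ _))) (B.distribʳ _ _ _)))
   (A.trans (CT-+ _ _) (A.trans (A.+-cong (CT-poly-ey l pf) (CT-poly-ey l pg)) (A.+-identityʳ A.0#)))

  CT-poly-y : ∀ {f} → Poly f → CT (f * y) A.≈ A.0#
  CT-poly-y pf = A.trans (CT-cong (*-congʳ (sym (B.*-identityʳ _)))) (CT-poly-ey 0 pf)

  splitA : (ℕ → ℕ → A.Carrier) → ℕ → ℕ → A.Carrier
  splitA F i zero    = A.0#
  splitA F i (suc j) = F i j A.+ splitA F (suc i) j

  splitA-cong : ∀ {F G} i j → (∀ i j → F i j A.≈ G i j) → splitA F i j A.≈ splitA G i j
  splitA-cong i zero    q = A.refl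
  splitA-cong i (suc j) q = A.+-cong (q i j) (splitA-cong (suc i) j q)

  splitA-shift : ∀ F i j → splitA (λ i l → F (suc i) l) i j A.≈ splitA F (suc i) j
  splitA-shift F i zero    = A.refl
  splitA-shift F i (suc j) = A.+-congˡ (splitA-shift F (suc i) j)

  -- The residue of X^i a dX. For a with negative powers of t only, it is the coefficient of
  -- X^(-i-1) when a is expanded in 1/X.
  moment : B.Carrier → ℕ → A.Carrier
  moment a i = CT (X ^ i * (y * a))

  moment-0 : ∀ a → CT (y * a) A.≈ moment a 0
  moment-0 a = CT-cong (sym (B.*-identityˡ _))

  module _ (P : B.Carrier → Set) (κ : A.Carrier)
   (P-step : ∀ {a} → P a → Σ B.Carrier λ a₁ → P a₁ × X * a ≈ ι (κ A.* CT (y * a)) + a₁)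
   (P-orth : ∀ {a b} → P a → P b → CT (y * a * b) A.≈ A.0#) where

   -- One factor X at a time is moved into a, where `P-step` turns it into a scalar and an element
   -- a₁ of the same kind. The scalar yields one term of the convolution; the moments of a₁ are
   -- those of a shifted by one, because the residues of X^i dX vanish; `P-orth` ends the recursion.
   -- For expansions in 1/X this is the rule for multiplying coefficients.
   moment-product : ∀ k {a b} → P a → P b → CT (X ^ k * (y * a * b)) A.≈ κ A.* splitA (λ i l → moment a i A.* moment b l) 0 k
   moment-product zero    pa pb = A.trans (CT-cong (B.*-identityˡ _)) (A.trans (P-orth pa pb) (A.sym (A.zeroʳ κ)))
   moment-product (suc k) {a} {b} pa pb with P-step pa
   ... | a₁ , pa₁ , Xa = begin
    CT (X * X ^ k * (y * a * b)) ≈⟨ CT-cong regroup ⟩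
    CT (ι (κ A.* c) * (X ^ k * (y * b)) + X ^ k * (y * a₁ * b)) ≈⟨ A.trans (CT-+ _ _) (A.+-congʳ (CT-ι* _ _)) ⟩
    (κ A.* c) A.* moment b k A.+ CT (X ^ k * (y * a₁ * b))
     ≈⟨ A.+-cong (A.trans (A.*-assoc κ c _) (A.*-congˡ (A.*-congʳ (moment-0 a)))) (moment-product k pa₁ pb) ⟩
    κ A.* (moment a 0 A.* moment b k) A.+ κ A.* splitA (λ i l → moment a₁ i A.* moment b l) 0 k
     ≈⟨ A.+-congˡ (A.*-congˡ (A.trans (splitA-cong 0 k (λ i l → A.*-congʳ (next i))) (splitA-shift (λ i l → moment a i A.* moment b l) 0 k))) ⟩
    κ A.* (moment a 0 A.* moment b k) A.+ κ A.* splitA (λ i l → moment a i A.* moment b l) 1 k ≈⟨ A.sym (A.distribˡ κ _ _) ⟩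
    κ A.* splitA (λ i l → moment a i A.* moment b l) 0 (suc k) ∎
    where
    open ≈A
    c = CT (y * a)
    regroup : X * X ^ k * (y * a * b) ≈ ι (κ A.* c) * (X ^ k * (y * b)) + X ^ k * (y * a₁ * b)
    regroup = trans (solve 5 (λ x w y a b → x :* w :* (y :* a :* b) := (x :* a) :* (w :* (y :* b))) refl X (X ^ k) y a b)
     (trans (*-congʳ Xa) (solve 5 (λ c w y a b → (c :+ a) :* (w :* (y :* b)) := c :* (w :* (y :* b)) :+ w :* (y :* a :* b)) refl (ι (κ A.* c)) (X ^ k) y a₁ b))
    next : ∀ i → moment a₁ i A.≈ moment a (suc i)
    next i = A.sym (begin
     CT (X * X ^ i * (y * a)) ≈⟨ CT-cong (trans (solve 4 (λ x w y a → x :* w :* (y :* a) := (x :* a) :* (w :* y)) refl X (X ^ i) y a)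
       (trans (*-congʳ Xa) (solve 4 (λ c a w y → (c :+ a) :* (w :* y) := c :* (w :* y) :+ w :* (y :* a)) refl (ι (κ A.* c)) a₁ (X ^ i) y))) ⟩
     CT (ι (κ A.* c) * (X ^ i * y) + X ^ i * (y * a₁)) ≈⟨ A.trans (CT-+ _ _) (A.+-congʳ (CT-ι* _ _)) ⟩
     (κ A.* c) A.* CT (X ^ i * y) A.+ moment a₁ i ≈⟨ A.+-congʳ (A.trans (A.*-congˡ (CT-poly-y (poly-^ i poly-X))) (A.zeroʳ _)) ⟩
     A.0# A.+ moment a₁ i ≈⟨ A.+-identityˡ _ ⟩
     moment a₁ i ∎)

  W : ℕ → A.Carrier
  W = moment ω

  -- The sum ω + ω̃ = V is a polynomial in T, so its residues are zero.
  moment-ω̃ : ∀ i → moment ω̃ i A.≈ A.- W i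
  moment-ω̃ i = PA.neg-unique (begin
   moment ω i A.+ moment ω̃ i ≈⟨ A.sym (CT-+ _ _) ⟩
   CT (X ^ i * (y * ω) + X ^ i * (y * ω̃))
    ≈⟨ CT-cong (trans (solve 4 (λ x y a b → x :* (y :* a) :+ x :* (y :* b) := x :* (a :+ b) :* y) refl (X ^ i) y ω ω̃) (*-congʳ (*-congˡ (sym V-eq)))) ⟩
   CT (X ^ i * V * y) ≈⟨ CT-poly-y (poly-* (poly-^ i poly-X) poly-V) ⟩
   A.0# ∎)
   where open ≈A

  private
   module SA = Powers A

  -- In the residues of V² = ω² + 2 ω ω̃ + ω̃² the squares cancel: by `moment-product` both are the
  -- same convolution, since the two signs in the moments of ω̃ compensate each other, but with κ =
  -- 1 and κ = -1. V² is a polynomial in T, so twice the mixed residue is zero.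
  mixed-zero : ∀ k → CT (X ^ k * (y * ω * ω̃)) A.≈ A.0#
  mixed-zero k = torsion-free 1 M (begin
   PA.int (+ 2) A.* M ≈⟨ SA.solve 2 (λ s m → SA.con (+ 2) SA.:* m SA.:= SA.con (+ 1) SA.:* s SA.:+ SA.con (+ 2) SA.:* m SA.:+ SA.con -[1+ 0 ] SA.:* s) A.refl s M ⟩
   PA.int (+ 1) A.* s A.+ PA.int (+ 2) A.* M A.+ PA.int -[1+ 0 ] A.* s
    ≈⟨ A.+-cong (A.+-cong (A.trans (A.*-congʳ PA.int-1) (A.sym (moment-product Neg A.1# neg-step neg-orth k neg-ω neg-ω))) (A.sym (CT-int* (+ 2) _)))
       (A.sym (A.trans (moment-product Pos (A.- A.1#) pos-step pos-orth k pos-ω̃ pos-ω̃)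
        (A.*-cong (A.-‿cong (A.sym PA.int-1)) (splitA-cong 0 k (λ i l → A.trans (A.*-cong (moment-ω̃ i) (moment-ω̃ l))
         (SA.solve 2 (λ a b → SA.:- a SA.:* SA.:- b SA.:= a SA.:* b) A.refl _ _)))))) ⟩
   CT (X ^ k * (y * ω * ω)) A.+ CT (int (+ 2) * (X ^ k * (y * ω * ω̃))) A.+ CT (X ^ k * (y * ω̃ * ω̃))
    ≈⟨ A.sym (A.trans (CT-+ _ _) (A.+-congʳ (CT-+ _ _))) ⟩
   CT (X ^ k * (y * ω * ω) + int (+ 2) * (X ^ k * (y * ω * ω̃)) + X ^ k * (y * ω̃ * ω̃))
    ≈⟨ CT-cong (trans (solve 4 (λ x y a b → x :* (y :* a :* a) :+ con (+ 2) :* (x :* (y :* a :* b)) :+ x :* (y :* b :* b) := x :* ((a :+ b) :* (a :+ b)) :* y) refl (X ^ k) y ω ω̃)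
       (*-congʳ (*-congˡ (*-cong (sym V-eq) (sym V-eq))))) ⟩
   CT (X ^ k * (V * V) * y) ≈⟨ CT-poly-y (poly-* (poly-^ k poly-X) (poly-* poly-V poly-V)) ⟩
   A.0# ∎)
   where
   open ≈A
   M = CT (X ^ k * (y * ω * ω̃))
   s = splitA (λ i l → W i A.* W l) 0 k

  -- The solution of the exploration recursion for a single word: a factor T for each undecided
  -- half-edge, a factor X for each decided one.
  w : ℕ → ℕ → A.Carrier
  w j k = CT (T ^ j * X ^ k * (y * ω))

  w-undecided : ∀ j k → w (suc j) k A.≈ w j (suc k) A.+ w (suc (suc p') ℕ.+ j) k
  w-undecided j k = A.trans (CT-cong (begin
    T * T ^ j * X ^ k * (y * ω) ≈⟨ solve 4 (λ t a b c → t :* a :* b :* c := t :* (a :* b :* c)) refl T (T ^ j) (X ^ k) (y * ω) ⟩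
    T * (T ^ j * X ^ k * (y * ω)) ≈⟨ *-congʳ T-eq ⟩
    (X + Y) * (T ^ j * X ^ k * (y * ω))
     ≈⟨ solve 5 (λ x y a b c → (x :+ y) :* (a :* b :* c) := a :* (x :* b) :* c :+ y :* a :* b :* c) refl X Y (T ^ j) (X ^ k) (y * ω) ⟩
    T ^ j * X ^ suc k * (y * ω) + Y * T ^ j * X ^ k * (y * ω) ≈⟨ +-congˡ (*-congʳ (*-congʳ (sym (^-+ T (suc (suc p')) j)))) ⟩
    T ^ j * X ^ suc k * (y * ω) + T ^ (suc (suc p') ℕ.+ j) * X ^ k * (y * ω) ∎)) (CT-+ _ _)
   where open ≈B

  W≈w : ∀ k → W k A.≈ w 0 k
  W≈w k = CT-cong (*-congʳ (sym (B.*-identityˡ _)))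

  -- Write X ω = (X - u Y) ω + u Y ω = ω² + ω̃ ω + u Y ω. The square splits the word, the mixed term
  -- vanishes, and the last term is a vertex of a new tree with p - 1 undecided half-edges.
  w-decided : ∀ k → w 0 (suc k) A.≈ splitA (λ i l → w 0 i A.* w 0 l) 0 k A.+ u A.* w (suc (suc p')) k
  w-decided k = begin
   w 0 (suc k) ≈⟨ CT-cong (trans (solve 6 (λ o x w y uY a → o :* (x :* w) :* (y :* a) := w :* (x :- uY) :* (o :* y :* a) :+ o :* uY :* w :* (y :* a)) refl 1# X (X ^ k) y (ι u * Y) ω)
      (+-cong (trans (*-congˡ (*-congʳ (B.*-identityˡ y))) (trans (*-congʳ (*-congˡ V-eq))
       (solve 4 (λ w y a b → w :* (a :+ b) :* (y :* a) := w :* (y :* a :* a) :+ w :* (y :* a :* b)) refl (X ^ k) y ω ω̃)))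
       (trans (*-congʳ (*-congʳ (B.*-identityˡ _))) (solve 4 (λ u y w a → u :* y :* w :* a := u :* (y :* w :* a)) refl (ι u) Y (X ^ k) (y * ω))))) ⟩
   CT (X ^ k * (y * ω * ω) + X ^ k * (y * ω * ω̃) + ι u * (Y * X ^ k * (y * ω))) ≈⟨ A.trans (CT-+ _ _) (A.+-cong (CT-+ _ _) (CT-ι* u _)) ⟩
   CT (X ^ k * (y * ω * ω)) A.+ CT (X ^ k * (y * ω * ω̃)) A.+ u A.* w (suc (suc p')) k
    ≈⟨ A.+-congʳ (A.trans (A.+-cong (A.trans (moment-product Neg A.1# neg-step neg-orth k neg-ω neg-ω) (A.*-identityˡ _)) (mixed-zero k)) (A.+-identityʳ _)) ⟩
   splitA (λ i l → W i A.* W l) 0 k A.+ u A.* w (suc (suc p')) k ≈⟨ A.+-congʳ (splitA-cong 0 k (λ i l → A.*-cong (W≈w i) (W≈w l))) ⟩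
   splitA (λ i l → w 0 i A.* w 0 l) 0 k A.+ u A.* w (suc (suc p')) k ∎
   where open ≈A

  w-end : w 0 0 A.≈ z
  w-end = A.trans (CT-cong (trans (*-congʳ (B.*-identityˡ _)) (B.*-identityˡ _))) CT-yω

  module Wd = Wedge B D-der ϑ-der X

  -- Here h is a function of X, so y D h = (D X) ϑ h, and D y = ϑ (D X). With the Jacobian this
  -- gives D (h y ω) = ϑ (h (D X) ω) + z h, whose first summand has no constant term.
  δ-w : ∀ j k → δ (w j k) A.≈ z A.* CT (T ^ j * X ^ k)
  δ-w j k = begin
   δ (CT (h * (y * ω))) ≈⟨ A.sym (CT-D _) ⟩
   CT (D (h * (y * ω))) ≈⟨ CT-cong expand ⟩
   CT (ϑ (h * D X * ω) + ι z * h) ≈⟨ A.trans (CT-+ _ _) (A.trans (A.+-cong (CT-ϑ _) (CT-ι* z h)) (A.+-identityˡ _)) ⟩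
   z A.* CT h ∎
   where
   open ≈A
   h = T ^ j * X ^ k
   prop : y * D h ≈ D X * ϑ h
   prop = trans (*-congʳ (sym ϑ-X)) (Wd.dependent-* (Wd.dependent-^ j (TS.T-dependent {T} {X} {e} T-eq e-E D-der ϑ-der))
    (Wd.dependent-^ k Wd.dependent-x))
   Dy : D y ≈ ϑ (D X)
   Dy = trans (DD.d-cong (sym ϑ-X)) (sym (ϑ-D X))
   expand : D (h * (y * ω)) ≈ ϑ (h * D X * ω) + ι z * h
   expand = ≈B.begin
    D (h * (y * ω)) ≈B.≈⟨ trans (DD.d-* h _) (+-congˡ (*-congˡ (DD.d-* y ω))) ⟩
    D h * (y * ω) + h * (D y * ω + y * D ω) ≈B.≈⟨ +-congˡ (*-congˡ (+-congʳ (*-congʳ Dy))) ⟩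
    D h * (y * ω) + h * (ϑ (D X) * ω + y * D ω) ≈B.≈⟨ solve 8 (λ dh y w h tx dw x tw → dh :* (y :* w) :+ h :* (tx :* w :+ y :* dw) :=
        (y :* dh) :* w :+ h :* tx :* w :+ h :* x :* tw :+ (y :* dw :- x :* tw) :* h) refl (D h) y ω h (ϑ (D X)) (D ω) (D X) (ϑ ω) ⟩
    y * D h * ω + h * ϑ (D X) * ω + h * D X * ϑ ω + (y * D ω - D X * ϑ ω) * h ≈B.≈⟨ +-cong (+-congʳ (+-congʳ (*-congʳ prop))) (*-congʳ jacobian) ⟩
    D X * ϑ h * ω + h * ϑ (D X) * ω + h * D X * ϑ ω + ι z * h
     ≈B.≈⟨ +-congʳ (solve 6 (λ x th w h tx tw → x :* th :* w :+ h :* tx :* w :+ h :* x :* tw := (th :* x :+ h :* tx) :* w :+ h :* x :* tw) refl (D X) (ϑ h) ω h (ϑ (D X)) (ϑ ω)) ⟩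
    (ϑ h * D X + h * ϑ (D X)) * ω + h * D X * ϑ ω + ι z * h ≈B.≈⟨ +-congʳ (sym (trans (Dϑ.d-* _ ω) (+-congʳ (*-congʳ (Dϑ.d-* h (D X)))))) ⟩
    ϑ (h * D X * ω) + ι z * h ≈B.∎

-- Laurent series in t as power series in two variables.

module Bivariate where

 open PowerSeries
 open Residues
 open import Algebra.Bundles using (CommutativeRing)
 open import Data.Integer using (+_)
 open import Data.Product using (_×_)
 import Algebra.Properties.Ring
 import Algebra.Properties.Semiring.Mult
 import Algebra.Properties.CommutativeMonoid.Mult
 open import Algebra.Properties.CommutativeSemigroup ℕP.+-commutativeSemigroup using (interchange)

 -- With z = t s, a Laurent series in t whose polar parts are controlled by z becomes an honest
 -- power series in t and s; U holds the coefficients, power series in u.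
 ℤ-ring U A B : CRing
 ℤ-ring = ℤP.+-*-commutativeRing
 U = Series.series ℤ-ring
 A = Series.series U
 B = Series.series A

 module U = CommutativeRing U
 module A = CommutativeRing A
 module B = CommutativeRing B
 module SU = Series ℤ-ring
 module SA = Series U
 module SB = Series A
 open B using (_≈_; _+_; _*_; _-_; -_; 0#; 1#)

 -- An alternative at each position rather than an implication, so that supports can be multiplied
 -- and intersected without deciding `P` or comparing coefficients.
 Supp : (ℕ → ℕ → Set) → B.Carrier → Set
 Supp P f = ∀ i j → P i j ⊎ f i j U.≈ U.0#

 private
  zero-+ : ∀ {x y} → x U.≈ U.0# → y U.≈ U.0# → x U.+ y U.≈ U.0#
  zero-+ p q = U.trans (U.+-cong p q) (U.+-identityʳ U.0#)

 module _ {P : ℕ → ℕ → Set} where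

  supp-weaken : ∀ {Q : ℕ → ℕ → Set} {f} → (∀ i j → P i j → Q i j) → Supp P f → Supp Q f
  supp-weaken w s i j with s i j
  ... | inj₁ p = inj₁ (w i j p)
  ... | inj₂ q = inj₂ q

  supp-cong : ∀ {f g} → f ≈ g → Supp P f → Supp P g
  supp-cong e s i j with s i j
  ... | inj₁ p = inj₁ p
  ... | inj₂ q = inj₂ (U.trans (U.sym (e i j)) q)

  supp-+ : ∀ {f g} → Supp P f → Supp P g → Supp P (f + g)
  supp-+ s t i j with s i j | t i j
  ... | inj₁ p | _      = inj₁ p
  ... | inj₂ _ | inj₁ p = inj₁ p
  ... | inj₂ a | inj₂ b = inj₂ (zero-+ a b)

  supp-neg : ∀ {f} → Supp P f → Supp P (- f)
  supp-neg s i j with s i j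
  ... | inj₁ p = inj₁ p
  ... | inj₂ a = inj₂ (U.trans (U.-‿cong a) -0#≈0#)
   where open Algebra.Properties.Ring U.ring using (-0#≈0#)

  supp-- : ∀ {f g} → Supp P f → Supp P g → Supp P (f - g)
  supp-- s t = supp-+ s (supp-neg t)

  supp-zero : Supp P 0#
  supp-zero i j = inj₂ U.refl

 supp-* : ∀ {P Q W : ℕ → ℕ → Set} {f g} → (∀ i j k l → P i j → Q k l → W (i ℕ.+ k) (j ℕ.+ l)) → Supp P f → Supp Q g → Supp W (f * g)
 supp-* {P} {Q} {W} {f} {g} comb s t i j = SB.mul-case (λ x → x j U.≈ U.0#) (λ p q → zero-+ p q) (W i j) i f g λ a b ab →
   SA.mul-case (U._≈ U.0#) zero-+ (W i j) j (f a) (g b) λ k l kl → case a b ab k l kl (s a k) (t b l)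
  where
  case : ∀ a b → a ℕ.+ b ≡ i → ∀ k l → k ℕ.+ l ≡ j → P a k ⊎ f a k U.≈ U.0# → Q b l ⊎ g b l U.≈ U.0# → W i j ⊎ f a k U.* g b l U.≈ U.0#
  case a b ≡.refl k l ≡.refl (inj₁ p) (inj₁ q) = inj₁ (comb a k b l p q)
  case a b ab k l kl (inj₂ p) _ = inj₂ (U.trans (U.*-congʳ p) (U.zeroˡ _))
  case a b ab k l kl (inj₁ _) (inj₂ q) = inj₂ (U.trans (U.*-congˡ q) (U.zeroʳ _))

 shiftA : A.Carrier → A.Carrier
 shiftA g zero    = U.0#
 shiftA g (suc j) = g j

 -- z^n becomes (t s)^n: scalars sit on the diagonal, and the constant term in t is the diagonal
 -- part.
 ι : A.Carrier → B.Carrier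
 ι a zero    zero    = a 0
 ι a zero    (suc j) = U.0#
 ι a (suc i) zero    = U.0#
 ι a (suc i) (suc j) = ι (a ∘ suc) i j

 CT : B.Carrier → A.Carrier
 CT f a = f a a

 ι-cong : ∀ {a b} → a A.≈ b → ι a ≈ ι b
 ι-cong q zero    zero    = q 0
 ι-cong q zero    (suc j) = U.refl
 ι-cong q (suc i) zero    = U.refl
 ι-cong q (suc i) (suc j) = ι-cong (q ∘ suc) i j

 ι-+ : ∀ a b → ι (a A.+ b) ≈ ι a + ι b
 ι-+ a b zero    zero    = U.refl
 ι-+ a b zero    (suc j) = U.sym (U.+-identityʳ U.0#)
 ι-+ a b (suc i) zero    = U.sym (U.+-identityʳ U.0#)
 ι-+ a b (suc i) (suc j) = ι-+ (a ∘ suc) (b ∘ suc) i j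

 CT-ι : ∀ a → CT (ι a) A.≈ a
 CT-ι a zero    = U.refl
 CT-ι a (suc n) = CT-ι (a ∘ suc) n

 ι-supp : ∀ a → Supp _≡_ (ι a)
 ι-supp a zero    zero    = inj₁ ≡.refl
 ι-supp a zero    (suc j) = inj₂ U.refl
 ι-supp a (suc i) zero    = inj₂ U.refl
 ι-supp a (suc i) (suc j) with ι-supp (a ∘ suc) i j
 ... | inj₁ e = inj₁ (≡.cong suc e)
 ... | inj₂ q = inj₂ q

 private
  shift-* : ∀ g h n → SA.mul (shiftA g) h (suc n) U.≈ SA.mul g h n
  shift-* g h n = U.trans (U.+-congʳ (U.zeroˡ (h (suc n)))) (U.+-identityˡ _)

  shiftB-* : ∀ (g : B.Carrier) f n m → SB.mul (λ i → shiftA (g i)) f n (suc m) U.≈ SB.mul g f n m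
  shiftB-* g f zero    m = shift-* (g 0) (f 0) m
  shiftB-* g f (suc n) m = U.+-cong (shift-* (g 0) (f (suc n)) m) (shiftB-* (g ∘ suc) f n m)

  ι-suc : ∀ a i → ι a (suc i) A.≈ shiftA (ι (a ∘ suc) i)
  ι-suc a i zero    = U.refl
  ι-suc a i (suc j) = U.refl

  ι-zero : ∀ a (g : A.Carrier) m → SA.mul (ι a 0) g m U.≈ a 0 U.* g m
  ι-zero a g m = U.trans (SA.mul-cong {ι a 0} {SA.constant (a 0)} {g} {g} (λ { zero → U.refl ; (suc _) → U.refl }) (λ _ → U.refl) m)
   (SA.mul-constant (a 0) g m)

 CT-ι* : ∀ a f → CT (ι a * f) A.≈ a A.* CT f
 CT-ι* a f zero    = U.refl
 CT-ι* a f (suc n) = U.+-cong (ι-zero a (f (suc n)) (suc n)) (U.trans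
  (SB.mul-cong {ι a ∘ suc} {λ i → shiftA (ι (a ∘ suc) i)} {f} {f} (ι-suc a) (λ _ → A.refl) n (suc n))
  (U.trans (shiftB-* (ι (a ∘ suc)) f n n) (CT-ι* (a ∘ suc) f n)))

 -- Turns information on supports into identities: a product such as t ρ is free of t because of its
 -- support, and is then the scalar read off from its constant term.
 diagonal : ∀ {f} → Supp _≡_ f → f ≈ ι (CT f)
 diagonal {f} s i j with s i j
 ... | inj₁ ≡.refl = U.sym (CT-ι (CT f) i)
 ... | inj₂ q with ι-supp (CT f) i j
 ...   | inj₁ ≡.refl = U.sym (CT-ι (CT f) i)
 ...   | inj₂ r = U.trans q (U.sym r)

 ι-* : ∀ a b → ι (a A.* b) ≈ ι a * ι b
 ι-* a b = B.sym (B.trans (diagonal {ι a * ι b} (supp-* {_≡_} {_≡_} {_≡_} {ι a} {ι b} (λ { i .i k .k ≡.refl ≡.refl → ≡.refl }) (ι-supp a) (ι-supp b)))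
  (ι-cong (A.trans (CT-ι* a (ι b)) (A.*-congˡ {a} (CT-ι b)))))

 ι-1 : ι A.1# ≈ 1#
 ι-1 zero    zero    = U.refl
 ι-1 zero    (suc j) = U.refl
 ι-1 (suc i) zero    = U.refl
 ι-1 (suc i) (suc j) = zeros i j
  where
  zeros : ∀ i j → ι (λ _ → U.0#) i j U.≈ U.0#
  zeros zero    zero    = U.refl
  zeros zero    (suc j) = U.refl
  zeros (suc i) zero    = U.refl
  zeros (suc i) (suc j) = zeros i j

 module MA = Algebra.Properties.Semiring.Mult A.semiring
 module MU = Algebra.Properties.Semiring.Mult U.semiring
 module MZ = Algebra.Properties.Semiring.Mult (CommutativeRing.semiring ℤ-ring)

 ×-pointwise : ∀ n (f : A.Carrier) j → (n MA.× f) j U.≈ n MU.× f j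
 ×-pointwise zero    f j = U.refl
 ×-pointwise (suc n) f j = U.+-congˡ {f j} (×-pointwise n f j)

 δ : A.Carrier → A.Carrier
 δ = SA.euler

 -- The monomial t^i s^j is t^(i-j) z^j, so z d/dz at fixed t multiplies it by j, and t d/dt at
 -- fixed z by i - j.
 D ϑ : B.Carrier → B.Carrier
 D f i = δ (f i)
 ϑ f = SB.euler f - D f

 δ-der : IsDerivation A δ
 δ-der = Derivations.euler-derivation U

 D-der : IsDerivation B D
 D-der = Derivations.lift-derivation A δ-der

 ϑ-der : IsDerivation B ϑ
 ϑ-der = Derivations.difference-derivation B (Derivations.euler-derivation A) D-der

 ϑ-at : ∀ f i j → ϑ f i j U.≈ i MU.× f i j U.- j MU.× f i j
 ϑ-at f i j = U.+-congʳ (×-pointwise i (f i) j)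

 private
  ×-zero : ∀ n {x} → x U.≈ U.0# → n MU.× x U.≈ U.0#
  ×-zero zero    q = U.refl
  ×-zero (suc n) q = zero-+ q (×-zero n q)

 supp-D : ∀ {P f} → Supp P f → Supp P (D f)
 supp-D s i j with s i j
 ... | inj₁ p = inj₁ p
 ... | inj₂ q = inj₂ (×-zero j q)

 supp-ϑ : ∀ {P f} → Supp P f → Supp P (ϑ f)
 supp-ϑ {f = f} s i j with s i j
 ... | inj₁ p = inj₁ p
 ... | inj₂ q = inj₂ (U.trans (ϑ-at f i j) (zero-+ (×-zero i q) (U.trans (U.-‿cong (×-zero j q)) -0#≈0#)))
  where open Algebra.Properties.Ring U.ring using (-0#≈0#)

 CT-ϑ : ∀ f → CT (ϑ f) A.≈ A.0#
 CT-ϑ f n = U.trans (ϑ-at f n n) (U.-‿inverseʳ (n MU.× f n n))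

 ϑ-ι : ∀ a → ϑ (ι a) ≈ 0#
 ϑ-ι a = B.trans (diagonal (supp-ϑ (ι-supp a))) (B.trans (ι-cong (CT-ϑ (ι a))) ι-0')
  where
  ι-0' : ι A.0# ≈ 0#
  ι-0' i j with ι-supp A.0# i j
  ... | inj₁ ≡.refl = CT-ι A.0# i
  ... | inj₂ q = q

 D-ι : ∀ a → D (ι a) ≈ ι (δ a)
 D-ι a = B.trans (diagonal (supp-D (ι-supp a))) (ι-cong (λ n → MU.×-congʳ n (CT-ι a n)))

 ϑ-D : ∀ f → ϑ (D f) ≈ D (ϑ f)
 ϑ-D f i j = U.trans (ϑ-at (D f) i j) (U.trans (U.+-congʳ (swap i j)) (U.trans (U.sym (minus j _ _)) (MU.×-congʳ j (U.sym (ϑ-at f i j)))))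
  where
  swap : ∀ i j → i MU.× (j MU.× f i j) U.≈ j MU.× (i MU.× f i j)
  swap i j = U.trans (MU.×-assocˡ _ i j) (U.trans (MU.×-congˡ (ℕP.*-comm i j)) (U.sym (MU.×-assocˡ _ j i)))
  open Algebra.Properties.CommutativeMonoid.Mult U.+-commutativeMonoid using (×-distrib-+)
  open Algebra.Properties.Ring U.ring using (-‿+-comm; -0#≈0#)
  neg : ∀ n x → n MU.× (U.- x) U.≈ U.- (n MU.× x)
  neg zero    x = U.sym -0#≈0#
  neg (suc n) x = U.trans (U.+-congˡ {U.- x} (neg n x)) (-‿+-comm x (n MU.× x))
  minus : ∀ n x y → n MU.× (x U.- y) U.≈ n MU.× x U.- n MU.× y
  minus n x y = U.trans (×-distrib-+ x (U.- y) n) (U.+-congˡ {n MU.× x} (neg n y))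

 restrict : (ℕ → ℕ → Bool) → B.Carrier → B.Carrier
 restrict P f i j = if P i j then f i j else U.0#

 restrict-true : ∀ P f {i j} → P i j ≡ true → restrict P f i j U.≈ f i j
 restrict-true P f q rewrite q = U.refl

 restrict-false : ∀ P f {i j} → P i j ≡ false → restrict P f i j U.≈ U.0#
 restrict-false P f q rewrite q = U.refl

 supp-restrict : ∀ P f → Supp (λ i j → P i j ≡ true) (restrict P f)
 supp-restrict P f i j with P i j
 ... | true  = inj₁ ≡.refl
 ... | false = inj₂ U.refl

 supp-restrict' : ∀ {Q} P {f} → Supp Q f → Supp Q (restrict P f)
 supp-restrict' P s i j with P i j
 ... | true  = s i j
 ... | false = inj₂ U.refl

 restrict-cong : ∀ P {f g} i j → f i j U.≈ g i j → restrict P f i j U.≈ restrict P g i j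
 restrict-cong P i j q with P i j
 ... | true  = q
 ... | false = U.refl

 -- In terms of the exponent i - j of t: the constant term, the term in t^(-1), the negative powers
 -- and the positive powers.
 onDiag onSub below above : ℕ → ℕ → Bool
 onDiag i j = ⌊ i ℕ.≟ j ⌋
 onSub  i j = ⌊ j ℕ.≟ suc i ⌋
 below  i j = ⌊ i ℕ.<? j ⌋
 above  i j = ⌊ j ℕ.<? i ⌋

 dec-holds : ∀ {P : Set} (d : Dec P) → ⌊ d ⌋ ≡ true → P
 dec-holds (yes p) _ = p

 holds-dec : ∀ {P : Set} (d : Dec P) → P → ⌊ d ⌋ ≡ true
 holds-dec (yes _) _ = ≡.refl
 holds-dec (no n)  p = ⊥-elim (n p)

 fails-dec : ∀ {P : Set} (d : Dec P) → ¬ P → ⌊ d ⌋ ≡ false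
 fails-dec (yes p) n = ⊥-elim (n p)
 fails-dec (no _)  _ = ≡.refl

 AtLeast : ℕ → B.Carrier → Set
 AtLeast n = Supp (λ i j → n ≤ i ℕ.+ j)

 atLeast-0 : ∀ f → AtLeast 0 f
 atLeast-0 f i j = inj₁ z≤n

 atLeast-≤ : ∀ {m n f} → m ≤ n → AtLeast n f → AtLeast m f
 atLeast-≤ l = supp-weaken (λ i j k → ℕP.≤-trans l k)

 atLeast-* : ∀ {m n f g} → AtLeast m f → AtLeast n g → AtLeast (m ℕ.+ n) (f * g)
 atLeast-* {m} {n} {f} {g} = supp-* {f = f} {g} λ i j k l a b → ℕP.≤-trans (ℕP.+-mono-≤ a b) (ℕP.≤-reflexive (interchange i j k l))

 module PB = Powers B
 module PA = Powers A
 module PU = Powers U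
 module IB = Identities B
 module IA = Identities A
 module IU = Identities U
 open PB using (_^_; ^-cong; int)

 atLeast-^ : ∀ {f} k → AtLeast 1 f → AtLeast k (f ^ k)
 atLeast-^ zero    a = atLeast-0 _
 atLeast-^ {f} (suc k) a = atLeast-* {f = f} {f ^ k} a (atLeast-^ k a)

 -- By f^(k+1) - g^(k+1) = (f - g) f^k + g (f^k - g^k), each power beyond the first raises the order
 -- of the difference by one. This makes the tree equation a contraction.
 atLeast-^-difference : ∀ {f g n} k → AtLeast 1 f → AtLeast 1 g → AtLeast n (f - g) → AtLeast (n ℕ.+ k) (f ^ suc k - g ^ suc k)
 atLeast-^-difference {f} {g} {n} zero a b d = supp-cong (B.sym (B.+-cong (B.*-identityʳ f) (B.-‿cong (B.*-identityʳ g))))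
  (atLeast-≤ {f = f - g} (ℕP.≤-reflexive (ℕP.+-identityʳ n)) d)
 atLeast-^-difference {f} {g} {n} (suc k) a b d = supp-cong (IB.id-power-difference f g (f ^ suc k) (g ^ suc k))
  (supp-+ (atLeast-* {f = f - g} {f ^ suc k} d (atLeast-^ (suc k) a)) (atLeast-≤ {f = g * (f ^ suc k - g ^ suc k)} (ℕP.≤-reflexive (ℕP.+-suc n k))
    (atLeast-* {f = g} {f ^ suc k - g ^ suc k} b (atLeast-^-difference k a b d))))

 module Limit (F : ℕ → B.Carrier) (cauchy : ∀ n → AtLeast (suc n) (F (suc n) - F n)) where

  -- Coefficients of total degree n in t and s no longer change from `F n` on.
  limit : B.Carrier
  limit i j = F (suc (i ℕ.+ j)) i j

  private
   stable : ∀ k i j → i ℕ.+ j ≤ k → F (suc k) i j U.≈ F k i j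
   stable k i j l with cauchy k i j
   ... | inj₁ q = ⊥-elim (ℕP.<⇒≱ (s≤s l) q)
   ... | inj₂ q = PU.difference-zero q

   from : ∀ n d i j → i ℕ.+ j ≤ n → F (d ℕ.+ n) i j U.≈ F n i j
   from n zero    i j l = U.refl
   from n (suc d) i j l = U.trans (stable (d ℕ.+ n) i j (ℕP.≤-trans l (ℕP.m≤n+m n d))) (from n d i j l)

  limit-at : ∀ n i j → i ℕ.+ j ≤ n → limit i j U.≈ F n i j
  limit-at n i j l = U.trans (stable (i ℕ.+ j) i j ℕP.≤-refl)
   (U.sym (U.trans (U.reflexive (≡.cong (λ k → F k i j) (≡.sym (ℕP.m∸n+n≡m l)))) (from (i ℕ.+ j) (n ℕ.∸ (i ℕ.+ j)) i j ℕP.≤-refl)))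

  limit-close : ∀ n → AtLeast (suc n) (limit - F n)
  limit-close n i j with i ℕ.+ j ℕ.≤? n
  ... | yes l = inj₂ (U.trans (U.+-congʳ {U.- F n i j} (limit-at n i j l)) (U.-‿inverseʳ (F n i j)))
  ... | no ¬l = inj₁ (ℕP.≰⇒> ¬l)

  limit-supp : ∀ {P} → (∀ n → Supp P (F n)) → Supp P limit
  limit-supp s i j = s (suc (i ℕ.+ j)) i j

  limit-fixed : ∀ (Φ : B.Carrier → B.Carrier) → (∀ n → F (suc n) ≈ Φ (F n)) → (∀ n → AtLeast (suc n) (Φ limit - Φ (F n))) → limit ≈ Φ limit
  limit-fixed Φ step close i j = U.trans (limit-at (suc (i ℕ.+ j)) i j (ℕP.n≤1+n _)) (U.trans (step (i ℕ.+ j) i j) (U.sym same))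
   where
   same : Φ limit i j U.≈ Φ (F (i ℕ.+ j)) i j
   same with close (i ℕ.+ j) i j
   ... | inj₁ q = ⊥-elim (ℕP.<-irrefl ≡.refl q)
   ... | inj₂ q = PU.difference-zero q

-- Construction of T, S, R and ω, and the properties required of them.

module TreeSetting where

 open PowerSeries
 open Residues
 open Bivariate
 open import Data.Integer using (+_)
 open import Data.Product using (_×_)
 open import Relation.Binary.Definitions using (tri<; tri≈; tri>)

 open B using (_≈_; _+_; _*_; _-_; -_; 0#; 1#)
 open PB using (_^_; ^-cong; int)

 t s : B.Carrier
 t = SB.variable-series
 s = SB.constant SA.variable-series

 uU : U.Carrier
 uU = SU.variable-series

 u z : A.Carrier
 u = SA.constant uU
 z = SA.variable-series

 scale : U.Carrier → B.Carrier → B.Carrier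
 scale c f i j = c U.* f i j

 ι-u : ∀ f → ι u * f ≈ scale uU f
 ι-u f i j = U.trans (B.*-congʳ {f} {ι u} {SB.constant u} same i j) (U.trans (SB.mul-constant u f i j) (SA.mul-constant uU (f i) j))
  where
  zeros : ∀ i j → ι (λ _ → U.0#) i j U.≈ U.0#
  zeros zero    zero    = U.refl
  zeros zero    (suc j) = U.refl
  zeros (suc i) zero    = U.refl
  zeros (suc i) (suc j) = zeros i j
  same : ι u ≈ SB.constant u
  same zero    zero    = U.refl
  same zero    (suc j) = U.refl
  same (suc i) zero    = U.refl
  same (suc i) (suc j) = zeros i j

 scale-zero : ∀ {x} → x U.≈ U.0# → uU U.* x U.≈ U.0#
 scale-zero {x} q = U.trans (U.*-congˡ {uU} q) (U.zeroʳ uU)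

 supp-scale : ∀ {P f} → Supp P f → Supp P (scale uU f)
 supp-scale a i j with a i j
 ... | inj₁ p = inj₁ p
 ... | inj₂ q = inj₂ (scale-zero q)

 supp-t : Supp (λ i j → i ≡ suc j × i ≡ 1) t
 supp-t zero          j       = inj₂ U.refl
 supp-t (suc zero)    zero    = inj₁ (≡.refl , ≡.refl)
 supp-t (suc zero)    (suc j) = inj₂ U.refl
 supp-t (suc (suc i)) j       = inj₂ U.refl

 supp-s : Supp (λ i j → j ≡ suc i × j ≡ 1) s
 supp-s zero    zero          = inj₂ U.refl
 supp-s zero    (suc zero)    = inj₁ (≡.refl , ≡.refl)
 supp-s zero    (suc (suc j)) = inj₂ U.refl
 supp-s (suc i) j             = inj₂ U.refl

 CT-below : ∀ {f} → Supp _<_ f → CT f A.≈ A.0#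
 CT-below a n with a n n
 ... | inj₁ l = ⊥-elim (ℕP.<-irrefl ≡.refl l)
 ... | inj₂ q = q

 CT-above : ∀ {f} → Supp (λ i j → j < i) f → CT f A.≈ A.0#
 CT-above a n with a n n
 ... | inj₁ l = ⊥-elim (ℕP.<-irrefl ≡.refl l)
 ... | inj₂ q = q

 supp-both : ∀ {P Q W : ℕ → ℕ → Set} {f} → (∀ i j → P i j → Q i j → W i j) → Supp P f → Supp Q f → Supp W f
 supp-both w a b i j with a i j | b i j
 ... | inj₂ q | _      = inj₂ q
 ... | inj₁ _ | inj₂ q = inj₂ q
 ... | inj₁ p | inj₁ q = inj₁ (w i j p q)

 ϑ-sub : ∀ {f} → Supp (λ i j → j ≡ suc i) f → ϑ f ≈ - f
 ϑ-sub {f} a i j with a i j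
 ... | inj₁ ≡.refl = U.trans (ϑ-at f i (suc i)) (IU.id-minus-one (f i (suc i)) (i MU.× f i (suc i)))
 ... | inj₂ e with supp-ϑ a i j
 ...   | inj₂ e' = U.trans e' (U.sym (U.trans (U.-‿cong e) (λ _ → ≡.refl)))
 ...   | inj₁ ≡.refl = U.trans (ϑ-at f i (suc i)) (IU.id-minus-one (f i (suc i)) (i MU.× f i (suc i)))

 ϑ-t : ϑ t ≈ t
 ϑ-t i j with supp-t i j
 ... | inj₁ (≡.refl , ≡.refl) = U.trans (ϑ-at t 1 0) (IU.id-plus-minus-0 (t 1 0))
 ... | inj₂ e with supp-ϑ supp-t i j
 ...   | inj₁ (≡.refl , ≡.refl) = U.trans (ϑ-at t 1 0) (IU.id-plus-minus-0 (t 1 0))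
 ...   | inj₂ e' = U.trans e' (U.sym e)

 D-t : D t ≈ 0#
 D-t i j with supp-D supp-t i j
 ... | inj₁ (≡.refl , ≡.refl) = U.refl
 ... | inj₂ e = e

 split-parts : ∀ {f} → CT f A.≈ A.0# → f ≈ restrict below f + restrict above f
 split-parts {f} f-diag i j with ℕP.<-cmp i j
 ... | tri< l ne ng = U.sym (U.trans (U.+-cong (restrict-true below f (holds-dec (i ℕ.<? j) l)) (restrict-false above f (fails-dec (j ℕ.<? i) ng)))
             (U.+-identityʳ (f i j)))
 ... | tri> nl ne g = U.sym (U.trans (U.+-cong (restrict-false below f (fails-dec (i ℕ.<? j) nl)) (restrict-true above f (holds-dec (j ℕ.<? i) g)))
             (U.+-identityˡ (f i j)))
 ... | tri≈ nl ≡.refl ng = U.sym (U.trans (U.+-cong (restrict-false below f (fails-dec (i ℕ.<? i) nl)) (restrict-false above f (fails-dec (i ℕ.<? i) ng)))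
             (U.trans (U.+-identityʳ U.0#) (U.sym (f-diag i))))

 split-below : ∀ {f c} → Supp _≤_ f → CT f A.≈ c → f ≈ ι c + restrict below f
 split-below {f} {c} sf e i j with ℕP.<-cmp i j
 ... | tri< l ne ng = U.sym (U.trans (U.+-cong (off (ι-supp c i j)) (restrict-true below f (holds-dec (i ℕ.<? j) l))) (U.+-identityˡ (f i j)))
  where off : ∀ {x} → i ≡ j ⊎ x U.≈ U.0# → x U.≈ U.0#
        off (inj₁ e) = ⊥-elim (ne e)
        off (inj₂ e) = e
 ... | tri≈ nl ≡.refl ng = U.sym (U.trans (U.+-cong (U.trans (CT-ι c i) (U.sym (e i))) (restrict-false below f (fails-dec (i ℕ.<? i) nl))) (U.+-identityʳ (f i i)))
 ... | tri> nl ne g = U.trans (big (sf i j)) (U.sym (U.trans (U.+-cong (off (ι-supp c i j)) (restrict-false below f (fails-dec (i ℕ.<? j) nl))) (U.+-identityʳ U.0#)))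
  where off : ∀ {x} → i ≡ j ⊎ x U.≈ U.0# → x U.≈ U.0#
        off (inj₁ e) = ⊥-elim (ne e)
        off (inj₂ e) = e
        big : ∀ {x} → i ≤ j ⊎ x U.≈ U.0# → x U.≈ U.0#
        big (inj₁ l) = ⊥-elim (ℕP.<⇒≱ g l)
        big (inj₂ e) = e

 split-above : ∀ {f c} → Supp (λ i j → j ≤ i) f → CT f A.≈ c → f ≈ ι c + restrict above f
 split-above {f} {c} sf e i j with ℕP.<-cmp j i
 ... | tri< l ne ng = U.sym (U.trans (U.+-cong (off (ι-supp c i j)) (restrict-true above f (holds-dec (j ℕ.<? i) l))) (U.+-identityˡ (f i j)))
  where off : ∀ {x} → i ≡ j ⊎ x U.≈ U.0# → x U.≈ U.0#
        off (inj₁ e) = ⊥-elim (ne (≡.sym e))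
        off (inj₂ e) = e
 ... | tri≈ nl ≡.refl ng = U.sym (U.trans (U.+-cong (U.trans (CT-ι c i) (U.sym (e i))) (restrict-false above f (fails-dec (i ℕ.<? i) nl))) (U.+-identityʳ (f i i)))
 ... | tri> nl ne g = U.trans (big (sf i j)) (U.sym (U.trans (U.+-cong (off (ι-supp c i j)) (restrict-false above f (fails-dec (j ℕ.<? i) nl))) (U.+-identityʳ U.0#)))
  where off : ∀ {x} → i ≡ j ⊎ x U.≈ U.0# → x U.≈ U.0#
        off (inj₁ e) = ⊥-elim (ne (≡.sym e))
        off (inj₂ e) = e
        big : ∀ {x} → j ≤ i ⊎ x U.≈ U.0# → x U.≈ U.0#
        big (inj₁ l) = ⊥-elim (ℕP.<⇒≱ g l)
        big (inj₂ e) = e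

 CT-+ : ∀ f g → CT (f + g) A.≈ CT f A.+ CT g
 CT-+ f g n = U.refl

 CT-cong : ∀ {f g} → f ≈ g → CT f A.≈ CT g
 CT-cong e n = e n n

 ×-zero-U : ∀ n → n MU.× U.0# U.≈ U.0#
 ×-zero-U zero    = U.refl
 ×-zero-U (suc n) = U.trans (U.+-identityˡ (n MU.× U.0#)) (×-zero-U n)

 δ-u : δ u A.≈ A.0#
 δ-u zero    = U.refl
 δ-u (suc n) = ×-zero-U (suc n)

 δ-z : δ z A.≈ z
 δ-z zero          = U.refl
 δ-z (suc zero)    = U.+-identityʳ (z 1)
 δ-z (suc (suc n)) = ×-zero-U (suc (suc n))

 ι-0 : ι A.0# ≈ 0#
 ι-0 i j with ι-supp A.0# i j
 ... | inj₁ ≡.refl = CT-ι A.0# i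
 ... | inj₂ q = q

 module Tree (p' : ℕ) where

  q : ℕ
  q = suc (suc p')

  -- Total degrees that are at least d and congruent to d modulo p - 2. This grading is Euler's
  -- relation on the side of the series and leads to `vanish`.
  Homog : ℕ → B.Carrier → Set
  Homog d = Supp (λ i j → ∃ λ w → i ℕ.+ j ≡ d ℕ.+ w ℕ.* suc p')

  homog-* : ∀ {c d f g} → Homog c f → Homog d g → Homog (c ℕ.+ d) (f * g)
  homog-* {c} {d} {f} {g} = supp-* {f = f} {g} λ i j k l (v , a) (w , b) → v ℕ.+ w , (begin
    (i ℕ.+ k) ℕ.+ (j ℕ.+ l) ≡⟨ solve 4 (λ i k j l → (i :+ k) :+ (j :+ l) := (i :+ j) :+ (k :+ l)) ≡.refl i k j l ⟩
    (i ℕ.+ j) ℕ.+ (k ℕ.+ l) ≡⟨ ≡.cong₂ ℕ._+_ a b ⟩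
    (c ℕ.+ v ℕ.* suc p') ℕ.+ (d ℕ.+ w ℕ.* suc p')
     ≡⟨ solve 5 (λ c v d w p → (c :+ v :* p) :+ (d :+ w :* p) := (c :+ d) :+ (v :+ w) :* p) ≡.refl c v d w (suc p') ⟩
    (c ℕ.+ d) ℕ.+ (v ℕ.+ w) ℕ.* suc p' ∎)
   where
   open ≡.≡-Reasoning
   open +-*-Solver

  homog-1 : Homog 0 1#
  homog-1 zero    zero    = inj₁ (0 , ≡.refl)
  homog-1 zero    (suc j) = inj₂ U.refl
  homog-1 (suc i) j       = inj₂ U.refl

  homog-^ : ∀ {f} k → Homog 1 f → Homog k (f ^ k)
  homog-^ zero    a = homog-1
  homog-^ {f} (suc k) a = homog-* {f = f} {f ^ k} a (homog-^ k a)

  homog-≥ : ∀ {d f} → Homog d f → AtLeast d f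
  homog-≥ = supp-weaken (λ i j (w , e) → ℕP.≤-trans (ℕP.m≤m+n _ _) (ℕP.≤-reflexive (≡.sym e)))

  homog-lower : ∀ {f} → Homog q f → Homog 1 f
  homog-lower = supp-weaken (λ i j (w , e) → suc w , e)

  homog-t : Homog 1 t
  homog-t = supp-weaken (λ { .1 .0 (≡.refl , ≡.refl) → 0 , ≡.refl }) supp-t

  homog-s : Homog 1 s
  homog-s = supp-weaken (λ { .0 .1 (≡.refl , ≡.refl) → 0 , ≡.refl }) supp-s

  -- For g = Y the four summands become t, S, ρ and Y, with S = u CT Y and ρ = s + u times the
  -- t^(-1) part of Y. A single fixed point thus solves the tree equation together with the
  -- equations for S and R.
  Ψ : B.Carrier → B.Carrier
  Ψ g = t + scale uU (restrict onDiag g) + (s + scale uU (restrict onSub g)) + g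

  Ψ-at : ∀ {f g} i j → f i j U.≈ g i j → Ψ f i j U.≈ Ψ g i j
  Ψ-at {f} {g} i j e = U.+-cong (U.+-cong (U.+-congˡ {t i j} (U.*-congˡ {uU} (restrict-cong onDiag {f} {g} i j e)))
   (U.+-congˡ {s i j} (U.*-congˡ {uU} (restrict-cong onSub {f} {g} i j e)))) e

  Ψ-close : ∀ {n f g} → AtLeast n (f - g) → AtLeast n (Ψ f - Ψ g)
  Ψ-close {n} {f} {g} a i j with a i j
  ... | inj₁ l = inj₁ l
  ... | inj₂ e = inj₂ (U.trans (U.+-congʳ {U.- Ψ g i j} (Ψ-at {f} {g} i j (PU.difference-zero e))) (U.-‿inverseʳ (Ψ g i j)))

  homog-Ψ : ∀ {g} → Homog 1 g → Homog 1 (Ψ g)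
  homog-Ψ a = supp-+ (supp-+ (supp-+ homog-t (supp-scale (supp-restrict' onDiag a))) (supp-+ homog-s (supp-scale (supp-restrict' onSub a)))) a

  Φ : B.Carrier → B.Carrier
  Φ f = Ψ (f ^ q)

  -- A contraction: raising to the power p - 1, which is at least 2, gains one order in a
  -- difference, and Ψ keeps it because each of its coefficients depends only on the same
  -- coefficient of its argument.
  Φ-close : ∀ {n f g} → AtLeast 1 f → AtLeast 1 g → AtLeast n (f - g) → AtLeast (suc n) (Φ f - Φ g)
  Φ-close {n} {f} {g} a b d = Ψ-close {f = f ^ q} {g ^ q} (atLeast-≤ {f = f ^ q - g ^ q}
   (ℕP.≤-trans (s≤s (ℕP.m≤m+n n p')) (ℕP.≤-reflexive (≡.sym (ℕP.+-suc n p')))) (atLeast-^-difference {f} {g} (suc p') a b d))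

  approx : ℕ → B.Carrier
  approx zero    = 0#
  approx (suc n) = Φ (approx n)

  homog-approx : ∀ n → Homog 1 (approx n)
  homog-approx zero    = supp-zero
  homog-approx (suc n) = homog-Ψ (homog-lower (homog-^ q (homog-approx n)))

  approx-cauchy : ∀ n → AtLeast (suc n) (approx (suc n) - approx n)
  approx-cauchy zero    = homog-≥ (supp-- (homog-approx 1) (homog-approx 0))
  approx-cauchy (suc n) = Φ-close {f = approx (suc n)} {approx n} (homog-≥ (homog-approx (suc n))) (homog-≥ (homog-approx n)) (approx-cauchy n)

  module LT = Limit approx approx-cauchy

  T : B.Carrier
  T = LT.limit

  homog-T : Homog 1 T
  homog-T = LT.limit-supp homog-approx

  T-fixed : T ≈ Φ T
  T-fixed = LT.limit-fixed Φ (λ n → B.refl) (λ n → atLeast-≤ {f = Φ T - Φ (approx n)} (ℕP.n≤1+n (suc n))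
   (Φ-close {f = T} {approx n} (homog-≥ homog-T) (homog-≥ (homog-approx n)) (LT.limit-close n)))

  module Inverse (T : B.Carrier) (homog-T : Homog 1 T) where

   g E : B.Carrier
   g = int (+ suc (suc p')) * T ^ suc p'
   E = int (+ 1) - g

   atLeast-g : AtLeast 1 g
   atLeast-g = atLeast-* {0} {1} {int (+ suc (suc p'))} {T ^ suc p'} (atLeast-0 (int (+ suc (suc p'))))
    (atLeast-≤ {f = T ^ suc p'} (s≤s z≤n) (homog-≥ (homog-^ (suc p') homog-T)))

   approx-e : ℕ → B.Carrier
   approx-e zero    = 1#
   approx-e (suc n) = 1# + g * approx-e n

   step-close : ∀ {n} a b → AtLeast n (a - b) → AtLeast (suc n) ((1# + g * a) - (1# + g * b))
   step-close {n} a b d = supp-cong (IB.id-affine 1# g a b) (atLeast-* {1} {n} {g} {a - b} atLeast-g d)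

   approx-e-cauchy : ∀ n → AtLeast (suc n) (approx-e (suc n) - approx-e n)
   approx-e-cauchy zero = supp-cong (IB.id-affine₀ 1# g) (atLeast-* {1} {0} {g} {1#} atLeast-g (atLeast-0 1#))
   approx-e-cauchy (suc n) = step-close (approx-e (suc n)) (approx-e n) (approx-e-cauchy n)

   module LE = Limit approx-e approx-e-cauchy

   e : B.Carrier
   e = LE.limit

   e-fixed : e ≈ 1# + g * e
   e-fixed = LE.limit-fixed (λ f → 1# + g * f) (λ n → B.refl)
    (λ n → atLeast-≤ {f = (1# + g * e) - (1# + g * approx-e n)} (ℕP.n≤1+n (suc n)) (step-close e (approx-e n) (LE.limit-close n)))

   e-E : e * E ≈ 1#
   e-E = B.trans (IB.id-inverse e g) (PB.move e-fixed)

  -- T and e enter as parameters with their equations, so that nothing here depends on their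
  -- construction as limits.
  module Around (T : B.Carrier) (homog-T : Homog 1 T) (T-fixed : T ≈ Ψ (T ^ q)) (e : B.Carrier)
   (e-E : e * (int (+ 1) - int (+ q) * T ^ suc p') ≈ 1#) where

   Y : B.Carrier
   Y = T ^ q

   homog-Y : Homog 1 Y
   homog-Y = homog-lower (homog-^ q homog-T)

   ρ : B.Carrier
   ρ = s + scale uU (restrict onSub Y)

   S R : A.Carrier
   S = u A.* CT Y
   R = CT (t * ρ)

   X y V : B.Carrier
   X = t + ι S + ρ
   y = t - ρ
   V = X - ι u * Y

   supp-ρ : Supp (λ i j → j ≡ suc i) ρ
   supp-ρ = supp-+ (supp-weaken (λ i j → proj₁) supp-s) (supp-scale (supp-weaken (λ i j e → dec-holds (j ℕ.≟ suc i) e) (supp-restrict onSub Y)))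

   homog-ρ : Homog 1 ρ
   homog-ρ = supp-+ homog-s (supp-scale (supp-restrict' onSub homog-Y))

   u-diag : scale uU (restrict onDiag Y) ≈ ι S
   u-diag = B.trans (diagonal {scale uU (restrict onDiag Y)} (supp-scale (supp-weaken (λ i j e → dec-holds (i ℕ.≟ j) e) (supp-restrict onDiag Y))))
    (ι-cong (λ n → U.trans (U.*-congˡ {uU} (restrict-true onDiag Y (holds-dec (n ℕ.≟ n) ≡.refl))) (U.sym (SA.mul-constant uU (CT Y) n))))

   T-eq : T ≈ X + Y
   T-eq = B.trans T-fixed (B.+-congʳ {Y} (B.+-congʳ {ρ} (B.+-congˡ {t} u-diag)))

   homog-X : Homog 1 X
   homog-X = supp-+ (supp-+ homog-t (supp-cong u-diag (supp-scale (supp-restrict' onDiag homog-Y)))) homog-ρ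

   homog-y : Homog 1 y
   homog-y = supp-- homog-t homog-ρ

   homog-V : Homog 1 V
   homog-V = supp-- homog-X (supp-cong (B.sym (ι-u Y)) (supp-scale homog-Y))

   tρ : t * ρ ≈ ι R
   tρ = diagonal {t * ρ} (supp-* {f = t} {ρ} (λ { .1 .0 k .(suc k) (≡.refl , ≡.refl) ≡.refl → ≡.refl }) supp-t supp-ρ)

   ω ω̃ : B.Carrier
   ω = restrict below V
   ω̃ = restrict above V

   ϑ-ρ : ϑ ρ ≈ - ρ
   ϑ-ρ = ϑ-sub supp-ρ

   Neg Pos : B.Carrier → Set
   Neg = Supp _<_
   Pos = Supp (λ i j → j < i)

   neg-ω : Neg ω
   neg-ω = supp-weaken (λ i j e → dec-holds (i ℕ.<? j) e) (supp-restrict below V)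

   pos-ω̃ : Pos ω̃
   pos-ω̃ = supp-weaken (λ i j e → dec-holds (j ℕ.<? i) e) (supp-restrict above V)

   homog-ω : Homog 1 ω
   homog-ω = supp-restrict' below homog-V

   Up Down : B.Carrier → Set
   Up   = Supp (λ i j → i ≤ suc j)
   Down = Supp (λ i j → j ≤ suc i)

   t-up : Up t
   t-up = supp-weaken (λ { i j (≡.refl , _) → ℕP.≤-refl }) supp-t
   t-down : Down t
   t-down = supp-weaken (λ { i j (≡.refl , _) → ℕP.m≤n+m j 2 }) supp-t
   t-pos : Pos t
   t-pos = supp-weaken (λ { i j (≡.refl , _) → ℕP.≤-refl }) supp-t
   ρ-up : Up ρ
   ρ-up = supp-weaken (λ { i j ≡.refl → ℕP.m≤n+m i 2 }) supp-ρ
   ρ-down : Down ρ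
   ρ-down = supp-weaken (λ { i j ≡.refl → ℕP.≤-refl }) supp-ρ
   ρ-neg : Neg ρ
   ρ-neg = supp-weaken (λ { i j ≡.refl → ℕP.≤-refl }) supp-ρ
   ι-up : ∀ a → Up (ι a)
   ι-up a = supp-weaken (λ { i j ≡.refl → ℕP.n≤1+n i }) (ι-supp a)
   ι-down : ∀ a → Down (ι a)
   ι-down a = supp-weaken (λ { i j ≡.refl → ℕP.n≤1+n i }) (ι-supp a)

   X-up : Up X
   X-up = supp-+ (supp-+ t-up (ι-up S)) ρ-up
   X-down : Down X
   X-down = supp-+ (supp-+ t-down (ι-down S)) ρ-down
   y-up : Up y
   y-up = supp-- t-up ρ-up
   y-down : Down y
   y-down = supp-- t-down ρ-down

   up-neg : ∀ {f g} → Up f → Neg g → Supp _≤_ (f * g)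
   up-neg {f} {g} = supp-* {f = f} {g} λ i j k l a b → ℕP.≤-trans (ℕP.+-monoˡ-≤ k a)
    (ℕP.≤-trans (ℕP.≤-reflexive (≡.sym (ℕP.+-suc j k))) (ℕP.+-monoʳ-≤ j b))

   down-pos : ∀ {f g} → Down f → Pos g → Supp (λ i j → j ≤ i) (f * g)
   down-pos {f} {g} = supp-* {f = f} {g} λ i j k l a b → ℕP.≤-trans (ℕP.+-monoˡ-≤ l a)
    (ℕP.≤-trans (ℕP.≤-reflexive (≡.sym (ℕP.+-suc i l))) (ℕP.+-monoʳ-≤ i b))

   le-neg : ∀ {f g} → Supp _≤_ f → Neg g → Neg (f * g)
   le-neg {f} {g} = supp-* {f = f} {g} λ i j k l a b → ℕP.+-mono-≤-< a b

   ge-pos : ∀ {f g} → Supp (λ i j → j ≤ i) f → Pos g → Pos (f * g)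
   ge-pos {f} {g} = supp-* {f = f} {g} λ i j k l a b → ℕP.+-mono-≤-< a b

   neg-le : ∀ {f} → Neg f → Supp _≤_ f
   neg-le = supp-weaken (λ i j → ℕP.<⇒≤)

   pos-ge : ∀ {f} → Pos f → Supp (λ i j → j ≤ i) f
   pos-ge = supp-weaken (λ i j → ℕP.<⇒≤)

   ι-le : ∀ a → Supp _≤_ (ι a)
   ι-le a = supp-weaken (λ { i j ≡.refl → ℕP.≤-refl }) (ι-supp a)
   ι-ge : ∀ a → Supp (λ i j → j ≤ i) (ι a)
   ι-ge a = supp-weaken (λ { i j ≡.refl → ℕP.≤-refl }) (ι-supp a)

   -- The equation for S is made for this: it removes the constant term of V, which is then the sum
   -- of its negative and positive powers of t.
   V-diag : CT V A.≈ A.0#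
   V-diag = A.trans {CT V} {A.0# A.+ S A.+ A.0# A.- S} {A.0#} (A.+-cong {CT X} {A.0# A.+ S A.+ A.0#} {A.- CT (ι u * Y)} {A.- S}
     (A.+-cong {CT t A.+ CT (ι S)} {A.0# A.+ S} {CT ρ} {A.0#} (A.+-cong {CT t} {A.0#} {CT (ι S)} {S} (CT-above t-pos) (CT-ι S)) (CT-below ρ-neg))
     (A.-‿cong {CT (ι u * Y)} {S} (CT-ι* u Y))) (IA.id-cancel S)

   V-eq : V ≈ ω + ω̃
   V-eq = split-parts V-diag

   neg-step : ∀ {a} → Neg a → Σ B.Carrier λ a₁ → Neg a₁ × X * a ≈ ι (A.1# A.* CT (y * a)) + a₁
   neg-step {a} na = restrict below (X * a) , supp-weaken (λ i j e → dec-holds (i ℕ.<? j) e) (supp-restrict below (X * a)) ,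
     split-below (up-neg {X} {a} X-up na) const
    where
    rest : B.Carrier
    rest = (ι S + (ρ + ρ)) * a
    -- X = y + (S + 2 ρ), and S + 2 ρ has no positive powers of t, so its product with a has no
    -- constant term.
    const : CT (X * a) A.≈ A.1# A.* CT (y * a)
    const = A.trans {CT (X * a)} {CT (y * a) A.+ CT rest} {A.1# A.* CT (y * a)} (CT-cong {X * a} {y * a + rest} (IB.id-up t (ι S) ρ a))
     (A.trans {CT (y * a) A.+ CT rest} {CT (y * a) A.+ A.0#} {A.1# A.* CT (y * a)}
      (A.+-congˡ {CT (y * a)} {CT rest} {A.0#} (CT-below (le-neg {ι S + (ρ + ρ)} {a} (supp-+ (ι-le S) (supp-+ (neg-le ρ-neg) (neg-le ρ-neg))) na)))
      (A.trans {CT (y * a) A.+ A.0#} {CT (y * a)} {A.1# A.* CT (y * a)} (A.+-identityʳ (CT (y * a))) (A.sym {A.1# A.* CT (y * a)} {CT (y * a)} (A.*-identityˡ (CT (y * a))))))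

   pos-step : ∀ {a} → Pos a → Σ B.Carrier λ a₁ → Pos a₁ × X * a ≈ ι (A.- A.1# A.* CT (y * a)) + a₁
   pos-step {a} pa = restrict above (X * a) , supp-weaken (λ i j e → dec-holds (j ℕ.<? i) e) (supp-restrict above (X * a)) ,
     split-above (down-pos {X} {a} X-down pa) const
    where
    rest : B.Carrier
    rest = (ι S + (t + t)) * a
    const : CT (X * a) A.≈ A.- A.1# A.* CT (y * a)
    const = A.trans {CT (X * a)} {CT rest A.- CT (y * a)} {A.- A.1# A.* CT (y * a)} (CT-cong {X * a} {rest - y * a} (IB.id-down t (ι S) ρ a))
     (A.trans {CT rest A.- CT (y * a)} {A.0# A.- CT (y * a)} {A.- A.1# A.* CT (y * a)}
      (A.+-congʳ {A.- CT (y * a)} {CT rest} {A.0#} (CT-above (ge-pos {ι S + (t + t)} {a} (supp-+ (ι-ge S) (supp-+ (pos-ge t-pos) (pos-ge t-pos))) pa)))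
      (A.trans {A.0# A.- CT (y * a)} {A.- CT (y * a)} {A.- A.1# A.* CT (y * a)} (A.+-identityˡ (A.- CT (y * a))) (IA.id-negate (CT (y * a)))))

   neg-orth : ∀ {a b} → Neg a → Neg b → CT (y * a * b) A.≈ A.0#
   neg-orth {a} {b} na nb = CT-below (le-neg {y * a} {b} (up-neg {y} {a} y-up na) nb)

   pos-orth : ∀ {a b} → Pos a → Pos b → CT (y * a * b) A.≈ A.0#
   pos-orth {a} {b} pa pb = CT-above (ge-pos {y * a} {b} (down-pos {y} {a} y-down pa) pb)

   z-diag : R A.≈ z A.+ u A.* CT (t * Y)
   z-diag zero    = U.sym (U.trans (U.+-cong (U.refl {U.0#}) (U.trans (SA.mul-constant uU (CT (t * Y)) 0) (scale-zero (SB.mul-variable-zero Y 0))))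
    (U.trans (U.+-identityʳ U.0#) (U.sym (SB.mul-variable-zero ρ 0))))
   z-diag (suc n) = U.trans (SB.mul-variable-suc ρ n (suc n)) (U.+-cong (s-z n)
    (U.trans (U.*-congˡ {uU} (U.trans (restrict-true onSub Y (holds-dec (suc n ℕ.≟ suc n) ≡.refl)) (U.sym (SB.mul-variable-suc Y n (suc n)))))
     (U.sym (SA.mul-constant uU (CT (t * Y)) (suc n)))))
    where
    s-z : ∀ n → s n (suc n) U.≈ z (suc n)
    s-z zero    = U.refl
    s-z (suc n) = U.refl

   -- The product t ω̃ has only positive powers, so ω may be replaced by V. In CT (t V) = R - u CT
   -- (t Y) the equation for R leaves z.
   CT-tω : CT (t * ω) A.≈ z
   CT-tω = A.trans {CT (t * ω)} {CT (t * V)} {z} (A.sym {CT (t * V)} {CT (t * ω)} (A.trans {CT (t * V)} {CT (t * ω) A.+ CT (t * ω̃)} {CT (t * ω)}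
      (CT-cong {t * V} {t * ω + t * ω̃} (B.trans (B.*-congˡ {t} V-eq) (B.distribˡ t ω ω̃)))
      (A.trans {CT (t * ω) A.+ CT (t * ω̃)} {CT (t * ω) A.+ A.0#} {CT (t * ω)}
       (A.+-congˡ {CT (t * ω)} {CT (t * ω̃)} {A.0#} (CT-above (ge-pos {t} {ω̃} (pos-ge t-pos) pos-ω̃))) (A.+-identityʳ (CT (t * ω))))))
    (A.trans {CT (t * V)} {CT (t * t) A.+ CT (ι S * t) A.+ R A.- CT (ι u * (t * Y))} {z}
     (CT-cong {t * V} {t * t + ι S * t + t * ρ - ι u * (t * Y)} (IB.id-tV t (ι S) ρ (ι u) Y))
     (A.trans {CT (t * t) A.+ CT (ι S * t) A.+ R A.- CT (ι u * (t * Y))} {A.0# A.+ A.0# A.+ (z A.+ c) A.- c} {z}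
      (A.+-cong {CT (t * t) A.+ CT (ι S * t) A.+ R} {A.0# A.+ A.0# A.+ (z A.+ c)} {A.- CT (ι u * (t * Y))} {A.- c}
       (A.+-cong {CT (t * t) A.+ CT (ι S * t)} {A.0# A.+ A.0#} {R} {z A.+ c}
        (A.+-cong {CT (t * t)} {A.0#} {CT (ι S * t)} {A.0#} (CT-above (ge-pos {t} {t} (pos-ge t-pos) t-pos)) (CT-above (ge-pos {ι S} {t} (ι-ge S) t-pos)))
        z-diag) (A.-‿cong {CT (ι u * (t * Y))} {c} (CT-ι* u (t * Y)))) (IA.id-residue z c)))
    where
    c : A.Carrier
    c = u A.* CT (t * Y)

   CT-yω : CT (y * ω) A.≈ z
   CT-yω = A.trans {CT (y * ω)} {CT (t * ω) A.- CT (ρ * ω)} {z} (CT-cong {y * ω} {t * ω - ρ * ω} (IB.id-distrib t ρ ω))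
    (A.trans {CT (t * ω) A.- CT (ρ * ω)} {z A.- A.0#} {z}
     (A.+-cong {CT (t * ω)} {z} {A.- CT (ρ * ω)} {A.- A.0#} CT-tω (A.-‿cong {CT (ρ * ω)} {A.0#} (CT-below (le-neg {ρ} {ω} (neg-le ρ-neg) neg-ω))))
     (IA.id-minus-0 z))

   module Dt = Derivation B ϑ-der
   module Ds = Derivation B D-der

   ϑ-X : ϑ X ≈ y
   ϑ-X = B.trans (Dt.d-+ (t + ι S) ρ) (B.+-cong (B.trans (Dt.d-+ t (ι S)) (B.trans (B.+-cong ϑ-t (ϑ-ι S)) (B.+-identityʳ t))) ϑ-ρ)

   module Wd = Wedge B D-der ϑ-der X
   module TS = TreeSeries B p'

   V-dependent : Wd.Dependent V
   V-dependent = Wd.dependent-- {X} {ι u * Y} Wd.dependent-x (Wd.dependent-* {ι u} {Y}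
    (Wd.dependent-constant {ι u} (B.trans (D-ι u) (B.trans (ι-cong δ-u) ι-0)) (ϑ-ι u))
    (Wd.dependent-^ {T} q (TS.T-dependent {T} {X} {e} T-eq e-E D-der ϑ-der)))

   J : B.Carrier → B.Carrier
   J f = y * D f - D X * ϑ f

   -- `D` treats t as a constant, so X loses its only positive power.
   DX-le : Supp _≤_ (D X)
   DX-le = supp-cong (B.sym (B.trans (Ds.d-+ (t + ι S) ρ) (B.+-congʳ {D ρ} (B.trans (Ds.d-+ t (ι S)) (B.trans (B.+-congʳ {D (ι S)} D-t) (B.+-identityˡ (D (ι S))))))))
    (supp-+ (supp-D (supp-weaken (λ { i j ≡.refl → ℕP.≤-refl }) (ι-supp S))) (supp-D (neg-le ρ-neg)))

   J-ω : Supp _≤_ (J ω)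
   J-ω = supp-- (up-neg {y} {D ω} y-up (supp-D neg-ω)) (neg-le (le-neg {D X} {ϑ ω} DX-le (supp-ϑ neg-ω)))

   J-ω̃ : Supp (λ i j → j ≤ i) (J ω̃)
   J-ω̃ = supp-- (down-pos {y} {D ω̃} y-down (supp-D pos-ω̃)) (down-pos {D X} {ϑ ω̃} (supp-D X-down) (supp-ϑ pos-ω̃))

   J-sum : J ω ≈ - J ω̃
   J-sum = PB.neg-unique (B.trans (B.+-comm (J ω̃) (J ω)) (B.trans (IB.id-bracket-sum y (D ω) (D ω̃) (D X) (ϑ ω) (ϑ ω̃))
    (B.trans (B.+-cong (B.*-congˡ {y} (B.trans (B.sym (Ds.d-+ ω ω̃)) (Ds.d-cong (B.sym V-eq))))
      (B.-‿cong (B.*-congˡ {D X} (B.trans (B.sym (Dt.d-+ ω ω̃)) (Dt.d-cong (B.sym V-eq))))))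
     (B.trans (B.+-congʳ { - (D X * ϑ V)} (B.trans (B.*-congʳ {D V} (B.sym ϑ-X)) V-dependent)) (B.-‿inverseʳ (D X * ϑ V))))))

   -- `J` is additive and kills V, a function of X; hence J ω = - J ω̃. The left side has no
   -- positive powers of t and the right side no negative ones, so both are scalars. The scalar is
   -- the constant term of t D ω = D (t ω), which is δ z = z.
   jacobian : y * D ω - D X * ϑ ω ≈ ι z
   jacobian = B.trans (diagonal {J ω} diag) (ι-cong value)
    where
    both : Supp (λ i j → j ≤ i) (J ω)
    both = supp-cong (B.sym J-sum) (supp-neg J-ω̃)
    diag : Supp _≡_ (J ω)
    diag = supp-both (λ i j → ℕP.≤-antisym) J-ω both
    tD : CT (t * D ω) A.≈ z
    tD = A.trans {CT (t * D ω)} {δ (CT (t * ω))} {z}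
     (CT-cong {t * D ω} {D (t * ω)} (B.sym (B.trans (Ds.d-* t ω) (B.trans (B.+-congʳ {t * D ω} (B.trans (B.*-congʳ {ω} D-t) (B.zeroˡ ω))) (B.+-identityˡ (t * D ω))))))
     (A.trans {δ (CT (t * ω))} {δ z} {z} (IsDerivation.d-cong δ-der {CT (t * ω)} {z} CT-tω) δ-z)
    value : CT (J ω) A.≈ z
    value = A.trans {CT (J ω)} {CT (t * D ω) A.- CT (ρ * D ω) A.- CT (D X * ϑ ω)} {z} (CT-cong {J ω} {t * D ω - ρ * D ω - D X * ϑ ω} (IB.id-bracket t ρ (D ω) (D X) (ϑ ω)))
     (A.trans {CT (t * D ω) A.- CT (ρ * D ω) A.- CT (D X * ϑ ω)} {z A.- A.0# A.- A.0#} {z}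
      (A.+-cong {CT (t * D ω) A.- CT (ρ * D ω)} {z A.- A.0#} {A.- CT (D X * ϑ ω)} {A.- A.0#}
       (A.+-cong {CT (t * D ω)} {z} {A.- CT (ρ * D ω)} {A.- A.0#} tD (A.-‿cong {CT (ρ * D ω)} {A.0#} (CT-below (le-neg {ρ} {D ω} (neg-le ρ-neg) (supp-D neg-ω)))))
       (A.-‿cong {CT (D X * ϑ ω)} {A.0#} (CT-below (le-neg {D X} {ϑ ω} DX-le (supp-ϑ neg-ω))))) (IA.id-minus-00 z))

-- The concrete setting and the series that satisfy the recursion.

module Instance where

 open PowerSeries
 open Residues
 open Bivariate
 open TreeSetting
 open Recursions
 open import Algebra.Bundles using (CommutativeRing)
 open import Data.Nat.Induction using (<-rec)
 open import Data.Nat.ListAction using (sum)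
 open import Data.Integer using (+_)
 open import Data.Product using (_×_)
 import Algebra.Properties.Semiring.Mult

 open B using (_≈_; _+_; _*_; _-_; -_; 0#; 1#)
 open PB using (_^_; int)

 record TreeData (p' : ℕ) : Set where
  open Tree p' using (Homog; Ψ; q)
  field
   T       : B.Carrier
   homog-T : Homog 1 T
   T-fixed : T ≈ Ψ (T ^ q)
   e       : B.Carrier
   e-E     : e * (int (+ 1) - int (+ q) * T ^ suc p') ≈ 1#

 abstract
  -- Sealed: everything later uses T and e through their equations, and the limits are never
  -- evaluated.
  treeData : ∀ p' → TreeData p'
  treeData p' = record { T = T ; homog-T = homog-T ; T-fixed = T-fixed ; e = Inverse.e T homog-T ; e-E = Inverse.e-E T homog-T }
   where open Tree p'

 module _ (R : CRing) where
  open CommutativeRing R renaming (_*_ to infixl 7 _·_; _≈_ to infix 4 _∼_) hiding (zero; _+_; _-_; -_; 0#; 1#)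
  open Algebra.Properties.Semiring.Mult semiring renaming (_×_ to _⋆_)

  int-multiple : ∀ n x → Powers.int R (+ n) · x ∼ n ⋆ x
  int-multiple n x = trans (×-assoc-* n (CommutativeRing.1# R) x) (×-congʳ n (*-identityˡ x))

 ×-ℤ : ∀ n (x : U.Carrier) m → (n MU.× x) m ≡ + n ℤ.* x m
 ×-ℤ zero    x m = ≡.sym (ℤP.*-zeroˡ (x m))
 ×-ℤ (suc n) x m = ≡.trans (≡.cong (λ y → x m ℤ.+ y) (×-ℤ n x m)) (≡.sym (≡.trans (≡.cong (ℤ._* x m) (ℤP.pos-+ 1 n))
  (≡.trans (ℤP.*-distribʳ-+ (x m) (+ 1) (+ n)) (≡.cong (ℤ._+ + n ℤ.* x m) (ℤP.*-identityˡ (x m))))))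

 int-at : ∀ n a i m → (PA.int (+ n) A.* a) i m ≡ + n ℤ.* a i m
 int-at n a i m = ≡.trans (int-multiple A n a i m) (≡.trans (×-pointwise n a i m) (×-ℤ n (a i) m))

 cancel-suc : ∀ k y → + suc k ℤ.* y ≡ + 0 → y ≡ + 0
 cancel-suc k y e with ℤP.i*j≡0⇒i≡0∨j≡0 (+ suc k) e
 ... | inj₁ ()
 ... | inj₂ q = q

 torsion-free : ∀ k a → PA.int (+ suc k) A.* a A.≈ A.0# → a A.≈ A.0#
 torsion-free k a e i m = cancel-suc k (a i m) (≡.trans (≡.sym (int-at (suc k) a i m)) (e i m))

 mul-u : ∀ g i m → (u A.* g) i m ≡ delay (g i) m
 mul-u g i m = ≡.trans (SA.mul-constant uU g i m) (go m)
  where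
  go : ∀ m → (uU U.* g i) m ≡ delay (g i) m
  go zero    = SU.mul-variable-zero (g i)
  go (suc m) = SU.mul-variable-suc (g i) m

 module _ (b a : A.Carrier) where
  product-vanishes : ∀ m → (∀ i m' → m' ≤ m → a i m' ≡ + 0) → ∀ i → (b A.* a) i m ≡ + 0
  product-vanishes m z i with SA.mul-case (λ x → x m ≡ + 0) (λ p q → ≡.cong₂ ℤ._+_ p q) ⊥ i b a
    (λ k l _ → SU.mul-case (_≡ + 0) (λ p q → ≡.cong₂ ℤ._+_ p q) ⊥ m (b k) (a l)
     (λ c d cd → inj₂ (≡.trans (≡.cong (b k c ℤ.*_) (z l d (ℕP.≤-trans (ℕP.m≤n+m d c) (ℕP.≤-reflexive cd)))) (ℤP.*-zeroʳ (b k c)))))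
  ... | inj₂ q = q

 -- A series that is a nonzero multiple of z modulo u is not a zero divisor.
 regular-z : ∀ k b a → (PA.int (+ suc k) A.* z A.+ u A.* b) A.* a A.≈ A.0# → a A.≈ A.0#
 regular-z k b a e i m = <-rec (λ m → ∀ i → a i m ≡ + 0) step m i
  where
  K = PA.int (+ suc k)
  expand : (K A.* z A.+ u A.* b) A.* a A.≈ z A.* (K A.* a) A.+ u A.* (b A.* a)
  expand = IA.id-regular K z u b a
  equation : ∀ i m → + suc k ℤ.* a i m ℤ.+ delay ((b A.* a) (suc i)) m ≡ + 0
  equation i m = ≡.trans (≡.sym (≡.cong₂ ℤ._+_ (≡.trans (SA.mul-variable-suc (K A.* a) i m) (int-at (suc k) a i m)) (mul-u (b A.* a) (suc i) m)))
   (≡.trans (≡.sym (expand (suc i) m)) (e (suc i) m))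
  step : ∀ m → (∀ {m'} → m' < m → ∀ i → a i m' ≡ + 0) → ∀ i → a i m ≡ + 0
  step zero    rec i = cancel-suc k (a i 0) (≡.trans (≡.sym (ℤP.+-identityʳ _)) (equation i 0))
  step (suc m) rec i = cancel-suc k (a i (suc m)) (≡.trans (≡.sym (≡.trans (≡.cong (λ y → + suc k ℤ.* a i (suc m) ℤ.+ y)
   (product-vanishes b a m (λ i m' l → rec (s≤s l) i) (suc i))) (ℤP.+-identityʳ _))) (equation i (suc m)))

 module _ (p' : ℕ) where
  private
   module Tr = Tree p'
   module TD = TreeData (treeData p')
   module Ar = Tr.Around TD.T TD.homog-T TD.T-fixed TD.e TD.e-E

  ambient : Ambient
  ambient = record
   { A = A ; B = B ; ι = ι ; ι-cong = ι-cong ; ι-+ = ι-+ ; ι-* = ι-* ; ι-1 = ι-1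
   ; CT = CT ; CT-cong = λ {f} {g} → CT-cong {f} {g} ; CT-+ = CT-+ ; CT-ι* = CT-ι* ; ϑ = ϑ ; D = D ; δ = δ
   ; ϑ-der = ϑ-der ; D-der = D-der ; δ-der = δ-der ; CT-ϑ = CT-ϑ ; CT-D = λ f n → U.refl
   ; ϑ-ι = ϑ-ι ; D-ι = D-ι ; ϑ-D = ϑ-D ; torsion-free = torsion-free
   ; u = u ; z = z ; δ-u = δ-u ; δ-z = δ-z ; t = t ; ρ = Ar.ρ ; T = TD.T ; S = Ar.S ; R = Ar.R }

  -- R and z differ by a multiple of u, which is absorbed into b to reach the case of z.
  regular : ∀ k x b → x A.≈ PA.int (+ suc k) A.* Ar.R A.+ u A.* b → ∀ a → x A.* a A.≈ A.0# → a A.≈ A.0#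
  regular k x b e a xa = regular-z k (K A.* c A.+ b) a (A.trans {(K A.* z A.+ u A.* (K A.* c A.+ b)) A.* a} {x A.* a} {A.0#}
     (A.*-congʳ {a} {K A.* z A.+ u A.* (K A.* c A.+ b)} {x} (A.trans {K A.* z A.+ u A.* (K A.* c A.+ b)} {K A.* Ar.R A.+ u A.* b} {x}
       (A.trans {K A.* z A.+ u A.* (K A.* c A.+ b)} {K A.* (z A.+ u A.* c) A.+ u A.* b} {K A.* Ar.R A.+ u A.* b} (IA.id-regroup K z u c b)
        (A.+-congʳ {u A.* b} {K A.* (z A.+ u A.* c)} {K A.* Ar.R} (A.*-congˡ {K} {z A.+ u A.* c} {Ar.R} (A.sym {Ar.R} {z A.+ u A.* c} Ar.z-diag))))
       (A.sym {x} {K A.* Ar.R A.+ u A.* b} e))) xa)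
   where
   K = PA.int (+ suc k)
   c = CT (t * Ar.Y)

  treeSetting : Setting p'
  treeSetting = record
   { ambient = ambient
   ; T-eq = Ar.T-eq ; tρ = Ar.tρ ; ϑ-t = ϑ-t ; ϑ-ρ = Ar.ϑ-ρ ; D-t = D-t ; ω = Ar.ω ; ω̃ = Ar.ω̃ ; V-eq = Ar.V-eq
   ; Neg = Ar.Neg ; Pos = Ar.Pos ; neg-ω = Ar.neg-ω ; pos-ω̃ = Ar.pos-ω̃ ; neg-step = Ar.neg-step ; pos-step = Ar.pos-step
   ; neg-orth = λ {a} {b} → Ar.neg-orth {a} {b} ; pos-orth = λ {a} {b} → Ar.pos-orth {a} {b} ; jacobian = Ar.jacobian ; CT-yω = Ar.CT-yω
   ; S-eq = λ n → U.refl ; R-eq = Ar.z-diag ; e = TD.e ; e-E = TD.e-E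
   -- z^i has total degree 2 i in t and s; hence the comparison of i + i with the order n.
   ; Small = λ n a → ∀ i → i ℕ.+ i < n → a i U.≈ U.0#
   ; small-cong = λ e s i l → U.trans (U.sym (e i)) (s i l)
   ; small-zero = λ s i → s (suc (i ℕ.+ i)) i ℕP.≤-refl
   ; small-scale = small-scale
   ; small-CT = small-CT
   ; regular = regular }
   where
   small-scale : ∀ {n a} c → (∀ i → i ℕ.+ i < n → a i U.≈ U.0#) → ∀ i → i ℕ.+ i < n → (c A.* a) i U.≈ U.0#
   small-scale {n} {a} c s i l with SA.mul-case (U._≈ U.0#) (λ p q → U.trans (U.+-cong p q) (U.+-identityʳ U.0#)) ⊥ i c a
    (λ k j kj → inj₂ (U.trans (U.*-congˡ {c k} (s j (ℕP.≤-<-trans (ℕP.+-mono-≤ (≤i k j kj) (≤i k j kj)) l))) (U.zeroʳ (c k))))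
    where
    ≤i : ∀ k j → k ℕ.+ j ≡ i → j ≤ i
    ≤i k j kj = ℕP.≤-trans (ℕP.m≤n+m j k) (ℕP.≤-reflexive kj)
   ... | inj₂ q = q
   small-CT : ∀ k f i → i ℕ.+ i < k → (TD.T ^ k * f) i i U.≈ U.0#
   small-CT k f i l with atLeast-* {k} {0} {TD.T ^ k} {f} (atLeast-^ k (Tr.homog-≥ TD.homog-T)) (atLeast-0 f) i i
   ... | inj₂ q = q
   ... | inj₁ g = ⊥-elim (ℕP.<⇒≱ l (ℕP.≤-trans (ℕP.≤-reflexive (≡.sym (ℕP.+-identityʳ k))) g))

  module An = Analysis treeSetting

  -- Waiting words consist of decided half-edges and are completed independently of each other,
  -- hence a product.
  stackW : List ℕ → A.Carrier
  stackW []       = A.1#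
  stackW (k ∷ st) = An.w 0 k A.* stackW st

  N : ℕ → ℕ → List ℕ → A.Carrier
  N j k st = An.w j k A.* stackW st

  -- The grading `Homog` as seen on scalars, z^n having total degree 2 n.
  Balanced : ℕ → A.Carrier → Set
  Balanced d a = ∀ n → (∃ λ v → n ℕ.+ n ≡ d ℕ.+ v ℕ.* suc p') ⊎ a n U.≈ U.0#

  balanced-* : ∀ {c d a b} → Balanced c a → Balanced d b → Balanced (c ℕ.+ d) (a A.* b)
  balanced-* {c} {d} {a} {b} ba bb n = SA.mul-case (U._≈ U.0#) (λ p q → U.trans (U.+-cong p q) (U.+-identityʳ U.0#))
    (∃ λ v → n ℕ.+ n ≡ (c ℕ.+ d) ℕ.+ v ℕ.* suc p') n a b each
   where
   each : ∀ i k → i ℕ.+ k ≡ n → (∃ λ v → n ℕ.+ n ≡ (c ℕ.+ d) ℕ.+ v ℕ.* suc p') ⊎ a i U.* b k U.≈ U.0#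
   each i k e with ba i | bb k
   ... | inj₂ q | _ = inj₂ (U.trans (U.*-congʳ {b k} q) (U.zeroˡ (b k)))
   ... | inj₁ _ | inj₂ q = inj₂ (U.trans (U.*-congˡ {a i} q) (U.zeroʳ (a i)))
   ... | inj₁ (v , x) | inj₁ (w , y) = inj₁ (v ℕ.+ w , (begin
    n ℕ.+ n ≡⟨ ≡.cong (λ n → n ℕ.+ n) (≡.sym e) ⟩
    (i ℕ.+ k) ℕ.+ (i ℕ.+ k) ≡⟨ solve 2 (λ i k → (i :+ k) :+ (i :+ k) := (i :+ i) :+ (k :+ k)) ≡.refl i k ⟩
    (i ℕ.+ i) ℕ.+ (k ℕ.+ k) ≡⟨ ≡.cong₂ ℕ._+_ x y ⟩
    (c ℕ.+ v ℕ.* suc p') ℕ.+ (d ℕ.+ w ℕ.* suc p')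
     ≡⟨ solve 5 (λ c v d w p → (c :+ v :* p) :+ (d :+ w :* p) := (c :+ d) :+ (v :+ w) :* p) ≡.refl c v d w (suc p') ⟩
    (c ℕ.+ d) ℕ.+ (v ℕ.+ w) ℕ.* suc p' ∎))
    where
    open ≡.≡-Reasoning
    open +-*-Solver

  balanced-w : ∀ j k → Balanced ((j ℕ.+ k) ℕ.+ 2) (An.w j k)
  balanced-w j k n = Tr.homog-* {j ℕ.+ k} {2} {TD.T ^ j * Ar.X ^ k} {Ar.y * Ar.ω}
   (Tr.homog-* {j} {k} {TD.T ^ j} {Ar.X ^ k} (Tr.homog-^ j TD.homog-T) (Tr.homog-^ k Ar.homog-X))
   (Tr.homog-* {1} {1} {Ar.y} {Ar.ω} Ar.homog-y Ar.homog-ω) n n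

  depth : List ℕ → ℕ
  depth []       = 0
  depth (k ∷ st) = (k ℕ.+ 2) ℕ.+ depth st

  balanced-stack : ∀ st → Balanced (depth st) (stackW st)
  balanced-stack []       zero    = inj₁ (0 , ≡.refl)
  balanced-stack []       (suc n) = inj₂ U.refl
  balanced-stack (k ∷ st) = balanced-* {k ℕ.+ 2} {depth st} (balanced-w 0 k) (balanced-stack st)

  depth-sum : ∀ st → depth st ≡ (length st ℕ.+ length st) ℕ.+ sum st
  depth-sum []       = ≡.refl
  depth-sum (k ∷ st) = ≡.trans (≡.cong ((k ℕ.+ 2) ℕ.+_) (depth-sum st))
   (solve 3 (λ k l s → (k :+ con 2) :+ ((l :+ l) :+ s) := (con 1 :+ l) :+ (con 1 :+ l) :+ (k :+ s)) ≡.refl k (length st) (sum st))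
   where open +-*-Solver

  vanish : ∀ j k st a m → (∀ w → a ℕ.+ a ≢ 2 ℕ.+ (length st ℕ.+ length st) ℕ.+ (j ℕ.+ k ℕ.+ sum st) ℕ.+ w ℕ.* suc p') → N j k st a m ≡ + 0
  vanish j k st a m ne = by-cases (balanced-* {(j ℕ.+ k) ℕ.+ 2} {depth st} {An.w j k} {stackW st} (balanced-w j k) (balanced-stack st) a)
   where
   open +-*-Solver
   by-cases : (∃ λ v → a ℕ.+ a ≡ ((j ℕ.+ k) ℕ.+ 2 ℕ.+ depth st) ℕ.+ v ℕ.* suc p') ⊎ N j k st a U.≈ U.0# → N j k st a m ≡ + 0
   by-cases (inj₂ q) = q m
   by-cases (inj₁ (v , e)) = ⊥-elim (ne v (≡.trans e (≡.cong (ℕ._+ v ℕ.* suc p') (≡.trans (≡.cong (((j ℕ.+ k) ℕ.+ 2) ℕ.+_) (depth-sum st))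
     (solve 4 (λ j k l s → ((j :+ k) :+ con 2) :+ ((l :+ l) :+ s) := con 2 :+ (l :+ l) :+ (j :+ k :+ s)) ≡.refl j k (length st) (sum st))))))

  seriesRecursion : SeriesRecursion p' N
  seriesRecursion = record
   { undecided = λ j k st a m → A.trans {N (suc j) k st} {(An.w j (suc k) A.+ An.w (suc (suc p') ℕ.+ j) k) A.* stackW st} {N j (suc k) st A.+ N (suc (suc p') ℕ.+ j) k st}
     (A.*-congʳ {stackW st} {An.w (suc j) k} {An.w j (suc k) A.+ An.w (suc (suc p') ℕ.+ j) k} (An.w-undecided j k))
     (A.distribʳ (stackW st) (An.w j (suc k)) (An.w (suc (suc p') ℕ.+ j) k)) a m
   ; decided = decided
   ; pop = λ k st a m → ≡.trans (A.*-congʳ {N 0 k st} {An.w 0 0} {z} An.w-end (suc a) m) (SA.mul-variable-suc (N 0 k st) a m)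
   ; end = at-end 1 0
   ; end' = λ m → at-end 1 (suc m)
   ; end'' = λ a m → at-end (suc (suc a)) m
   ; vanish = vanish }
   where
   at-end : ∀ a m → N 0 0 [] a m ≡ z a m
   at-end a m = ≡.trans (A.*-identityʳ (An.w 0 0) a m) (An.w-end a m)
   split-* : ∀ (F : ℕ → ℕ → A.Carrier) (P : A.Carrier) a m i k → (An.splitA F i k A.* P) a m ≡ splitSum (λ i l → (F i l A.* P) a m) i k
   split-* F P a m i zero    = A.zeroˡ P a m
   split-* F P a m i (suc k) = ≡.trans (A.distribʳ P (F i k) (An.splitA F (suc i) k) a m) (≡.cong (λ y → (F i k A.* P) a m ℤ.+ y) (split-* F P a m (suc i) k))
   splitSum-cong : ∀ {F G : ℕ → ℕ → ℤ} i k → (∀ i l → F i l ≡ G i l) → splitSum F i k ≡ splitSum G i k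
   splitSum-cong i zero    q = ≡.refl
   splitSum-cong i (suc k) q = ≡.cong₂ ℤ._+_ (q i k) (splitSum-cong (suc i) k q)
   decided : ∀ k st a m → N 0 (suc k) st a m ≡ splitSum (λ i l → N 0 i (l ∷ st) a m) 0 k ℤ.+ delay (N (suc (suc p')) k st a) m
   decided k st a m = ≡.trans (A.*-congʳ {P} {An.w 0 (suc k)} {W A.+ u A.* v} (An.w-decided k) a m)
    (≡.trans (A.distribʳ P W (u A.* v) a m) (≡.cong₂ ℤ._+_ (≡.trans (split-* (λ i l → An.w 0 i A.* An.w 0 l) P a m 0 k)
      (splitSum-cong 0 k (λ i l → A.*-assoc (An.w 0 i) (An.w 0 l) P a m))) (≡.trans (A.*-assoc u v P a m) (mul-u (v A.* P) a m))))
    where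
    P = stackW st
    W = An.splitA (λ i l → An.w 0 i A.* An.w 0 l) 0 k
    v = An.w (suc (suc p')) k

  derivative-w : ∀ j k a m → + suc a ℤ.* An.w j k (suc a) m ≡ CT (TD.T ^ j * Ar.X ^ k) a m
  derivative-w j k a m = ≡.trans (≡.sym (×-ℤ (suc a) (An.w j k (suc a)) m))
   (≡.trans (An.δ-w j k (suc a) m) (SA.mul-variable-suc (CT (TD.T ^ j * Ar.X ^ k)) a m))

-- Algebraic dependence by linear algebra over the integers.

module Elimination where

 open PowerSeries
 open Residues using (module Powers)
 open import Algebra.Bundles using (CommutativeRing)
 open import Data.Integer using (+_)
 open import Data.Fin using (fromℕ<)
 open import Data.Vec as Vec using (Vec; []; _∷_; lookup)
 import Data.Vec.Properties as VecP
 open import Data.Product using (_×_)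

 sumZ : ∀ {I : Set} → List I → (I → ℤ) → ℤ
 sumZ []       f = + 0
 sumZ (i ∷ is) f = f i ℤ.+ sumZ is f

 private
  module ZS = Data.Integer.Solver.+-*-Solver

 sumZ-cong : ∀ {I : Set} (is : List I) {f g : I → ℤ} → (∀ {i} → i ∈ is → f i ≡ g i) → sumZ is f ≡ sumZ is g
 sumZ-cong []       q = ≡.refl
 sumZ-cong (i ∷ is) q = ≡.cong₂ ℤ._+_ (q (here ≡.refl)) (sumZ-cong is (q ∘ there))

 sumZ-zero : ∀ {I : Set} (is : List I) {f : I → ℤ} → (∀ {i} → i ∈ is → f i ≡ + 0) → sumZ is f ≡ + 0
 sumZ-zero []       q = ≡.refl
 sumZ-zero (i ∷ is) q = ≡.cong₂ ℤ._+_ (q (here ≡.refl)) (sumZ-zero is (q ∘ there))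

 sumZ-combine : ∀ {I : Set} (is : List I) (f g : I → ℤ) p q → sumZ is (λ i → p ℤ.* f i ℤ.- g i ℤ.* q) ≡ p ℤ.* sumZ is f ℤ.- sumZ is g ℤ.* q
 sumZ-combine []       f g p q = ZS.solve 2 (λ p q → ZS.con (+ 0) ZS.:= p ZS.:* ZS.con (+ 0) ZS.:- ZS.con (+ 0) ZS.:* q) ≡.refl p q
 sumZ-combine (i ∷ is) f g p q = ≡.trans (≡.cong (λ y → p ℤ.* f i ℤ.- g i ℤ.* q ℤ.+ y) (sumZ-combine is f g p q))
  (ZS.solve 6 (λ p q a b c d → (p ZS.:* a ZS.:- b ZS.:* q) ZS.:+ (p ZS.:* c ZS.:- d ZS.:* q) ZS.:= p ZS.:* (a ZS.:+ c) ZS.:- (b ZS.:+ d) ZS.:* q) ≡.refl p q (f i) (g i) (sumZ is f) (sumZ is g))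

 module _ {I J : Set} (_≟_ : (i i' : I) → Dec (i ≡ i')) where

  private
   remove : ∀ {i : I} is → i ∈ is → List I
   remove (_ ∷ is) (here _)  = is
   remove (x ∷ is) (there m) = x ∷ remove is m

   remove-length : ∀ {i : I} is (m : i ∈ is) → length is ≡ suc (length (remove is m))
   remove-length (_ ∷ is) (here _)  = ≡.refl
   remove-length (x ∷ is) (there m) = ≡.cong suc (remove-length is m)

   remove-⊆ : ∀ {i j : I} is (m : i ∈ is) → j ∈ remove is m → j ∈ is
   remove-⊆ (_ ∷ is) (here _)  k         = there k
   remove-⊆ (x ∷ is) (there m) (here e)  = here e
   remove-⊆ (x ∷ is) (there m) (there k) = there (remove-⊆ is m k)

   remove-∉ : ∀ {i : I} is (m : i ∈ is) → Unique is → ¬ (i ∈ remove is m)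
   remove-∉ (_ ∷ is) (here ≡.refl) (a ∷ u) k = All.lookup a k ≡.refl
   remove-∉ (x ∷ is) (there m) (a ∷ u) (here e)  = All.lookup a m (≡.sym e)
   remove-∉ (x ∷ is) (there m) (a ∷ u) (there k) = remove-∉ is m u k

   remove-unique : ∀ {i : I} is (m : i ∈ is) → Unique is → Unique (remove is m)
   remove-unique (_ ∷ is) (here _)  (a ∷ u) = u
   remove-unique (x ∷ is) (there m) (a ∷ u) = All.tabulate (λ k → All.lookup a (remove-⊆ is m k)) ∷ remove-unique is m u

   sum-remove : ∀ {i : I} is (m : i ∈ is) (f : I → ℤ) → sumZ is f ≡ f i ℤ.+ sumZ (remove is m) f
   sum-remove (_ ∷ is) (here ≡.refl) f = ≡.refl
   sum-remove {i} (x ∷ is) (there m) f = ≡.trans (≡.cong (λ y → f x ℤ.+ y) (sum-remove is m f))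
    (ZS.solve 3 (λ a b c → a ZS.:+ (b ZS.:+ c) ZS.:= b ZS.:+ (a ZS.:+ c)) ≡.refl (f x) (f i) (sumZ (remove is m) f))

   search : ∀ (is : List I) (f : I → ℤ) → (∃ λ i → i ∈ is × f i ≢ + 0) ⊎ (∀ {i} → i ∈ is → f i ≡ + 0)
   search []       f = inj₂ λ ()
   search (i ∷ is) f with f i ℤ.≟ + 0 | search is f
   ... | no ne | _ = inj₁ (i , here ≡.refl , ne)
   ... | yes e | inj₁ (j , m , ne) = inj₁ (j , there m , ne)
   ... | yes e | inj₂ all = inj₂ λ { (here ≡.refl) → e ; (there m) → all m }

  -- Fraction-free Gaussian elimination: more vectors than coordinates are linearly dependent over ℤ.
  dependence : ∀ (js : List J) (is : List I) → Unique is → length js < length is → (M : I → J → ℤ) →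
   Σ (I → ℤ) λ c → (∃ λ i → i ∈ is × c i ≢ + 0) × (∀ {j} → j ∈ js → sumZ is (λ i → c i ℤ.* M i j) ≡ + 0)
  dependence []       (i ∷ is) u l M = (λ _ → + 1) , (i , here ≡.refl , λ ()) , λ ()
  dependence (j ∷ js) is u l M with search is (λ i → M i j)
  ... | inj₂ zero-column with dependence js is u (ℕP.<-trans (ℕP.n<1+n _) l) M
  ...   | c , nz , rel = c , nz , λ { (here ≡.refl) → sumZ-zero is (λ {i} m → ≡.trans (≡.cong (c i ℤ.*_) (zero-column m)) (ℤP.*-zeroʳ (c i)))
   ; (there m) → rel m }
  dependence (j ∷ js) is u l M | inj₁ (i₀ , m₀ , p≢0)
   with dependence js (remove is m₀) (remove-unique is m₀ u) (ℕP.≤-pred (ℕP.≤-trans l (ℕP.≤-reflexive (remove-length is m₀))))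
       (λ i k → M i₀ j ℤ.* M i k ℤ.- M i j ℤ.* M i₀ k)
  ... | c' , (i₁ , m₁ , nz) , rel = c , (i₁ , remove-⊆ is m₀ m₁ , c-i₁) , columns
   where
   p = M i₀ j
   rest = remove is m₀
   σ = sumZ rest (λ i → c' i ℤ.* M i j)
   c : I → ℤ
   c i with i ≟ i₀
   ... | yes _ = + 0 ℤ.- σ
   ... | no _  = p ℤ.* c' i
   c-pivot : c i₀ ≡ + 0 ℤ.- σ
   c-pivot with i₀ ≟ i₀
   ... | yes _ = ≡.refl
   ... | no n  = ⊥-elim (n ≡.refl)
   c-rest : ∀ {i} → i ∈ rest → c i ≡ p ℤ.* c' i
   c-rest {i} k with i ≟ i₀
   ... | yes ≡.refl = ⊥-elim (remove-∉ is m₀ u k)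
   ... | no _ = ≡.refl
   c-i₁ : c i₁ ≢ + 0
   c-i₁ e with ℤP.i*j≡0⇒i≡0∨j≡0 p (≡.trans (≡.sym (c-rest m₁)) e)
   ... | inj₁ z = p≢0 z
   ... | inj₂ z = nz z
   total : ∀ k → sumZ is (λ i → c i ℤ.* M i k) ≡ + 0 ℤ.- σ ℤ.* M i₀ k ℤ.+ sumZ rest (λ i → c i ℤ.* M i k)
   total k = ≡.trans (sum-remove is m₀ (λ i → c i ℤ.* M i k)) (≡.cong (ℤ._+ sumZ rest (λ i → c i ℤ.* M i k))
    (≡.trans (≡.cong (ℤ._* M i₀ k) c-pivot) (ZS.solve 2 (λ s q → (ZS.con (+ 0) ZS.:- s) ZS.:* q ZS.:= ZS.con (+ 0) ZS.:- s ZS.:* q) ≡.refl σ (M i₀ k))))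
   scaled : ∀ k → sumZ rest (λ i → c i ℤ.* M i k) ≡ p ℤ.* sumZ rest (λ i → c' i ℤ.* M i k)
   scaled k = ≡.trans (sumZ-cong rest (λ {i} m → ≡.trans (≡.cong (ℤ._* M i k) (c-rest m)) (ℤP.*-assoc p (c' i) (M i k)))) (go rest)
    where
    go : ∀ is → sumZ is (λ i → p ℤ.* (c' i ℤ.* M i k)) ≡ p ℤ.* sumZ is (λ i → c' i ℤ.* M i k)
    go []       = ≡.sym (ℤP.*-zeroʳ p)
    go (i ∷ is) = ≡.trans (≡.cong (λ y → p ℤ.* (c' i ℤ.* M i k) ℤ.+ y) (go is)) (≡.sym (ℤP.*-distribˡ-+ p _ _))

   columns : ∀ {k} → k ∈ j ∷ js → sumZ is (λ i → c i ℤ.* M i k) ≡ + 0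
   columns (here ≡.refl) = ≡.trans (total j) (≡.trans (≡.cong (λ y → + 0 ℤ.- σ ℤ.* p ℤ.+ y) (scaled j))
    (ZS.solve 2 (λ s p → ZS.con (+ 0) ZS.:- s ZS.:* p ZS.:+ p ZS.:* s ZS.:= ZS.con (+ 0)) ≡.refl σ p))
   columns {k} (there m) = ≡.trans (total k) (≡.trans (≡.cong (λ y → + 0 ℤ.- σ ℤ.* M i₀ k ℤ.+ y) (scaled k))
    (≡.trans (ZS.solve 4 (λ s q p x → ZS.con (+ 0) ZS.:- s ZS.:* q ZS.:+ p ZS.:* x ZS.:= p ZS.:* x ZS.:- s ZS.:* q) ≡.refl σ (M i₀ k) p (sumZ rest (λ i → c' i ℤ.* M i k)))
     (≡.trans (≡.sym (sumZ-combine rest (λ i → c' i ℤ.* M i k) (λ i → c' i ℤ.* M i j) p (M i₀ k)))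
      (≡.trans (sumZ-cong rest (λ {i} _ → ZS.solve 5 (λ p c x y q → p ZS.:* (c ZS.:* x) ZS.:- (c ZS.:* y) ZS.:* q ZS.:= c ZS.:* (p ZS.:* x ZS.:- y ZS.:* q)) ≡.refl p (c' i) (M i k) (M i j) (M i₀ k))) (rel m)))))

 vecs : ∀ {X : Set} n → List X → List (Vec X n)
 vecs zero    xs = [] ∷ []
 vecs (suc n) xs = concatMap (λ x → List.map (x ∷_) (vecs n xs)) xs

 length-vecs : ∀ {X : Set} n (xs : List X) → length (vecs n xs) ≡ length xs ℕ.^ n
 length-vecs zero    xs = ≡.refl
 length-vecs (suc n) xs = go xs
  where
  go : ∀ ys → length (concatMap (λ x → List.map (x ∷_) (vecs n xs)) ys) ≡ length ys ℕ.* length xs ℕ.^ n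
  go []       = ≡.refl
  go (y ∷ ys) = ≡.trans (ListP.length-++ (List.map (y ∷_) (vecs n xs)))
   (≡.cong₂ ℕ._+_ (≡.trans (ListP.length-map (y ∷_) (vecs n xs)) (length-vecs n xs)) (go ys))

 vecs-unique : ∀ {X : Set} n (xs : List X) → Unique xs → Unique (vecs n xs)
 vecs-unique zero    xs u = [] ∷ []
 vecs-unique {X} (suc n) xs u = go xs u
  where
  go : ∀ ys → Unique ys → Unique (concatMap (λ x → List.map (x ∷_) (vecs n xs)) ys)
  go []       []      = []
  go (y ∷ ys) (a ∷ v) = UniqueP.++⁺ (UniqueP.map⁺ VecP.∷-injectiveʳ (vecs-unique n xs u)) (go ys v) (λ (i , j) → apart i (head-in ys j))
   where
   import Data.List.Relation.Unary.Unique.Propositional.Properties as UniqueP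
   open import Data.List.Membership.Propositional.Properties using (∈-map⁻; ∈-++⁻)
   head-in : ∀ {v} ys → v ∈ concatMap (λ x → List.map (x ∷_) (vecs n xs)) ys → Vec.head v ∈ ys
   head-in (z ∷ zs) i with ∈-++⁻ (List.map (z ∷_) (vecs n xs)) i
   ... | inj₂ k = there (head-in zs k)
   ... | inj₁ k with ∈-map⁻ (z ∷_) k
   ...   | _ , _ , ≡.refl = here ≡.refl
   apart : ∀ {v} → v ∈ List.map (y ∷_) (vecs n xs) → Vec.head v ∈ ys → ⊥
   apart i k with ∈-map⁻ (y ∷_) i
   ... | _ , _ , ≡.refl = All.lookup a k ≡.refl

 module Eliminate (R : CRing) where
  open CommutativeRing R hiding (zero)
  open Powers R
  open SetoidReasoning setoid

  -- Division is replaced by cancellation of elements that are not zero divisors, so no field of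
  -- fractions has to be formed.
  Regular : Carrier → Set
  Regular x = ∀ a → x * a ≈ 0# → a ≈ 0#

  regular-* : ∀ {x y} → Regular x → Regular y → Regular (x * y)
  regular-* {x} {y} rx ry a e = ry a (rx (y * a) (trans (sym (*-assoc x y a)) e))

  regular-1 : Regular 1#
  regular-1 a e = trans (sym (*-identityˡ a)) e

  regular-^ : ∀ {x} n → Regular x → Regular (x ^ n)
  regular-^ zero    r = regular-1
  regular-^ (suc n) r = regular-* r (regular-^ n r)

  sumR : ∀ {I : Set} → List I → (I → Carrier) → Carrier
  sumR []       f = 0#
  sumR (i ∷ is) f = f i + sumR is f

  sumR-cong : ∀ {I : Set} (is : List I) {f g : I → Carrier} → (∀ i → f i ≈ g i) → sumR is f ≈ sumR is g
  sumR-cong []       q = refl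
  sumR-cong (i ∷ is) q = +-cong (q i) (sumR-cong is q)

  sumR-0 : ∀ {I : Set} (is : List I) → sumR is (λ _ → 0#) ≈ 0#
  sumR-0 []       = refl
  sumR-0 (i ∷ is) = trans (+-identityˡ _) (sumR-0 is)

  sumR-+ : ∀ {I : Set} (is : List I) (f g : I → Carrier) → sumR is (λ i → f i + g i) ≈ sumR is f + sumR is g
  sumR-+ []       f g = sym (+-identityʳ 0#)
  sumR-+ (i ∷ is) f g = trans (+-congˡ (sumR-+ is f g))
   (solve 4 (λ a b c d → (a :+ b) :+ (c :+ d) := (a :+ c) :+ (b :+ d)) refl (f i) (g i) (sumR is f) (sumR is g))

  sumR-* : ∀ {I : Set} (is : List I) c (f : I → Carrier) → sumR is (λ i → c * f i) ≈ c * sumR is f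
  sumR-* []       c f = sym (zeroʳ c)
  sumR-* (i ∷ is) c f = trans (+-congˡ (sumR-* is c f)) (sym (distribˡ c _ _))

  sumR-swap : ∀ {I J : Set} (is : List I) (js : List J) (f : I → J → Carrier) →
   sumR is (λ i → sumR js (f i)) ≈ sumR js (λ j → sumR is (λ i → f i j))
  sumR-swap []       js f = sym (sumR-0 js)
  sumR-swap (i ∷ is) js f = trans (+-congˡ (sumR-swap is js f)) (sym (sumR-+ js (f i) (λ j → sumR is (λ i → f i j))))

  sumR-++ : ∀ {I : Set} (is js : List I) f → sumR (is ++ js) f ≈ sumR is f + sumR js f
  sumR-++ []       js f = sym (+-identityˡ _)
  sumR-++ (i ∷ is) js f = trans (+-congˡ (sumR-++ is js f)) (sym (+-assoc _ _ _))

  sumR-map : ∀ {I J : Set} (g : I → J) is f → sumR (List.map g is) f ≈ sumR is (f ∘ g)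
  sumR-map g []       f = refl
  sumR-map g (i ∷ is) f = +-congˡ (sumR-map g is f)

  sumR-concatMap : ∀ {I J : Set} (g : I → List J) is f → sumR (concatMap g is) f ≈ sumR is (λ i → sumR (g i) f)
  sumR-concatMap g []       f = refl
  sumR-concatMap g (i ∷ is) f = trans (sumR-++ (g i) (concatMap g is) f) (+-congˡ (sumR-concatMap g is f))

  int-sum : ∀ {I : Set} (is : List I) (c : I → ℤ) → int (sumZ is c) ≈ sumR is (int ∘ c)
  int-sum []       c = refl
  int-sum (i ∷ is) c = trans (int-+ (c i) _) (+-congˡ (int-sum is c))

  monomial : ∀ {n} → (Fin n → Carrier) → (Fin n → ℕ) → Carrier
  monomial {zero}  x e = 1#
  monomial {suc n} x e = x zero ^ e zero * monomial (x ∘ suc) (e ∘ suc)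

  monomial-cong : ∀ {n} (x : Fin n → Carrier) {e e'} → (∀ i → e i ≡ e' i) → monomial x e ≈ monomial x e'
  monomial-cong {zero}  x q = refl
  monomial-cong {suc n} x q = *-cong (reflexive (≡.cong (x zero ^_) (q zero))) (monomial-cong (x ∘ suc) (q ∘ suc))

  monomial-* : ∀ {n} (x : Fin n → Carrier) e e' → monomial x (λ i → e i ℕ.+ e' i) ≈ monomial x e * monomial x e'
  monomial-* {zero}  x e e' = sym (*-identityˡ 1#)
  monomial-* {suc n} x e e' = trans (*-cong (^-+ (x zero) (e zero) (e' zero)) (monomial-* (x ∘ suc) (e ∘ suc) (e' ∘ suc)))
   (solve 4 (λ a b c d → a :* b :* (c :* d) := a :* c :* (b :* d)) refl _ _ _ _)

  monomial-0 : ∀ {n} (x : Fin n → Carrier) → monomial x (λ _ → 0) ≈ 1#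
  monomial-0 {zero}  x = refl
  monomial-0 {suc n} x = trans (*-identityˡ _) (monomial-0 (x ∘ suc))

  record AlgebraicRelation {n} (f : Fin n → Carrier) : Set where
   field
    D           : ℕ
    coefficient : Vec (Fin (suc D)) n → ℤ
    nontrivial  : ∃ λ v → coefficient v ≢ + 0
    relation    : sumR (vecs n (allFin (suc D))) (λ v → int (coefficient v) * monomial f (toℕ ∘ lookup v)) ≈ 0#

  module Generated {n} (x : Fin n → Carrier) where

   -- The bound d is on each exponent separately: the possible exponents then form the cube
   -- enumerated by `vecs`, and bounds add under multiplication.
   data Poly (d : ℕ) : Carrier → Set where
    mono : ∀ (c : ℤ) (e : Fin n → ℕ) → (∀ i → e i ≤ d) → ∀ {a} → a ≈ int c * monomial x e → Poly d a
    plus : ∀ {a b} → Poly d a → Poly d b → ∀ {c} → c ≈ a + b → Poly d c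

   poly-≤ : ∀ {d d' a} → d ≤ d' → Poly d a → Poly d' a
   poly-≤ l (mono c e b q) = mono c e (λ i → ℕP.≤-trans (b i) l) q
   poly-≤ l (plus p q r)   = plus (poly-≤ l p) (poly-≤ l q) r

   poly-cong : ∀ {d a b} → a ≈ b → Poly d b → Poly d a
   poly-cong r (mono c e b q) = mono c e b (trans r q)
   poly-cong r (plus p q s)   = plus p q (trans r s)

   poly-* : ∀ {d d' a b} → Poly d a → Poly d' b → Poly (d ℕ.+ d') (a * b)
   poly-* (mono c e b q) (mono c' e' b' q') = mono (c ℤ.* c') (λ i → e i ℕ.+ e' i) (λ i → ℕP.+-mono-≤ (b i) (b' i))
    (trans (*-cong q q') (trans (solve 4 (λ a b c d → a :* b :* (c :* d) := a :* c :* (b :* d)) refl _ _ _ _)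
     (*-cong (sym (int-* c c')) (sym (monomial-* x e e')))))
   poly-* p@(mono _ _ _ _) (plus q r s) = plus (poly-* p q) (poly-* p r) (trans (*-congˡ s) (distribˡ _ _ _))
   poly-* (plus p q r) s = plus (poly-* p s) (poly-* q s) (trans (*-congʳ r) (distribʳ _ _ _))

   poly-int : ∀ c {d} → Poly d (int c)
   poly-int c = mono c (λ _ → 0) (λ _ → z≤n) (sym (trans (*-congˡ (monomial-0 x)) (*-identityʳ _)))

   poly-1 : ∀ {d} → Poly d 1#
   poly-1 = poly-cong (sym int-1) (poly-int (+ 1))

   poly-^ : ∀ {d a} k → Poly d a → Poly (k ℕ.* d) (a ^ k)
   poly-^ zero    p = poly-1
   poly-^ (suc k) p = poly-* p (poly-^ k p)

   poly-generator : ∀ i → Poly 1 (x i)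
   poly-generator i = mono (+ 1) (δ i) (δ-≤ i) (sym (trans (*-congʳ int-1) (trans (*-identityˡ _) (pick x i))))
    where
    δ : ∀ {n} → Fin n → Fin n → ℕ
    δ zero    zero    = 1
    δ zero    (suc _) = 0
    δ (suc i) zero    = 0
    δ (suc i) (suc j) = δ i j
    δ-≤ : ∀ {n} (i j : Fin n) → δ i j ≤ 1
    δ-≤ zero    zero    = ℕP.≤-refl
    δ-≤ zero    (suc _) = z≤n
    δ-≤ (suc i) zero    = z≤n
    δ-≤ (suc i) (suc j) = δ-≤ i j
    pick : ∀ {n} (x : Fin n → Carrier) i → monomial x (δ i) ≈ x i
    pick x zero    = trans (*-cong (*-identityʳ _) (monomial-0 (x ∘ suc))) (*-identityʳ _)
    pick x (suc i) = trans (*-identityˡ _) (pick (x ∘ suc) i)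

   exponent : ∀ {m d} → Vec (Fin d) m → Fin m → ℕ
   exponent v i = toℕ (lookup v i)

   Span : ℕ → Carrier → Set
   Span d a = Σ (Vec (Fin (suc d)) n → ℤ) λ c → a ≈ sumR (vecs n (allFin (suc d))) (λ v → int (c v) * monomial x (exponent v))

   private
    _≟V_ : ∀ {d m} (v w : Vec (Fin d) m) → Dec (v ≡ w)
    _≟V_ = VecP.≡-dec Fin._≟_

    -- A function supported at one vector is summed to its value there.
    point : ∀ {X : Set} (xs : List X) → (∀ (y : X) (g : X → Carrier) → (∀ z → z ≢ y → g z ≈ 0#) → sumR xs g ≈ g y) →
     ∀ m (v : Vec X m) (g : Vec X m → Carrier) → (∀ w → w ≢ v → g w ≈ 0#) → sumR (vecs m xs) g ≈ g v
    point xs pick zero    []      g z = +-identityʳ _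
    point xs pick (suc m) (y ∷ v) g z = trans (sumR-concatMap (λ x → List.map (x ∷_) (vecs m xs)) xs g)
     (trans (sumR-cong xs (λ x → sumR-map (x ∷_) (vecs m xs) g)) (trans (pick y (λ x → sumR (vecs m xs) (g ∘ (x ∷_)))
      (λ x ne → trans (sumR-cong (vecs m xs) (λ w → z (x ∷ w) (ne ∘ VecP.∷-injectiveˡ))) (sumR-0 (vecs m xs))))
      (point xs pick m v (g ∘ (y ∷_)) (λ w ne → z (y ∷ w) (ne ∘ VecP.∷-injectiveʳ)))))

    pickFin : ∀ m (y : Fin m) (g : Fin m → Carrier) → (∀ z → z ≢ y → g z ≈ 0#) → sumR (allFin m) g ≈ g y
    pickFin (suc m) zero    g z = trans (+-congˡ (trans (tab m suc g) (trans (sumR-cong (allFin m) (λ i → z (suc i) λ ())) (sumR-0 (allFin m))))) (+-identityʳ _)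
     where
     tab : ∀ {X : Set} m (h : Fin m → X) (g : X → Carrier) → sumR (List.tabulate h) g ≈ sumR (allFin m) (g ∘ h)
     tab zero    h g = refl
     tab (suc m) h g = +-congˡ (trans (tab m (h ∘ suc) g) (sym (tab m suc (g ∘ h))))
    pickFin (suc m) (suc y) g z = trans (+-cong (z zero λ ()) (trans (tab m suc g) (pickFin m y (g ∘ suc) (λ w ne → z (suc w) (λ { ≡.refl → ne ≡.refl }))))) (+-identityˡ _)
     where
     tab : ∀ {X : Set} m (h : Fin m → X) (g : X → Carrier) → sumR (List.tabulate h) g ≈ sumR (allFin m) (g ∘ h)
     tab zero    h g = refl
     tab (suc m) h g = +-congˡ (trans (tab m (h ∘ suc) g) (sym (tab m suc (g ∘ h))))

   poly-span : ∀ {d a} → Poly d a → Span d a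
   poly-span {d} {a} (mono c e b q) = coef , trans q (sym (trans
     (point (allFin (suc d)) (pickFin (suc d)) n v₀ (λ v → int (coef v) * monomial x (exponent v))
      (λ w ne → trans (*-congʳ (reflexive (≡.cong int (coef-off w ne)))) (zeroˡ _)))
     (*-cong (reflexive (≡.cong int coef-on)) (monomial-cong x exps))))
    where
    v₀ : Vec (Fin (suc d)) n
    v₀ = Vec.tabulate (λ i → fromℕ< (s≤s (b i)))
    exps : ∀ i → exponent v₀ i ≡ e i
    exps i = ≡.trans (≡.cong toℕ (VecP.lookup∘tabulate (λ i → fromℕ< (s≤s (b i))) i)) (toℕ-fromℕ< (s≤s (b i)))
    coef : Vec (Fin (suc d)) n → ℤ
    coef v with v ≟V v₀
    ... | yes _ = c
    ... | no _  = + 0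
    coef-on : coef v₀ ≡ c
    coef-on with v₀ ≟V v₀
    ... | yes _ = ≡.refl
    ... | no ne = ⊥-elim (ne ≡.refl)
    coef-off : ∀ w → w ≢ v₀ → coef w ≡ + 0
    coef-off w ne with w ≟V v₀
    ... | yes e = ⊥-elim (ne e)
    ... | no _  = ≡.refl
   poly-span {d} (plus p q r) with poly-span p | poly-span q
   ... | c , e | c' , e' = (λ v → c v ℤ.+ c' v) , trans r (trans (+-cong e e') (sym (trans
     (sumR-cong (vecs n (allFin (suc d))) (λ v → trans (*-congʳ (int-+ (c v) (c' v))) (distribʳ _ _ _))) (sumR-+ (vecs n (allFin (suc d))) _ _))))

   -- Elements a with q a polynomial in the generators for some regular polynomial q.
   record Fraction (a : Carrier) : Set where
    constructor fraction
    field
     degree    : ℕ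
     denom     : Carrier
     reg       : Regular denom
     denomPoly : Poly degree denom
     numerPoly : Poly degree (denom * a)

   fraction-poly : ∀ {d a} → Poly d a → Fraction a
   fraction-poly {d} p = fraction d 1# regular-1 poly-1 (poly-cong (*-identityˡ _) p)

   fraction-cong : ∀ {a b} → a ≈ b → Fraction b → Fraction a
   fraction-cong e (fraction d q r p n) = fraction d q r p (poly-cong (*-congˡ e) n)

   fraction-+ : ∀ {a b} → Fraction a → Fraction b → Fraction (a + b)
   fraction-+ {a} {b} (fraction d q r p n) (fraction d' q' r' p' n') = fraction (d ℕ.+ d') (q * q') (regular-* r r') (poly-* p p')
    (plus (poly-* n p') (poly-* p n') (solve 4 (λ q q' a b → q :* q' :* (a :+ b) := q :* a :* q' :+ q :* (q' :* b)) refl q q' a b))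

   fraction-* : ∀ {a b} → Fraction a → Fraction b → Fraction (a * b)
   fraction-* {a} {b} (fraction d q r p n) (fraction d' q' r' p' n') = fraction (d ℕ.+ d') (q * q') (regular-* r r') (poly-* p p')
    (poly-cong (solve 4 (λ q q' a b → q :* q' :* (a :* b) := q :* a :* (q' :* b)) refl q q' a b) (poly-* n n'))

   fraction-quotient : ∀ {a b} → Regular b → Fraction b → Fraction (b * a) → Fraction a
   fraction-quotient {a} {b} rb (fraction d q r p n) (fraction d' q' r' p' n') =
    fraction (d ℕ.+ d') (q * b * q') (regular-* (regular-* r rb) r') (poly-* n p')
     (poly-cong (solve 4 (λ q b q' a → q :* b :* q' :* a := q :* (q' :* (b :* a))) refl q b q' a) (poly-* p n'))

   -- Algebraic dependence by comparing the number of monomials in the f i with the number of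
   -- monomials in the generators that can occur.
   module Relation (f : Fin (suc n) → Carrier) (frac : ∀ i → Fraction (f i)) where

    private
     maxDeg : ∀ {m} → (Fin m → ℕ) → ℕ
     maxDeg {zero}  g = 0
     maxDeg {suc m} g = g zero ℕ.⊔ maxDeg (g ∘ suc)
     ≤-max : ∀ {m} (g : Fin m → ℕ) i → g i ≤ maxDeg g
     ≤-max g zero    = ℕP.m≤m⊔n _ _
     ≤-max g (suc i) = ℕP.≤-trans (≤-max (g ∘ suc) i) (ℕP.m≤n⊔m (g zero) _)

     b : ℕ
     b = maxDeg (λ i → Fraction.degree (frac i))
     qf : Fin (suc n) → Carrier
     qf i = Fraction.denom (frac i)
     q-poly : ∀ i → Poly b (qf i)
     q-poly i = poly-≤ (≤-max (λ i → Fraction.degree (frac i)) i) (Fraction.denomPoly (frac i))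
     n-poly : ∀ i → Poly b (qf i * f i)
     n-poly i = poly-≤ (≤-max (λ i → Fraction.degree (frac i)) i) (Fraction.numerPoly (frac i))

     c₀ : ℕ
     c₀ = suc n ℕ.* b

    -- Chosen so that the unknowns outnumber the equations. After clearing denominators the
    -- exponents of the generators are at most d = D c₀, and (d + 1)^n ≤ (c₀ + 1)^n (D + 1)^n = D (D
    -- + 1)^n < (D + 1)^(n+1).
    D : ℕ
    D = suc c₀ ℕ.^ n

    private
     -- One multiplier for all monomials with exponents up to D, because q^D a^k = q^(D-k) (q a)^k
     -- is a polynomial whenever q and q a are.
     clear : ∀ {m} → (Fin m → Carrier) → Carrier
     clear {zero}  q = 1#
     clear {suc m} q = q zero ^ D * clear (q ∘ suc)

     clear-regular : ∀ {m} (q : Fin m → Carrier) → (∀ i → Regular (q i)) → Regular (clear q)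
     clear-regular {zero}  q r = regular-1
     clear-regular {suc m} q r = regular-* (regular-^ D (r zero)) (clear-regular (q ∘ suc) (r ∘ suc))

     *-^ : ∀ x y k → (x * y) ^ k ≈ x ^ k * y ^ k
     *-^ x y zero    = sym (*-identityˡ 1#)
     *-^ x y (suc k) = trans (*-congˡ (*-^ x y k)) (solve 4 (λ x y a b → x :* y :* (a :* b) := x :* a :* (y :* b)) refl x y (x ^ k) (y ^ k))

     one-factor : ∀ {q a} → Poly b q → Poly b (q * a) → ∀ k → k ≤ D → Poly (D ℕ.* b) (q ^ D * a ^ k)
     one-factor {q} {a} p np k l = poly-cong (trans (*-congʳ (trans (reflexive (≡.cong (q ^_) (≡.sym (ℕP.m∸n+n≡m l)))) (^-+ q (D ℕ.∸ k) k)))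
       (trans (*-assoc _ _ _) (*-congˡ (sym (*-^ q a k)))))
      (poly-≤ (ℕP.≤-reflexive (≡.trans (≡.sym (ℕP.*-distribʳ-+ b (D ℕ.∸ k) k)) (≡.cong (ℕ._* b) (ℕP.m∸n+n≡m l))))
       (poly-* (poly-^ (D ℕ.∸ k) p) (poly-^ k np)))

     cleared : ∀ {m} (q a : Fin m → Carrier) → (∀ i → Poly b (q i)) → (∀ i → Poly b (q i * a i)) →
      ∀ (e : Fin m → ℕ) → (∀ i → e i ≤ D) → Poly (m ℕ.* (D ℕ.* b)) (clear q * monomial a e)
     cleared {zero}  q a p np e l = poly-cong (*-identityˡ 1#) poly-1
     cleared {suc m} q a p np e l = poly-cong (solve 4 (λ a b c d → a :* b :* (c :* d) := a :* c :* (b :* d)) refl _ _ _ _)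
      (poly-* (one-factor (p zero) (np zero) (e zero) (l zero)) (cleared (q ∘ suc) (a ∘ suc) (p ∘ suc) (np ∘ suc) (e ∘ suc) (l ∘ suc)))

     d : ℕ
     d = suc n ℕ.* (D ℕ.* b)

     d≡ : d ≡ D ℕ.* c₀
     d≡ = ≡.trans (≡.sym (ℕP.*-assoc (suc n) D b)) (≡.trans (≡.cong (ℕ._* b) (ℕP.*-comm (suc n) D)) (ℕP.*-assoc D (suc n) b))

     Unknowns = vecs (suc n) (allFin (suc D))
     Equations = vecs n (allFin (suc d))

     *-^ℕ : ∀ a b k → (a ℕ.* b) ℕ.^ k ≡ a ℕ.^ k ℕ.* b ℕ.^ k
     *-^ℕ a b zero    = ≡.refl
     *-^ℕ a b (suc k) = ≡.trans (≡.cong (a ℕ.* b ℕ.*_) (*-^ℕ a b k)) (ℕP.[m*n]*[o*p]≡[m*o]*[n*p] a b (a ℕ.^ k) (b ℕ.^ k))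

     enough : length Equations < length Unknowns
     enough = ℕP.≤-<-trans (ℕP.≤-reflexive (≡.trans (length-vecs n (allFin (suc d))) (≡.cong (ℕ._^ n) (ListP.length-tabulate {n = suc d} id))))
      (ℕP.<-≤-trans (ℕP.≤-<-trans (ℕP.^-monoˡ-≤ n bound) (ℕP.≤-<-trans (ℕP.≤-reflexive (*-^ℕ (suc c₀) (suc D) n))
        (ℕP.*-monoˡ-< (suc D ℕ.^ n) {{ℕP.m^n≢0 (suc D) n}} (ℕP.n<1+n D))))
       (ℕP.≤-reflexive (≡.sym (≡.trans (length-vecs (suc n) (allFin (suc D))) (≡.cong (ℕ._^ suc n) (ListP.length-tabulate {n = suc D} id))))))
      where
      bound : suc d ≤ suc c₀ ℕ.* suc D
      bound = ℕP.≤-trans (s≤s (ℕP.≤-trans (ℕP.≤-reflexive (≡.trans d≡ (ℕP.*-comm D c₀))) (ℕP.≤-trans (ℕP.*-monoʳ-≤ c₀ (ℕP.n≤1+n D)) (ℕP.m≤n+m _ D)))) ℕP.≤-refl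

     span : ∀ (v : Vec (Fin (suc D)) (suc n)) → Span d (clear qf * monomial f (exponent v))
     span v = poly-span (cleared qf f q-poly n-poly (exponent v) (λ i → ℕP.≤-pred (toℕ<n (lookup v i))))

     solution = dependence _≟V_ Equations Unknowns
      (vecs-unique (suc n) (allFin (suc D)) (UniqueP.allFin⁺ (suc D))) enough (λ v w → proj₁ (span v) w)
      where import Data.List.Relation.Unary.Unique.Propositional.Properties as UniqueP

    coefficient : Vec (Fin (suc D)) (suc n) → ℤ
    coefficient = proj₁ solution

    nontrivial : ∃ λ v → coefficient v ≢ + 0
    nontrivial = let v , _ , ne = proj₁ (proj₂ solution) in v , ne

    relation : sumR (vecs (suc n) (allFin (suc D))) (λ v → int (coefficient v) * monomial f (exponent v)) ≈ 0#
    relation = clear-regular qf (λ i → Fraction.reg (frac i)) _ (begin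
     clear qf * sumR Unknowns (λ v → int (coefficient v) * monomial f (exponent v)) ≈⟨ sym (sumR-* Unknowns (clear qf) _) ⟩
     sumR Unknowns (λ v → clear qf * (int (coefficient v) * monomial f (exponent v)))
      ≈⟨ sumR-cong Unknowns (λ v → trans (solve 3 (λ q c m → q :* (c :* m) := c :* (q :* m)) refl (clear qf) (int (coefficient v)) _)
         (trans (*-congˡ (proj₂ (span v))) (sym (sumR-* Equations _ _)))) ⟩
     sumR Unknowns (λ v → sumR Equations (λ w → int (coefficient v) * (int (proj₁ (span v) w) * monomial x (exponent w))))
      ≈⟨ sumR-swap Unknowns Equations _ ⟩
     sumR Equations (λ w → sumR Unknowns (λ v → int (coefficient v) * (int (proj₁ (span v) w) * monomial x (exponent w))))
      ≈⟨ zero-sum Equations id ⟩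
     0# ∎)
     where
     column : ∀ w → w ∈ Equations → sumR Unknowns (λ v → int (coefficient v) * (int (proj₁ (span v) w) * monomial x (exponent w))) ≈ 0#
     column w w∈ = begin
      sumR Unknowns (λ v → int (coefficient v) * (int (proj₁ (span v) w) * monomial x (exponent w)))
       ≈⟨ sumR-cong Unknowns (λ v → trans (solve 3 (λ a b m → a :* (b :* m) := m :* (a :* b)) refl _ _ _) (*-congˡ (sym (int-* (coefficient v) (proj₁ (span v) w))))) ⟩
      sumR Unknowns (λ v → monomial x (exponent w) * int (coefficient v ℤ.* proj₁ (span v) w)) ≈⟨ sumR-* Unknowns _ _ ⟩
      monomial x (exponent w) * sumR Unknowns (λ v → int (coefficient v ℤ.* proj₁ (span v) w)) ≈⟨ *-congˡ (sym (int-sum Unknowns _)) ⟩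
      monomial x (exponent w) * int (sumZ Unknowns (λ v → coefficient v ℤ.* proj₁ (span v) w)) ≈⟨ *-congˡ (reflexive (≡.cong int (proj₂ (proj₂ solution) w∈))) ⟩
      monomial x (exponent w) * 0# ≈⟨ zeroʳ _ ⟩
      0# ∎
     zero-sum : ∀ ws → (∀ {w} → w ∈ ws → w ∈ Equations) →
      sumR ws (λ w → sumR Unknowns (λ v → int (coefficient v) * (int (proj₁ (span v) w) * monomial x (exponent w)))) ≈ 0#
     zero-sum []       _ = refl
     zero-sum (w ∷ ws) s = trans (+-cong (column w (s (here ≡.refl))) (zero-sum ws (s ∘ there))) (+-identityˡ 0#)

   dependent : (f : Fin (suc n) → Carrier) → (∀ i → Fraction (f i)) → AlgebraicRelation f
   dependent f frac = record { D = D ; coefficient = coefficient ; nontrivial = nontrivial ; relation = relation }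
    where open Relation f frac

-- From an algebraic relation to a differential polynomial in the required format.

module Polynomials where

 open import Defs using (funs)
 open PowerSeries
 open Residues using (module Powers)
 open Elimination
 open import Algebra.Bundles using (CommutativeRing)
 open import Data.Integer using (+_)
 open import Data.Vec as Vec using (Vec; _∷_; tabulate; lookup)
 open import Data.Vec.Properties using (lookup∘tabulate)

 only : ∀ {n} → Fin (suc n) → ℤ → ℤ
 only zero    x = x
 only (suc _) x = + 0

 module Evaluation (R : CRing) where
  open CommutativeRing R hiding (zero)
  open Powers R
  open Eliminate R
  open SetoidReasoning setoid

  sum-first : ∀ n (g : Fin (suc n) → Carrier) → (∀ i → g (suc i) ≈ 0#) → sumR (allFin (suc n)) g ≈ g zero
  sum-first n g q = trans (+-congˡ (vanish suc q)) (+-identityʳ _)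
   where
   vanish : ∀ {n m} (h : Fin n → Fin m) {g : Fin m → Carrier} → (∀ i → g (h i) ≈ 0#) → sumR (List.tabulate h) g ≈ 0#
   vanish {zero}  h q = refl
   vanish {suc n} h q = trans (+-cong (q zero) (vanish (h ∘ suc) (q ∘ suc))) (+-identityʳ 0#)

  -- Elimination needs decidable equality of exponents, which vectors have and functions do not; the
  -- differential polynomial is indexed by functions. Hence the passage between the two
  -- enumerations.
  sum-funs : ∀ {X : Set} n (xs : List X) (g : Vec X n → Carrier) → sumR (funs n xs) (g ∘ tabulate) ≈ sumR (vecs n xs) g
  sum-funs zero    xs g = refl
  sum-funs (suc n) xs g = begin
   sumR (funs (suc n) xs) (g ∘ tabulate) ≈⟨ sumR-concatMap (λ x → List.map (x VF.∷_) (funs n xs)) xs _ ⟩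
   sumR xs (λ x → sumR (List.map (x VF.∷_) (funs n xs)) (g ∘ tabulate))
    ≈⟨ sumR-cong xs (λ x → trans (sumR-map (x VF.∷_) (funs n xs) _) (trans (sum-funs n xs (g ∘ (x ∷_))) (sym (sumR-map (x ∷_) (vecs n xs) g)))) ⟩
   sumR xs (λ x → sumR (List.map (x ∷_) (vecs n xs)) g) ≈⟨ sym (sumR-concatMap (λ x → List.map (x ∷_) (vecs n xs)) xs g) ⟩
   sumR (vecs (suc n) xs) g ∎

  -- The relation among u, f 1, …, f n, viewed as a polynomial in a further variable z and in f 0, …, f n
  -- that involves neither z nor f 0.
  module _ {n D : ℕ} (coefficient : Vec (Fin (suc D)) (suc n) → ℤ) where

   spread : Fin (suc D) → (Fin (suc n) → Fin (suc D)) → Fin (suc D) → ℤ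
   spread a e m = only a (only (e zero) (coefficient (m ∷ tabulate (e ∘ suc))))

   module _ (u : Carrier) (f y : Fin (suc n) → Carrier) (y-zero : u ≈ y zero) (y-suc : ∀ i → f (suc i) ≈ y (suc i)) (mono : ℤ → ℕ → ℕ → Carrier)
    (mono-0 : ∀ a m → mono (+ 0) a m ≈ 0#) (mono-u : ∀ c m → mono c 0 m ≈ int c * u ^ m) where

    term : Fin (suc D) → (Fin (suc n) → Fin (suc D)) → Fin (suc D) → Carrier
    term a e m = mono (spread a e m) (toℕ a) (toℕ m) * monomial f (toℕ ∘ e)

    evaluation : Carrier
    evaluation = sumR (allFin (suc D)) (λ a → sumR (funs (suc n) (allFin (suc D))) (λ e → sumR (allFin (suc D)) (term a e)))

    private
     K : List (Fin (suc D))
     K = allFin (suc D)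
     monomial-cong₂ : ∀ {n} {x x' : Fin n → Carrier} {e e'} → (∀ i → x i ≈ x' i) → (∀ i → e i ≡ e' i) → monomial x e ≈ monomial x' e'
     monomial-cong₂ {zero}  q r = refl
     monomial-cong₂ {suc n} {e = e} q r = *-cong (trans (^-cong (e zero) (q zero)) (reflexive (≡.cong (_ ^_) (r zero)))) (monomial-cong₂ (q ∘ suc) (r ∘ suc))
     z-free : ∀ i e m → term (suc i) e m ≈ 0#
     z-free i e m = trans (*-congʳ (mono-0 _ (toℕ m))) (zeroˡ _)
     f₀-free : ∀ i (e : Fin n → Fin (suc D)) m → term zero (suc i VF.∷ e) m ≈ 0#
     f₀-free i e m = trans (*-congʳ (mono-0 0 (toℕ m))) (zeroˡ _)
     value : Vec (Fin (suc D)) (suc n) → Carrier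
     value v = int (coefficient v) * monomial y (toℕ ∘ lookup v)
     same : ∀ e m → term zero (zero VF.∷ e) m ≈ value (m ∷ tabulate e)
     same e m = trans (*-cong (trans (mono-u (coefficient (m ∷ tabulate e)) (toℕ m)) (*-congˡ (^-cong (toℕ m) y-zero)))
       (trans (*-identityˡ _) (monomial-cong₂ y-suc (λ i → ≡.cong toℕ (≡.sym (lookup∘tabulate e i)))))) (*-assoc _ _ _)
     where-zero : ∀ {I : Set} (is : List I) {g : I → Carrier} → (∀ i → g i ≈ 0#) → sumR is g ≈ 0#
     where-zero is q = trans (sumR-cong is q) (sumR-0 is)

    evaluation≈ : evaluation ≈ sumR (vecs (suc n) (allFin (suc D))) value
    evaluation≈ = begin
     evaluation ≈⟨ sum-first D _ (λ i → where-zero (funs (suc n) K) (λ e → where-zero K (z-free i e))) ⟩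
     sumR (funs (suc n) K) (λ e → sumR K (term zero e))
      ≈⟨ trans (sumR-concatMap (λ x → List.map (x VF.∷_) (funs n K)) K _) (sumR-cong K (λ x → sumR-map (x VF.∷_) (funs n K) (λ e → sumR K (term zero e)))) ⟩
     sumR K (λ x → sumR (funs n K) (λ e → sumR K (term zero (x VF.∷ e))))
      ≈⟨ sum-first D _ (λ i → where-zero (funs n K) (λ e → where-zero K (f₀-free i e))) ⟩
     sumR (funs n K) (λ e → sumR K (term zero (zero VF.∷ e))) ≈⟨ sumR-cong (funs n K) (λ e → sumR-cong K (same e)) ⟩
     sumR (funs n K) (λ e → sumR K (λ m → value (m ∷ tabulate e))) ≈⟨ sum-funs n K (λ v → sumR K (λ m → value (m ∷ v))) ⟩
     sumR (vecs n K) (λ v → sumR K (λ m → value (m ∷ v))) ≈⟨ sumR-swap (vecs n K) K (λ v m → value (m ∷ v)) ⟩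
     sumR K (λ m → sumR (vecs n K) (λ v → value (m ∷ v))) ≈⟨ sumR-cong K (λ m → sym (sumR-map (m ∷_) (vecs n K) value)) ⟩
     sumR K (λ m → sumR (List.map (m ∷_) (vecs n K)) value) ≈⟨ sym (sumR-concatMap (λ m → List.map (m ∷_) (vecs n K)) K value) ⟩
     sumR (vecs (suc n) K) value ∎

-- Differentiation of the moments CT (T^i e^l) and their reduction to finitely many.

module Moments where

 open PowerSeries
 open Residues
 open import Algebra.Bundles using (CommutativeRing)
 open import Data.Nat.Induction using (<-rec)
 import Data.Nat.Solver
 open import Data.Integer using (+_; -[1+_])
 import Algebra.Properties.Ring

 -- With x = X and D' = dX, differentiation of monomials in T and e is multiplication of D' by H.
 module MonomialDerivative (R : CRing) (p' : ℕ) where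
  open CommutativeRing R hiding (zero)
  open Powers R
  open SetoidReasoning setoid

  module _ {T X e : Carrier} (T-eq : T ≈ X + T ^ suc (suc p')) (e-E : e * (int (+ 1) - int (+ suc (suc p')) * T ^ suc p') ≈ 1#) where
   m m' : Carrier
   m  = int (+ suc (suc p'))
   m' = m * int (+ suc p')

   private
    E = int (+ 1) - m * T ^ suc p'

   module _ {d : Carrier → Carrier} (der : IsDerivation R d) where
    open Derivation R der
    open TreeSeries R p'

    dT : d T ≈ e * d X
    dT = derivative {T} {X} {e} T-eq e-E der

    -- From e E = 1 one has de = - e² dE, where dE = - (p-1)(p-2) T^(p-3) dT and dT = e dX.
    -- Differentiating a power of e therefore raises its exponent by two.
    de : d e ≈ m' * T ^ p' * (e * e) * (e * d X)
    de = begin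
     d e ≈⟨ sym (trans (*-congˡ (trans (*-comm E e) e-E)) (*-identityʳ (d e))) ⟩
     d e * (E * e) ≈⟨ solve 3 (λ a b c → a :* (b :* c) := (a :* b) :* c) refl (d e) E e ⟩
     d e * E * e ≈⟨ *-congʳ (trans (sym (move (trans (sym d-1) (trans (d-cong (sym e-E)) (d-* e E))))) (+-identityˡ _)) ⟩
     - (e * d E) * e ≈⟨ *-congʳ (-‿cong (*-congˡ dE)) ⟩
     - (e * - (m * (int (+ suc p') * T ^ p' * d T))) * e ≈⟨ *-congʳ (-‿cong (*-congˡ (-‿cong (*-congˡ (*-congˡ dT))))) ⟩
     - (e * - (m * (int (+ suc p') * T ^ p' * (e * d X)))) * e
      ≈⟨ solve 5 (λ e m k t x → :- (e :* :- (m :* (k :* t :* x))) :* e := m :* k :* t :* (e :* e) :* x) refl e m (int (+ suc p')) (T ^ p') (e * d X) ⟩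
     m' * T ^ p' * (e * e) * (e * d X) ∎
     where
     dE : d E ≈ - (m * (int (+ suc p') * T ^ p' * d T))
     dE = trans (d-- _ _) (trans (+-cong (d-int (+ 1)) (-‿cong (trans (d-int* (+ suc (suc p')) _) (*-congˡ (d-^ T p'))))) (+-identityˡ _))

    H : ℕ → ℕ → Carrier
    H zero    zero    = 0#
    H zero    (suc l) = int (+ suc l) * m' * (T ^ p' * e ^ (3 ℕ.+ l))
    H (suc i) zero    = int (+ suc i) * (T ^ i * e ^ 1)
    H (suc i) (suc l) = int (+ suc i) * (T ^ i * e ^ (2 ℕ.+ l)) + int (+ suc l) * m' * (T ^ (suc i ℕ.+ p') * e ^ (3 ℕ.+ l))

    d-T^ : ∀ i → d (T ^ suc i) ≈ int (+ suc i) * T ^ i * (e * d X)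
    d-T^ i = trans (d-^ T i) (*-congˡ dT)

    d-e^ : ∀ l → d (e ^ suc l) ≈ int (+ suc l) * m' * (T ^ p' * e ^ (3 ℕ.+ l)) * d X
    d-e^ l = trans (d-^ e l) (trans (*-congˡ de)
     (solve 6 (λ c a m t e x → c :* a :* (m :* t :* (e :* e) :* (e :* x)) := c :* m :* (t :* (e :* (e :* (e :* a)))) :* x) refl
      (int (+ suc l)) (e ^ l) m' (T ^ p') e (d X)))

    d-monomial : ∀ i l → d (T ^ i * e ^ l) ≈ H i l * d X
    d-monomial zero    zero    = trans (d-cong (*-identityˡ 1#)) (trans d-1 (sym (zeroˡ _)))
    d-monomial zero    (suc l) = trans (d-cong (*-identityˡ _)) (d-e^ l)
    d-monomial (suc i) zero    = trans (d-cong (*-identityʳ _)) (trans (d-T^ i) (trans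
     (solve 4 (λ c a e x → c :* a :* (e :* x) := c :* (a :* e) :* x) refl (int (+ suc i)) (T ^ i) e (d X)) (*-congʳ (*-congˡ (*-congˡ (sym (*-identityʳ e)))))))
    d-monomial (suc i) (suc l) = begin
     d (T ^ suc i * e ^ suc l) ≈⟨ d-* _ _ ⟩
     d (T ^ suc i) * e ^ suc l + T ^ suc i * d (e ^ suc l) ≈⟨ +-cong (*-congʳ (d-T^ i)) (*-congˡ (d-e^ l)) ⟩
     int (+ suc i) * T ^ i * (e * d X) * e ^ suc l + T ^ suc i * (int (+ suc l) * m' * (T ^ p' * e ^ (3 ℕ.+ l)) * d X)
      ≈⟨ +-cong (solve 5 (λ c a e x f → c :* a :* (e :* x) :* f := c :* (a :* (e :* f)) :* x) refl (int (+ suc i)) (T ^ i) e (d X) (e ^ suc l))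
         (solve 4 (λ b k g x → b :* (k :* g :* x) := k :* (b :* g) :* x) refl (T ^ suc i) (int (+ suc l) * m') (T ^ p' * e ^ (3 ℕ.+ l)) (d X)) ⟩
     int (+ suc i) * (T ^ i * e ^ (2 ℕ.+ l)) * d X + int (+ suc l) * m' * (T ^ suc i * (T ^ p' * e ^ (3 ℕ.+ l))) * d X ≈⟨ sym (distribʳ _ _ _) ⟩
     (int (+ suc i) * (T ^ i * e ^ (2 ℕ.+ l)) + int (+ suc l) * m' * (T ^ suc i * (T ^ p' * e ^ (3 ℕ.+ l)))) * d X
      ≈⟨ *-congʳ (+-congˡ (*-congˡ (trans (sym (*-assoc _ _ _)) (*-congʳ (sym (^-+ T (suc i) p')))))) ⟩
     H (suc i) (suc l) * d X ∎

 module MomentField {p' : ℕ} (𝕊 : Setting p') where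
  open Analysis 𝕊
  open B using (_≈_; _+_; _*_; _-_; -_; 0#; 1#; refl; sym; trans; +-cong; +-congˡ; +-congʳ; *-cong; *-congˡ; *-congʳ; -‿cong)
  open PB using (_^_; int; ^-+) renaming (solve to solveB; _:=_ to _B:=_; _:+_ to _B:+_; _:*_ to _B:*_; _:-_ to _B:-_; :-_ to B:-_; con to Bcon)
  open MonomialDerivative B p'
  module SA = Powers A

  Regular : A.Carrier → Set
  Regular x = ∀ a → x A.* a A.≈ A.0# → a A.≈ A.0#

  -- Subrings closed under division by regular elements take the place of subfields.
  record Closed (K : A.Carrier → Set) : Set where
   field
    k-cong     : ∀ {a b} → a A.≈ b → K b → K a
    k-int      : ∀ c → K (PA.int c)
    k-+        : ∀ {a b} → K a → K b → K (a A.+ b)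
    k-*        : ∀ {a b} → K a → K b → K (a A.* b)
    k-quotient : ∀ {a b} → Regular b → K b → K (b A.* a) → K a

   k-neg : ∀ {a} → K a → K (A.- a)
   k-neg {a} ka = k-cong (SA.solve 1 (λ x → SA.:- x SA.:= SA.con -[1+ 0 ] SA.:* x) A.refl a) (k-* (k-int -[1+ 0 ]) ka)

   k-- : ∀ {a b} → K a → K b → K (a A.- b)
   k-- ka kb = k-+ ka (k-neg kb)

   k-0 : K A.0#
   k-0 = k-int (+ 0)

  M : ℕ → ℕ → A.Carrier
  M i l = CT (T ^ i * e ^ l)

  -- The smallest closed class with the moments up to level l. Being inductive, it lets δ be
  -- followed through every way of generating an element.
  data Tower (l : ℕ) : A.Carrier → Set where
   t-u : Tower l u
   t-z : Tower l z
   t-R : Tower l R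
   t-S : Tower l S
   t-M : ∀ i l' → l' ≤ l → Tower l (M i l')
   t-int : ∀ c → Tower l (PA.int c)
   t-cong : ∀ {a b} → a A.≈ b → Tower l b → Tower l a
   t-+ : ∀ {a b} → Tower l a → Tower l b → Tower l (a A.+ b)
   t-* : ∀ {a b} → Tower l a → Tower l b → Tower l (a A.* b)
   t-quotient : ∀ {a b} → Regular b → Tower l b → Tower l (b A.* a) → Tower l a

  tower-closed : ∀ l → Closed (Tower l)
  tower-closed l = record { k-cong = t-cong ; k-int = t-int ; k-+ = t-+ ; k-* = t-* ; k-quotient = t-quotient }

  tower-≤ : ∀ {l l' a} → l ≤ l' → Tower l a → Tower l' a
  tower-≤ q t-u = t-u
  tower-≤ q t-z = t-z
  tower-≤ q t-R = t-R
  tower-≤ q t-S = t-S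
  tower-≤ q (t-M i k r) = t-M i k (ℕP.≤-trans r q)
  tower-≤ q (t-int c) = t-int c
  tower-≤ q (t-cong r a) = t-cong r (tower-≤ q a)
  tower-≤ q (t-+ a b) = t-+ (tower-≤ q a) (tower-≤ q b)
  tower-≤ q (t-* a b) = t-* (tower-≤ q a) (tower-≤ q b)
  tower-≤ q (t-quotient r a b) = t-quotient r (tower-≤ q a) (tower-≤ q b)

  regular-int : ∀ c → c ≢ + 0 → Regular (PA.int c)
  regular-int (+ zero)    ne a q = ⊥-elim (ne ≡.refl)
  regular-int (+ (suc n)) ne a q = torsion-free n a q
  regular-int -[1+ n ]    ne a q = torsion-free n a (A.trans (SA.solve 2 (λ c a → c SA.:* a SA.:= SA.:- (SA.:- c SA.:* a)) A.refl _ a)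
   (A.trans (A.-‿cong q) -0#≈0#))
   where open Algebra.Properties.Ring A.ring using (-0#≈0#)

  regular-2R : Regular (PA.int (+ 2) A.* R)
  regular-2R = regular 1 _ A.0# (SA.solve 2 (λ r u → SA.con (+ 2) SA.:* r SA.:= SA.con (+ 2) SA.:* r SA.:+ u SA.:* SA.con (+ 0)) A.refl R u)

  regular-z : Regular z
  regular-z = regular 0 z (A.- CT (t * Y)) (A.trans (SA.solve 3 (λ z u c → z SA.:= SA.con (+ 1) SA.:* (z SA.:+ u SA.:* c) SA.:+ u SA.:* SA.:- c) A.refl z u (CT (t * Y)))
   (A.+-congʳ (A.*-congˡ (A.sym R-eq))))

  -- Linear combinations of monomials in T and e with coefficients in the tower.
  data Combination (l : ℕ) : B.Carrier → Set where
   term : ∀ {a} → Tower l a → ∀ i l' → l' ≤ l → ∀ {f} → f ≈ ι a * (T ^ i * e ^ l') → Combination l f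
   plus : ∀ {f g h} → Combination l f → Combination l g → h ≈ f + g → Combination l h

  CT-combination : ∀ {l f} → Combination l f → Tower l (CT f)
  CT-combination (term ta i l' q r) = t-cong (A.trans (CT-cong r) (CT-ι* _ _)) (t-* ta (t-M i l' q))
  CT-combination (plus p q r) = t-cong (A.trans (CT-cong r) (CT-+ _ _)) (t-+ (CT-combination p) (CT-combination q))

  comb-cong : ∀ {l f g} → g ≈ f → Combination l f → Combination l g
  comb-cong r (term ta i l' q s) = term ta i l' q (trans r s)
  comb-cong r (plus p q s)       = plus p q (trans r s)

  comb-ι* : ∀ {l f a} → Tower l a → Combination l f → Combination l (ι a * f)
  comb-ι* ta (term tb i l' q r) = term (t-* ta tb) i l' q (trans (*-congˡ r) (trans (sym (B.*-assoc _ _ _)) (*-congʳ (sym (ι-* _ _)))))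
  comb-ι* ta (plus p q r) = plus (comb-ι* ta p) (comb-ι* ta q) (trans (*-congˡ r) (B.distribˡ _ _ _))

  comb-T^* : ∀ {l f} k → Combination l f → Combination l (T ^ k * f)
  comb-T^* k (term ta i l' q r) = term ta (k ℕ.+ i) l' q (trans (*-congˡ r) (trans
   (solveB 4 (λ x a y b → x B:* (a B:* (y B:* b)) B:= a B:* (x B:* y B:* b)) refl _ _ _ _) (*-congˡ (*-congʳ (sym (^-+ T k i))))))
  comb-T^* k (plus p q r) = plus (comb-T^* k p) (comb-T^* k q) (trans (*-congˡ r) (B.distribˡ _ _ _))

  comb-int* : ∀ {l f} c → Combination l f → Combination l (int c * f)
  comb-int* c p = comb-cong (*-congʳ (sym (ι-int c))) (comb-ι* (t-int c) p)

  comb-monomial : ∀ {l} i l' → l' ≤ l → Combination l (T ^ i * e ^ l')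
  comb-monomial i l' q = term (t-int (+ 1)) i l' q (sym (trans (*-congʳ (trans (ι-int (+ 1)) PB.int-1)) (B.*-identityˡ _)))

  comb-Q : ∀ {l f} → Combination l f → Combination l (f * (X - ι S))
  comb-Q p = plus (plus (comb-T^* 1 p) (comb-int* -[1+ 0 ] (comb-T^* (suc (suc p')) p)) refl) (comb-int* -[1+ 0 ] (comb-ι* t-S p))
   (trans (*-congˡ (+-congʳ X≈)) (solveB 4 (λ f t y s → f B:* (t B:- y B:- s) B:= t B:* f B:+ Bcon -[1+ 0 ] B:* (y B:* f) B:+ Bcon -[1+ 0 ] B:* (s B:* f)) refl _ T Y (ι S))
    ⟨≈⟩ +-congʳ (+-congʳ (*-congʳ (sym (B.*-identityʳ T)))))
   where _⟨≈⟩_ = trans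

  HH : ℕ → ℕ → B.Carrier
  HH = H {T} {X} {e} T-eq e-E D-der

  comb-H : ∀ {l} i l' → l' ≤ l → Combination (2 ℕ.+ l) (HH i l')
  comb-H zero    zero    q = term (t-int (+ 0)) 0 0 z≤n (sym (trans (*-congʳ (ι-int (+ 0))) (B.zeroˡ _)))
  comb-H zero    (suc l) q = comb-cong (B.*-assoc _ _ _) (comb-int* (+ suc l) (comb-cong (B.*-assoc _ _ _)
   (comb-int* (+ suc (suc p')) (comb-int* (+ suc p') (comb-monomial p' (3 ℕ.+ l) (s≤s (s≤s q)))))))
  comb-H (suc i) zero    q = comb-int* (+ suc i) (comb-monomial i 1 (s≤s z≤n))
  comb-H (suc i) (suc l) q = plus (comb-int* (+ suc i) (comb-monomial i (2 ℕ.+ l) (s≤s (s≤s (ℕP.≤-trans (ℕP.n≤1+n l) q)))))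
   (comb-cong (B.*-assoc _ _ _) (comb-int* (+ suc l) (comb-cong (B.*-assoc _ _ _)
    (comb-int* (+ suc (suc p')) (comb-int* (+ suc p') (comb-monomial (suc i ℕ.+ p') (3 ℕ.+ l) (s≤s (s≤s q)))))))) refl

  CT-comb-y : ∀ {l f} → Combination l f → CT (f * y) A.≈ A.0#
  CT-comb-y (term {a} ta i l' q r) = A.trans (CT-cong (trans (*-congʳ r) (B.*-assoc _ _ _))) (A.trans (CT-ι* _ _)
   (A.trans (A.*-congˡ (CT-Tey l' i)) (A.zeroʳ a)))
  CT-comb-y (plus p q r) = A.trans (CT-cong (trans (*-congʳ r) (B.distribʳ _ _ _))) (A.trans (CT-+ _ _)
   (A.trans (A.+-cong (CT-comb-y p) (CT-comb-y q)) (A.+-identityʳ A.0#)))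

  tDρ : t * D ρ ≈ ι (δ R)
  tDρ = trans (sym (trans (DD.d-* t ρ) (trans (+-congʳ (trans (*-congʳ D-t) (B.zeroˡ ρ))) (B.+-identityˡ _)))) (trans (DD.d-cong tρ) (D-ι R))

  DX≈ : D X ≈ ι (δ S) + D ρ
  DX≈ = trans (DD.d-+ _ _) (+-congʳ (trans (DD.d-+ t (ι S)) (trans (+-cong D-t (D-ι S)) (B.+-identityˡ _))))

  RDρ : ι R * D ρ ≈ ι (δ R) * ρ
  RDρ = trans (*-congʳ (sym tρ)) (trans (solveB 3 (λ t r d → t B:* r B:* d B:= t B:* d B:* r) refl t ρ (D ρ)) (*-congʳ tDρ))

  2R = PA.int (+ 2) A.* R

  -- 2 R times the derivative of a moment, without the denominator t of D X.
  CT-H-DX : ∀ {l f} → Combination l f → 2R A.* CT (f * D X) A.≈ 2R A.* δ S A.* CT f A.+ δ R A.* CT (f * (X - ι S))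
  CT-H-DX {l} {f} p = begin
   2R A.* CT (f * D X) ≈⟨ A.trans (A.sym (CT-ι* 2R _)) (CT-cong expand) ⟩
   CT (ι (2R A.* δ S) * f + (ι (δ R) * (f * (X - ι S)) - ι (δ R) * (f * y)))
    ≈⟨ A.trans (CT-+ _ _) (A.+-cong (CT-ι* _ _) (A.trans (CT-- _ _) (A.+-cong (CT-ι* _ _) (A.-‿cong (A.trans (CT-ι* _ _)
       (A.trans (A.*-congˡ (CT-comb-y p)) (A.zeroʳ _))))))) ⟩
   2R A.* δ S A.* CT f A.+ (δ R A.* CT (f * (X - ι S)) A.- A.0#) ≈⟨ A.+-congˡ (SA.solve 1 (λ x → x SA.:- SA.con (+ 0) SA.:= x) A.refl _) ⟩
   2R A.* δ S A.* CT f A.+ δ R A.* CT (f * (X - ι S)) ∎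
   where
   open ≈A
   -- Multiplying by R replaces D ρ by ρ, since R D ρ = (δ R) ρ; the factor 2 is for 2 ρ = (X - S) -
   -- y, whose part in y has no constant term against f.
   expand : ι 2R * (f * D X) ≈ ι (2R A.* δ S) * f + (ι (δ R) * (f * (X - ι S)) - ι (δ R) * (f * y))
   expand = trans (*-cong (trans (ι-* _ _) (*-congʳ (ι-int (+ 2)))) (*-congˡ DX≈))
    (trans (solveB 4 (λ r f s d → Bcon (+ 2) B:* r B:* (f B:* (s B:+ d)) B:= Bcon (+ 2) B:* r B:* s B:* f B:+ Bcon (+ 2) B:* f B:* (r B:* d)) refl (ι R) f (ι (δ S)) (D ρ))
    (trans (+-cong (*-congʳ (sym (trans (ι-* _ _) (*-congʳ (trans (ι-* _ _) (*-congʳ (ι-int (+ 2)))))))) (*-congˡ RDρ))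
     (+-congˡ (solveB 5 (λ f d r t s → Bcon (+ 2) B:* f B:* (d B:* r) B:= d B:* (f B:* (t B:+ s B:+ r B:- s)) B:- d B:* (f B:* (t B:- r))) refl f (ι (δ R)) ρ t (ι S)))))

  δ-CT-monomial : ∀ i l → 2R A.* δ (M i l) A.≈ 2R A.* δ S A.* CT (HH i l) A.+ δ R A.* CT (HH i l * (X - ι S))
  δ-CT-monomial i l = A.trans (A.*-congˡ (A.trans (A.sym (CT-D _)) (CT-cong (d-monomial {T} {X} {e} T-eq e-E D-der i l)))) (CT-H-DX (comb-H i l ℕP.≤-refl))

  private
   HY : B.Carrier
   HY = HH (suc (suc p')) 0
   -- Coefficients and determinant of the linear system for δ S and δ R that results from
   -- differentiating S = u CT Y and R = z + u CT (t Y).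
   a₁ b₁ α Δ : A.Carrier
   a₁ = CT HY
   b₁ = CT (HY * (X - ι S))
   α = PA.int (+ 1) A.- u A.* a₁
   Δ = PA.int (+ 4) A.* R A.* (α A.* α) A.- u A.* b₁ A.* (u A.* b₁)

   tower-a : Tower 2 a₁
   tower-a = CT-combination (comb-H {0} (suc (suc p')) 0 z≤n)
   tower-b : Tower 2 b₁
   tower-b = CT-combination (comb-Q (comb-H {0} (suc (suc p')) 0 z≤n))

   DY : D Y ≈ HY * D X
   DY = trans (DD.d-cong (sym (B.*-identityʳ Y))) (d-monomial {T} {X} {e} T-eq e-E D-der (suc (suc p')) 0)

   S-equation : 2R A.* α A.* δ S A.≈ u A.* b₁ A.* δ R
   S-equation = A.trans (SA.solve 4 (λ r u a s → r SA.:* (SA.con (+ 1) SA.:- u SA.:* a) SA.:* s SA.:= r SA.:* s SA.:- u SA.:* (r SA.:* s SA.:* a)) A.refl 2R u a₁ (δ S))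
    (A.trans (A.+-congʳ first) (SA.solve 4 (λ u x d b → u SA.:* (x SA.:+ d SA.:* b) SA.:- u SA.:* x SA.:= u SA.:* b SA.:* d) A.refl u (2R A.* δ S A.* a₁) (δ R) b₁))
    where
    first : 2R A.* δ S A.≈ u A.* (2R A.* δ S A.* a₁ A.+ δ R A.* b₁)
    first = A.trans (A.*-congˡ (A.trans (Dδ.d-cong S-eq) (A.trans (Dδ.d-* _ _) (A.trans (A.+-congʳ (A.trans (A.*-congʳ δ-u) (A.zeroˡ _)))
      (A.trans (A.+-identityˡ _) (A.*-congˡ (A.trans (A.sym (CT-D Y)) (CT-cong DY))))))))
     (A.trans (SA.solve 3 (λ r u c → r SA.:* (u SA.:* c) SA.:= u SA.:* (r SA.:* c)) A.refl 2R u _) (A.*-congˡ (CT-H-DX (comb-H {0} (suc (suc p')) 0 z≤n))))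

   R-equation : PA.int (+ 2) A.* α A.* δ R A.≈ PA.int (+ 2) A.* z A.+ u A.* b₁ A.* δ S
   R-equation = A.trans (SA.solve 3 (λ u a d → SA.con (+ 2) SA.:* (SA.con (+ 1) SA.:- u SA.:* a) SA.:* d SA.:= SA.con (+ 2) SA.:* d SA.:- u SA.:* (SA.con (+ 2) SA.:* d SA.:* a)) A.refl u a₁ (δ R))
    (A.trans (A.+-congʳ (A.*-congˡ second)) (A.trans (A.+-congʳ (A.trans (A.distribˡ _ _ _) (A.+-congˡ (A.trans (SA.solve 2 (λ u c → SA.con (+ 2) SA.:* (u SA.:* c) SA.:= u SA.:* (SA.con (+ 2) SA.:* c)) A.refl u _) (A.*-congˡ third)))))
     (SA.solve 6 (λ z u s b d a → SA.con (+ 2) SA.:* z SA.:+ u SA.:* (s SA.:* b SA.:+ SA.con (+ 2) SA.:* d SA.:* a) SA.:- u SA.:* (SA.con (+ 2) SA.:* d SA.:* a) SA.:= SA.con (+ 2) SA.:* z SA.:+ u SA.:* b SA.:* s) A.refl z u (δ S) b₁ (δ R) a₁)))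
    where
    second : δ R A.≈ z A.+ u A.* CT (t * (HY * D X))
    second = A.trans (Dδ.d-cong R-eq) (A.trans (Dδ.d-+ _ _) (A.+-cong δ-z (A.trans (Dδ.d-* _ _) (A.trans (A.+-congʳ (A.trans (A.*-congʳ δ-u) (A.zeroˡ _)))
     (A.trans (A.+-identityˡ _) (A.*-congˡ (A.trans (A.sym (CT-D _)) (CT-cong (trans (DD.d-* t Y) (trans (+-cong (trans (*-congʳ D-t) (B.zeroˡ Y)) (*-congˡ DY)) (B.+-identityˡ _)))))))))))
    -- Here t D X = t δ S + δ R, and 2 t = (X - S) + y, whose part in y again contributes nothing.
    third : PA.int (+ 2) A.* CT (t * (HY * D X)) A.≈ δ S A.* b₁ A.+ PA.int (+ 2) A.* δ R A.* a₁
    third = A.trans (A.sym (CT-int* (+ 2) _)) (A.trans (CT-cong expand) (A.trans (CT-+ _ _) (A.+-cong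
      (A.trans (CT-ι* _ _) (A.*-congˡ (A.trans (CT-+ _ _) (A.trans (A.+-congˡ (CT-comb-y (comb-H {0} (suc (suc p')) 0 z≤n))) (A.+-identityʳ _)))))
      (A.trans (CT-ι* _ _) A.refl))))
     where
     expand : int (+ 2) * (t * (HY * D X)) ≈ ι (δ S) * (HY * (X - ι S) + HY * y) + ι (PA.int (+ 2) A.* δ R) * HY
     expand = trans (*-congˡ (*-congˡ (*-congˡ DX≈))) (trans
      (solveB 6 (λ t h s d σ r → Bcon (+ 2) B:* (t B:* (h B:* (s B:+ d))) B:= s B:* (h B:* (t B:+ σ B:+ r B:- σ) B:+ h B:* (t B:- r)) B:+ Bcon (+ 2) B:* (t B:* d) B:* h) refl t HY (ι (δ S)) (D ρ) (ι S) ρ)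
      (+-congˡ (*-congʳ (trans (*-congˡ tDρ) (sym (trans (ι-* _ _) (*-congʳ (ι-int (+ 2)))))))))

   -- Modulo u, α is 1 and Δ is 4 R.
   regular-Δ : Regular Δ
   regular-Δ = regular 3 Δ (PA.int -[1+ 7 ] A.* R A.* a₁ A.+ PA.int (+ 4) A.* R A.* u A.* a₁ A.* a₁ A.- u A.* b₁ A.* b₁)
    (SA.solve 4 (λ r u a b → SA.con (+ 4) SA.:* r SA.:* ((SA.con (+ 1) SA.:- u SA.:* a) SA.:* (SA.con (+ 1) SA.:- u SA.:* a)) SA.:- u SA.:* b SA.:* (u SA.:* b) SA.:=
     SA.con (+ 4) SA.:* r SA.:+ u SA.:* (SA.con -[1+ 7 ] SA.:* r SA.:* a SA.:+ SA.con (+ 4) SA.:* r SA.:* u SA.:* a SA.:* a SA.:- u SA.:* b SA.:* b)) A.refl R u a₁ b₁)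

   Δ-δR : Δ A.* δ R A.≈ PA.int (+ 4) A.* z A.* R A.* α
   Δ-δR = A.trans (SA.solve 4 (λ r α b d → (SA.con (+ 4) SA.:* r SA.:* (α SA.:* α) SA.:- b SA.:* b) SA.:* d SA.:= SA.con (+ 2) SA.:* r SA.:* α SA.:* (SA.con (+ 2) SA.:* α SA.:* d) SA.:- b SA.:* (b SA.:* d)) A.refl R α (u A.* b₁) (δ R))
    (A.trans (A.+-cong (A.*-congˡ R-equation) (A.-‿cong (A.*-congˡ (A.sym S-equation))))
     (SA.solve 5 (λ r α b z s → SA.con (+ 2) SA.:* r SA.:* α SA.:* (SA.con (+ 2) SA.:* z SA.:+ b SA.:* s) SA.:- b SA.:* (SA.con (+ 2) SA.:* r SA.:* α SA.:* s) SA.:= SA.con (+ 4) SA.:* z SA.:* r SA.:* α) A.refl R α (u A.* b₁) z (δ S)))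

   Δ-δS : Δ A.* δ S A.≈ PA.int (+ 2) A.* z A.* (u A.* b₁)
   Δ-δS = A.trans (SA.solve 4 (λ r α b d → (SA.con (+ 4) SA.:* r SA.:* (α SA.:* α) SA.:- b SA.:* b) SA.:* d SA.:= SA.con (+ 2) SA.:* α SA.:* (SA.con (+ 2) SA.:* r SA.:* α SA.:* d) SA.:- b SA.:* (b SA.:* d)) A.refl R α (u A.* b₁) (δ S))
    (A.trans (A.+-congʳ (A.trans (A.*-congˡ S-equation) (SA.solve 3 (λ α b d → SA.con (+ 2) SA.:* α SA.:* (b SA.:* d) SA.:= b SA.:* (SA.con (+ 2) SA.:* α SA.:* d)) A.refl α (u A.* b₁) (δ R))))
     (A.trans (A.+-congʳ (A.*-congˡ R-equation)) (SA.solve 3 (λ b z s → b SA.:* (SA.con (+ 2) SA.:* z SA.:+ b SA.:* s) SA.:- b SA.:* (b SA.:* s) SA.:= SA.con (+ 2) SA.:* z SA.:* b) A.refl (u A.* b₁) z (δ S))))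

   tower-α : Tower 2 α
   tower-α = Closed.k-- (tower-closed 2) (t-int (+ 1)) (t-* t-u tower-a)

   tower-Δ : Tower 2 Δ
   tower-Δ = Closed.k-- (tower-closed 2) (t-* (t-* (t-int (+ 4)) t-R) (t-* tower-α tower-α)) (t-* (t-* t-u tower-b) (t-* t-u tower-b))

  tower-δR : Tower 2 (δ R)
  tower-δR = t-quotient regular-Δ tower-Δ (t-cong Δ-δR (t-* (t-* (t-* (t-int (+ 4)) t-z) t-R) tower-α))

  tower-δS : Tower 2 (δ S)
  tower-δS = t-quotient regular-Δ tower-Δ (t-cong Δ-δS (t-* (t-* (t-int (+ 2)) t-z) (t-* t-u tower-b)))

  tower-δ : ∀ {l a} → Tower l a → Tower (2 ℕ.+ l) (δ a)
  tower-δ t-u = t-cong δ-u (t-int (+ 0))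
  tower-δ t-z = t-cong δ-z t-z
  tower-δ {l} t-R = tower-≤ (ℕP.m≤m+n 2 l) tower-δR
  tower-δ {l} t-S = tower-≤ (ℕP.m≤m+n 2 l) tower-δS
  tower-δ {l} (t-M i l' q) = t-quotient regular-2R (t-* (t-int (+ 2)) t-R) (t-cong (δ-CT-monomial i l')
   (t-+ (t-* (t-* (t-* (t-int (+ 2)) t-R) (tower-≤ (ℕP.m≤m+n 2 l) tower-δS)) (CT-combination (comb-H i l' q)))
    (t-* (tower-≤ (ℕP.m≤m+n 2 l) tower-δR) (CT-combination (comb-Q (comb-H i l' q))))))
  tower-δ (t-int c) = t-cong (Dδ.d-int c) (t-int (+ 0))
  tower-δ (t-cong r a) = t-cong (Dδ.d-cong r) (tower-δ a)
  tower-δ (t-+ a b) = t-cong (Dδ.d-+ _ _) (t-+ (tower-δ a) (tower-δ b))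
  tower-δ {l} (t-* a b) = t-cong (Dδ.d-* _ _) (t-+ (t-* (tower-δ a) (up b)) (t-* (up a) (tower-δ b)))
   where up : ∀ {a} → Tower l a → Tower (2 ℕ.+ l) a
         up = tower-≤ (ℕP.m≤n+m l 2)
  -- b δ a = δ (b a) - (δ b) a, so the derivative of a quotient is again a quotient by b.
  tower-δ {l} (t-quotient {a} {b} r tb tba) = t-quotient r (up tb) (t-cong (A.trans (SA.solve 3 (λ b d x → b SA.:* d SA.:= x SA.:+ b SA.:* d SA.:- x) A.refl b (δ a) (δ b A.* a)) (A.+-congʳ (A.sym (Dδ.d-* b a))))
    (Closed.k-- (tower-closed (2 ℕ.+ l)) (tower-δ tba) (t-* (tower-δ tb) (up (t-quotient r tb tba)))))
   where up : ∀ {a} → Tower l a → Tower (2 ℕ.+ l) a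
         up = tower-≤ (ℕP.m≤n+m l 2)

  -- Reduction of the moments of level 2 + l to finitely many of them, in any field-like K.
  module Reduction {K : A.Carrier → Set} (KC : Closed K) (l : ℕ) (K-R : K R) (K-S : K S) where
   open Closed KC

   L : ℕ
   L = 2 ℕ.+ l

   data Low (n : ℕ) : B.Carrier → Set where
    low-0 : ∀ {f} → f ≈ 0# → Low n f
    low-mono : ∀ {a} → K a → ∀ k → k < n → ∀ {f} → f ≈ ι a * T ^ k → Low n f
    low-+ : ∀ {f g h} → Low n f → Low n g → h ≈ f + g → Low n h

   low-≤ : ∀ {m n f} → m ≤ n → Low m f → Low n f
   low-≤ q (low-0 r) = low-0 r
   low-≤ q (low-mono ka k l r) = low-mono ka k (ℕP.≤-trans l q) r
   low-≤ q (low-+ a b r) = low-+ (low-≤ q a) (low-≤ q b) r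

   low-* : ∀ {m n f g} → Low m f → Low n g → Low (m ℕ.+ n) (f * g)
   low-* (low-0 q) _ = low-0 (trans (*-congʳ q) (B.zeroˡ _))
   low-* p@(low-mono _ _ _ _) (low-0 q) = low-0 (trans (*-congˡ q) (B.zeroʳ _))
   low-* (low-mono ka k l q) (low-mono kb k' l' q') = low-mono (k-* ka kb) (k ℕ.+ k') (ℕP.+-mono-< l l')
    (trans (*-cong q q') (trans (solveB 4 (λ a b c d → a B:* b B:* (c B:* d) B:= a B:* c B:* (b B:* d)) refl _ _ _ _) (*-cong (sym (ι-* _ _)) (sym (^-+ T k k')))))
   low-* p@(low-mono _ _ _ _) (low-+ q r s) = low-+ (low-* p q) (low-* p r) (trans (*-congˡ s) (B.distribˡ _ _ _))
   low-* (low-+ p q r) s = low-+ (low-* p s) (low-* q s) (trans (*-congʳ r) (B.distribʳ _ _ _))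

   low-T^* : ∀ {n f} k → Low n f → Low (k ℕ.+ n) (T ^ k * f)
   low-T^* k (low-0 q) = low-0 (trans (*-congˡ q) (B.zeroʳ _))
   low-T^* k (low-mono ka i l q) = low-mono ka (k ℕ.+ i) (ℕP.+-monoʳ-< k l) (trans (*-congˡ q)
    (trans (solveB 3 (λ a b c → a B:* (b B:* c) B:= b B:* (a B:* c)) refl _ _ _) (*-congˡ (sym (^-+ T k i)))))
   low-T^* k (low-+ p q r) = low-+ (low-T^* k p) (low-T^* k q) (trans (*-congˡ r) (B.distribˡ _ _ _))

   low-int* : ∀ {n f} c → Low n f → Low n (int c * f)
   low-int* c (low-0 q) = low-0 (trans (*-congˡ q) (B.zeroʳ _))
   low-int* c (low-mono {a} ka k l q) = low-mono (k-* (k-int c) ka) k l (trans (*-congˡ q) (trans (sym (B.*-assoc _ _ _)) (*-congʳ (sym (trans (ι-* _ _) (*-congʳ (ι-int c)))))))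
   low-int* c (low-+ p q r) = low-+ (low-int* c p) (low-int* c q) (trans (*-congˡ r) (B.distribˡ _ _ _))

   -- The leading coefficient in T is required to be an integer, because nonzero integers are
   -- regular and the leading moment can then be solved for.
   record Lead (c : ℤ) (n : ℕ) (f : B.Carrier) : Set where
    constructor lead
    field
     {remainder} : B.Carrier
     low         : Low n remainder
     expansion   : f ≈ int c * T ^ n + remainder

   lead-n : ∀ {c m n f} → m ≡ n → Lead c m f → Lead c n f
   lead-n ≡.refl p = p

   lead-* : ∀ {c d m n f g} → Lead c m f → Lead d n g → Lead (c ℤ.* d) (m ℕ.+ n) (f * g)
   lead-* {c} {d} {m} {n} (lead {f'} p q) (lead {g'} r s) = lead
    (low-+ (low-+ (low-int* c (low-T^* m r)) (low-≤ (ℕP.≤-reflexive (ℕP.+-comm n m)) (low-int* d (low-T^* n p))) refl) (low-* p r) refl)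
    (trans (*-cong q s) (trans (solveB 6 (λ c x f d y g → (c B:* x B:+ f) B:* (d B:* y B:+ g) B:= c B:* d B:* (x B:* y) B:+ (c B:* (x B:* g) B:+ d B:* (y B:* f) B:+ f B:* g)) refl (int c) (T ^ m) f' (int d) (T ^ n) g')
     (+-congʳ (*-cong (sym (PB.int-* c d)) (sym (^-+ T m n))))))

   lead-+ : ∀ {c d n f g} → Lead c n f → Lead d n g → Lead (c ℤ.+ d) n (f + g)
   lead-+ {c} {d} {n} (lead {f'} p q) (lead {g'} r s) = lead (low-+ p r refl)
    (trans (+-cong q s) (trans (solveB 5 (λ c d x f g → (c B:* x B:+ f) B:+ (d B:* x B:+ g) B:= (c B:+ d) B:* x B:+ (f B:+ g)) refl (int c) (int d) (T ^ n) f' g')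
     (+-congʳ (*-congʳ (sym (PB.int-+ c d))))))

   lead-T^ : ∀ k → Lead (+ 1) k (T ^ k)
   lead-T^ k = lead (low-0 {f = 0#} refl) (sym (trans (B.+-identityʳ _) (trans (*-congʳ PB.int-1) (B.*-identityˡ _))))

   lead-int : ∀ c → Lead c 0 (int c)
   lead-int c = lead (low-0 {f = 0#} refl) (sym (trans (B.+-identityʳ _) (B.*-identityʳ _)))

   lead-E : Lead -[1+ suc p' ] (suc p') E
   lead-E = lead (low-mono (k-int (+ 1)) 0 (s≤s z≤n) (sym (trans (B.*-identityʳ _) (ι-int (+ 1)))))
    (solveB 3 (λ m x o → o B:- m B:* x B:= B:- m B:* x B:+ o) refl (int (+ suc (suc p'))) (T ^ suc p') (int (+ 1)))

   Q Dd : B.Carrier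
   Q = X - ι S
   Dd = Q * Q - int (+ 4) * ι R

   lead-Q : Lead -[1+ 0 ] (suc (suc p')) Q
   lead-Q = lead (low-+ (low-mono (k-int (+ 1)) 1 (s≤s (s≤s z≤n)) (sym (trans (*-cong (trans (ι-int (+ 1)) PB.int-1) (B.*-identityʳ T)) (B.*-identityˡ T))))
     (low-mono (k-neg K-S) 0 (s≤s z≤n) (sym (trans (B.*-identityʳ _) (ι-neg S)))) refl)
    (trans (+-congʳ X≈) (solveB 3 (λ t y s → t B:- y B:- s B:= Bcon -[1+ 0 ] B:* y B:+ (t B:- s)) refl T Y (ι S)))

   lead-Dd : Lead (+ 1) (suc (suc p') ℕ.+ suc (suc p')) Dd
   lead-Dd = let lead p q = lead-* lead-Q lead-Q in
    lead (low-+ p (low-mono (k-neg (k-* (k-int (+ 4)) K-R)) 0 (s≤s z≤n)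
      (sym (trans (B.*-identityʳ _) (trans (ι-neg _) (-‿cong (trans (ι-* _ _) (*-congʳ (ι-int (+ 4))))))))) refl)
    (trans (+-congʳ q) (B.+-assoc _ _ _))

   -- y and X - S are the difference and the sum of t and ρ, whose product is R.
   y² : y * y ≈ Dd
   y² = trans (solveB 3 (λ t r s → (t B:- r) B:* (t B:- r) B:= (t B:+ s B:+ r B:- s) B:* (t B:+ s B:+ r B:- s) B:- Bcon (+ 4) B:* (t B:* r)) refl t ρ (ι S))
    (+-congˡ (-‿cong (*-congˡ tρ)))

   private
    module ZS = Data.Integer.Solver.+-*-Solver
    module NS = Data.Nat.Solver.+-*-Solver
    q+ : ℤ
    q+ = + suc (suc p')

   -- The numerator of ϑ (T^(i+1) e^l y) over e^(2+l).
   G : ℕ → B.Carrier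
   G i = int (+ suc i) * (T ^ i * (E * Dd)) + int (+ l ℤ.* (q+ ℤ.* + suc p')) * (T ^ (suc i ℕ.+ p') * Dd) + T ^ suc i * (E * (E * Q))

   leading : ℕ → ℤ
   leading i = + suc i ℤ.* (+ 1 ℤ.* (-[1+ suc p' ] ℤ.* + 1)) ℤ.+ + l ℤ.* (q+ ℤ.* + suc p') ℤ.* (+ 1 ℤ.* + 1) ℤ.+ + 1 ℤ.* (-[1+ suc p' ] ℤ.* (-[1+ suc p' ] ℤ.* -[1+ 0 ]))

   degree : ℕ → ℕ
   degree i = i ℕ.+ (5 ℕ.+ 3 ℕ.* p')

   lead-G : ∀ i → Lead (leading i) (degree i) (G i)
   lead-G i = lead-+ (lead-+
    (lead-n (NS.solve 2 (λ i p → NS.con 0 NS.:+ (i NS.:+ ((NS.con 1 NS.:+ p) NS.:+ ((NS.con 2 NS.:+ p) NS.:+ (NS.con 2 NS.:+ p)))) NS.:= i NS.:+ (NS.con 5 NS.:+ NS.con 3 NS.:* p)) ≡.refl i p')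
     (lead-* (lead-int (+ suc i)) (lead-* (lead-T^ i) (lead-* lead-E lead-Dd))))
    (lead-n (NS.solve 2 (λ i p → NS.con 0 NS.:+ ((NS.con 1 NS.:+ i NS.:+ p) NS.:+ ((NS.con 2 NS.:+ p) NS.:+ (NS.con 2 NS.:+ p))) NS.:= i NS.:+ (NS.con 5 NS.:+ NS.con 3 NS.:* p)) ≡.refl i p')
     (lead-* (lead-int (+ l ℤ.* (q+ ℤ.* + suc p'))) (lead-* (lead-T^ (suc i ℕ.+ p')) lead-Dd))))
    (lead-n (NS.solve 2 (λ i p → (NS.con 1 NS.:+ i) NS.:+ ((NS.con 1 NS.:+ p) NS.:+ ((NS.con 1 NS.:+ p) NS.:+ (NS.con 2 NS.:+ p))) NS.:= i NS.:+ (NS.con 5 NS.:+ NS.con 3 NS.:* p)) ≡.refl i p')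
     (lead-* (lead-T^ (suc i)) (lead-* lead-E (lead-* lead-E lead-Q))))

   -- The value is affine in i with slope -(p-1), so at most one i makes it vanish; this is the
   -- origin of the exceptional moment.
   leading-value : ∀ i → leading i ≡ q+ ℤ.* (+ (l ℕ.* suc p') ℤ.- + (suc i ℕ.+ suc (suc p')))
   leading-value i = ≡.trans (≡.cong (λ n → + suc i ℤ.* (+ 1 ℤ.* (n ℤ.* + 1)) ℤ.+ + l ℤ.* (q+ ℤ.* + suc p') ℤ.* (+ 1 ℤ.* + 1) ℤ.+ + 1 ℤ.* (n ℤ.* (n ℤ.* -[1+ 0 ]))) {x = -[1+ suc p' ]} {y = ℤ.- q+} ≡.refl)
    (≡.trans (ZS.solve 4 (λ i l q s → i ZS.:* (ZS.con (+ 1) ZS.:* (ZS.:- q ZS.:* ZS.con (+ 1))) ZS.:+ l ZS.:* (q ZS.:* s) ZS.:* (ZS.con (+ 1) ZS.:* ZS.con (+ 1)) ZS.:+ ZS.con (+ 1) ZS.:* (ZS.:- q ZS.:* (ZS.:- q ZS.:* ZS.con -[1+ 0 ])) ZS.:= q ZS.:* (l ZS.:* s ZS.:- (i ZS.:+ q))) ≡.refl (+ suc i) (+ l) q+ (+ suc p'))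
     (≡.cong (q+ ℤ.*_) (≡.cong₂ ℤ._-_ (≡.sym (ℤP.pos-* l (suc p'))) (≡.sym (ℤP.pos-+ (suc i) (suc (suc p')))))))

   exceptional : ℕ
   exceptional = l ℕ.* suc p' ℕ.+ (2 ℕ.+ 2 ℕ.* p')

   leading-zero : ∀ i → leading i ≡ + 0 → degree i ≡ exceptional
   leading-zero i z = by-cases (ℤP.i*j≡0⇒i≡0∨j≡0 q+ (≡.trans (≡.sym (leading-value i)) z))
    where
    by-cases : q+ ≡ + 0 ⊎ + (l ℕ.* suc p') ℤ.- + (suc i ℕ.+ suc (suc p')) ≡ + 0 → degree i ≡ exceptional
    by-cases (inj₁ ())
    by-cases (inj₂ d) = ≡.trans (NS.solve 2 (λ i p → i NS.:+ (NS.con 5 NS.:+ NS.con 3 NS.:* p) NS.:= (NS.con 1 NS.:+ i) NS.:+ (NS.con 2 NS.:+ p) NS.:+ (NS.con 2 NS.:+ NS.con 2 NS.:* p)) ≡.refl i p')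
     (≡.cong (ℕ._+ (2 ℕ.+ 2 ℕ.* p')) (≡.sym (ℤP.+-injective (ℤP.i-j≡0⇒i≡j (+ (l ℕ.* suc p')) (+ (suc i ℕ.+ suc (suc p'))) d))))

   -- Differentiating the monomial gives a second factor y and so y² = `Dd`; differentiating y gives
   -- X - S. Factors E bring all terms to the common power e^(l+2). Taking constant terms yields a
   -- linear relation between the moments of level l + 2.
   exact : ∀ i → ϑ (T ^ suc i * e ^ l * y) ≈ G i * e ^ L
   exact i = begin
    ϑ (T ^ suc i * e ^ l * y) ≈⟨ Dϑ.d-* _ _ ⟩
    ϑ (T ^ suc i * e ^ l) * y + T ^ suc i * e ^ l * ϑ y
     ≈⟨ +-cong (*-congʳ (trans (d-monomial {T} {X} {e} T-eq e-E ϑ-der (suc i) l) (*-congˡ ϑ-X))) (*-congˡ ϑ-y) ⟩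
    H {T} {X} {e} T-eq e-E ϑ-der (suc i) l * y * y + T ^ suc i * e ^ l * Q ≈⟨ +-cong (trans (B.*-assoc _ y y) (*-cong Hl y²)) (*-congʳ (*-congˡ up)) ⟩
    (int (+ suc i) * (T ^ i * (E * (e * (e * e ^ l)))) + int (+ l) * (m'' * (T ^ (suc i ℕ.+ p') * (e * (e * e ^ l))))) * Dd + T ^ suc i * (E * (E * (e * (e * e ^ l)))) * Q
     ≈⟨ +-cong (trans (B.distribʳ _ _ _) (+-cong (out₁ _ _ E _ _) (out₂ _ _ _ _ _))) (out₃ _ E _ _) ⟩
    int (+ suc i) * (T ^ i * (E * Dd)) * e ^ L + int (+ l) * m'' * (T ^ (suc i ℕ.+ p') * Dd) * e ^ L + T ^ suc i * (E * (E * Q)) * e ^ L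
     ≈⟨ sym (trans (B.distribʳ _ _ _) (+-congʳ (B.distribʳ _ _ _))) ⟩
    (int (+ suc i) * (T ^ i * (E * Dd)) + int (+ l) * m'' * (T ^ (suc i ℕ.+ p') * Dd) + T ^ suc i * (E * (E * Q))) * e ^ L
     ≈⟨ *-congʳ (+-congʳ (+-congˡ (*-congʳ (sym (trans (PB.int-* (+ l) _) (*-congˡ (PB.int-* q+ (+ suc p')))))))) ⟩
    G i * e ^ L ∎
    where
    open ≈B
    out₁ : ∀ c a E f d → c * (a * (E * f)) * d ≈ c * (a * (E * d)) * f
    out₁ = solveB 5 (λ c a E f d → c B:* (a B:* (E B:* f)) B:* d B:= c B:* (a B:* (E B:* d)) B:* f) refl
    out₂ : ∀ k m b f d → k * (m * (b * f)) * d ≈ k * m * (b * d) * f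
    out₂ = solveB 5 (λ k m b f d → k B:* (m B:* (b B:* f)) B:* d B:= k B:* m B:* (b B:* d) B:* f) refl
    out₃ : ∀ x E f q → x * (E * (E * f)) * q ≈ x * (E * (E * q)) * f
    out₃ = solveB 4 (λ x E f q → x B:* (E B:* (E B:* f)) B:* q B:= x B:* (E B:* (E B:* q)) B:* f) refl
    m'' = int q+ * int (+ suc p')
    up1 : ∀ k → e ^ k ≈ E * e ^ suc k
    up1 k = sym (trans (sym (B.*-assoc E e (e ^ k))) (trans (*-congʳ (trans (B.*-comm E e) e-E)) (B.*-identityˡ _)))
    up : e ^ l ≈ E * (E * (e * (e * e ^ l)))
    up = trans (up1 l) (*-congˡ (up1 (suc l)))
    Hl : H {T} {X} {e} T-eq e-E ϑ-der (suc i) l ≈ int (+ suc i) * (T ^ i * (E * (e * (e * e ^ l)))) + int (+ l) * (m'' * (T ^ (suc i ℕ.+ p') * (e * (e * e ^ l))))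
    Hl = go l
     where
     go : ∀ l → H {T} {X} {e} T-eq e-E ϑ-der (suc i) l ≈ int (+ suc i) * (T ^ i * (E * (e * (e * e ^ l)))) + int (+ l) * (m'' * (T ^ (suc i ℕ.+ p') * (e * (e * e ^ l))))
     go zero    = trans (*-congˡ (*-congˡ (up1 1))) (sym (trans (+-congˡ (B.zeroˡ _)) (B.+-identityʳ _)))
     go (suc l) = +-cong (*-congˡ (*-congˡ (up1 (2 ℕ.+ l)))) (B.*-assoc _ _ _)

   module _ (base : ∀ k → k < 5 ℕ.+ 3 ℕ.* p' → K (M k L)) (special : K (M exceptional L)) where

    low-CT : ∀ {n f} → (∀ k → k < n → K (M k L)) → Low n f → K (CT (f * e ^ L))
    low-CT rec (low-0 q) = k-cong (A.trans (CT-cong (trans (*-congʳ q) (B.zeroˡ _))) CT-0) k-0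
    low-CT rec (low-mono ka k l q) = k-cong (A.trans (CT-cong (trans (*-congʳ q) (B.*-assoc _ _ _))) (CT-ι* _ _)) (k-* ka (rec k l))
    low-CT rec (low-+ p q r) = k-cong (A.trans (CT-cong (trans (*-congʳ r) (B.distribʳ _ _ _))) (CT-+ _ _)) (k-+ (low-CT rec p) (low-CT rec q))

    all-top : ∀ k → K (M k L)
    all-top = <-rec (λ k → K (M k L)) step
     where
     from-lead : ∀ i {c} → c ≢ + 0 → Lead c (degree i) (G i) → (∀ k → k < degree i → K (M k L)) → K (M (degree i) L)
     from-lead i {c} ne (lead {g} low Geq) rec = k-quotient (regular-int c ne) (k-int c) (k-cong solved (k-neg (low-CT rec low)))
      where
      solved : PA.int c A.* M (degree i) L A.≈ A.- CT (g * e ^ L)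
      solved = PA.neg-unique (A.trans (A.+-comm _ _) (A.trans (A.+-congʳ (A.sym (CT-int* c _))) (A.trans (A.sym (CT-+ _ _))
       (A.trans (CT-cong (sym (trans (exact i) (trans (*-congʳ Geq) (trans (B.distribʳ _ _ _) (+-congʳ (B.*-assoc _ _ _))))))) (CT-ϑ _)))))
     reduce : ∀ i → (∀ k → k < degree i → K (M k L)) → K (M (degree i) L)
     reduce i rec = by-cases (leading i ℤ.≟ + 0)
      where
      by-cases : Dec (leading i ≡ + 0) → K (M (degree i) L)
      by-cases (yes z) = ≡.subst (λ k → K (M k L)) (≡.sym (leading-zero i z)) special
      by-cases (no ne) = from-lead i ne (lead-G i) rec
     step : ∀ k → (∀ {k'} → k' < k → K (M k' L)) → K (M k L)
     step k rec with k ℕ.<? 5 ℕ.+ 3 ℕ.* p'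
     ... | yes l = base k l
     ... | no ¬l = ≡.subst (λ k → K (M k L)) d≡ (reduce (k ℕ.∸ (5 ℕ.+ 3 ℕ.* p')) (λ k' l' → rec (ℕP.<-≤-trans l' (ℕP.≤-reflexive d≡))))
      where
      d≡ : degree (k ℕ.∸ (5 ℕ.+ 3 ℕ.* p')) ≡ k
      d≡ = ℕP.m∸n+n≡m (ℕP.≮⇒≥ ¬l)

    -- Since e^l = E e^(l+1), a moment is a combination of two moments of the next level; the
    -- highest level is enough.
    all-lower : ∀ d l' → d ℕ.+ l' ≡ L → ∀ k → K (M k l')
    all-lower zero    l' ≡.refl k = all-top k
    all-lower (suc d) l' q k = k-cong (A.trans (CT-cong (trans (*-congˡ expand) (trans
      (solveB 4 (λ a m x f → a B:* ((Bcon (+ 1) B:- m B:* x) B:* f) B:= a B:* f B:- m B:* (a B:* x B:* f)) refl (T ^ k) (int (+ suc (suc p'))) (T ^ suc p') (e ^ suc l'))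
      (+-congˡ (-‿cong (*-congˡ (*-congʳ (sym (^-+ T k (suc p'))))))))))
      (A.trans (CT-- _ _) (A.+-congˡ (A.-‿cong (CT-int* (+ suc (suc p')) _)))))
     (k-- (rec k) (k-* (k-int (+ suc (suc p'))) (rec (k ℕ.+ suc p'))))
     where
     rec : ∀ k → K (M k (suc l'))
     rec = all-lower d (suc l') (≡.trans (ℕP.+-suc d l') q)
     expand : e ^ l' ≈ E * (e * e ^ l')
     expand = sym (trans (sym (B.*-assoc E e (e ^ l'))) (trans (*-congʳ (trans (B.*-comm E e) e-E)) (B.*-identityˡ _)))

    tower⊆ : K u → K z → ∀ {a} → Tower L a → K a
    tower⊆ ku kz t-u = ku
    tower⊆ ku kz t-z = kz
    tower⊆ ku kz t-R = K-R
    tower⊆ ku kz t-S = K-S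
    tower⊆ ku kz (t-M i l' q) = all-lower (L ℕ.∸ l') l' (ℕP.m∸n+n≡m q) i
    tower⊆ ku kz (t-int c) = k-int c
    tower⊆ ku kz (t-cong r a) = k-cong r (tower⊆ ku kz a)
    tower⊆ ku kz (t-+ a b) = k-+ (tower⊆ ku kz a) (tower⊆ ku kz b)
    tower⊆ ku kz (t-* a b) = k-* (tower⊆ ku kz a) (tower⊆ ku kz b)
    tower⊆ ku kz (t-quotient r a b) = k-quotient r (tower⊆ ku kz a) (tower⊆ ku kz b)

-- Dependence of u and the derivatives by comparing numbers of generators.

module Independence where

 open PowerSeries
 open Residues
 open Elimination
 open Moments
 open import Data.Integer using (+_)
 open import Data.Fin using (fromℕ<)

 module Dependence {p' : ℕ} (𝕊 : Setting p') where
  open Analysis 𝕊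
  open MomentField 𝕊
  open Eliminate A using (module Generated; AlgebraicRelation)
  open B using (_*_; trans; sym; refl)
  open PB using (_^_)

  tower-power : ∀ j → Tower 0 (CT (T ^ j * X ^ 0))
  tower-power j = t-M j 0 z≤n

  tower-power-X : ∀ j → Tower 0 (CT (T ^ j * X ^ 1))
  tower-power-X j = t-cong (A.trans (CT-cong split) (CT-- _ _)) (Closed.k-- (tower-closed 0) (t-M (suc j) 0 z≤n) (t-M (j ℕ.+ suc (suc p')) 0 z≤n))
   where
   split : T ^ j * X ^ 1 B.≈ T ^ suc j * B.1# B.- T ^ (j ℕ.+ suc (suc p')) * B.1#
   split = trans (B.*-congˡ (B.*-congʳ X≈)) (trans
    (PB.solve 4 (λ f t y o → f PB.:* ((t PB.:- y) PB.:* o) PB.:= t PB.:* f PB.:* o PB.:- f PB.:* y PB.:* o) refl (T ^ j) T Y B.1#)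
    (B.+-congˡ (B.-‿cong (B.*-congʳ (sym (PB.^-+ T j (suc (suc p'))))))))

  -- u, z, R, S, the exceptional moment, and the 3 p - 4 moments with small exponent of T. The
  -- number is the same for every level.
  generators : ℕ
  generators = 5 ℕ.+ (5 ℕ.+ 3 ℕ.* p')

  module Level (l : ℕ) where
   exceptional : ℕ
   exceptional = l ℕ.* suc p' ℕ.+ (2 ℕ.+ 2 ℕ.* p')

   generator : ∀ {r} → Fin (5 ℕ.+ r) → A.Carrier
   generator zero                            = u
   generator (suc zero)                      = z
   generator (suc (suc zero))                = R
   generator (suc (suc (suc zero)))          = S
   generator (suc (suc (suc (suc zero))))    = M exceptional (2 ℕ.+ l)
   generator (suc (suc (suc (suc (suc i))))) = M (toℕ i) (2 ℕ.+ l)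

   module G = Generated {generators} generator
   open G

   closed : Closed Fraction
   closed = record { k-cong = fraction-cong ; k-int = λ c → fraction-poly (poly-int c {0}) ; k-+ = fraction-+ ; k-* = fraction-* ; k-quotient = fraction-quotient }

   fraction-generator : ∀ i → Fraction (generator i)
   fraction-generator i = fraction-poly (poly-generator i)

   base : ∀ k → k < 5 ℕ.+ 3 ℕ.* p' → Fraction (M k (2 ℕ.+ l))
   base k l< = ≡.subst (λ k → Fraction (M k (2 ℕ.+ l))) (toℕ-fromℕ< l<) (fraction-generator (suc (suc (suc (suc (suc (fromℕ< l<)))))))

   tower-fraction : ∀ {a} → Tower (2 ℕ.+ l) a → Fraction a
   tower-fraction = Reduction.tower⊆ closed l (fraction-generator (suc (suc zero))) (fraction-generator (suc (suc (suc zero))))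
    base (fraction-generator (suc (suc (suc (suc zero))))) (fraction-generator zero) (fraction-generator (suc zero))

   dependent-tower : (f : Fin (suc generators) → A.Carrier) → (∀ i → Tower (2 ℕ.+ l) (f i)) → AlgebraicRelation f
   dependent-tower f tf = G.dependent f (λ i → tower-fraction (tf i))

  module _ (∂ : A.Carrier → A.Carrier) (z∂ : ∀ a → z A.* ∂ a A.≈ δ a) where

   derivatives : A.Carrier → ℕ → A.Carrier
   derivatives a zero    = a
   derivatives a (suc i) = ∂ (derivatives a i)

   tower-derivatives : ∀ {a} → Tower 0 a → ∀ i → Tower (i ℕ.* 2) (derivatives a i)
   tower-derivatives ta zero    = ta
   tower-derivatives ta (suc i) = t-quotient regular-z t-z (t-cong (z∂ _) (tower-δ (tower-derivatives ta i)))

   family : A.Carrier → Fin (suc generators) → A.Carrier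
   family a zero    = u
   family a (suc i) = derivatives a (toℕ i)

   -- One element more than there are generators. The level merely has to be high enough for all the
   -- derivatives, at two per derivative; raising it does not add generators.
   dependent : ∀ {a} → Tower 0 a → AlgebraicRelation (family a)
   dependent {a} ta = Level.dependent-tower (generators ℕ.* 2) (family a) member
    where
    member : ∀ i → Tower (2 ℕ.+ generators ℕ.* 2) (family a i)
    member zero    = t-u
    member (suc i) = tower-≤ (ℕP.≤-trans (ℕP.*-monoˡ-≤ 2 (ℕP.<⇒≤ (toℕ<n i))) (ℕP.m≤n+m _ 2)) (tower-derivatives ta (toℕ i))

-- The operations on series in the statement as operations of the ring of series.

module Algebraicity where

 open import Defs
 open PowerSeries
 open Residues
 open Bivariate using (module U; A; module A; module B; module SA; module PA; module PB; CT; δ)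
 open TreeSetting using (u; z)
 open Recursions using (delay)
 open Instance using (int-at; mul-u; ×-ℤ; treeSetting; N; derivative-w; module An)
 open Elimination
 open Polynomials
 open Moments
 open Independence
 open import Algebra.Bundles using (CommutativeRing)
 open import Data.Bool using (_∧_)
 open import Data.Nat using (_∸_)
 open import Data.Integer using (+_; -[1+_])
 open import Data.Vec using ([]; _∷_; lookup; tabulate)
 import Data.Vec.Properties as VecP
 open import Data.List using (applyUpTo)

 private
  module EA = Eliminate A

 sum-upTo : ∀ (h : ℕ → ℤ) n → sumℤ (List.map h (upTo n)) ≡ sumℤ (applyUpTo h n)
 sum-upTo h n = ≡.cong sumℤ (ListP.map-upTo h n)

 convolution : ∀ f g m → sumℤ (List.map (λ j → f j ℤ.* g (m ∸ j)) (upTo (suc m))) ≡ (f U.* g) m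
 convolution f g m = ≡.trans (sum-upTo (λ j → f j ℤ.* g (m ∸ j)) (suc m)) (go f g m)
  where
  go : ∀ f g m → sumℤ (applyUpTo (λ j → f j ℤ.* g (m ∸ j)) (suc m)) ≡ (f U.* g) m
  go f g zero    = ℤP.+-identityʳ _
  go f g (suc m) = ≡.cong (λ x → f 0 ℤ.* g (suc m) ℤ.+ x) (go (f ∘ suc) g m)

 *ₛ≈ : ∀ P Q → (P *ₛ Q) A.≈ P A.* Q
 *ₛ≈ P Q a m = ≡.trans (≡.trans (≡.cong sumℤ (ListP.map-cong (λ i → convolution (P i) (Q (a ∸ i)) m) (upTo (suc a)))) (sum-upTo (λ i → (P i U.* Q (a ∸ i)) m) (suc a))) (go P Q a m)
  where
  go : ∀ P Q a m → sumℤ (applyUpTo (λ i → (P i U.* Q (a ∸ i)) m) (suc a)) ≡ (P A.* Q) a m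
  go P Q zero    m = ℤP.+-identityʳ _
  go P Q (suc a) m = ≡.cong (λ x → (P 0 U.* Q (suc a)) m ℤ.+ x) (go (P ∘ suc) Q a m)

 1ₛ≈ : 1ₛ A.≈ A.1#
 1ₛ≈ zero    zero    = ≡.refl
 1ₛ≈ zero    (suc m) = ≡.refl
 1ₛ≈ (suc a) m       = ≡.refl

 powₛ≈ : ∀ P j → powₛ P j A.≈ P PA.^ j
 powₛ≈ P zero    = 1ₛ≈
 powₛ≈ P (suc j) = A.trans {powₛ P (suc j)} {P A.* powₛ P j} {P PA.^ suc j} (*ₛ≈ P (powₛ P j)) (A.*-congˡ {P} {powₛ P j} {P PA.^ j} (powₛ≈ P j))

 prodF≈ : ∀ k (P : Fin k → Ser) e → prodF k (λ i → powₛ (P i) (e i)) A.≈ EA.monomial P e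
 prodF≈ zero    P e = 1ₛ≈
 prodF≈ (suc k) P e = A.trans {powₛ (P zero) (e zero) *ₛ rest} {powₛ (P zero) (e zero) A.* rest} {EA.monomial P e} (*ₛ≈ (powₛ (P zero) (e zero)) rest)
   (A.*-cong {powₛ (P zero) (e zero)} {P zero PA.^ e zero} {rest} {EA.monomial (P ∘ suc) (e ∘ suc)} (powₛ≈ (P zero) (e zero)) (prodF≈ k (P ∘ suc) (e ∘ suc)))
  where rest = prodF k (λ i → powₛ (P (suc i)) (e (suc i)))

 sumₛ≈ : ∀ {I : Set} (is : List I) {f g : I → Ser} → (∀ i → f i A.≈ g i) → sumₛ (List.map f is) A.≈ EA.sumR is g
 sumₛ≈ []       q a m = ≡.refl
 sumₛ≈ (i ∷ is) q a m = ≡.cong₂ ℤ._+_ (q i a m) (sumₛ≈ is q a m)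

 mono-0 : ∀ a m → mono (+ 0) a m A.≈ A.0#
 mono-0 a m a' m' with (a ℕ.≡ᵇ a') ∧ (m ℕ.≡ᵇ m')
 ... | true  = ≡.refl
 ... | false = ≡.refl

 int-value : ∀ n i m → PA.int (+ n) i m ≡ + n ℤ.* A.1# i m
 int-value n i m = ≡.trans (≡.sym (A.*-identityʳ (PA.int (+ n)) i m)) (int-at n A.1# i m)

 mono-int : ∀ c → mono c 0 0 A.≈ PA.int c
 mono-int c zero    zero    = at-0 c
  where
  at-0 : ∀ c → c ≡ PA.int c 0 0
  at-0 (+ n)    = ≡.sym (≡.trans (int-value n 0 0) (ℤP.*-identityʳ (+ n)))
  at-0 -[1+ n ] = ≡.cong ℤ.-_ (at-0 (+ suc n))
 mono-int c zero    (suc m) = vanish c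
  where
  vanish : ∀ c → + 0 ≡ PA.int c 0 (suc m)
  vanish (+ n)    = ≡.sym (≡.trans (int-value n 0 (suc m)) (ℤP.*-zeroʳ (+ n)))
  vanish -[1+ n ] = ≡.cong ℤ.-_ (vanish (+ suc n))
 mono-int c (suc a) m       = vanish c
  where
  vanish : ∀ c → + 0 ≡ PA.int c (suc a) m
  vanish (+ n)    = ≡.sym (≡.trans (int-value n (suc a) m) (ℤP.*-zeroʳ (+ n)))
  vanish -[1+ n ] = ≡.cong ℤ.-_ (vanish (+ suc n))

 mono-suc : ∀ c m → mono c 0 (suc m) A.≈ u A.* mono c 0 m
 mono-suc c m i m' = ≡.trans (pointwise i m') (≡.sym (mul-u (mono c 0 m) i m'))
  where
  pointwise : ∀ i m' → mono c 0 (suc m) i m' ≡ delay (mono c 0 m i) m'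
  pointwise zero    zero     = ≡.refl
  pointwise zero    (suc m') = ≡.refl
  pointwise (suc i) zero     = ≡.refl
  pointwise (suc i) (suc m') = ≡.refl

 mono-u : ∀ c m → mono c 0 m A.≈ PA.int c A.* u PA.^ m
 mono-u c zero    = A.trans {mono c 0 0} {PA.int c} {PA.int c A.* A.1#} (mono-int c) (A.sym {PA.int c A.* A.1#} {PA.int c} (A.*-identityʳ (PA.int c)))
 mono-u c (suc m) = A.trans {mono c 0 (suc m)} {u A.* mono c 0 m} {C A.* (u A.* v)} (mono-suc c m)
   (A.trans {u A.* mono c 0 m} {u A.* (C A.* v)} {C A.* (u A.* v)} (A.*-congˡ {u} {mono c 0 m} {C A.* v} (mono-u c m)) (exchange A u C v))
  where
  C = PA.int c
  v = u PA.^ m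
  exchange : ∀ (R : CRing) → let open CommutativeRing R in ∀ x y z → x * (y * z) ≈ y * (x * z)
  exchange R x y z = trans (sym (*-assoc x y z)) (trans (*-congʳ (*-comm x y)) (*-assoc y x z))
   where open CommutativeRing R

 z-∂z : ∀ a → z A.* ∂z a A.≈ δ a
 z-∂z a zero    m = ≡.trans (SA.mul-variable-zero (∂z a) m) (≡.sym (×-ℤ 0 (a 0) m))
 z-∂z a (suc i) m = ≡.trans (SA.mul-variable-suc (∂z a) i m) (≡.sym (×-ℤ (suc i) (a (suc i)) m))

 module _ {k : ℕ} (F : Ser) {y : Fin (suc k) → Ser} (y-zero : u A.≈ y zero) (y-suc : ∀ i → ∂z^ (toℕ (suc i)) F A.≈ y (suc i))
  (dependence : EA.AlgebraicRelation y) where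

  private
   module Ev = Evaluation A
   open EA.AlgebraicRelation dependence
   f : Fin (suc k) → Ser
   f i = ∂z^ (toℕ i) F
   c : PolyCoeffs k D
   c = Ev.spread coefficient
   terms : ∀ a e m → mono (c a e m) (toℕ a) (toℕ m) *ₛ prodF (suc k) (λ i → powₛ (f i) (toℕ (e i)))
    A.≈ mono (c a e m) (toℕ a) (toℕ m) A.* EA.monomial f (toℕ ∘ e)
   terms a e m = A.trans {P *ₛ Q} {P A.* Q} {P A.* EA.monomial f (toℕ ∘ e)} (*ₛ≈ P Q) (A.*-congˡ {P} {Q} {EA.monomial f (toℕ ∘ e)} (prodF≈ (suc k) f (toℕ ∘ e)))
    where
    P = mono (c a e m) (toℕ a) (toℕ m)
    Q = prodF (suc k) (λ i → powₛ (f i) (toℕ (e i)))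
   evaluation : Ser
   evaluation = Ev.evaluation coefficient u f y y-zero y-suc mono mono-0 mono-u

  evalP≈ : evalP k D c F A.≈ evaluation
  evalP≈ = sumₛ≈ (allFin (suc D)) (λ a → sumₛ≈ (funs (suc k) (allFin (suc D))) (λ e → sumₛ≈ (allFin (suc D)) (terms a e)))

  relation⇒DAlgebraic : 1 ≤ k → DAlgebraic F
  relation⇒DAlgebraic k≥1 with nontrivial
  ... | m ∷ v , ne = k , k≥1 , D , c , (zero , zero VF.∷ lookup v , m , nonzero) ,
    A.trans {evalP k D c F} {evaluation} {A.0#} evalP≈ (A.trans {evaluation} {_} {A.0#}
     (Ev.evaluation≈ coefficient u f y y-zero y-suc mono mono-0 mono-u) relation)
   where
   nonzero : coefficient (m ∷ tabulate (lookup v)) ≢ + 0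
   nonzero = ≡.subst (λ v → coefficient (m ∷ v) ≢ + 0) (≡.sym (VecP.tabulate∘lookup v)) ne

 module _ (p' : ℕ) where

  private
   module De = Dependence (treeSetting p')
   module MF = MomentField (treeSetting p')

  -- The derivative of F is what is known to lie in the tower; the differential polynomial obtained
  -- involves only u and derivatives of F of order at least one.
  tower⇒DAlgebraic : ∀ F → MF.Tower 0 (∂z F) → DAlgebraic F
  tower⇒DAlgebraic F t = relation⇒DAlgebraic F (A.refl {u}) shifted (De.dependent ∂z z-∂z t) (s≤s z≤n)
   where
   derivatives : ∀ i → ∂z^ (suc i) F ≡ De.derivatives ∂z z-∂z (∂z F) i
   derivatives zero    = ≡.refl
   derivatives (suc i) = ≡.cong ∂z (derivatives i)
   shifted : ∀ i → ∂z^ (toℕ (suc i)) F A.≈ De.family ∂z z-∂z (∂z F) (suc i)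
   shifted i a m = ≡.cong (λ s → s a m) (derivatives (toℕ i))

  module _ {j k : ℕ} {F : Ser} (F≡ : ∀ f m → F f m ≡ N p' j k [] f m) where
   open Setting (treeSetting p') using (T; X)
   open PB using (_^_)

   derivative : ∂z F A.≈ CT (T ^ j B.* X ^ k)
   derivative a m = ≡.trans (≡.cong (λ x → + suc a ℤ.* x) (≡.trans (F≡ (suc a) m) (A.*-identityʳ (An.w p' j k) (suc a) m))) (derivative-w p' j k a m)

  power⇒DAlgebraic : ∀ j {F} → (∀ f m → F f m ≡ N p' j 0 [] f m) → DAlgebraic F
  power⇒DAlgebraic j {F} e = tower⇒DAlgebraic F (MF.t-cong (derivative {j} {0} e) (De.tower-power j))

  power-X⇒DAlgebraic : ∀ j {F} → (∀ f m → F f m ≡ N p' j 1 [] f m) → DAlgebraic F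
  power-X⇒DAlgebraic j {F} e = tower⇒DAlgebraic F (MF.t-cong (derivative {j} {1} e) (De.tower-power-X j))

open import Defs
open import Data.Nat.Properties
open import Relation.Binary.PropositionalEquality hiding ([_])
import Data.List.Relation.Binary.Permutation.Propositional as ↭
open Recursions
open import Data.Nat using (_+_; _*_; _≤ᵇ_; _∸_; _%_; _/_; _!)
open import Data.Bool using (_∧_; _∨_; not; T)
open import Data.Bool.Properties using (T?; ∧-assoc)
open import Data.List using (tabulate; filter; [_]; concat; map; foldr)
open import Data.Product using (_×_)
open import Data.Nat.Induction using (<-wellFounded; Acc; acc)
open import Data.Fin.Properties using (pigeonhole)
open import Data.List.Membership.Propositional.Properties using (∈-allFin; ∈-filter⁺; ∈-filter⁻; ∈-++⁺ˡ; ∈-++⁺ʳ; ∈-++⁻; ∈-upTo⁺)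
open import Data.Nat.DivMod using (m≡m%n+[m/n]*n; m%n<n; _/_; m*n/n≡m)
open import Data.Unit using (⊤; tt)
open import Data.List.Properties using (++-assoc; length-++; ≡-dec; ++-identityʳ)
open import Data.List.Relation.Binary.Permutation.Propositional using (_↭_; prep; swap; ↭-sym)
open import Data.List.Relation.Binary.Permutation.Propositional.Properties using (∈-resp-↭; shift; ++-comm; ++⁺ʳ; ↭-length; All-resp-↭)
open import Data.Maybe using (Maybe; just; nothing)
open Recursions using (splitSum)
open import Data.Integer using (+_; -[1+_]; ∣_∣)
open import Data.Nat.ListAction using (sum)
open Instance using (seriesRecursion)
open Algebraicity using (power⇒DAlgebraic; power-X⇒DAlgebraic)

-- Boolean tests, finite sums and counts.

∧-split : ∀ {a b} → a ∧ b ≡ true → a ≡ true × b ≡ true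
∧-split {true} {true} _ = refl , refl

∧-join : ∀ {a b} → a ≡ true → b ≡ true → a ∧ b ≡ true
∧-join refl refl = refl

∨-split : ∀ {a b} → a ∨ b ≡ true → a ≡ true ⊎ b ≡ true
∨-split {true}  _ = inj₁ refl
∨-split {false} q = inj₂ q

∨-left : ∀ {a b} → a ≡ true → a ∨ b ≡ true
∨-left refl = refl

∨-right : ∀ {a b} → b ≡ true → a ∨ b ≡ true
∨-right {true}  _ = refl
∨-right {false} q = q

not-true : ∀ {a} → not a ≡ true → a ≡ false
not-true {false} _ = refl

not-false : ∀ {a} → a ≡ false → not a ≡ true
not-false refl = refl

true≢false : ∀ {a} → a ≡ true → a ≡ false → ⊥
true≢false refl ()

implies-split : ∀ {a b} → not a ∨ b ≡ true → a ≡ true → b ≡ true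
implies-split q refl = q

implies-join : ∀ {a b} → (a ≡ true → b ≡ true) → not a ∨ b ≡ true
implies-join {false} _ = refl
implies-join {true}  f = f refl

implies-false : ∀ {a b} → not a ∨ b ≡ false → a ≡ true × b ≡ false
implies-false {true} q = refl , q

bool-iff : ∀ {a b} → (a ≡ true → b ≡ true) → (b ≡ true → a ≡ true) → a ≡ b
bool-iff {false} {false} _ _ = refl
bool-iff {true}  {true}  _ _ = refl
bool-iff {false} {true}  _ g with g refl
... | ()
bool-iff {true}  {false} f _ with f refl
... | ()

¬true⇒false : ∀ {a} → (a ≡ true → ⊥) → a ≡ false
¬true⇒false {false} _ = refl
¬true⇒false {true}  f = ⊥-elim (f refl)

dec-true : ∀ {a} {A : Set a} (d : Dec A) → A → ⌊ d ⌋ ≡ true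
dec-true (yes _) _ = refl
dec-true (no q) a = ⊥-elim (q a)

true-dec : ∀ {a} {A : Set a} (d : Dec A) → ⌊ d ⌋ ≡ true → A
true-dec (yes a) _ = a

=ᶠ-true : ∀ {n} {g h : Fin n} → g ≡ h → (g =ᶠ h) ≡ true
=ᶠ-true {g = g} {h} = dec-true (g Fin.≟ h)

=ᶠ-eq : ∀ {n} {g h : Fin n} → (g =ᶠ h) ≡ true → g ≡ h
=ᶠ-eq {g = g} {h} = true-dec (g Fin.≟ h)

same? : ∀ {n} (g h : Fin n) → g ≡ h ⊎ g ≢ h
same? g h with g Fin.≟ h
... | yes e = inj₁ e
... | no ne = inj₂ ne

=ᶠ-refl : ∀ {n} (g : Fin n) → (g =ᶠ g) ≡ true
=ᶠ-refl g = =ᶠ-true refl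

=ᶠ-false : ∀ {n} {g h : Fin n} → g ≢ h → (g =ᶠ h) ≡ false
=ᶠ-false g≢h = ¬true⇒false (g≢h ∘ =ᶠ-eq)

allF-sound : ∀ n {P : Fin n → Bool} → allF n P ≡ true → ∀ i → P i ≡ true
allF-sound (suc n) q zero    = proj₁ (∧-split q)
allF-sound (suc n) q (suc i) = allF-sound n (proj₂ (∧-split q)) i

allF-complete : ∀ n {P : Fin n → Bool} → (∀ i → P i ≡ true) → allF n P ≡ true
allF-complete zero    _ = refl
allF-complete (suc n) f = ∧-join (f zero) (allF-complete n (f ∘ suc))

allF-witness : ∀ n {P : Fin n → Bool} → allF n P ≡ false → ∃ λ i → P i ≡ false
allF-witness (suc n) {P} q with P zero in eq
... | false = zero , eq
... | true  with allF-witness n q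
...   | i , r = suc i , r

anyF-sound : ∀ n {P : Fin n → Bool} → anyF n P ≡ true → ∃ λ i → P i ≡ true
anyF-sound (suc n) {P} q with P zero in eq
... | true  = zero , eq
... | false with anyF-sound n q
...   | i , r = suc i , r

anyF-complete : ∀ n {P : Fin n → Bool} i → P i ≡ true → anyF n P ≡ true
anyF-complete (suc n) zero    q = ∨-left q
anyF-complete (suc n) (suc i) q = ∨-right (anyF-complete n i q)

allL-tabulate : ∀ {A : Set} {P : A → Bool} n (f : Fin n → A) → allL P (tabulate f) ≡ allF n (P ∘ f)
allL-tabulate zero    f = refl
allL-tabulate {P = P} (suc n) f = cong (P (f zero) ∧_) (allL-tabulate n (f ∘ suc))

allL-applyUpTo-sound : ∀ {A : Set} {P : A → Bool} (f : ℕ → A) n → allL P (List.applyUpTo f n) ≡ true → ∀ j → j < n → P (f j) ≡ true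
allL-applyUpTo-sound f (suc n) q zero    _ = proj₁ (∧-split q)
allL-applyUpTo-sound f (suc n) q (suc j) (s≤s l) = allL-applyUpTo-sound (f ∘ suc) n (proj₂ (∧-split q)) j l

allL-applyUpTo-complete : ∀ {A : Set} {P : A → Bool} (f : ℕ → A) n → (∀ j → j < n → P (f j) ≡ true) → allL P (List.applyUpTo f n) ≡ true
allL-applyUpTo-complete f zero    _ = refl
allL-applyUpTo-complete f (suc n) q = ∧-join (q zero (s≤s z≤n)) (allL-applyUpTo-complete (f ∘ suc) n (λ j l → q (suc j) (s≤s l)))

allL-upTo-sound : ∀ {P : ℕ → Bool} n → allL P (upTo n) ≡ true → ∀ j → j < n → P j ≡ true
allL-upTo-sound = allL-applyUpTo-sound id

allL-upTo-complete : ∀ {P : ℕ → Bool} n → (∀ j → j < n → P j ≡ true) → allL P (upTo n) ≡ true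
allL-upTo-complete = allL-applyUpTo-complete id

allL-upTo-witness : ∀ {P : ℕ → Bool} n → allL P (upTo n) ≡ false → ∃ λ j → j < n × P j ≡ false
allL-upTo-witness n q = go id n q
 where
 go : ∀ {A : Set} {P : A → Bool} (f : ℕ → A) n → allL P (List.applyUpTo f n) ≡ false → ∃ λ j → j < n × P (f j) ≡ false
 go {P = P} f (suc n) q with P (f zero) in eq
 ... | false = zero , s≤s z≤n , eq
 ... | true with go (f ∘ suc) n q
 ...   | j , l , r = suc j , s≤s l , r

indicator : Bool → ℕ
indicator b = if b then 1 else 0

sumOver : ∀ {A : Set} → List A → (A → ℕ) → ℕ
sumOver []       f = 0
sumOver (x ∷ xs) f = f x + sumOver xs f

sumOver-cong : ∀ {A : Set} (xs : List A) {f g : A → ℕ} → (∀ x → f x ≡ g x) → sumOver xs f ≡ sumOver xs g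
sumOver-cong []       q = refl
sumOver-cong (x ∷ xs) q = cong₂ _+_ (q x) (sumOver-cong xs q)

sumOver-cong-∈ : ∀ {A : Set} (xs : List A) {f g : A → ℕ} → (∀ {x} → x ∈ xs → f x ≡ g x) → sumOver xs f ≡ sumOver xs g
sumOver-cong-∈ []       q = refl
sumOver-cong-∈ (x ∷ xs) q = cong₂ _+_ (q (here refl)) (sumOver-cong-∈ xs (q ∘ there))

sumOver-zero : ∀ {A : Set} (xs : List A) → sumOver xs (λ _ → 0) ≡ 0
sumOver-zero []       = refl
sumOver-zero (_ ∷ xs) = sumOver-zero xs

sumOver-const : ∀ {A : Set} (xs : List A) c → sumOver xs (λ _ → c) ≡ length xs * c
sumOver-const []       c = refl
sumOver-const (_ ∷ xs) c = cong (_+_ c) (sumOver-const xs c)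

sumOver-+ : ∀ {A : Set} (xs : List A) (f g : A → ℕ) → sumOver xs (λ x → f x + g x) ≡ sumOver xs f + sumOver xs g
sumOver-+ []       f g = refl
sumOver-+ (x ∷ xs) f g = begin
 f x + g x + sumOver xs (λ x → f x + g x)    ≡⟨ cong (_+_ (f x + g x)) (sumOver-+ xs f g) ⟩
 f x + g x + (sumOver xs f + sumOver xs g)   ≡⟨ +-assoc (f x) (g x) _ ⟩
 f x + (g x + (sumOver xs f + sumOver xs g)) ≡⟨ cong (_+_ (f x)) (sym (+-assoc (g x) (sumOver xs f) _)) ⟩
 f x + (g x + sumOver xs f + sumOver xs g)   ≡⟨ cong (λ a → f x + (a + sumOver xs g)) (+-comm (g x) _) ⟩
 f x + (sumOver xs f + g x + sumOver xs g)   ≡⟨ cong (_+_ (f x)) (+-assoc (sumOver xs f) (g x) _) ⟩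
 f x + (sumOver xs f + (g x + sumOver xs g)) ≡⟨ sym (+-assoc (f x) (sumOver xs f) _) ⟩
 f x + sumOver xs f + (g x + sumOver xs g)   ∎
 where open ≡-Reasoning

sumOver-*ʳ : ∀ {A : Set} (xs : List A) (f : A → ℕ) c → sumOver xs (λ x → f x * c) ≡ sumOver xs f * c
sumOver-*ʳ []       f c = refl
sumOver-*ʳ (x ∷ xs) f c = trans (cong (_+_ (f x * c)) (sumOver-*ʳ xs f c)) (sym (*-distribʳ-+ c (f x) (sumOver xs f)))

sumOver-swap : ∀ {A B : Set} (xs : List A) (ys : List B) (f : A → B → ℕ) →
 sumOver xs (λ x → sumOver ys (f x)) ≡ sumOver ys (λ y → sumOver xs (λ x → f x y))
sumOver-swap []       ys f = sym (sumOver-zero ys)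
sumOver-swap (x ∷ xs) ys f = trans (cong (_+_ (sumOver ys (f x))) (sumOver-swap xs ys f)) (sym (sumOver-+ ys (f x) (λ y → sumOver xs (λ x → f x y))))

sumOver-++ : ∀ {A : Set} (xs ys : List A) (f : A → ℕ) → sumOver (xs ++ ys) f ≡ sumOver xs f + sumOver ys f
sumOver-++ []       ys f = refl
sumOver-++ (x ∷ xs) ys f = trans (cong (_+_ (f x)) (sumOver-++ xs ys f)) (sym (+-assoc (f x) _ _))

sumOver-map : ∀ {A B : Set} (g : A → B) xs (f : B → ℕ) → sumOver (List.map g xs) f ≡ sumOver xs (f ∘ g)
sumOver-map g []       f = refl
sumOver-map g (x ∷ xs) f = cong (_+_ (f (g x))) (sumOver-map g xs f)

sumOver-concatMap : ∀ {A B : Set} (g : A → List B) xs (f : B → ℕ) → sumOver (concatMap g xs) f ≡ sumOver xs (λ x → sumOver (g x) f)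
sumOver-concatMap g []       f = refl
sumOver-concatMap g (x ∷ xs) f = trans (sumOver-++ (g x) (concatMap g xs) f) (cong (_+_ (sumOver (g x) f)) (sumOver-concatMap g xs f))

countL-sumOver : ∀ {A : Set} (P : A → Bool) xs → countL P xs ≡ sumOver xs (indicator ∘ P)
countL-sumOver P []       = refl
countL-sumOver P (x ∷ xs) = cong (_+_ (indicator (P x))) (countL-sumOver P xs)

sumFin : ∀ n → (Fin n → ℕ) → ℕ
sumFin n = sumOver (allFin n)

sumOver-tabulate : ∀ {A : Set} n (g : Fin n → A) (f : A → ℕ) → sumOver (tabulate g) f ≡ sumFin n (f ∘ g)
sumOver-tabulate n g f = trans (go n g f) (sym (go n id (f ∘ g)))
 where
 go' : (n : ℕ) → (Fin n → ℕ) → ℕ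
 go' zero    f = 0
 go' (suc n) f = f zero + go' n (f ∘ suc)
 go : ∀ {A : Set} n (g : Fin n → A) (f : A → ℕ) → sumOver (tabulate g) f ≡ go' n (f ∘ g)
 go zero    g f = refl
 go (suc n) g f = cong (_+_ (f (g zero))) (go n (g ∘ suc) f)

sumFin-suc : ∀ n (f : Fin (suc n) → ℕ) → sumFin (suc n) f ≡ f zero + sumFin n (f ∘ suc)
sumFin-suc n f = cong (_+_ (f zero)) (sumOver-tabulate n suc f)

sumFin-δ : ∀ n (x : Fin n) (f : Fin n → ℕ) → sumFin n (λ y → indicator (x =ᶠ y) * f y) ≡ f x
sumFin-δ (suc n) zero f = begin
 sumFin (suc n) (λ y → indicator (zero =ᶠ y) * f y) ≡⟨ sumFin-suc n (λ y → indicator (zero =ᶠ y) * f y) ⟩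
 f zero + 0 + sumFin n (λ _ → 0) ≡⟨ cong₂ _+_ (+-identityʳ (f zero)) (sumOver-zero (allFin n)) ⟩
 f zero + 0 ≡⟨ +-identityʳ (f zero) ⟩
 f zero ∎
 where open ≡-Reasoning
sumFin-δ (suc n) (suc x) f = begin
 sumFin (suc n) (λ y → indicator (suc x =ᶠ y) * f y) ≡⟨ sumFin-suc n (λ y → indicator (suc x =ᶠ y) * f y) ⟩
 sumFin n (λ y → indicator (suc x =ᶠ suc y) * f (suc y)) ≡⟨ sumOver-cong (allFin n) (λ y → cong (λ b → indicator b * f (suc y)) (same y)) ⟩
 sumFin n (λ y → indicator (x =ᶠ y) * f (suc y)) ≡⟨ sumFin-δ n x (f ∘ suc) ⟩
 f (suc x) ∎
 where
 open ≡-Reasoning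
 same : ∀ y → (suc x =ᶠ suc y) ≡ (x =ᶠ y)
 same y = bool-iff (λ q → =ᶠ-true (suc-inj (=ᶠ-eq q))) (λ q → =ᶠ-true (cong suc (=ᶠ-eq q)))
  where
  suc-inj : ∀ {n} {a b : Fin n} → Fin.suc a ≡ suc b → a ≡ b
  suc-inj refl = refl

member : ∀ {n} → Fin n → List (Fin n) → Bool
member x []       = false
member x (y ∷ ys) = (x =ᶠ y) ∨ member x ys

member-sound : ∀ {n} {x : Fin n} ys → member x ys ≡ true → x ∈ ys
member-sound (y ∷ ys) q with ∨-split q
... | inj₁ r = here (=ᶠ-eq r)
... | inj₂ r = there (member-sound ys r)

member-complete : ∀ {n} {x : Fin n} {ys} → x ∈ ys → member x ys ≡ true
member-complete {x = x} (here refl) = ∨-left (=ᶠ-refl x)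
member-complete (there q)   = ∨-right (member-complete q)

member-false : ∀ {n} {x : Fin n} {ys} → ¬ (x ∈ ys) → member x ys ≡ false
member-false {ys = ys} q = ¬true⇒false (q ∘ member-sound ys)

sumFin-member : ∀ n (xs : List (Fin n)) → Unique xs → (f : Fin n → ℕ) → sumFin n (λ y → indicator (member y xs) * f y) ≡ sumOver xs f
sumFin-member n []       _       f = sumOver-zero (allFin n)
sumFin-member n (x ∷ xs) (x∉ ∷ u) f = begin
 sumFin n (λ y → indicator ((y =ᶠ x) ∨ member y xs) * f y) ≡⟨ sumOver-cong (allFin n) split ⟩
 sumFin n (λ y → indicator (x =ᶠ y) * f y + indicator (member y xs) * f y) ≡⟨ sumOver-+ (allFin n) _ _ ⟩
 sumFin n (λ y → indicator (x =ᶠ y) * f y) + sumFin n (λ y → indicator (member y xs) * f y) ≡⟨ cong₂ _+_ (sumFin-δ n x f) (sumFin-member n xs u f) ⟩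
 f x + sumOver xs f ∎
 where
 open ≡-Reasoning
 split : ∀ y → indicator ((y =ᶠ x) ∨ member y xs) * f y ≡ indicator (x =ᶠ y) * f y + indicator (member y xs) * f y
 split y with y Fin.≟ x | x Fin.≟ y
 ... | yes refl | yes _ rewrite member-false {x = y} {xs} (λ q → All.lookup x∉ q refl) = sym (+-identityʳ _)
 ... | yes refl | no q = ⊥-elim (q refl)
 ... | no q | yes refl = ⊥-elim (q refl)
 ... | no _ | no _ = refl

countF-sumFin : ∀ n P → countF n P ≡ sumFin n (indicator ∘ P)
countF-sumFin n P = countL-sumOver P (allFin n)

countF-cong : ∀ n {P Q : Fin n → Bool} → (∀ x → P x ≡ Q x) → countF n P ≡ countF n Q
countF-cong n {P} {Q} q = trans (countF-sumFin n P) (trans (sumOver-cong (allFin n) (λ x → cong indicator (q x))) (sym (countF-sumFin n Q)))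

countF-remove : ∀ n (P : Fin n → Bool) xs → Unique xs → (∀ {x} → x ∈ xs → P x ≡ true) →
 countF n P ≡ length xs + countF n (λ x → P x ∧ not (member x xs))
countF-remove n P xs u q = begin
 countF n P ≡⟨ countF-sumFin n P ⟩
 sumFin n (indicator ∘ P) ≡⟨ sumOver-cong (allFin n) split ⟩
 sumFin n (λ x → indicator (member x xs) * 1 + indicator (P x ∧ not (member x xs))) ≡⟨ sumOver-+ (allFin n) _ _ ⟩
 sumFin n (λ x → indicator (member x xs) * 1) + sumFin n (λ x → indicator (P x ∧ not (member x xs)))
  ≡⟨ cong₂ _+_ (trans (sumFin-member n xs u (λ _ → 1)) (trans (sumOver-const xs 1) (*-identityʳ _))) (sym (countF-sumFin n _)) ⟩
 length xs + countF n (λ x → P x ∧ not (member x xs)) ∎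
 where
 open ≡-Reasoning
 split : ∀ x → indicator (P x) ≡ indicator (member x xs) * 1 + indicator (P x ∧ not (member x xs))
 split x with member x xs in eq
 ... | true rewrite q (member-sound xs eq) = refl
 ... | false with P x
 ...   | true = refl
 ...   | false = refl

countF-positive : ∀ n {P : Fin n → Bool} x → P x ≡ true → ∃ λ k → countF n P ≡ suc k
countF-positive n {P} x q = _ , countF-remove n P (x ∷ []) ([] ∷ []) (λ { (here refl) → q })

countF-full : ∀ n → countF n (λ _ → true) ≡ n
countF-full n = trans (countF-sumFin n _) (trans (sumOver-const (allFin n) 1)
 (trans (*-identityʳ _) (Data.List.Properties.length-tabulate {n = n} id)))
 where import Data.List.Properties

countF-none : ∀ n {P : Fin n → Bool} → countF n P ≡ 0 → ∀ x → P x ≡ false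
countF-none n {P} q x with P x in eq
... | false = refl
... | true with countF-positive n {P} x eq
...   | k , r with trans (sym q) r
...     | ()

countF-empty : ∀ n {P : Fin n → Bool} → (∀ x → P x ≡ false) → countF n P ≡ 0
countF-empty n {P} q = trans (countF-cong n q) (trans (countF-sumFin n _) (sumOver-zero (allFin n)))

countF-witness : ∀ n {P : Fin n → Bool} k → countF n P ≡ suc k → ∃ λ x → P x ≡ true
countF-witness n {P} k q with anyF n P in eq
... | true = anyF-sound n eq
... | false with trans (sym q) (countF-empty n (λ x → ¬true⇒false (λ r → true≢false (anyF-complete n x r) eq)))
...   | ()

-- Counting equivalence classes by systems of representatives.

module _ {A : Set} {P : A → Set} where
 delete : ∀ {xs} → Any P xs → List A
 delete {_ ∷ xs} (here _)  = xs
 delete {x ∷ _}  (there a) = x ∷ delete a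

 found : ∀ {xs} → Any P xs → A
 found {x ∷ _} (here _)  = x
 found         (there a) = found a

 found-holds : ∀ {xs} (a : Any P xs) → P (found a)
 found-holds (here p)  = p
 found-holds (there a) = found-holds a

 length-delete : ∀ {xs} (a : Any P xs) → length xs ≡ suc (length (delete a))
 length-delete (here _)  = refl
 length-delete (there a) = cong suc (length-delete a)

 Any-delete : ∀ {Q : A → Set} {xs} (a : Any P xs) → ¬ Q (found a) → Any Q xs → Any Q (delete a)
 Any-delete (here _)  ¬q (here q)  = ⊥-elim (¬q q)
 Any-delete (here _)  ¬q (there b) = b
 Any-delete (there a) ¬q (here q)  = here q
 Any-delete (there a) ¬q (there b) = there (Any-delete a ¬q b)

 All-delete : ∀ {Q : A → Set} {xs} (a : Any P xs) → All Q xs → All Q (delete a)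
 All-delete (here _)  (_ ∷ qs) = qs
 All-delete (there a) (q ∷ qs) = q ∷ All-delete a qs

 All-found : ∀ {Q : A → Set} {xs} (a : Any P xs) → All Q xs → Q (found a)
 All-found (here _)  (q ∷ _)  = q
 All-found (there a) (_ ∷ qs) = All-found a qs

 AllPairs-delete : ∀ {R : A → A → Set} {xs} (a : Any P xs) → AllPairs R xs → AllPairs R (delete a)
 AllPairs-delete (here _)  (_ ∷ rs) = rs
 AllPairs-delete (there a) (r ∷ rs) = All-delete a r ∷ AllPairs-delete a rs

 AllPairs-found : ∀ {R : A → A → Set} {xs} → (∀ {x y} → R x y → R y x) → (a : Any P xs) → AllPairs R xs → All (R (found a)) (delete a)
 AllPairs-found sym (here _)  (r ∷ _)  = r
 AllPairs-found sym (there a) (r ∷ rs) = sym (All-found a r) ∷ AllPairs-found sym a rs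

module _ {A : Set} (E : A → A → Set)
     (E-sym : ∀ {x y} → E x y → E y x) (E-trans : ∀ {x y z} → E x y → E y z → E x z) where

 -- Each x uses up the element of `ys` that covers it: nothing unrelated to x can be covered by the
 -- same element, so the rest stays covered after deletion.
 unrelated≤covering : ∀ xs ys → AllPairs (λ x y → ¬ E x y) xs → All (λ x → Any (E x) ys) xs → length xs ≤ length ys
 unrelated≤covering []       ys _        _        = z≤n
 unrelated≤covering (x ∷ xs) ys (ns ∷ us) (a ∷ as) = subst (suc (length xs) ≤_) (sym (length-delete a))
   (s≤s (unrelated≤covering xs (delete a) us (go ns as)))
  where
  go : ∀ {xs} → All (λ y → ¬ E x y) xs → All (λ y → Any (E y) ys) xs → All (λ y → Any (E y) (delete a)) xs
  go []       []       = []
  go (n ∷ ns) (b ∷ bs) = Any-delete a (λ e → n (E-trans (found-holds a) (E-sym e))) b ∷ go ns bs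

-- The numbers of cycles and components are defined through minimal elements. Since the size of a
-- system of representatives is unique, they can be followed through gluings with any convenient
-- system.
record Reps {n} (E : Fin n → Fin n → Set) (k : ℕ) : Set where
 constructor mkReps
 field
  list      : List (Fin n)
  size      : length list ≡ k
  unrelated : AllPairs (λ x y → ¬ E x y) list
  covering  : ∀ x → Any (E x) list

module Equivalence {n} (E : Fin n → Fin n → Set) (E-refl : ∀ {x} → E x x)
          (E-sym : ∀ {x y} → E x y → E y x) (E-trans : ∀ {x y z} → E x y → E y z → E x z) where

 reps-unique : ∀ {k l} → Reps E k → Reps E l → k ≡ l
 reps-unique (mkReps xs refl u c) (mkReps ys refl v d) = ≤-antisym (unrelated≤covering E E-sym E-trans xs ys u (All.universal d xs))
       (unrelated≤covering E E-sym E-trans ys xs v (All.universal c ys))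

 minimalReps : (b : Fin n → Bool) → (∀ {x y} → b x ≡ true → b y ≡ true → E x y → x ≡ y) → (∀ x → b x ≡ false → ∃ λ y → toℕ y < toℕ x × E x y) →
  Reps E (countF n b)
 minimalReps b injective descend = mkReps minimals (sym (len (allFin n)))
   (unrel (UniqueP.filter⁺ (T? ∘ b) (UniqueP.allFin⁺ n)) (All.tabulate (λ q → Tb (proj₂ (∈-filter⁻ (T? ∘ b) {xs = allFin n} q)))))
   (λ x → cover x (<-wellFounded (toℕ x)))
  where
  minimals : List (Fin n)
  minimals = filter (T? ∘ b) (allFin n)
  Tb : ∀ {x} → T (b x) → b x ≡ true
  Tb {x} t with b x
  ... | true = refl
  bT : ∀ {x} → b x ≡ true → T (b x)
  bT q = subst T (sym q) _
  len : ∀ xs → countL b xs ≡ length (filter (T? ∘ b) xs)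
  len []       = refl
  len (x ∷ xs) with b x
  ... | true  = cong suc (len xs)
  ... | false = len xs
  unrel : ∀ {xs} → Unique xs → All (λ x → b x ≡ true) xs → AllPairs (λ x y → ¬ E x y) xs
  unrel []       []       = []
  unrel (x∉ ∷ u) (bx ∷ bs) = go x∉ bs ∷ unrel u bs
   where
   go : ∀ {ys} → All (_ ≢_) ys → All (λ x → b x ≡ true) ys → All (λ y → ¬ E _ y) ys
   go []       []       = []
   go (ne ∷ n) (q ∷ qs) = (λ e → ne (injective bx q e)) ∷ go n qs
  cover : ∀ x → Acc _<_ (toℕ x) → Any (E x) minimals
  cover x (acc rs) with b x in eq
  ... | true = Any.map (λ { refl → E-refl }) (∈-filter⁺ (T? ∘ b) (∈-allFin x) (bT eq))
  ... | false with descend x eq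
  ...   | y , y<x , e = Any.map (E-trans e) (cover y (rs y<x))

≤ᵇ-sound : ∀ {a b} → (a ≤ᵇ b) ≡ true → a ≤ b
≤ᵇ-sound {a} {b} q = ≤ᵇ⇒≤ a b (subst T (sym q) _)

≤ᵇ-false : ∀ {a b} → (a ≤ᵇ b) ≡ false → b < a
≤ᵇ-false {a} {b} q = ≰⇒> (λ l → subst T q (≤⇒≤ᵇ l))

-- Reachability by paths.

data Path {n} (adj : Fin n → Fin n → Bool) (x : Fin n) : Fin n → Set where
 stop : Path adj x x
 step : ∀ {y z} → Path adj x y → adj y z ≡ true → Path adj x z

module _ {n} {adj : Fin n → Fin n → Bool} where

 path-trans : ∀ {x y z} → Path adj x y → Path adj y z → Path adj x z
 path-trans p stop       = p
 path-trans p (step q e) = step (path-trans p q) e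

 path-sym : (∀ {x y} → adj x y ≡ true → Path adj y x) → ∀ {x y} → Path adj x y → Path adj y x
 path-sym back stop       = stop
 path-sym back (step p e) = path-trans (back e) (path-sym back p)

 path-invariant : ∀ {A : Set} (f : Fin n → A) → (∀ {x y} → adj x y ≡ true → f y ≡ f x) → ∀ {x y} → Path adj x y → f y ≡ f x
 path-invariant f inv stop       = refl
 path-invariant f inv (step p e) = trans (inv e) (path-invariant f inv p)

 path-closed : (P : Fin n → Set) → (∀ {x y} → adj x y ≡ true → P x → P y) → ∀ {x y} → Path adj x y → P x → P y
 path-closed P cl stop       px = px
 path-closed P cl (step p e) px = cl e (path-closed P cl p px)

 private
  expand : (Fin n → Bool) → Fin n → Bool
  expand S h = S h ∨ anyF n (λ g → S g ∧ adj g h)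

 closure-sound : ∀ k S h → closure adj k S h ≡ true → ∃ λ g → S g ≡ true × Path adj g h
 closure-sound zero    S h q = h , q , stop
 closure-sound (suc k) S h q with closure-sound k (expand S) h q
 ... | g , r , p with ∨-split {S g} r
 ...   | inj₁ s = g , s , p
 ...   | inj₂ s with anyF-sound n s
 ...     | f , t = f , proj₁ (∧-split t) , path-trans (step stop (proj₂ (∧-split {S f} t))) p

 reach-sound : ∀ {g h} → reach adj g h ≡ true → Path adj g h
 reach-sound {g} {h} q with closure-sound n _ h q
 ... | x , r , p rewrite =ᶠ-eq {g = x} {g} r = p

 private
  Closed : (Fin n → Bool) → Set
  Closed S = ∀ {g h} → S g ≡ true → adj g h ≡ true → S h ≡ true

  closure-⊇ : ∀ k S h → S h ≡ true → closure adj k S h ≡ true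
  closure-⊇ zero    S h q = q
  closure-⊇ (suc k) S h q = closure-⊇ k (expand S) h (∨-left q)

  closed-closure : ∀ k S → (∀ h → expand S h ≡ S h) → Closed (closure adj k S)
  closed-closure zero    S fix {g} {h} q e = trans (sym (fix h)) (∨-right {S h} (anyF-complete n g (∧-join q e)))
  closed-closure (suc k) S fix = closed-closure k (expand S) expand-fix
   where
   anyF-cong : ∀ m {P Q : Fin m → Bool} → (∀ i → P i ≡ Q i) → anyF m P ≡ anyF m Q
   anyF-cong zero    q = refl
   anyF-cong (suc m) q = cong₂ _∨_ (q zero) (anyF-cong m (q ∘ suc))
   expand-fix : ∀ h → expand (expand S) h ≡ expand S h
   expand-fix h = cong₂ _∨_ (fix h) (anyF-cong n (λ g → cong (_∧ adj g h) (fix g)))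

  countF-< : (P Q : Fin n → Bool) → (∀ x → P x ≡ true → Q x ≡ true) → ∀ y → P y ≡ false → Q y ≡ true → countF n P < countF n Q
  countF-< P Q P⊆Q y py qy = subst (countF n P <_) (sym (countF-remove n Q (y ∷ []) ([] ∷ []) (λ { (here refl) → qy })))
   (s≤s (subst₂ _≤_ (sym (countF-sumFin n P)) (sym (countF-sumFin n _)) (go (allFin n))))
   where
   le : ∀ x → indicator (P x) ≤ indicator (Q x ∧ not (member x (y ∷ [])))
   le x with P x in eq
   ... | false = z≤n
   ... | true rewrite P⊆Q x eq | member-false {x = x} {y ∷ []} (λ { (here refl) → true≢false eq py }) = ≤-refl
   go : ∀ xs → sumOver xs (indicator ∘ P) ≤ sumOver xs (λ x → indicator (Q x ∧ not (member x (y ∷ []))))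
   go []       = z≤n
   go (x ∷ xs) = +-mono-≤ (le x) (go xs)

  -- A round that is not yet stable adds at least one element, so as many rounds as there are
  -- missing elements suffice.
  saturate : ∀ k S → n ≤ countF n S + k → Closed (closure adj k S)
  saturate k S bound with allF n (λ h → not (expand S h) ∨ S h) in eq
  ... | true  = closed-closure k S (λ h → bool-iff (implies-split (allF-sound n eq h)) ∨-left)
  ... | false with allF-witness n {λ h → not (expand S h) ∨ S h} eq
  ...   | h , r = grow k bound (implies-false {expand S h} r)
   where
   grow : ∀ k → n ≤ countF n S + k → expand S h ≡ true × S h ≡ false → Closed (closure adj k S)
   grow zero bound (eqE , eqS) = ⊥-elim (<⇒≱ (countF-< S (λ _ → true) (λ _ _ → refl) h eqS refl)
     (subst₂ _≤_ (sym (countF-full n)) (+-identityʳ _) bound))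
   grow (suc k) bound (eqE , eqS) = saturate k (expand S) (≤-trans bound (subst (_≤ countF n (expand S) + k) (sym (+-suc (countF n S) k))
     (+-monoˡ-≤ k (countF-< S (expand S) (λ _ → ∨-left) h eqS eqE))))

 reach-complete : ∀ {g h} → Path adj g h → reach adj g h ≡ true
 reach-complete {g} p = path-closed (λ x → reach adj g x ≡ true) (λ e q → saturate n _ (m≤n+m n _) q e) p (closure-⊇ n _ g (=ᶠ-refl g))

path-map : ∀ {n} {adj adj' : Fin n → Fin n → Bool} → (∀ {x y} → adj x y ≡ true → Path adj' x y) → ∀ {x y} → Path adj x y → Path adj' x y
path-map f stop       = stop
path-map f (step p e) = path-trans (path-map f p) (f e)

-- Orbits and cycles of permutations.

Inj : ∀ {n} → (Fin n → Fin n) → Set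
Inj π = ∀ {x y} → π x ≡ π y → x ≡ y

least : (P : ℕ → Set) → (∀ k → Dec (P k)) → ∀ k → P k → ∃ λ m → P m × (∀ j → j < m → ¬ P j)
least P P? k pk with P? 0
... | yes p = 0 , p , λ _ ()
least P P? zero    pk | no ¬p = ⊥-elim (¬p pk)
least P P? (suc k) pk | no ¬p with least (P ∘ suc) (P? ∘ suc) k pk
... | m , pm , below = suc m , pm , λ { zero _ → ¬p ; (suc j) (s≤s l) → below j l }

module _ {n} (π : Fin n → Fin n) where

 iter-+ : ∀ a b x → iter π (a + b) x ≡ iter π a (iter π b x)
 iter-+ zero    b x = refl
 iter-+ (suc a) b x = cong π (iter-+ a b x)

 iter-comm : ∀ k x → iter π k (π x) ≡ π (iter π k x)
 iter-comm zero    x = refl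
 iter-comm (suc k) x = cong π (iter-comm k x)

 iter-fixed : ∀ d x → iter π d x ≡ x → ∀ k → iter π (k * d) x ≡ x
 iter-fixed d x q zero    = refl
 iter-fixed d x q (suc k) = trans (iter-+ d (k * d) x) (trans (cong (iter π d) (iter-fixed d x q k)) q)

 Orb : Fin n → Fin n → Set
 Orb x y = ∃ λ k → iter π k x ≡ y

 orb-refl : ∀ {x} → Orb x x
 orb-refl = 0 , refl

 orb-step : ∀ {x y} → Orb x y → Orb x (π y)
 orb-step (k , refl) = suc k , refl

 orb-trans : ∀ {x y z} → Orb x y → Orb y z → Orb x z
 orb-trans {x} (k , refl) (l , refl) = l + k , iter-+ l k x

 orb-closed : (P : Fin n → Set) → (∀ {x} → P x → P (π x)) → ∀ {x y} → Orb x y → P x → P y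
 orb-closed P cl (zero  , refl) px = px
 orb-closed P cl (suc k , refl) px = cl (orb-closed P cl (k , refl) px)

 module _ (inj : Inj π) where

  iter-inj : ∀ k {x y} → iter π k x ≡ iter π k y → x ≡ y
  iter-inj zero    q = q
  iter-inj (suc k) q = iter-inj k (inj q)

  period : ∀ x → ∃ λ d → iter π (suc d) x ≡ x × suc d ≤ n
  period x with pigeonhole (n<1+n n) (λ (i : Fin (suc n)) → iter π (toℕ i) x)
  ... | i , j , i<j , q = extract (toℕ j ∸ toℕ i) refl
   where
   back : iter π (toℕ j ∸ toℕ i) x ≡ x
   back = iter-inj (toℕ i) (trans (sym (iter-+ (toℕ i) (toℕ j ∸ toℕ i) x)) (trans (cong (λ k → iter π k x) (m+[n∸m]≡n (<⇒≤ i<j))) (sym q)))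
   extract : ∀ d → d ≡ toℕ j ∸ toℕ i → ∃ λ d → iter π (suc d) x ≡ x × suc d ≤ n
   extract zero    e = ⊥-elim (<-irrefl e (m<n⇒0<n∸m i<j))
   extract (suc d) e = d , trans (cong (λ k → iter π k x) e) back , subst (_≤ n) (sym e) (≤-trans (m∸n≤m (toℕ j) (toℕ i)) (≤-pred (toℕ<n j)))

  orb-sym : ∀ {x y} → Orb x y → Orb y x
  orb-sym {x} (k , refl) with period x
  ... | d , q , _ = k * suc d ∸ k , trans (sym (iter-+ (k * suc d ∸ k) k x))
    (trans (cong (λ m → iter π m x) (m∸n+n≡m (m≤m*n k (suc d)))) (iter-fixed (suc d) x q k))

  orb-bounded : ∀ {x y} → Orb x y → ∃ λ k → k < n × iter π k x ≡ y
  orb-bounded {x} (k , refl) with period x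
  ... | d , q , l = k % suc d , <-≤-trans (m%n<n k (suc d)) l , sym (begin
   iter π k x ≡⟨ cong (λ m → iter π m x) (m≡m%n+[m/n]*n k (suc d)) ⟩
   iter π (k % suc d + k / suc d * suc d) x ≡⟨ iter-+ (k % suc d) (k / suc d * suc d) x ⟩
   iter π (k % suc d) (iter π (k / suc d * suc d) x) ≡⟨ cong (iter π (k % suc d)) (iter-fixed (suc d) x q (k / suc d)) ⟩
   iter π (k % suc d) x ∎)
   where open ≡-Reasoning

  orb? : ∀ x y → Dec (Orb x y)
  orb? x y with anyF n (λ k → iter π (toℕ k) x =ᶠ y) in eq
  ... | true  = yes (let k , q = anyF-sound n {λ k → iter π (toℕ k) x =ᶠ y} eq in toℕ k , =ᶠ-eq q)
  ... | false = no λ o → let k , l , q = orb-bounded o in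
   true≢false (anyF-complete n {λ k → iter π (toℕ k) x =ᶠ y} (Fin.fromℕ< l)
    (=ᶠ-true (trans (cong (λ m → iter π m x) (Data.Fin.Properties.toℕ-fromℕ< l)) q))) eq
   where import Data.Fin.Properties

  cycReps : Reps Orb (numCycles π)
  cycReps = minimalReps _ minimal descend
   where
   open Equivalence Orb orb-refl orb-sym orb-trans
   least-in-orbit : ∀ {x y} → allL (λ j → toℕ x ≤ᵇ toℕ (iter π j x)) (upTo n) ≡ true → Orb x y → toℕ x ≤ toℕ y
   least-in-orbit {x} q o with orb-bounded o
   ... | k , l , refl = ≤ᵇ-sound (allL-upTo-sound {λ j → toℕ x ≤ᵇ toℕ (iter π j x)} n q k l)
   minimal : ∀ {x y} → allL (λ j → toℕ x ≤ᵇ toℕ (iter π j x)) (upTo n) ≡ true →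
    allL (λ j → toℕ y ≤ᵇ toℕ (iter π j y)) (upTo n) ≡ true → Orb x y → x ≡ y
   minimal bx by o = toℕ-injective (≤-antisym (least-in-orbit bx o) (least-in-orbit by (orb-sym o)))
   descend : ∀ x → allL (λ j → toℕ x ≤ᵇ toℕ (iter π j x)) (upTo n) ≡ false → ∃ λ y → toℕ y < toℕ x × Orb x y
   descend x q with allL-upTo-witness {λ j → toℕ x ≤ᵇ toℕ (iter π j x)} n q
   ... | j , _ , r = iter π j x , ≤ᵇ-false r , (j , refl)

  numCycles-reps : ∀ {k} → Reps Orb k → numCycles π ≡ k
  numCycles-reps = Equivalence.reps-unique Orb orb-refl orb-sym orb-trans cycReps

orb-map : ∀ {n} {π π' : Fin n → Fin n} → (∀ x → π x ≡ π' x) → ∀ {x y} → Orb π x y → Orb π' x y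
orb-map {π = π} {π'} q {x} (k , refl) = k , sym (go k)
 where
 go : ∀ k → iter π k x ≡ iter π' k x
 go zero    = refl
 go (suc k) = trans (q _) (cong π' (go k))

numCycles-cong : ∀ {n} {π π' : Fin n → Fin n} → Inj π → (∀ x → π x ≡ π' x) → numCycles π ≡ numCycles π'
numCycles-cong {π = π} {π'} inj q with cycReps π inj
... | mkReps xs s u c = sym (numCycles-reps π' (λ e → inj (trans (q _) (trans e (sym (q _)))))
 (mkReps xs s (mapU u) (λ x → Any.map (orb-map q) (c x))))
 where
 mapU : ∀ {ys} → AllPairs (λ x y → ¬ Orb π x y) ys → AllPairs (λ x y → ¬ Orb π' x y) ys
 mapU []       = []
 mapU (r ∷ rs) = All.map (_∘ orb-map (λ x → sym (q x))) r ∷ mapU rs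

-- Effect of exchanging two values on the number of cycles.

record Twist {n} (φ φ' : Fin n → Fin n) (h g : Fin n) : Set where
 constructor twist
 field
  h≢g   : h ≢ g
  at-h  : φ' h ≡ φ g
  at-g  : φ' g ≡ φ h
  other : ∀ {x} → x ≢ h → x ≢ g → φ' x ≡ φ x

twist-inverse : ∀ {n} {φ φ' : Fin n → Fin n} {h g} → Twist φ φ' h g → Twist φ' φ h g
twist-inverse (twist ne a b o) = twist ne (sym b) (sym a) (λ x y → sym (o x y))

module _ {n} {φ φ' : Fin n → Fin n} {h g : Fin n} (inj : Inj φ) (inj' : Inj φ') where

 private
  -- The φ-cycle of g, started at φ g, is traversed by φ' from h without meeting h or g.
  follow : Twist φ φ' h g → ∀ m → iter φ (suc m) g ≡ g → (∀ j → j < m → iter φ (suc j) g ≢ g) →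
   (∀ j → j ≤ m → iter φ (suc j) g ≢ h) → iter φ' (suc m) h ≡ g
  follow (twist ne a b o) m back below avoid = trans (go m ≤-refl) back
   where
   go : ∀ i → i ≤ m → iter φ' (suc i) h ≡ iter φ (suc i) g
   go zero    _ = a
   go (suc i) l = trans (cong φ' (go i (<⇒≤ l))) (o (avoid i (<⇒≤ l)) (below i l))

 merged : Twist φ φ' h g → ¬ Orb φ h g → Orb φ' h g
 merged t ¬o with period φ inj g
 ... | d , q , _ with least (λ k → iter φ (suc k) g ≡ g) (λ k → iter φ (suc k) g Fin.≟ g) d q
 ...   | m , back , below = suc m , follow t m back below (λ j _ e → ¬o (orb-sym φ inj (suc j , e)))

 separated : Twist φ φ' h g → Orb φ h g → ¬ Orb φ' h g
 separated (twist ne a b o) (zero , e) _ = ne e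
 separated (twist ne a b o) (suc k , e) o' with least (λ k → iter φ (suc k) h ≡ g) (λ k → iter φ (suc k) h Fin.≟ g) k e
 ... | m , hit , below = arc-avoids (orb-closed φ' Arc closed (orb-sym φ' inj' o') (m , ≤-refl , hit))
  where
  -- The part of the φ-cycle after h up to g is closed under φ'.
  Arc : Fin n → Set
  Arc x = ∃ λ i → i ≤ m × iter φ (suc i) h ≡ x
  arc-avoids : ¬ Arc h
  arc-avoids (i , l , q) with m≤n⇒m<n∨m≡n l
  ... | inj₂ refl = ne (trans (sym q) hit)
  ... | inj₁ i<m = below (m ∸ suc i) (∸-monoʳ-< {m} {suc i} {0} (s≤s z≤n) i<m) (begin
   iter φ (suc (m ∸ suc i)) h ≡⟨ cong (iter φ (suc (m ∸ suc i))) (sym q) ⟩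
   iter φ (suc (m ∸ suc i)) (iter φ (suc i) h) ≡⟨ sym (iter-+ φ (suc (m ∸ suc i)) (suc i) h) ⟩
   iter φ (suc (m ∸ suc i) + suc i) h ≡⟨ cong (λ k → iter φ (suc k) h) (m∸n+n≡m i<m) ⟩
   iter φ (suc m) h ≡⟨ hit ⟩
   g ∎)
   where open ≡-Reasoning
  closed : ∀ {x} → Arc x → Arc (φ' x)
  closed {x} (i , l , q) with x Fin.≟ g
  ... | yes refl = 0 , z≤n , sym b
  ... | no x≢g with m≤n⇒m<n∨m≡n l
  ...   | inj₂ refl = ⊥-elim (x≢g (trans (sym q) hit))
  ...   | inj₁ i<m = suc i , i<m , trans (cong φ q) (sym (o (λ { refl → arc-avoids (i , l , q) }) x≢g))

module _ {n} {φ φ' : Fin n → Fin n} {h g : Fin n} (inj : Inj φ) (inj' : Inj φ') where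

 -- The representative of the class of g is dropped, and the one of h then stands for both classes.
 -- `origin` shows that nothing else is lost: a relation that is new for φ' connects two members of
 -- the two old classes.
 numCycles-merge : Twist φ φ' h g → ¬ Orb φ h g → numCycles φ ≡ suc (numCycles φ')
 numCycles-merge t@(twist ne a b o) ¬o with cycReps φ inj
 ... | mkReps L size unrel cov = trans (sym size) (trans (length-delete ag) (cong suc (sym (numCycles-reps φ' inj' (mkReps L' refl unrel' cov')))))
  where
  ag = cov g
  L' = delete ag
  ρg = found ag
  g~ρg : Orb φ g ρg
  g~ρg = found-holds ag
  hg' : Orb φ' h g
  hg' = merged inj inj' t ¬o
  gh' : Orb φ' g h
  gh' = orb-sym φ' inj' hg'
  keep : ∀ {x y} → Orb φ x y → Orb φ' x y
  keep (zero , refl) = orb-refl φ'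
  keep {x} (suc k , refl) with keep {x} (k , refl) | iter φ k x Fin.≟ h | iter φ k x Fin.≟ g
  ... | p | yes e | _ rewrite e = orb-trans φ' (orb-trans φ' p hg') (1 , b)
  ... | p | no _ | yes e rewrite e = orb-trans φ' (orb-trans φ' p gh') (1 , a)
  ... | p | no u | no v = orb-trans φ' p (1 , o u v)
  C : Fin n → Set
  C x = Orb φ h x ⊎ Orb φ g x
  C-back : ∀ {x y} → Orb φ x y → C y → C x
  C-back p (inj₁ q) = inj₁ (orb-trans φ q (orb-sym φ inj p))
  C-back p (inj₂ q) = inj₂ (orb-trans φ q (orb-sym φ inj p))
  origin : ∀ {x y} → Orb φ' x y → Orb φ x y ⊎ (C x × C y)
  origin (zero , refl) = inj₁ (orb-refl φ)
  origin {x} (suc k , refl) with origin {x} (k , refl) | iter φ' k x Fin.≟ h | iter φ' k x Fin.≟ g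
  ... | inj₁ p | yes e | _ rewrite e = inj₂ (C-back p (inj₁ (orb-refl φ)) , inj₂ (subst (Orb φ g) (sym a) (1 , refl)))
  ... | inj₂ (c , _) | yes e | _ rewrite e = inj₂ (c , inj₂ (subst (Orb φ g) (sym a) (1 , refl)))
  ... | inj₁ p | no _ | yes e rewrite e = inj₂ (C-back p (inj₂ (orb-refl φ)) , inj₁ (subst (Orb φ h) (sym b) (1 , refl)))
  ... | inj₂ (c , _) | no _ | yes e rewrite e = inj₂ (c , inj₁ (subst (Orb φ h) (sym b) (1 , refl)))
  ... | inj₁ p | no u | no v rewrite o u v = inj₁ (orb-step φ p)
  ... | inj₂ (c , inj₁ q) | no u | no v rewrite o u v = inj₂ (c , inj₁ (orb-step φ q))
  ... | inj₂ (c , inj₂ q) | no u | no v rewrite o u v = inj₂ (c , inj₂ (orb-step φ q))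
  notg : All (λ y → ¬ Orb φ g y) L'
  notg = All.map (λ n q → n (orb-trans φ (orb-sym φ inj g~ρg) q)) (AllPairs-found (λ n e → n (orb-sym φ inj e)) ag unrel)
  unrel' : AllPairs (λ x y → ¬ Orb φ' x y) L'
  unrel' = go (AllPairs-delete ag unrel) notg
   where
   pair : ∀ {x y} → ¬ Orb φ x y → ¬ Orb φ g x → ¬ Orb φ g y → ¬ Orb φ' x y
   pair n u v q with origin q
   ... | inj₁ p = n p
   ... | inj₂ (inj₂ c , _) = u c
   ... | inj₂ (_ , inj₂ c) = v c
   ... | inj₂ (inj₁ c , inj₁ d) = n (orb-trans φ (orb-sym φ inj c) d)
   row : ∀ {x xs} → All (λ y → ¬ Orb φ x y) xs → ¬ Orb φ g x → All (λ y → ¬ Orb φ g y) xs → All (λ y → ¬ Orb φ' x y) xs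
   row []       u []       = []
   row (n ∷ ns) u (v ∷ vs) = pair n u v ∷ row ns u vs
   go : ∀ {xs} → AllPairs (λ x y → ¬ Orb φ x y) xs → All (λ y → ¬ Orb φ g y) xs → AllPairs (λ x y → ¬ Orb φ' x y) xs
   go []       []       = []
   go (r ∷ rs) (u ∷ us) = row r u us ∷ go rs us
  near-h : Any (Orb φ h) L'
  near-h = Any-delete ag (λ q → ¬o (orb-trans φ q (orb-sym φ inj g~ρg))) (cov h)
  cov' : ∀ x → Any (Orb φ' x) L'
  cov' x with orb? φ inj x g
  ... | yes p = Any.map (λ q → orb-trans φ' (keep p) (orb-trans φ' gh' (keep q))) near-h
  ... | no ¬p = Any.map keep (Any-delete ag (λ q → ¬p (orb-trans φ q (orb-sym φ inj g~ρg))) (cov x))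

module _ {n} {φ φ' : Fin n → Fin n} {h g : Fin n} (inj : Inj φ) (inj' : Inj φ') where

 numCycles-split : Twist φ φ' h g → Orb φ h g → numCycles φ' ≡ suc (numCycles φ)
 numCycles-split t o = numCycles-merge inj' inj (twist-inverse t) (separated inj inj' t o)

 numCycles-≤ : Twist φ φ' h g → numCycles φ' ≤ suc (numCycles φ)
 numCycles-≤ t with orb? φ inj h g
 ... | yes o = ≤-reflexive (numCycles-split t o)
 ... | no ¬o = ≤-trans (n≤1+n _) (≤-trans (≤-reflexive (sym (numCycles-merge inj inj' t ¬o))) (n≤1+n _))

-- Sums over all functions.

Enumerates : {X : Set} → List X → ((x y : X) → Dec (x ≡ y)) → Set
Enumerates {X} xs _≟_ = ∀ (x : X) (G : X → ℕ) → sumOver xs (λ y → indicator ⌊ x ≟ y ⌋ * G y) ≡ G x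

module _ {X : Set} (xs : List X) (_≟_ : (x y : X) → Dec (x ≡ y)) (enum : Enumerates xs _≟_) where

 sumOver-fibres : ∀ {A : Set} (L : List A) (f : A → X) (Q : A → ℕ) → sumOver L Q ≡ sumOver xs (λ y → sumOver L (λ a → indicator ⌊ f a ≟ y ⌋ * Q a))
 sumOver-fibres L f Q = trans (sumOver-cong L (λ a → sym (enum (f a) (λ _ → Q a)))) (sumOver-swap L xs (λ a y → indicator ⌊ f a ≟ y ⌋ * Q a))

 -- Without function extensionality c itself need not occur in the list. A function f with the same
 -- values does, and a sum supported on functions with these values reduces to its term at f.
 funs-point : ∀ k (c : Fin k → X) → Σ (Fin k → X) λ f → (∀ i → f i ≡ c i) ×
  (∀ (G : (Fin k → X) → ℕ) → (∀ g i → g i ≢ c i → G g ≡ 0) → sumOver (funs k xs) G ≡ G f)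
 funs-point zero    c = (λ ()) , (λ ()) , λ G _ → +-identityʳ _
 funs-point (suc k) c with funs-point k (c ∘ suc)
 ... | f , f≗ , pick = c zero VF.∷ f , (λ { zero → refl ; (suc i) → f≗ i }) , λ G supp → begin
  sumOver (concatMap (λ x → List.map (λ g → x VF.∷ g) (funs k xs)) xs) G ≡⟨ sumOver-concatMap _ xs G ⟩
  sumOver xs (λ x → sumOver (List.map (λ g → x VF.∷ g) (funs k xs)) G) ≡⟨ sumOver-cong xs (λ x → sumOver-map _ (funs k xs) G) ⟩
  sumOver xs (λ x → sumOver (funs k xs) (λ g → G (x VF.∷ g))) ≡⟨ sumOver-cong xs (row G supp) ⟩
  sumOver xs (λ x → indicator ⌊ c zero ≟ x ⌋ * G (x VF.∷ f)) ≡⟨ enum (c zero) (λ x → G (x VF.∷ f)) ⟩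
  G (c zero VF.∷ f) ∎
  where
  open ≡-Reasoning
  row : ∀ G → (∀ g i → g i ≢ c i → G g ≡ 0) → ∀ x → sumOver (funs k xs) (λ g → G (x VF.∷ g)) ≡ indicator ⌊ c zero ≟ x ⌋ * G (x VF.∷ f)
  row G supp x with c zero ≟ x
  ... | yes refl = trans (pick (λ g → G (x VF.∷ g)) (λ g i ne → supp (x VF.∷ g) (suc i) ne)) (sym (*-identityˡ _))
  ... | no ne = trans (sumOver-cong (funs k xs) (λ g → supp (x VF.∷ g) zero (ne ∘ sym))) (sumOver-zero (funs k xs))

bools : List Bool
bools = false ∷ true ∷ []

enumBool : Enumerates bools Bool._≟_
enumBool false G = trans (+-identityʳ _) (+-identityʳ _)
enumBool true  G = trans (+-identityʳ _) (+-identityʳ _)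

module _ {n : ℕ} where

 private
  αs = funs n (allFin n)
  Ss = funs n bools

 total : ((Fin n → Fin n) → (Fin n → Bool) → Bool) → ℕ
 total Q = sumOver αs (λ α → sumOver Ss (λ S → indicator (Q α S)))

 total-cong : ∀ {Q Q'} → (∀ α S → Q α S ≡ Q' α S) → total Q ≡ total Q'
 total-cong q = sumOver-cong αs (λ α → sumOver-cong Ss (λ S → cong indicator (q α S)))

 total-zero : ∀ {Q} → (∀ α S → Q α S ≡ true → ⊥) → total Q ≡ 0
 total-zero q = trans (total-cong (λ α S → ¬true⇒false (q α S))) (trans (sumOver-cong αs (λ _ → sumOver-zero Ss)) (sumOver-zero αs))

 total-split-S : ∀ h Q → total Q ≡ total (λ α S → S h ∧ Q α S) + total (λ α S → not (S h) ∧ Q α S)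
 total-split-S h Q = trans (sumOver-cong αs (λ α → trans (sumOver-cong Ss (λ S → split (S h) (Q α S))) (sumOver-+ Ss _ _))) (sumOver-+ αs _ _)
  where
  split : ∀ a b → indicator b ≡ indicator (a ∧ b) + indicator (not a ∧ b)
  split true  b = sym (+-identityʳ _)
  split false b = refl

 total-split-α : ∀ h Q → total Q ≡ sumFin n (λ g → total (λ α S → (α h =ᶠ g) ∧ Q α S))
 total-split-α h Q = trans (sumOver-fibres (allFin n) Fin._≟_ (sumFin-δ n) αs (λ α → α h) _) (sumOver-cong (allFin n) (λ g → sumOver-cong αs (λ α →
   trans (trans (*-comm (indicator (α h =ᶠ g)) _) (sym (sumOver-*ʳ Ss _ (indicator (α h =ᶠ g)))))
    (sumOver-cong Ss (λ S → mul (Q α S) (α h =ᶠ g))))))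
  where
  mul : ∀ a b → indicator a * indicator b ≡ indicator (b ∧ a)
  mul true  true  = refl
  mul true  false = refl
  mul false true  = refl
  mul false false = refl

 total-point : ∀ (α₀ : Fin n → Fin n) (S₀ : Fin n → Bool) → Σ (Fin n → Fin n) λ α → Σ (Fin n → Bool) λ S → (∀ x → α x ≡ α₀ x) × (∀ x → S x ≡ S₀ x) ×
  (∀ Q → (∀ α S → Q α S ≡ true → (∀ x → α x ≡ α₀ x) × (∀ x → S x ≡ S₀ x)) → total Q ≡ indicator (Q α S))
 total-point α₀ S₀ with funs-point (allFin n) Fin._≟_ (sumFin-δ n) n α₀ | funs-point bools Bool._≟_ enumBool n S₀
 ... | α , α≗ , pickα | S , S≗ , pickS = α , S , α≗ , S≗ , λ Q supp → trans (sumOver-cong αs (λ α' → pickS (λ S' → indicator (Q α' S'))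
      (λ S' i ne → cong indicator (¬true⇒false (λ t → ne (proj₂ (supp α' S' t) i)))))) (pickα (λ α' → indicator (Q α' S))
      (λ α' i ne → cong indicator (¬true⇒false (λ t → ne (proj₁ (supp α' S t) i)))))

-- Gluing two open half-edges, and discovering a vertex.

Involutive : ∀ {n} → (Fin n → Fin n) → Set
Involutive α = ∀ x → α (α x) ≡ x

involutive⇒inj : ∀ {n} {α : Fin n → Fin n} → Involutive α → Inj α
involutive⇒inj {α = α} inv {x} {y} q = trans (sym (inv x)) (trans (cong α q) (inv y))

match : ∀ {n} → (Fin n → Fin n) → Fin n → Fin n → Fin n → Fin n
match α h g x = if x =ᶠ h then g else if x =ᶠ g then h else α x

module _ {n} (α : Fin n → Fin n) (h g : Fin n) where

 match-h : match α h g h ≡ g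
 match-h rewrite =ᶠ-refl h = refl

 match-g : match α h g g ≡ h
 match-g with g =ᶠ h in eq
 ... | true  = =ᶠ-eq eq
 ... | false rewrite =ᶠ-refl g = refl

 match-other : ∀ {x} → x ≢ h → x ≢ g → match α h g x ≡ α x
 match-other u v rewrite =ᶠ-false u | =ᶠ-false v = refl

 data MatchView (x : Fin n) : Set where
  is-h  : x ≡ h → match α h g x ≡ g → MatchView x
  is-g  : x ≡ g → match α h g x ≡ h → MatchView x
  is-other : x ≢ h → x ≢ g → match α h g x ≡ α x → MatchView x

 matchView : ∀ x → MatchView x
 matchView x with x Fin.≟ h | x Fin.≟ g
 ... | yes refl | _ = is-h refl match-h
 ... | no _ | yes refl = is-g refl match-g
 ... | no u | no v = is-other u v (match-other u v)

module Match {n} {α : Fin n → Fin n} (inv : Involutive α) {h g : Fin n}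
       (αh : α h ≡ h) (αg : α g ≡ g) (h≢g : h ≢ g) where

 matchedElsewhere : ∀ {x} → x ≢ h → x ≢ g → (α x ≢ h) × (α x ≢ g)
 matchedElsewhere {x} u v = (λ e → u (trans (sym (inv x)) (trans (cong α e) αh))) , (λ e → v (trans (sym (inv x)) (trans (cong α e) αg)))

 match-involutive : Involutive (match α h g)
 match-involutive x with matchView α h g x
 ... | is-h refl q = trans (cong (match α h g) q) (match-g α h g)
 ... | is-g refl q = trans (cong (match α h g) q) (match-h α h g)
 ... | is-other u v q = let u' , v' = matchedElsewhere u v in
  trans (cong (match α h g) q) (trans (match-other α h g u' v') (inv x))

 -- Gluing two fixed points of α exchanges the values of σ α at them, so it either merges two cycles
 -- or splits one.
 match-twist : (σ : Fin n → Fin n) → Twist (σ ∘ α) (σ ∘ match α h g) h g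
 match-twist σ = twist h≢g (cong σ (trans (match-h α h g) (sym αg))) (cong σ (trans (match-g α h g) (sym αh)))
  (λ u v → cong σ (match-other α h g u v))

module _ {n} (σ : Fin n → Fin n) where

 orbL : ℕ → Fin n → List (Fin n)
 orbL zero    x = []
 orbL (suc d) x = x ∷ orbL d (σ x)

 length-orbL : ∀ d x → length (orbL d x) ≡ d
 length-orbL zero    x = refl
 length-orbL (suc d) x = cong suc (length-orbL d (σ x))

 ∈-orbL : ∀ {d x y} → y ∈ orbL d x → ∃ λ j → j < d × iter σ j x ≡ y
 ∈-orbL {suc d} (here refl) = 0 , s≤s z≤n , refl
 ∈-orbL {suc d} {x} (there q) with ∈-orbL {d} q
 ... | j , l , e = suc j , s≤s l , trans (sym (iter-comm σ j x)) e

 orbL-∈ : ∀ {d x} j → j < d → iter σ j x ∈ orbL d x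
 orbL-∈ {suc d} zero    _       = here refl
 orbL-∈ {suc d} {x} (suc j) (s≤s l) = there (subst (_∈ orbL d (σ x)) (iter-comm σ j x) (orbL-∈ j l))

 module _ (inj : Inj σ) where

  hasDeg-period : ∀ d {x} → hasDeg σ (suc d) x ≡ true → iter σ (suc d) x ≡ x
  hasDeg-period d q = =ᶠ-eq (proj₁ (∧-split q))

  hasDeg-least : ∀ d {x} → hasDeg σ (suc d) x ≡ true → ∀ j → j < d → iter σ (suc j) x ≢ x
  hasDeg-least d {x} q j l e = true≢false (=ᶠ-true e) (not-true (allL-upTo-sound {λ j → not (iter σ (suc j) x =ᶠ x)} d (proj₂ (∧-split q)) j l))

  hasDeg-σ : ∀ d {x} → hasDeg σ (suc d) x ≡ true → hasDeg σ (suc d) (σ x) ≡ true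
  hasDeg-σ d {x} q = ∧-join (=ᶠ-true (trans (iter-comm σ (suc d) x) (cong σ (hasDeg-period d q))))
   (allL-upTo-complete {λ j → not (iter σ (suc j) (σ x) =ᶠ σ x)} d (λ j l → not-false (=ᶠ-false
    (λ e → hasDeg-least d q j l (inj (trans (sym (iter-comm σ (suc j) x)) e))))))

  module _ d {g} (deg : hasDeg σ (suc d) g ≡ true) where

   orbL-unique : Unique (orbL (suc d) g)
   orbL-unique = go (suc d) 0 (≤-reflexive (+-identityʳ (suc d)))
    where
    distinct : ∀ i j → i < j → j < suc d → iter σ i g ≢ iter σ j g
    distinct i j i<j j<d e = hasDeg-least d deg (j ∸ suc i) (<-≤-trans (∸-monoʳ-< {j} {suc i} {0} (s≤s z≤n) i<j) (≤-pred j<d))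
      (iter-inj σ inj i (trans (sym (iter-+ σ i (suc (j ∸ suc i)) g)) (trans
       (cong (λ k → iter σ k g) (trans (+-suc i _) (m+[n∸m]≡n i<j))) (sym e))))
    go : ∀ k i → k + i ≤ suc d → Unique (orbL k (iter σ i g))
    go zero    i l = []
    go (suc k) i l = All.tabulate (λ q e → let j , j<k , r = ∈-orbL {k} q in
      distinct i (j + suc i) (m≤n+m (suc i) j) (<-≤-trans (+-monoˡ-< (suc i) j<k) (subst (_≤ suc d) (sym (+-suc k i)) l))
       (trans e (trans (sym r) (sym (iter-+ σ j (suc i) g)))))
     ∷ go k (suc i) (subst (_≤ suc d) (sym (+-suc k i)) l)

   orbL-σ : ∀ {x} → x ∈ orbL (suc d) g → σ x ∈ orbL (suc d) g
   orbL-σ q with ∈-orbL {suc d} q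
   ... | j , s≤s l , refl with m≤n⇒m<n∨m≡n l
   ...   | inj₁ j<d = orbL-∈ (suc j) (s≤s j<d)
   ...   | inj₂ refl = subst (_∈ orbL (suc d) g) (sym (hasDeg-period d deg)) (here refl)

   orbL-σ⁻ : ∀ {x} → σ x ∈ orbL (suc d) g → x ∈ orbL (suc d) g
   orbL-σ⁻ {x} q with ∈-orbL {suc d} q
   ... | zero , l , e = subst (_∈ orbL (suc d) g) (inj (trans (hasDeg-period d deg) e)) (orbL-∈ d (n<1+n d))
   ... | suc j , l , e = subst (_∈ orbL (suc d) g) (inj e) (orbL-∈ j (<⇒≤ l))

   member-σ : ∀ x → member (σ x) (orbL (suc d) g) ≡ member x (orbL (suc d) g)
   member-σ x = bool-iff (member-complete ∘ orbL-σ⁻ ∘ member-sound _) (member-complete ∘ orbL-σ ∘ member-sound _)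

discover : ∀ {n} → (Fin n → Bool) → List (Fin n) → Fin n → Bool
discover Dsc vs x = Dsc x ∨ member x vs

StableSet : ∀ {n} → (Fin n → Fin n) → (Fin n → Bool) → Set
StableSet σ Dsc = ∀ x → Dsc (σ x) ≡ Dsc x

module Discover {n} {σ : Fin n → Fin n} (inj : Inj σ) {Dsc : Fin n → Bool} (stable : StableSet σ Dsc)
        (d : ℕ) {g : Fin n} (deg : hasDeg σ (suc d) g ≡ true) (undisc : Dsc g ≡ false) where

 vs : List (Fin n)
 vs = orbL σ (suc d) g

 Dsc' : Fin n → Bool
 Dsc' = discover Dsc vs

 vs-undiscovered : ∀ {x} → x ∈ vs → Dsc x ≡ false
 vs-undiscovered q with ∈-orbL σ {suc d} q
 ... | j , _ , refl = go j
  where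
  go : ∀ j → Dsc (iter σ j g) ≡ false
  go zero    = undisc
  go (suc j) = trans (stable _) (go j)

 stable' : StableSet σ Dsc'
 stable' x = cong₂ _∨_ (stable x) (member-σ σ inj d deg x)

 discover-⊇ : ∀ {x} → Dsc x ≡ true → Dsc' x ≡ true
 discover-⊇ = ∨-left

 discover-vs : ∀ {x} → x ∈ vs → Dsc' x ≡ true
 discover-vs {x} q = ∨-right {Dsc x} (member-complete q)

 discover-false : ∀ {x} → Dsc' x ≡ false → Dsc x ≡ false
 discover-false q = ¬true⇒false (λ t → true≢false (discover-⊇ t) q)

 discover-count : countF n (not ∘ Dsc) ≡ suc d + countF n (not ∘ Dsc')
 discover-count = trans (countF-remove n (not ∘ Dsc) vs (orbL-unique σ inj d deg) (λ q → not-false (vs-undiscovered q)))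
  (cong₂ _+_ (length-orbL σ (suc d) g) (countF-cong n (λ x → demorgan (Dsc x) _)))
  where
  demorgan : ∀ a b → not a ∧ not b ≡ not (a ∨ b)
  demorgan true  b = refl
  demorgan false b = refl

-- An Euler inequality for completions of a partial gluing.

adjMap : ∀ {n} → (Fin n → Fin n) → (Fin n → Fin n) → Fin n → Fin n → Bool
adjMap σ α g h = (σ g =ᶠ h) ∨ (α g =ᶠ h)

-- Each new vertex costs a merge of face cycles, and every other edge gains at most one.
module EulerBound {n} {σ : Fin n → Fin n} (inj : Inj σ) {r : Fin n} (q : ℕ)
 (D₀ : Fin n → Bool) (deg : ∀ x → D₀ x ≡ false → hasDeg σ (suc q) x ≡ true)
 {α : Fin n → Fin n} (inv : Involutive α) (fpf : ∀ x → α x ≢ x) (conn : ∀ x → Path (adjMap σ α) r x) where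

 module Extend {α₀ : Fin n → Fin n} (inv₀ : Involutive α₀) (ext : ∀ x → α₀ x ≢ x → α x ≡ α₀ x)
        {h : Fin n} (αh₀ : α₀ h ≡ h) (αg₀ : α₀ (α h) ≡ α h) where

  open Match {α = α₀} inv₀ αh₀ αg₀ (fpf h ∘ sym) public

  α₁ : Fin n → Fin n
  α₁ = match α₀ h (α h)

  injφ : Inj (σ ∘ α₀)
  injφ e = involutive⇒inj inv₀ (inj e)

  injφ' : Inj (σ ∘ α₁)
  injφ' e = involutive⇒inj match-involutive (inj e)

  ext' : ∀ x → α₁ x ≢ x → α x ≡ α₁ x
  ext' x ne with matchView α₀ h (α h) x
  ... | is-h refl q = sym q
  ... | is-g refl q = trans (inv h) (sym q)
  ... | is-other u v q = trans (ext x (λ e → ne (trans q e))) (sym q)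

  unmatched' : ∀ e → countF n (λ x → α₀ x =ᶠ x) ≡ suc e + suc e → countF n (λ x → α₁ x =ᶠ x) ≡ e + e
  unmatched' e unm = suc-injective (suc-injective (sym (begin
    suc (suc (e + e)) ≡⟨ cong suc (sym (+-suc e e)) ⟩
    suc e + suc e ≡⟨ sym unm ⟩
    countF n (λ x → α₀ x =ᶠ x) ≡⟨ countF-remove n (λ x → α₀ x =ᶠ x) pair (((fpf h ∘ sym) ∷ []) ∷ [] ∷ [])
        (λ { (here refl) → =ᶠ-true αh₀ ; (there (here refl)) → =ᶠ-true αg₀ }) ⟩
    2 + countF n (λ x → (α₀ x =ᶠ x) ∧ not (member x pair)) ≡⟨ cong (_+_ 2) (countF-cong n same) ⟩
    2 + countF n (λ x → α₁ x =ᶠ x) ∎)))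
   where
   open ≡-Reasoning
   pair : List (Fin n)
   pair = h ∷ α h ∷ []
   forth : ∀ x → α₀ x ≡ x → ¬ (x ∈ pair) → α₁ x ≡ x
   forth x a b = trans (match-other α₀ h (α h) (b ∘ here) (b ∘ there ∘ here)) a
   back : ∀ x → α₁ x ≡ x → (α₀ x ≡ x) × ¬ (x ∈ pair)
   back x t with matchView α₀ h (α h) x
   ... | is-h refl q = ⊥-elim (fpf h (trans (sym q) t))
   ... | is-g refl q = ⊥-elim (fpf h (sym (trans (sym q) t)))
   ... | is-other u v q = trans (sym q) t , λ { (here e) → u e ; (there (here e)) → v e }
   same : ∀ x → (α₀ x =ᶠ x) ∧ not (member x pair) ≡ (α₁ x =ᶠ x)
   same x = bool-iff
    (λ t → let a , b = ∧-split {α₀ x =ᶠ x} t in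
     =ᶠ-true (forth x (=ᶠ-eq a) (λ i → true≢false (member-complete i) (not-true b))))
    (λ t → let a , b = back x (=ᶠ-eq t) in ∧-join (=ᶠ-true a) (not-false (member-false b)))

 bound : ∀ e v α₀ Dsc → Involutive α₀ → (∀ x → α₀ x ≢ x → α x ≡ α₀ x) → (∀ x → Dsc x ≡ false → α₀ x ≡ x) → StableSet σ Dsc → Dsc r ≡ true →
  (∀ x → D₀ x ≡ true → Dsc x ≡ true) → countF n (not ∘ Dsc) ≡ v * suc q → countF n (λ x → α₀ x =ᶠ x) ≡ e + e →
  numCycles (σ ∘ α) + (v + v) ≤ numCycles (σ ∘ α₀) + e
 bound zero v α₀ Dsc inv₀ ext und st root D₀⊆ cnt unm = ≤-reflexive
  (cong₂ _+_ (numCycles-cong (λ e → involutive⇒inj inv (inj e)) (λ x → cong σ (ext x (matched x)))) (v≡0 v cnt))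
  where
  matched : ∀ x → α₀ x ≢ x
  matched x e = true≢false (=ᶠ-true e) (countF-none n unm x)
  v≡0 : ∀ v → countF n (not ∘ Dsc) ≡ v * suc q → v + v ≡ 0
  v≡0 zero    _ = refl
  v≡0 (suc v) c with countF-witness n _ c
  ... | x , ux = ⊥-elim (matched x (und x (not-true ux)))
 bound (suc e) zero α₀ Dsc inv₀ ext und st root D₀⊆ cnt unm with countF-witness n {λ x → α₀ x =ᶠ x} (e + suc e) unm
 ... | h , uh = ≤-trans (bound e 0 α₁ Dsc match-involutive ext' und' st root D₀⊆ cnt (unmatched' e unm))
   (≤-trans (+-monoˡ-≤ e (numCycles-≤ injφ injφ' (match-twist σ))) (≤-reflexive (sym (+-suc _ e))))
  where
  αh₀ : α₀ h ≡ h
  αh₀ = =ᶠ-eq uh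
  αg₀ : α₀ (α h) ≡ α h
  αg₀ with α₀ (α h) Fin.≟ α h
  ... | yes p = p
  ... | no ne = ⊥-elim (fpf h (trans (sym (inv₀ (α h))) (trans (cong α₀ (trans (sym (ext (α h) ne)) (inv h))) αh₀)))
  open Extend inv₀ ext αh₀ αg₀
  und' : ∀ x → Dsc x ≡ false → α₁ x ≡ x
  und' x f = ⊥-elim (true≢false (not-false f) (countF-none n cnt x))
 -- While vertices are missing, the next edge is chosen with one end discovered and the other not.
 -- It exists, since otherwise the discovered half-edges would be closed under σ and α, and
 -- connectivity would leave none undiscovered.
 bound (suc e) (suc w) α₀ Dsc inv₀ ext und st root D₀⊆ cnt unm with anyF n (λ x → Dsc x ∧ not (Dsc (α x))) in eq
 ... | false = ⊥-elim (let x , ux = countF-witness n _ cnt in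
     true≢false (path-closed (λ y → Dsc y ≡ true) closed (conn x) root) (not-true ux))
  where
  closed : ∀ {x y} → adjMap σ α x y ≡ true → Dsc x ≡ true → Dsc y ≡ true
  closed {x} {y} a dx with ∨-split {σ x =ᶠ y} a
  ... | inj₁ s = subst (λ y → Dsc y ≡ true) (=ᶠ-eq s) (trans (st x) dx)
  ... | inj₂ s with Dsc (α x) in eqα
  ...   | true  = subst (λ y → Dsc y ≡ true) (=ᶠ-eq s) eqα
  ...   | false = ⊥-elim (true≢false (anyF-complete n {λ x → Dsc x ∧ not (Dsc (α x))} x (∧-join dx (not-false eqα))) eq)
 ... | true with anyF-sound n {λ x → Dsc x ∧ not (Dsc (α x))} eq
 ...   | h , t = final
  where
  dh = proj₁ (∧-split t)
  ug = not-true (proj₂ (∧-split {Dsc h} t))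
  αg₀ : α₀ (α h) ≡ α h
  αg₀ = und (α h) ug
  αh₀ : α₀ h ≡ h
  αh₀ with α₀ h Fin.≟ h
  ... | yes p = p
  ... | no ne = ⊥-elim (fpf h (trans (trans (sym αg₀) (cong α₀ (ext h ne))) (inv₀ h)))
  open Extend inv₀ ext αh₀ αg₀
  open Discover inj st q (deg (α h) (¬true⇒false (λ d → true≢false (D₀⊆ _ d) ug))) ug
  apart : ¬ Orb (σ ∘ α₀) h (α h)
  apart o = true≢false (orb-closed (σ ∘ α₀) (λ x → Dsc x ≡ true) (λ {x} d → trans (st _) (inside x d)) o dh) ug
   where
   inside : ∀ x → Dsc x ≡ true → Dsc (α₀ x) ≡ true
   inside x d with Dsc (α₀ x) in eq'
   ... | true = refl
   ... | false = ⊥-elim (true≢false d (trans (cong Dsc (trans (sym (inv₀ x)) (und _ eq'))) eq'))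
  und' : ∀ x → Dsc' x ≡ false → α₁ x ≡ x
  und' x f = trans (match-other α₀ h (α h) (λ { refl → true≢false (discover-⊇ dh) f }) (λ { refl → true≢false (discover-vs (here refl)) f }))
           (und x (discover-false f))
  cnt' : countF n (not ∘ Dsc') ≡ w * suc q
  cnt' = +-cancelˡ-≡ (suc q) _ _ (trans (sym discover-count) cnt)
  ih = bound e w α₁ Dsc' match-involutive ext' und' stable' (discover-⊇ root) (λ x d → discover-⊇ (D₀⊆ x d)) cnt' (unmatched' e unm)
  final : numCycles (σ ∘ α) + (suc w + suc w) ≤ numCycles (σ ∘ α₀) + suc e
  final = subst₂ _≤_ (solve 2 (λ a w → con 2 :+ (a :+ (w :+ w)) := a :+ ((con 1 :+ w) :+ (con 1 :+ w))) refl (numCycles (σ ∘ α)) w)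
   (trans (solve 2 (λ a e → con 2 :+ (a :+ e) := (con 1 :+ a) :+ (con 1 :+ e)) refl _ e)
       (cong (_+ suc e) (sym (numCycles-merge injφ injφ' (match-twist σ) apart)))) (s≤s (s≤s ih))
   where open +-*-Solver

-- Boundary words of a partial gluing.

module _ {n} (σ : Fin n → Fin n) where

 -- A partial gluing is an involution α whose fixed points are the half-edges still open.
 -- Walks follow σ ∘ α through glued half-edges until an open one is met; the words of open
 -- half-edges read off in this way are the boundary words of the partially glued map.
 data Walk (α : Fin n → Fin n) : Fin n → Fin n → Set where
  arrive : ∀ {y} → Walk α y y
  pass   : ∀ {z y} → α z ≢ z → Walk α (σ (α z)) y → Walk α z y

 Next : (Fin n → Fin n) → Fin n → Fin n → Set
 Next α x y = Walk α (σ (α x)) y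

 Chain : (Fin n → Fin n) → Fin n → List (Fin n) → Fin n → Set
 Chain α x []      y = Next α x y
 Chain α x (z ∷ l) y = Next α x z × Chain α z l y

 Cyclic : (Fin n → Fin n) → List (Fin n) → Set
 Cyclic α []      = ⊤
 Cyclic α (x ∷ l) = Chain α x l x

 module _ {α : Fin n → Fin n} where

  walk-orb : ∀ {z y} → Walk α z y → Orb (σ ∘ α) z y
  walk-orb arrive     = orb-refl (σ ∘ α)
  walk-orb (pass _ w) = orb-trans (σ ∘ α) (1 , refl) (walk-orb w)

  next-orb : ∀ {x y} → Next α x y → Orb (σ ∘ α) x y
  next-orb w = orb-trans (σ ∘ α) (1 , refl) (walk-orb w)

  chain-append : ∀ {x z y} l m → Chain α x l z → Chain α z m y → Chain α x (l ++ z ∷ m) y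
  chain-append []      m p q       = p , q
  chain-append (_ ∷ l) m (s , p) q = s , chain-append l m p q

  chain-split : ∀ {x z y} l m → Chain α x (l ++ z ∷ m) y → Chain α x l z × Chain α z m y
  chain-split []      m (p , q) = p , q
  chain-split (_ ∷ l) m (s , p) = let a , b = chain-split l m p in (s , a) , b

  chain-orb : ∀ {x y} l → Chain α x l y → Orb (σ ∘ α) x y
  chain-orb []      p       = next-orb p
  chain-orb (_ ∷ l) (s , p) = orb-trans (σ ∘ α) (next-orb s) (chain-orb l p)

  cyclic-rotate : ∀ h w → Cyclic α (h ∷ w) → Cyclic α (w ++ [ h ])
  cyclic-rotate h []      c       = c
  cyclic-rotate h (x ∷ l) (s , p) = chain-append l [] p s

  cyclic-same : ∀ h {g} l m → Cyclic α (h ∷ l ++ g ∷ m) → Orb (σ ∘ α) h g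
  cyclic-same h l m c = chain-orb l (proj₁ (chain-split l m c))

  next-in : ∀ {x y} l → Chain α x l y → ∀ {z} → z ∈ (x ∷ l) → ∃ λ w → (w ∈ (l ++ [ y ])) × Next α z w
  next-in []      p       (here refl) = _ , here refl , p
  next-in (_ ∷ l) (s , p) (here refl) = _ , here refl , s
  next-in (_ ∷ l) (s , p) (there q) with next-in l p q
  ... | w , i , t = w , there i , t

  -- Between consecutive letters of the word, σ α passes only through glued half-edges. The
  -- half-edges from which a walk leads to a letter (`Near`) are therefore closed under σ α, and an
  -- open half-edge admits only the trivial walk, so it is itself a letter.
  cyclic-orbit : ∀ w → Cyclic α w → ∀ {h g} → h ∈ w → α g ≡ g → Orb (σ ∘ α) h g → g ∈ w
  cyclic-orbit (x ∷ l) c {h} {g} h∈ αg o =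
    let y , y∈ , w = orb-closed (σ ∘ α) Near near-closed o (h , h∈ , arrive) in
    subst (_∈ x ∷ l) (sym (stuck w)) y∈
   where
   Near : Fin n → Set
   Near z = ∃ λ y → (y ∈ x ∷ l) × Walk α z y
   back : ∀ {z} l → z ∈ (l ++ [ x ]) → z ∈ x ∷ l
   back []      (here refl) = here refl
   back (_ ∷ l) (here refl) = there (here refl)
   back (_ ∷ l) (there q) with back l q
   ... | here e  = here e
   ... | there r = there (there r)
   near-closed : ∀ {z} → Near z → Near (σ (α z))
   near-closed (y , i , pass _ w) = y , i , w
   near-closed (y , i , arrive) with next-in l c i
   ... | y' , j , t = y' , back l j , t
   stuck : ∀ {y} → Walk α g y → g ≡ y
   stuck arrive     = refl
   stuck (pass m _) = ⊥-elim (m αg)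

  fresh-cyclic : ∀ d g → (∀ {x} → x ∈ orbL σ (suc d) g → α x ≡ x) → iter σ (suc d) g ≡ g → Cyclic α (orbL σ (suc d) g)
  fresh-cyclic d g fixed back = go d g fixed (trans (iter-comm σ d g) back)
   where
   go : ∀ d x → (∀ {y} → y ∈ orbL σ (suc d) x → α y ≡ y) → iter σ d (σ x) ≡ g → Chain α x (orbL σ d (σ x)) g
   go zero    x fx e = subst (Walk α (σ (α x))) (trans (cong σ (fx (here refl))) e) arrive
   go (suc d) x fx e = subst (Walk α (σ (α x))) (cong σ (fx (here refl))) arrive , go d (σ x) (fx ∘ there) (trans (iter-comm σ d (σ x)) e)

 module Glue {α : Fin n → Fin n} {h g : Fin n} (αh : α h ≡ h) (αg : α g ≡ g) (h≢g : h ≢ g) where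

  private
   β : Fin n → Fin n
   β = match α h g

  Avoids : Fin n → Set
  Avoids x = x ≢ h × x ≢ g

  walk-transfer : ∀ {z y} → Walk α z y → Walk β z y
  walk-transfer arrive = arrive
  walk-transfer {z} {y} (pass m w) = pass (λ e → m (trans (sym same) e)) (subst (λ x → Walk β (σ x) y) (sym same) (walk-transfer w))
   where
   same : β z ≡ α z
   same = match-other α h g (λ { refl → m αh }) (λ { refl → m αg })

  next-transfer : ∀ {x y} → Avoids x → Next α x y → Next β x y
  next-transfer {x} {y} (u , v) w = subst (λ z → Walk β (σ z) y) (sym (match-other α h g u v)) (walk-transfer w)

  jump-h : ∀ {y} → Next α g y → Next β h y
  jump-h {y} w = subst (λ z → Walk β (σ z) y) (trans αg (sym (match-h α h g))) (walk-transfer w)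

  jump-g : ∀ {y} → Next α h y → Next β g y
  jump-g {y} w = subst (λ z → Walk β (σ z) y) (trans αh (sym (match-g α h g))) (walk-transfer w)

  through-h : ∀ {z y} → Walk α z h → Next β h y → Walk β z y
  through-h arrive     t = pass (λ e → h≢g (trans (sym e) (match-h α h g))) t
  through-h {z} {y} (pass m w) t = pass (λ e → m (trans (sym same) e)) (subst (λ x → Walk β (σ x) y) (sym same) (through-h w t))
   where
   same : β z ≡ α z
   same = match-other α h g (λ { refl → m αh }) (λ { refl → m αg })

  through-g : ∀ {z y} → Walk α z g → Next β g y → Walk β z y
  through-g arrive     t = pass (λ e → h≢g (trans (sym (match-g α h g)) e)) t
  through-g {z} {y} (pass m w) t = pass (λ e → m (trans (sym same) e)) (subst (λ x → Walk β (σ x) y) (sym same) (through-g w t))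
   where
   same : β z ≡ α z
   same = match-other α h g (λ { refl → m αh }) (λ { refl → m αg })

  chain-extend : ∀ {x z y} l → All Avoids (x ∷ l) → (∀ {w} → Walk α w z → Walk β w y) → Chain α x l z → Chain β x l y
  chain-extend {x} {z} {y} [] ((u , v) ∷ []) f p = subst (λ z → Walk β (σ z) y) (sym (match-other α h g u v)) (f p)
  chain-extend (_ ∷ l) (a ∷ as) f (s , p) = next-transfer a s , chain-extend l as f p

  cyclic-transfer : ∀ l → All Avoids l → Cyclic α l → Cyclic β l
  cyclic-transfer []      _  _ = tt
  cyclic-transfer (x ∷ l) as c = chain-extend l as walk-transfer c

  cyclic-split : ∀ l m → All Avoids l → All Avoids m → Cyclic α (h ∷ l ++ g ∷ m) → Cyclic β l × Cyclic β m
  cyclic-split l m al am c = let p , q = chain-split l m c in left l al p , right m am q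
   where
   left : ∀ l → All Avoids l → Chain α h l g → Cyclic β l
   left []      _  _       = tt
   left (x ∷ l) as (s , p) = chain-extend l as (λ w → through-g w (jump-g s)) p
   right : ∀ l → All Avoids l → Chain α g l h → Cyclic β l
   right []      _  _       = tt
   right (x ∷ l) as (s , p) = chain-extend l as (λ w → through-h w (jump-h s)) p

  -- The other half-edges of the new vertex are inserted in the place of h: a walk arriving at h now
  -- continues after g, and one arriving at g continues after h. For empty l the predecessor and the
  -- successor of h are h itself, hence the separate case.
  cyclic-merge : ∀ l y ys → All Avoids l → All Avoids (y ∷ ys) → Cyclic α (h ∷ l) → Cyclic α (g ∷ y ∷ ys) → Cyclic β ((y ∷ ys) ++ l)
  cyclic-merge [] y ys al ay c (s , p) = subst (Cyclic β) (sym (++-identityʳ (y ∷ ys))) (chain-extend ys ay (λ w → through-g w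
     (subst (λ z → Walk β (σ z) y) (trans αh (sym (match-g α h g))) (through-h c (jump-h s)))) p)
   where open import Data.List.Properties using (++-identityʳ)
  cyclic-merge (x ∷ l) y ys al ay (t , q) (s , p) = chain-append ys l (chain-extend ys ay (λ w → through-g w (jump-g t)) p)
            (chain-extend l al (λ w → through-h w (jump-h s)) q)

Unique-resp : ∀ {A : Set} {xs ys : List A} → xs ↭ ys → Unique xs → Unique ys
Unique-resp ↭.refl       u = u
Unique-resp (prep x p)   (a ∷ u) = All-resp-↭ p a ∷ Unique-resp p u
Unique-resp (swap x y p) ((n ∷ a) ∷ b ∷ u) = ((n ∘ sym) ∷ All-resp-↭ p b) ∷ All-resp-↭ p a ∷ Unique-resp p u
Unique-resp (↭.trans p p') u = Unique-resp p' (Unique-resp p u)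

-- Partial gluings that can still become planar with f faces.

module Geo {n} (σ : Fin n → Fin n) (inj : Inj σ) (r : Fin n) (q' : ℕ)
 (D₀ : Fin n → Bool) (deg : ∀ x → D₀ x ≡ false → hasDeg σ (suc (suc q')) x ≡ true) (f : ℕ) where

 q : ℕ
 q = suc q'

 -- e edges and v vertices are still missing. If every missing vertex merges two cycles of σ α and
 -- every other edge splits one, then `euler` says that f cycles remain at the end; the two kinds of
 -- steps preserve it.
 record Partial (α : Fin n → Fin n) (Dsc : Fin n → Bool) (ws : List (List (Fin n))) (e v : ℕ) : Set where
  field
   inv      : Involutive α
   und      : ∀ x → Dsc x ≡ false → α x ≡ x
   stable   : StableSet σ Dsc
   root     : Dsc r ≡ true
   base     : ∀ x → D₀ x ≡ true → Dsc x ≡ true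
   open-mem : ∀ x → Dsc x ≡ true → α x ≡ x → x ∈ concat ws
   mem-open : ∀ {x} → x ∈ concat ws → Dsc x ≡ true × α x ≡ x
   unique   : Unique (concat ws)
   cyclic   : All (Cyclic σ α) ws
   euler    : numCycles (σ ∘ α) + e ≡ f + (v + v)
   edges    : e + e ≡ length (concat ws) + v * suc q
   count    : countF n (not ∘ Dsc) ≡ v * suc q
   conn     : ∀ x → Dsc x ≡ true → Path (adjMap σ α) r x

 open Partial

 injφ : ∀ {α} → Involutive α → Inj (σ ∘ α)
 injφ i e = involutive⇒inj i (inj e)

 undiscovered : ∀ {α Dsc ws e v g} → Partial α Dsc ws e v → Dsc g ≡ false → hasDeg σ (suc q) g ≡ true
 undiscovered P u = deg _ (¬true⇒false (λ d → true≢false (base P _ d) u))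

 rotate : ∀ {α Dsc h w ws e v} → Partial α Dsc ((h ∷ w) ∷ ws) e v → Partial α Dsc ((w ++ [ h ]) ∷ ws) e v
 rotate {α} {Dsc} {h} {w} {ws} {e} {v} P = record
  { inv = inv P ; und = und P ; stable = stable P ; root = root P ; base = base P
  ; euler = euler P ; count = count P ; conn = conn P
  ; open-mem = λ x d o → ∈-resp-↭ perm (open-mem P x d o)
  ; mem-open = λ i → mem-open P (∈-resp-↭ (↭-sym perm) i)
  ; unique   = Unique-resp perm (unique P)
  ; cyclic   = cyclic-rotate σ h w (All.head (cyclic P)) ∷ All.tail (cyclic P)
  ; edges    = trans (edges P) (cong (_+ v * suc q) (↭-length perm)) }
  where
  perm : h ∷ w ++ concat ws ↭ (w ++ [ h ]) ++ concat ws
  perm = ++⁺ʳ (concat ws) (++-comm [ h ] w)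

 pop : ∀ {α Dsc ws e v} → Partial α Dsc ([] ∷ ws) e v → Partial α Dsc ws e v
 pop P = record
  { inv = inv P ; und = und P ; stable = stable P ; root = root P ; base = base P
  ; euler = euler P ; count = count P ; conn = conn P ; open-mem = open-mem P ; mem-open = mem-open P ; unique = unique P
  ; cyclic = All.tail (cyclic P) ; edges = edges P }

 adj-match : ∀ {α} h g → α h ≡ h → α g ≡ g → ∀ {x y} → adjMap σ α x y ≡ true → Path (adjMap σ (match α h g)) x y
 adj-match {α} h g αh αg {x} {y} a with ∨-split {σ x =ᶠ y} a
 ... | inj₁ s = step stop (∨-left s)
 ... | inj₂ s with matchView α h g x
 ...   | is-h refl _ = subst (Path _ x) (trans (sym αh) (=ᶠ-eq s)) stop
 ...   | is-g refl _ = subst (Path _ x) (trans (sym αg) (=ᶠ-eq s)) stop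
 ...   | is-other _ _ m = step stop (∨-right {σ x =ᶠ y} (=ᶠ-true (trans m (=ᶠ-eq s))))

 orb-path : ∀ {α} k x → Path (adjMap σ α) x (iter σ k x)
 orb-path zero    x = stop
 orb-path (suc k) x = step (orb-path k x) (∨-left (=ᶠ-refl (iter σ (suc k) x)))

 module _ {α Dsc h l g m ws e v} (P : Partial α Dsc ((h ∷ l ++ g ∷ m) ∷ ws) (suc e) v) where
  private
   perm : h ∷ (l ++ g ∷ m) ++ concat ws ↭ h ∷ g ∷ l ++ (m ++ concat ws)
   perm = prep h (subst (_↭ g ∷ l ++ (m ++ concat ws)) (sym (++-assoc l (g ∷ m) (concat ws))) (shift g l (m ++ concat ws)))
   uniq : Unique (h ∷ g ∷ l ++ (m ++ concat ws))
   uniq = Unique-resp perm (unique P)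
   h≢g : h ≢ g
   h≢g = All.head (AllPairs.head uniq)
   mo : ∀ {x} → x ∈ h ∷ g ∷ l ++ (m ++ concat ws) → Dsc x ≡ true × α x ≡ x
   mo i = mem-open P (∈-resp-↭ (↭-sym perm) i)
   αh : α h ≡ h
   αh = proj₂ (mo (here refl))
   αg : α g ≡ g
   αg = proj₂ (mo (there (here refl)))
   avoid : ∀ {x} → x ∈ l ++ (m ++ concat ws) → x ≢ h × x ≢ g
   avoid i = (λ { refl → All.lookup (AllPairs.head uniq) (there i) refl }) , (λ { refl → All.lookup (AllPairs.head (AllPairs.tail uniq)) i refl })
  open Match {α = α} (inv P) αh αg h≢g
  open Glue σ {α} {h} {g} αh αg h≢g

  split : Partial (match α h g) Dsc (l ∷ m ∷ ws) e v
  split = record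
   { inv = match-involutive
   ; und = λ x u → trans (match-other α h g (λ { refl → true≢false (proj₁ (mo (here refl))) u })
                        (λ { refl → true≢false (proj₁ (mo (there (here refl)))) u })) (und P x u)
   ; stable = stable P ; root = root P ; base = base P
   ; open-mem = om
   ; mem-open = λ {x} i → let u , w = avoid i ; d , o = mo (there (there i)) in
     d , trans (match-other α h g u w) o
   ; unique = AllPairs.tail (AllPairs.tail uniq)
   ; cyclic = let cl , cm = cyclic-split l m (All.tabulate (avoid ∘ ∈-++⁺ˡ))
                   (All.tabulate (avoid ∘ ∈-++⁺ʳ l ∘ ∈-++⁺ˡ)) (All.head (cyclic P))
         in cl ∷ cm ∷ others ws (All.tabulate (avoid ∘ ∈-++⁺ʳ l ∘ ∈-++⁺ʳ m)) (All.tail (cyclic P))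
   ; euler = trans (cong (_+ e) (numCycles-split (injφ (inv P)) (injφ match-involutive) (match-twist σ)
         (cyclic-same σ h l m (All.head (cyclic P))))) (trans (sym (+-suc _ e)) (euler P))
   ; edges = suc-injective (suc-injective (trans (sym (cong suc (+-suc e e))) (trans (edges P) (cong (_+ v * suc q) (↭-length perm)))))
   ; count = count P
   ; conn = λ x d → path-map (adj-match h g αh αg) (conn P x d)
   }
   where
   om : ∀ x → Dsc x ≡ true → match α h g x ≡ x → x ∈ l ++ (m ++ concat ws)
   om x d o with matchView α h g x
   ... | is-h refl e = ⊥-elim (h≢g (trans (sym o) e))
   ... | is-g refl e = ⊥-elim (h≢g (trans (sym e) o))
   ... | is-other u w e with ∈-resp-↭ perm (open-mem P x d (trans (sym e) o))
   ...   | here e'         = ⊥-elim (u e')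
   ...   | there (here e') = ⊥-elim (w e')
   ...   | there (there i) = i
   others : ∀ ws → All Avoids (concat ws) → All (Cyclic σ α) ws → All (Cyclic σ (match α h g)) ws
   others []       _ []       = []
   others (w ∷ ws) a (c ∷ cs) = cyclic-transfer w (All.tabulate (λ i → All.lookup a (∈-++⁺ˡ i))) c ∷
    others ws (All.tabulate (λ i → All.lookup a (∈-++⁺ʳ w i))) cs

 module Merge {α Dsc h w ws e v g} (P : Partial α Dsc ((h ∷ w) ∷ ws) (suc e) (suc v)) (ug : Dsc g ≡ false) where
  open Discover inj (stable P) q (undiscovered P ug) ug public
  h-open : Dsc h ≡ true × α h ≡ h
  h-open = mem-open P (here refl)
  αg : α g ≡ g
  αg = und P g ug
  h≢g : h ≢ g
  h≢g refl = true≢false (proj₁ h-open) ug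
  open Match {α = α} (inv P) (proj₂ h-open) αg h≢g
  open Glue σ {α} {h} {g} (proj₂ h-open) αg h≢g
  new : List (Fin n)
  new = orbL σ q (σ g)
  private
   avoid : ∀ {x} → x ∈ w ++ concat ws → x ≢ h × x ≢ g
   avoid i = (λ { refl → All.lookup (AllPairs.head (unique P)) i refl }) , (λ { refl → true≢false (proj₁ (mem-open P (there i))) ug })
   uniq-vs : Unique vs
   uniq-vs = orbL-unique σ inj q (undiscovered P ug)
   avoid-new : ∀ {x} → x ∈ new → x ≢ h × x ≢ g
   avoid-new i = (λ { refl → true≢false (proj₁ h-open) (vs-undiscovered (there i)) }) , (λ { refl → All.lookup (AllPairs.head uniq-vs) i refl })
   apart : ¬ Orb (σ ∘ α) h g
   apart o with cyclic-orbit σ (h ∷ w) (All.head (cyclic P)) (here refl) αg o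
   ... | i = true≢false (proj₁ (mem-open P (∈-++⁺ˡ i))) ug
   om : ∀ x → Dsc' x ≡ true → match α h g x ≡ x → x ∈ (new ++ w) ++ concat ws
   om x d o with matchView α h g x
   ... | is-h refl e = ⊥-elim (h≢g (trans (sym o) e))
   ... | is-g refl e = ⊥-elim (h≢g (trans (sym e) o))
   ... | is-other u y e with ∨-split {Dsc x} d
   ...   | inj₁ d' with open-mem P x d' (trans (sym e) o)
   ...     | here e' = ⊥-elim (u e')
   ...     | there i = subst (x ∈_) (sym (++-assoc new w (concat ws))) (∈-++⁺ʳ new i)
   om x d o | is-other u y e | inj₂ i with member-sound vs i
   ...     | here e' = ⊥-elim (y e')
   ...     | there i' = ∈-++⁺ˡ (∈-++⁺ˡ i')
   mo : ∀ {x} → x ∈ (new ++ w) ++ concat ws → Dsc' x ≡ true × match α h g x ≡ x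
   mo {x} i with ∈-++⁻ new (subst (x ∈_) (++-assoc new w (concat ws)) i)
   ... | inj₁ j = let a , b = avoid-new j in discover-vs (there j) ,
    trans (match-other α h g a b) (und P x (vs-undiscovered (there j)))
   ... | inj₂ j = let a , b = avoid j ; d , o = mem-open P (there j) in
    discover-⊇ d , trans (match-other α h g a b) o
   others : ∀ ws → All Avoids (concat ws) → All (Cyclic σ α) ws → All (Cyclic σ (match α h g)) ws
   others []       _ []       = []
   others (w ∷ ws) a (c ∷ cs) = cyclic-transfer w (All.tabulate (λ i → All.lookup a (∈-++⁺ˡ i))) c ∷
    others ws (All.tabulate (λ i → All.lookup a (∈-++⁺ʳ w i))) cs
   cyc-new : Cyclic σ (match α h g) (new ++ w)
   cyc-new = cyclic-merge w (σ g) (orbL σ q' (σ (σ g))) (All.tabulate (avoid ∘ ∈-++⁺ˡ)) (All.tabulate avoid-new) (All.head (cyclic P))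
    (fresh-cyclic σ (suc q') g (λ i → und P _ (vs-undiscovered i)) (hasDeg-period σ inj (suc q') (undiscovered P ug)))
   conn' : ∀ x → Dsc' x ≡ true → Path (adjMap σ (match α h g)) r x
   conn' x d with ∨-split {Dsc x} d
   ... | inj₁ d' = path-map (adj-match h g (proj₂ h-open) αg) (conn P x d')
   ... | inj₂ i with ∈-orbL σ {suc q} {g} {x} (member-sound vs i)
   ...   | j , _ , e = subst (Path (adjMap σ (match α h g)) r) e (path-trans
    (step (path-map (adj-match h g (proj₂ h-open) αg) (conn P h (proj₁ h-open))) (∨-right {σ h =ᶠ g} (=ᶠ-true (match-h α h g)))) (orb-path j g))
   ed : e + e ≡ length ((new ++ w) ++ concat ws) + v * suc q
   ed = suc-injective (suc-injective (begin
    suc (suc (e + e)) ≡⟨ cong suc (sym (+-suc e e)) ⟩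
    suc e + suc e ≡⟨ edges P ⟩
    suc (length (w ++ concat ws)) + (suc q + v * suc q)
     ≡⟨ solve 3 (λ a q b → (con 1 :+ a) :+ ((con 1 :+ q) :+ b) := con 2 :+ ((q :+ a) :+ b)) refl (length (w ++ concat ws)) q (v * suc q) ⟩
    suc (suc (q + length (w ++ concat ws) + v * suc q)) ≡⟨ cong (λ a → suc (suc (a + v * suc q))) (sym len) ⟩
    suc (suc (length ((new ++ w) ++ concat ws) + v * suc q)) ∎))
    where
    open ≡-Reasoning
    open +-*-Solver
    len : length ((new ++ w) ++ concat ws) ≡ q + length (w ++ concat ws)
    len = trans (cong length (++-assoc new w (concat ws))) (trans (length-++ new) (cong (_+ length (w ++ concat ws)) (length-orbL σ q (σ g))))

  merge : Partial (match α h g) Dsc' ((new ++ w) ∷ ws) e v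
  merge = record
   { inv = match-involutive
   ; und = λ x u → trans (match-other α h g (λ { refl → true≢false (discover-⊇ (proj₁ h-open)) u })
                        (λ { refl → true≢false (discover-vs (here refl)) u })) (und P x (discover-false u))
   ; stable = stable' ; root = discover-⊇ (root P) ; base = λ x d → discover-⊇ (base P x d)
   ; open-mem = om
   ; mem-open = mo
   ; unique = subst Unique (sym (++-assoc new w (concat ws))) (UniqueP.++⁺ (AllPairs.tail uniq-vs) (AllPairs.tail (unique P))
     (λ (i , j) → true≢false (proj₁ (mem-open P (there j))) (vs-undiscovered (there i))))
   ; cyclic = cyc-new ∷ others ws (All.tabulate (avoid ∘ ∈-++⁺ʳ w)) (All.tail (cyclic P))
   ; euler = eul
   ; edges = ed
   ; count = +-cancelˡ-≡ (suc q) _ _ (trans (sym discover-count) (count P))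
   ; conn = conn'
   }
   where
   eul : numCycles (σ ∘ match α h g) + e ≡ f + (v + v)
   eul = suc-injective (suc-injective (begin
    suc (suc (numCycles (σ ∘ match α h g) + e)) ≡⟨ sym (+-suc (suc (numCycles (σ ∘ match α h g))) e) ⟩
    suc (numCycles (σ ∘ match α h g)) + suc e
     ≡⟨ cong (_+ suc e) (sym (numCycles-merge (injφ (inv P)) (injφ match-involutive) (match-twist σ) apart)) ⟩
    numCycles (σ ∘ α) + suc e ≡⟨ euler P ⟩
    f + (suc v + suc v) ≡⟨ solve 2 (λ f v → f :+ ((con 1 :+ v) :+ (con 1 :+ v)) := con 2 :+ (f :+ (v :+ v))) refl f v ⟩
    suc (suc (f + (v + v))) ∎))
    where
    open ≡-Reasoning
    open +-*-Solver

 -- Gluing two different boundary words creates genus.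
 nonplanar : ∀ {α₀ Dsc h w ws e v} → Partial α₀ Dsc ((h ∷ w) ∷ ws) (suc e) v → ∀ {α} → Involutive α →
  (∀ x → α x ≢ x) → (∀ x → Path (adjMap σ α) r x) → numCycles (σ ∘ α) ≡ f → (∀ x → α₀ x ≢ x → α x ≡ α₀ x) → α h ∈ concat ws → ⊥
 nonplanar {α₀} {Dsc} {h} {w} {ws} {e} {v} P {α} invα fpf con faces ext i = contradictory
  where
  h-open = mem-open P (here refl)
  g-open = mem-open P (∈-++⁺ʳ (h ∷ w) i)
  open EulerBound inj {r} q D₀ deg {α} invα fpf con
  open Extend {α₀} (inv P) ext {h} (proj₂ h-open) (proj₂ g-open)
  disjoint : ∀ u {t} → Unique (u ++ t) → ∀ {x} → x ∈ u → x ∈ t → ⊥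
  disjoint (y ∷ u) (a ∷ _) (here refl) j = All.lookup a (∈-++⁺ʳ u j) refl
  disjoint (y ∷ u) (_ ∷ p) (there i) j = disjoint u p i j
  apart : ¬ Orb (σ ∘ α₀) h (α h)
  apart o = disjoint (h ∷ w) (unique P) (cyclic-orbit σ (h ∷ w) (All.head (cyclic P)) (here refl) (proj₂ g-open) o) i
  unmatched : countF n (λ x → α₀ x =ᶠ x) ≡ suc e + suc e
  unmatched = begin
   countF n (λ x → α₀ x =ᶠ x) ≡⟨ countF-remove n (λ x → α₀ x =ᶠ x) (concat ((h ∷ w) ∷ ws)) (unique P) (λ j → =ᶠ-true (proj₂ (mem-open P j))) ⟩
   length (concat ((h ∷ w) ∷ ws)) + countF n (λ x → (α₀ x =ᶠ x) Data.Bool.∧ not (member x (concat ((h ∷ w) ∷ ws))))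
    ≡⟨ cong (_+_ (length (concat ((h ∷ w) ∷ ws)))) (trans (countF-cong n same) (count P)) ⟩
   length (concat ((h ∷ w) ∷ ws)) + v * suc q ≡⟨ sym (edges P) ⟩
   suc e + suc e ∎
   where
   open ≡-Reasoning
   import Data.Bool
   same : ∀ x → (α₀ x =ᶠ x) Data.Bool.∧ not (member x (concat ((h ∷ w) ∷ ws))) ≡ not (Dsc x)
   same x with Dsc x in eq
   ... | true = ¬true⇒false (λ t → let a , b = ∧-split {α₀ x =ᶠ x} t in
       true≢false (member-complete (open-mem P x eq (=ᶠ-eq a))) (not-true b))
   ... | false = ∧-join (=ᶠ-true (und P x eq)) (not-false (member-false (λ j → true≢false (proj₁ (mem-open P j)) eq)))
  undα : ∀ x → Dsc x ≡ false → α₁ x ≡ x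
  undα x u = trans (match-other α₀ h (α h) (λ { refl → true≢false (proj₁ h-open) u }) (λ { refl → true≢false (proj₁ g-open) u })) (und P x u)
  b : numCycles (σ ∘ α) + (v + v) ≤ numCycles (σ ∘ α₁) + e
  b = bound e v α₁ Dsc match-involutive ext' undα (stable P) (root P) (base P) (count P) (unmatched' e unmatched)
  contradictory : ⊥
  contradictory = <-irrefl refl (begin-strict numCycles (σ ∘ α) + (v + v) ≤⟨ b ⟩
   numCycles (σ ∘ α₁) + e <⟨ +-mono-<-≤ (n<1+n (numCycles (σ ∘ α₁))) (n≤1+n e) ⟩
   suc (numCycles (σ ∘ α₁)) + suc e ≡⟨ cong (_+ suc e) (sym (numCycles-merge (Extend.injφ {α₀} (inv P) ext (proj₂ h-open) (proj₂ g-open)) injφ' (match-twist σ) apart)) ⟩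
   numCycles (σ ∘ α₀) + suc e ≡⟨ euler P ⟩
   f + (v + v) ≡⟨ cong (_+ (v + v)) (sym faces) ⟩
   numCycles (σ ∘ α) + (v + v) ∎)
   where open ≤-Reasoning

-- The forest as far as it is revealed.

Knowledge : ℕ → Set
Knowledge n = Fin n → Maybe Bool

isTrue : Maybe Bool → Bool
isTrue (just b) = b
isTrue nothing  = false

isTrue-just : ∀ {m} → isTrue m ≡ true → m ≡ just true
isTrue-just {just true} _ = refl

assign : ∀ {n} → Knowledge n → Fin n → Fin n → Bool → Knowledge n
assign S h g b x = if x =ᶠ h then just b else if x =ᶠ g then just b else S x

module _ {n} (S : Knowledge n) (h g : Fin n) (b : Bool) where

 assign-h : assign S h g b h ≡ just b
 assign-h rewrite =ᶠ-refl h = refl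

 assign-g : assign S h g b g ≡ just b
 assign-g with g =ᶠ h
 ... | true  = refl
 ... | false rewrite =ᶠ-refl g = refl

 assign-other : ∀ {x} → x ≢ h → x ≢ g → assign S h g b x ≡ S x
 assign-other u v rewrite =ᶠ-false u | =ᶠ-false v = refl

module Forest {n} (σ : Fin n → Fin n) (inj : Inj σ) where

 adjKnown : (Fin n → Fin n) → Knowledge n → Fin n → Fin n → Bool
 adjKnown α S g h = (σ g =ᶠ h) ∨ (isTrue (S g) ∧ (α g =ᶠ h))

 TreePath : (Fin n → Fin n) → Knowledge n → Fin n → Fin n → Set
 TreePath α S = Path (adjKnown α S)

 treePath-mono : ∀ {α S α' S'} → (∀ x → S x ≡ just true → S' x ≡ just true × α' x ≡ α x) → ∀ {x y} → TreePath α S x y → TreePath α' S' x y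
 treePath-mono {α} {S} {α'} {S'} ext = path-map link
  where
  link : ∀ {x y} → adjKnown α S x y ≡ true → TreePath α' S' x y
  link {x} {y} a with ∨-split {σ x =ᶠ y} a
  ... | inj₁ s = step stop (∨-left s)
  ... | inj₂ t with ∧-split {isTrue (S x)} t
  ...   | i , e with ext x (isTrue-just i)
  ...     | s' , α' = step stop (∨-right {σ x =ᶠ y} (∧-join (cong isTrue s') (=ᶠ-true (trans α' (=ᶠ-eq e)))))

 treePath-orb : ∀ α S {x y} → Orb σ x y → TreePath α S x y
 treePath-orb α S (zero , refl) = stop
 treePath-orb α S {x} (suc k , refl) = step (treePath-orb α S (k , refl)) (∨-left (=ᶠ-refl (iter σ (suc k) x)))

 -- A certificate that the forest edge at x lies on no cycle: a set of vertices with exactly one of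
 -- its ends, which no other known forest edge leaves. Such a set can be extended when a vertex is
 -- added, unlike a bare statement that paths do not exist.
 record Cut (α : Fin n → Fin n) (S : Knowledge n) (x : Fin n) : Set where
  field
   side      : Fin n → Bool
   side-σ    : ∀ y → side (σ y) ≡ side y
   side-S    : ∀ y → S y ≡ just true → y ≢ x → y ≢ α x → side (α y) ≡ side y
   separates : side x ≢ side (α x)

 -- The half-edges in `U` are undecided and all belong to the tree of `hub`; those in `R` are known
 -- to be outside the forest. The labels are constant on trees and distinct on `reps`, so the κ
 -- trees are different; since they stay below κ on `reps`, κ is free for the next tree.
 record Tree (α : Fin n → Fin n) (S : Knowledge n) (Dsc : Fin n → Bool) (U R : List (Fin n)) (κ : ℕ) : Set where
  field
   unknown-und : ∀ x → Dsc x ≡ false → S x ≡ nothing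
   unknown-U   : ∀ {x} → x ∈ U → S x ≡ nothing
   decided     : ∀ {x} → x ∈ R → S x ≡ just false
   glued       : ∀ x → α x ≢ x → ∃ λ b → S x ≡ just b × S (α x) ≡ just b
   true-glued  : ∀ x → S x ≡ just true → α x ≢ x
   reps        : List (Fin n)
   reps-size   : length reps ≡ κ
   reps-Dsc    : All (λ c → Dsc c ≡ true) reps
   hub         : Fin n
   hub-U       : ∀ {x} → x ∈ U → TreePath α S hub x
   covered     : ∀ x → Dsc x ≡ true → Any (λ c → TreePath α S c x) reps
   label       : Fin n → ℕ
   label-σ     : ∀ x → label (σ x) ≡ label x
   label-S     : ∀ x → S x ≡ just true → label (α x) ≡ label x
   label-reps  : AllPairs (λ c d → label c ≢ label d) reps
   label-small : All (λ c → label c < κ) reps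
   cut         : ∀ x → S x ≡ just true → Cut α S x

 open Tree

 treePath-sym : ∀ {α S Dsc U R κ} → Involutive α → Tree α S Dsc U R κ → ∀ {x y} → TreePath α S x y → TreePath α S y x
 treePath-sym {α} {S} inv T = path-sym back
  where
  back : ∀ {x y} → adjKnown α S x y ≡ true → TreePath α S y x
  back {x} {y} a with ∨-split {σ x =ᶠ y} a
  ... | inj₁ s = treePath-orb α S (orb-sym σ inj (1 , =ᶠ-eq s))
  ... | inj₂ t with ∧-split {isTrue (S x)} t
  ...   | i , e with glued T x (true-glued T x (isTrue-just i))
  ...     | b , p , p' with trans (sym (isTrue-just i)) p
  ...       | refl = step stop (∨-right {σ y =ᶠ x} (∧-join (cong isTrue (trans (cong S (sym (=ᶠ-eq e))) p'))
   (=ᶠ-true (trans (cong α (sym (=ᶠ-eq e))) (inv x)))))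

 skip : ∀ {α S Dsc h U R R' κ} → Tree α S Dsc (h ∷ U) R κ → Dsc h ≡ true → α h ≡ h → ¬ (h ∈ U) →
  (∀ {x} → x ∈ R' → x ∈ R ⊎ x ≡ h) → Tree α (assign S h h false) Dsc U R' κ
 skip {α} {S} {Dsc} {h} {U} {R} {R'} T dh αh h∉ sub = record
  { unknown-und = λ x u → trans (new (λ { refl → true≢false dh u })) (unknown-und T x u)
  ; unknown-U = λ i → trans (new (λ { refl → h∉ i })) (unknown-U T (there i))
  ; decided = dec
  ; glued = λ x m → let b , p , p' = glued T x m in
    b , trans (new (λ { refl → m αh })) p ,
    trans (new (λ e → nothing≢just (trans (sym (unknown-U T (here refl))) (trans (cong S (sym e)) p')))) p'
  ; true-glued = λ x s → true-glued T x (old x s)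
  ; reps = reps T ; reps-size = reps-size T ; reps-Dsc = reps-Dsc T
  ; hub = hub T ; hub-U = λ i → treePath-mono keep (hub-U T (there i))
  ; covered = λ x d → Any.map (treePath-mono keep) (covered T x d)
  ; label = label T ; label-σ = label-σ T ; label-S = λ x s → label-S T x (old x s)
  ; label-reps = label-reps T ; label-small = label-small T
  ; cut = λ x s → let c = cut T x (old x s) in record
    { side = Cut.side c ; side-σ = Cut.side-σ c ; separates = Cut.separates c
    ; side-S = λ y t → Cut.side-S c y (old y t) } }
  where
  nothing≢just : ∀ {b : Bool} → nothing ≡ just b → ⊥
  nothing≢just ()
  new : ∀ {x} → x ≢ h → assign S h h false x ≡ S x
  new u = assign-other S h h false u u
  old : ∀ x → assign S h h false x ≡ just true → S x ≡ just true
  old x s with same? x h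
  ... | inj₁ refl with trans (sym s) (assign-h S h h false)
  ...   | ()
  old x s | inj₂ u = trans (sym (new u)) s
  keep : ∀ x → S x ≡ just true → assign S h h false x ≡ just true × α x ≡ α x
  keep x s = trans (new (λ { refl → nothing≢just (trans (sym (unknown-U T (here refl))) s) })) s , refl
  dec : ∀ {x} → x ∈ R' → assign S h h false x ≡ just false
  dec {x} i with same? x h
  ... | inj₁ refl = assign-h S h h false
  ... | inj₂ u with sub i
  ...   | inj₁ j = trans (new u) (decided T j)
  ...   | inj₂ e = ⊥-elim (u e)

 split-tree : ∀ {α S Dsc R R' κ h g} → Tree α S Dsc [] R κ → h ∈ R → g ∈ R → (∀ {x} → x ∈ R' → x ∈ R) → Tree (match α h g) S Dsc [] R' κ
 split-tree {α} {S} {Dsc} {R} {R'} {κ} {h} {g} T h∈ g∈ sub = record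
  { unknown-und = unknown-und T ; unknown-U = λ () ; decided = decided T ∘ sub
  ; glued = gl
  ; true-glued = λ x s e → true-glued T x s (trans (sym (same x s)) e)
  ; reps = reps T ; reps-size = reps-size T ; reps-Dsc = reps-Dsc T
  ; hub = hub T ; hub-U = λ ()
  ; covered = λ x d → Any.map (treePath-mono (λ y s → s , same y s)) (covered T x d)
  ; label = label T ; label-σ = label-σ T
  ; label-S = λ x s → trans (cong (label T) (same x s)) (label-S T x s)
  ; label-reps = label-reps T ; label-small = label-small T
  ; cut = λ x s → let c = cut T x s in record
    { side = Cut.side c ; side-σ = Cut.side-σ c
    ; separates = λ e → Cut.separates c (trans e (cong (Cut.side c) (same x s)))
    ; side-S = λ y t u v → trans (cong (Cut.side c) (same y t)) (Cut.side-S c y t u (λ e → v (trans e (sym (same x s))))) } }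
  where
  true≢jfalse : ∀ {m : Maybe Bool} → m ≡ just true → m ≡ just false → ⊥
  true≢jfalse refl ()
  same : ∀ x → S x ≡ just true → match α h g x ≡ α x
  same x s = match-other α h g (λ { refl → true≢jfalse s (decided T h∈) }) (λ { refl → true≢jfalse s (decided T g∈) })
  gl : ∀ x → match α h g x ≢ x → ∃ λ b → S x ≡ just b × S (match α h g x) ≡ just b
  gl x m with matchView α h g x
  ... | is-h refl e = false , decided T h∈ , trans (cong S e) (decided T g∈)
  ... | is-g refl e = false , decided T g∈ , trans (cong S e) (decided T h∈)
  ... | is-other _ _ e with glued T x (λ e' → m (trans e e'))
  ...   | b , p , p' = b , p , trans (cong S e) p'

 module Grow {α S Dsc U R κ} (T : Tree α S Dsc U R κ) (inv : Involutive α)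
       (und : ∀ x → Dsc x ≡ false → α x ≡ x) (stable : StableSet σ Dsc)
       {h g : Fin n} (dh : Dsc h ≡ true) (αh : α h ≡ h) (ug : Dsc g ≡ false)
       (d : ℕ) (deg : hasDeg σ (suc d) g ≡ true) (b : Bool) where
  open Discover inj stable d deg ug

  private
   α' : Fin n → Fin n
   α' = match α h g
   S' : Knowledge n
   S' = assign S h g b
   αg : α g ≡ g
   αg = und g ug
   h≢g : h ≢ g
   h≢g refl = true≢false dh ug
   open Match {α = α} inv αh αg h≢g

   outside : ∀ {x} → Dsc x ≡ true → ¬ (x ∈ vs)
   outside dx i = true≢false dx (vs-undiscovered i)

   Sα : ∀ x → S x ≡ just true → Dsc x ≡ true
   Sα x s with Dsc x in eq
   ... | true = refl
   ... | false with trans (sym s) (unknown-und T x eq)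
   ...   | ()

   Dscα : ∀ x → α x ≢ x → Dsc (α x) ≡ true
   Dscα x m with Dsc (α x) in eq
   ... | true = refl
   ... | false = ⊥-elim (m (sym (trans (sym (inv x)) (und (α x) eq))))

   old : ∀ x → S x ≡ just true → (x ≢ h × x ≢ g) × α' x ≡ α x
   old x s = av , match-other α h g (proj₁ av) (proj₂ av)
    where
    av : x ≢ h × x ≢ g
    av = (λ { refl → true-glued T x s αh }) , (λ { refl → true-glued T x s αg })

   keep : ∀ x → S x ≡ just true → S' x ≡ just true × α' x ≡ α x
   keep x s = let (u , v) , e = old x s in trans (assign-other S h g b u v) s , e

   module Extend {A : Set} (a : A) (k : Fin n → A) where
    extend : Fin n → A
    extend x = if member x vs then a else k x

    extend-in : ∀ {x} → x ∈ vs → extend x ≡ a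
    extend-in i rewrite member-complete i = refl

    extend-out : ∀ {x} → Dsc x ≡ true → extend x ≡ k x
    extend-out {x} dx rewrite member-false {x = x} {vs} (outside dx) = refl

    extend-σ : (∀ x → k (σ x) ≡ k x) → ∀ x → extend (σ x) ≡ extend x
    extend-σ q x rewrite member-σ σ inj d deg x | q x = refl

    extend-row : ∀ {c cs} → Dsc c ≡ true → All (λ c → Dsc c ≡ true) cs → All (λ d → k c ≢ k d) cs → All (λ d → extend c ≢ extend d) cs
    extend-row q []       []       = []
    extend-row q (q' ∷ qs) (n ∷ ns) = (λ e → n (trans (sym (extend-out q)) (trans e (extend-out q')))) ∷ extend-row q qs ns

    extend-pairs : ∀ {cs} → All (λ c → Dsc c ≡ true) cs → AllPairs (λ c d → k c ≢ k d) cs → AllPairs (λ c d → extend c ≢ extend d) cs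
    extend-pairs []       []       = []
    extend-pairs (q ∷ qs) (r ∷ rs) = extend-row q qs r ∷ extend-pairs qs rs

   unknown-und' : ∀ x → Dsc' x ≡ false → S' x ≡ nothing
   unknown-und' x u = trans (assign-other S h g b
    (λ { refl → true≢false (discover-⊇ dh) u }) (λ { refl → true≢false (discover-vs (here refl)) u })) (unknown-und T x (discover-false u))

   new-unknown : ∀ {x} → x ∈ orbL σ d (σ g) → S' x ≡ nothing
   new-unknown i = trans (assign-other S h g b (λ { refl → outside dh (there i) })
     (λ { refl → All.lookup (AllPairs.head (orbL-unique σ inj d deg)) i refl })) (unknown-und T _ (vs-undiscovered (there i)))

   glued' : ∀ x → α' x ≢ x → ∃ λ c → S' x ≡ just c × S' (α' x) ≡ just c
   glued' x m with matchView α h g x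
   ... | is-h refl e = b , assign-h S h g b , trans (cong S' e) (assign-g S h g b)
   ... | is-g refl e = b , assign-g S h g b , trans (cong S' e) (assign-h S h g b)
   ... | is-other u v e with glued T x (λ e' → m (trans e e')) | matchedElsewhere u v
   ...   | c , p , p' | u' , v' = c , trans (assign-other S h g b u v) p , trans (cong S' e) (trans (assign-other S h g b u' v') p')

   data TrueView (x : Fin n) : Set where
    new-edge : (x ≡ h × α' x ≡ g) ⊎ (x ≡ g × α' x ≡ h) → b ≡ true → TrueView x
    old-edge : S x ≡ just true → α' x ≡ α x → Dsc x ≡ true → Dsc (α x) ≡ true → TrueView x

   trueView : ∀ x → S' x ≡ just true → TrueView x
   trueView x s with matchView α h g x
   ... | is-h refl e = new-edge (inj₁ (refl , e)) (just-inj (trans (sym (assign-h S h g b)) s))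
    where just-inj : ∀ {c} → just b ≡ just c → b ≡ c
          just-inj refl = refl
   ... | is-g refl e = new-edge (inj₂ (refl , e)) (just-inj (trans (sym (assign-g S h g b)) s))
    where just-inj : ∀ {c} → just b ≡ just c → b ≡ c
          just-inj refl = refl
   ... | is-other u v e = old-edge s' e (Sα x s') (Dscα x (true-glued T x s'))
    where s' = trans (sym (assign-other S h g b u v)) s

   true-glued' : ∀ x → S' x ≡ just true → α' x ≢ x
   true-glued' x s e with trueView x s
   ... | new-edge (inj₁ (refl , e')) _ = h≢g (trans (sym e) e')
   ... | new-edge (inj₂ (refl , e')) _ = h≢g (trans (sym e') e)
   ... | old-edge s' e' _ _ = true-glued T x s' (trans (sym e') e)

   -- The new vertex is put on the side of h, so that the new edge does not cross the cut.
   oldCut : ∀ {x} → S x ≡ just true → α' x ≡ α x → Dsc x ≡ true → Dsc (α x) ≡ true → Cut α' S' x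
   oldCut {x} s e dx dαx = record
    { side = extend
    ; side-σ = extend-σ (Cut.side-σ c)
    ; separates = λ q → Cut.separates c (trans (sym (extend-out dx)) (trans q (trans (cong extend e) (extend-out dαx))))
    ; side-S = edge }
    where
    c : Cut α S x
    c = cut T x s
    open Extend (Cut.side c h) (Cut.side c)
    edge : ∀ y → S' y ≡ just true → y ≢ x → y ≢ α' x → extend (α' y) ≡ extend y
    edge y t u v with trueView y t
    ... | new-edge (inj₁ (refl , e')) _ = trans (cong extend e') (trans (extend-in (here refl)) (sym (extend-out dh)))
    ... | new-edge (inj₂ (refl , e')) _ = trans (cong extend e') (trans (extend-out dh) (sym (extend-in (here refl))))
    ... | old-edge s' e' dy dαy = trans (cong extend e') (trans (extend-out dαy)
     (trans (Cut.side-S c y s' u (λ q → v (trans q (sym e)))) (sym (extend-out dy))))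

   vs-path : ∀ {x} → x ∈ vs → TreePath α' S' g x
   vs-path i with ∈-orbL σ {suc d} i
   ... | j , _ , e = treePath-orb α' S' (j , e)

  -- The edge is outside the forest, so the vertex begins a tree of its own, and its remaining
  -- half-edges are the undecided ones from now on.
  grow-new : b ≡ false → ∀ {R'} → (∀ {x} → x ∈ R' → S' x ≡ just false) → Tree α' S' Dsc' (orbL σ d (σ g)) R' (suc κ)
  grow-new refl dec = record
   { unknown-und = unknown-und' ; unknown-U = new-unknown ; decided = dec
   ; glued = glued' ; true-glued = true-glued'
   ; reps = g ∷ reps T ; reps-size = cong suc (reps-size T)
   ; reps-Dsc = discover-vs (here refl) ∷ All.map discover-⊇ (reps-Dsc T)
   ; hub = g ; hub-U = vs-path ∘ there
   ; covered = cov
   ; label = Extend.extend κ (label T) ; label-σ = Extend.extend-σ κ (label T) (label-σ T)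
   ; label-S = lab
   ; label-reps = fresh (reps-Dsc T) (label-small T) ∷ Extend.extend-pairs κ (label T) (reps-Dsc T) (label-reps T)
   ; label-small = subst (_< suc κ) (sym (Extend.extend-in κ (label T) (here refl))) ≤-refl ∷ small (reps-Dsc T) (label-small T)
   ; cut = λ x s → oldEdge x s }
   where
   open Extend κ (label T)
   cov : ∀ x → Dsc' x ≡ true → Any (λ c → TreePath α' S' c x) (g ∷ reps T)
   cov x dx with ∨-split {Dsc x} dx
   ... | inj₁ dx' = there (Any.map (treePath-mono keep) (covered T x dx'))
   ... | inj₂ i = here (vs-path (member-sound vs i))
   lab : ∀ x → S' x ≡ just true → extend (α' x) ≡ extend x
   lab x s with trueView x s
   ... | old-edge s' e dx dαx = trans (cong extend e) (trans (extend-out dαx) (trans (label-S T x s') (sym (extend-out dx))))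
   oldEdge : ∀ x → S' x ≡ just true → Cut α' S' x
   oldEdge x s with trueView x s
   ... | old-edge s' e dx dαx = oldCut s' e dx dαx
   fresh : ∀ {cs} → All (λ c → Dsc c ≡ true) cs → All (λ c → label T c < κ) cs → All (λ c → extend g ≢ extend c) cs
   fresh []       []       = []
   fresh (q ∷ qs) (l ∷ ls) = (λ e → <-irrefl (trans (sym (extend-out q)) (trans (sym e) (extend-in (here refl)))) l) ∷ fresh qs ls
   small : ∀ {cs} → All (λ c → Dsc c ≡ true) cs → All (λ c → label T c < κ) cs → All (λ c → extend c < suc κ) cs
   small []       []       = []
   small (q ∷ qs) (l ∷ ls) = subst (_< suc κ) (sym (extend-out q)) (<⇒≤ (s≤s l)) ∷ small qs ls

  grow-tree : b ≡ true → TreePath α S (hub T) h → ∀ {U'} → (∀ {x} → x ∈ U' → x ∈ U × x ≢ h × Dsc x ≡ true) →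
   (∀ {x} → x ∈ R → x ≢ h) → Tree α' S' Dsc' (orbL σ d (σ g) ++ U') R κ
  grow-tree refl hub-h {U'} U'⊆ R∌h = record
   { unknown-und = unknown-und' ; unknown-U = unkU
   ; decided = λ {x} i → trans (assign-other S h g b (R∌h i) (λ { refl → nj (unknown-und T g ug) (decided T i) })) (decided T i)
   ; glued = glued' ; true-glued = true-glued'
   ; reps = reps T ; reps-size = reps-size T ; reps-Dsc = All.map discover-⊇ (reps-Dsc T)
   ; hub = hub T ; hub-U = hubU
   ; covered = cov
   ; label = Extend.extend (label T h) (label T) ; label-σ = Extend.extend-σ (label T h) (label T) (label-σ T)
   ; label-S = lab
   ; label-reps = Extend.extend-pairs (label T h) (label T) (reps-Dsc T) (label-reps T)
   ; label-small = small (reps-Dsc T) (label-small T)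
   ; cut = cuts }
   where
   open Extend (label T h) (label T)
   nj : ∀ {m : Maybe Bool} {c} → m ≡ nothing → m ≡ just c → ⊥
   nj refl ()
   bridge : TreePath α' S' h g
   bridge = step stop (∨-right {σ h =ᶠ g} (∧-join (cong isTrue (assign-h S h g b)) (=ᶠ-true (match-h α h g))))
   unkU : ∀ {x} → x ∈ orbL σ d (σ g) ++ U' → S' x ≡ nothing
   unkU i with ∈-++⁻ (orbL σ d (σ g)) i
   ... | inj₁ j = new-unknown j
   ... | inj₂ j = trans (assign-other S h g b (proj₁ (proj₂ (U'⊆ j))) (λ { refl → true≢false (proj₂ (proj₂ (U'⊆ j))) ug })) (unknown-U T (proj₁ (U'⊆ j)))
   hubU : ∀ {x} → x ∈ orbL σ d (σ g) ++ U' → TreePath α' S' (hub T) x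
   hubU i with ∈-++⁻ (orbL σ d (σ g)) i
   ... | inj₁ j = path-trans (treePath-mono keep hub-h) (path-trans bridge (vs-path (there j)))
   ... | inj₂ j = treePath-mono keep (hub-U T (proj₁ (U'⊆ j)))
   cov : ∀ x → Dsc' x ≡ true → Any (λ c → TreePath α' S' c x) (reps T)
   cov x dx with ∨-split {Dsc x} dx
   ... | inj₁ dx' = Any.map (treePath-mono keep) (covered T x dx')
   ... | inj₂ i = Any.map (λ p → path-trans (treePath-mono keep p) (path-trans bridge (vs-path (member-sound vs i)))) (covered T h dh)
   lab : ∀ x → S' x ≡ just true → extend (α' x) ≡ extend x
   lab x s with trueView x s
   ... | new-edge (inj₁ (refl , e)) _ = trans (cong extend e) (trans (extend-in (here refl)) (sym (extend-out dh)))
   ... | new-edge (inj₂ (refl , e)) _ = trans (cong extend e) (trans (extend-out dh) (sym (extend-in (here refl))))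
   ... | old-edge s' e dx dαx = trans (cong extend e) (trans (extend-out dαx) (trans (label-S T x s') (sym (extend-out dx))))
   -- The new vertex against everything else: so far the edge between h and g is its only one.
   newCut : ∀ {x} → (x ≡ h × α' x ≡ g) ⊎ (x ≡ g × α' x ≡ h) → Cut α' S' x
   newCut {x} end = record
    { side = λ y → member y vs ; side-σ = member-σ σ inj d deg
    ; separates = sep end
    ; side-S = edge end }
    where
    inG : member g vs ≡ true
    inG = member-complete {ys = vs} (here refl)
    outH : member h vs ≡ false
    outH = member-false (outside dh)
    sep : (x ≡ h × α' x ≡ g) ⊎ (x ≡ g × α' x ≡ h) → member x vs ≢ member (α' x) vs
    sep (inj₁ (refl , e)) q = true≢false (trans q (trans (cong (λ y → member y vs) e) inG)) outH
    sep (inj₂ (refl , e)) q = true≢false inG (trans q (trans (cong (λ y → member y vs) e) outH))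
    edge : (x ≡ h × α' x ≡ g) ⊎ (x ≡ g × α' x ≡ h) → ∀ y → S' y ≡ just true → y ≢ x → y ≢ α' x → member (α' y) vs ≡ member y vs
    edge end y t u v with trueView y t
    ... | old-edge s' e dy dαy = trans (cong (λ y → member y vs) e) (trans (member-false (outside dαy)) (sym (member-false (outside dy))))
    edge (inj₁ (refl , e)) y t u v | new-edge (inj₁ (q , _)) _ = ⊥-elim (u q)
    edge (inj₁ (refl , e)) y t u v | new-edge (inj₂ (q , _)) _ = ⊥-elim (v (trans q (sym e)))
    edge (inj₂ (refl , e)) y t u v | new-edge (inj₁ (q , _)) _ = ⊥-elim (v (trans q (sym e)))
    edge (inj₂ (refl , e)) y t u v | new-edge (inj₂ (q , _)) _ = ⊥-elim (u q)
   cuts : ∀ x → S' x ≡ just true → Cut α' S' x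
   cuts x s with trueView x s
   ... | new-edge end _ = newCut end
   ... | old-edge s' e dx dαx = oldCut s' e dx dαx
   small : ∀ {cs} → All (λ c → Dsc c ≡ true) cs → All (λ c → label T c < κ) cs → All (λ c → extend c < κ) cs
   small []       []       = []
   small (q ∷ qs) (l ∷ ls) = subst (_< κ) (sym (extend-out q)) l ∷ small qs ls

-- c j k st a κ is the coefficient attached to an exploration with j undecided and k decided open
-- half-edges in the active word, waiting words of lengths st, a faces still to be closed and κ
-- trees already met; the total number of trees has to be suc M.
record Recursion (p' M : ℕ) (c : ℕ → ℕ → List ℕ → ℕ → ℕ → ℤ) : Set where
 field
  c-undecided : ∀ j k st a κ → c (suc j) k st a κ ≡ c j (suc k) st a κ ℤ.+ c (suc (suc p') + j) k st a κ
  c-decided   : ∀ k st a κ → c 0 (suc k) st a κ ≡ splitSum (λ i l → c 0 i (l ∷ st) a κ) 0 k ℤ.+ c (suc (suc p')) k st a (suc κ)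
  c-pop       : ∀ k st a κ → c 0 0 (k ∷ st) (suc a) κ ≡ c 0 k st a κ
  c-end       : c 0 0 [] 1 (suc M) ≡ + 1
  c-end'      : ∀ κ → κ ≢ suc M → c 0 0 [] 1 κ ≡ + 0
  c-end''     : ∀ a κ → c 0 0 [] (suc (suc a)) κ ≡ + 0
  c-vanish    : ∀ j k st a κ → (∀ w → a + a ≢ 2 + (length st + length st) + (j + k + sum st) + w * suc p') → c j k st a κ ≡ + 0

-- With v vertices left, the next one can be entered through any of v p undiscovered half-edges. A
-- labelled count exceeds the coefficient of the recursion by the product of these numbers.
choices : ℕ → ℕ → ℕ
choices p zero    = 1
choices p (suc v) = (suc v * p) * choices p v

sumFin-const : ∀ n (b : Fin n → Bool) (t : Fin n → ℕ) C → (∀ g → b g ≡ true → t g ≡ C) → sumFin n (λ g → indicator (b g) * t g) ≡ countF n b * C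
sumFin-const n b t C q = trans (sumOver-cong (allFin n) each)
  (trans (sumOver-*ʳ (allFin n) (indicator ∘ b) C) (cong (_* C) (sym (countF-sumFin n b))))
 where
 each : ∀ g → indicator (b g) * t g ≡ indicator (b g) * C
 each g with b g in eq
 ... | true  = cong (1 *_) (q g eq)
 ... | false = refl

-- Counting the completions of an exploration with a fixed rotation.

module Explore {n} (σ : Fin n → Fin n) (inj : Inj σ) (r : Fin n) (p' : ℕ)
 (D₀ : Fin n → Bool) (deg : ∀ x → D₀ x ≡ false → hasDeg σ (suc (suc (suc p'))) x ≡ true) (f M : ℕ)
 (eulerF : 2 * numCycles σ + 2 * f ≡ n + 4)
 (c : ℕ → ℕ → List ℕ → ℕ → ℕ → ℤ) (C : Recursion p' M c) where

 open Geo σ inj r (suc p') D₀ deg f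
 open Forest σ inj
 open Recursion C
 open Partial
 open Tree

 good : (Fin n → Fin n) → (Fin n → Bool) → Bool
 good α S = isFPFInvolution α ∧ isConnected σ α r ∧ isPlanar σ α ∧ isEdgeSubset α S ∧ isForest σ α S
  ∧ ⌊ numCycles (λ h → σ (α h)) ℕ.≟ f ⌋ ∧ ⌊ numComponents σ α S ℕ.≟ suc M ⌋

 without : (Fin n → Fin n) → (Fin n → Bool) → Fin n → Fin n → Bool
 without α S h g = S g ∧ not (g =ᶠ h) ∧ not (g =ᶠ α h)

 record Good (α : Fin n → Fin n) (S : Fin n → Bool) : Set where
  field
   invol   : Involutive α
   fpf     : ∀ h → α h ≢ h
   linked  : ∀ h → Path (adjMap σ α) r h
   edgeset : ∀ h → S h ≡ S (α h)
   acyclic : ∀ h → S h ≡ true → ¬ Path (adjSub σ α (without α S h)) h (α h)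
   faces   : numCycles (σ ∘ α) ≡ f
   trees   : numComponents σ α S ≡ suc M

 good-sound : ∀ {α S} → good α S ≡ true → Good α S
 good-sound {α} {S} t with ∧-split {isFPFInvolution α} t
 ... | t1 , t with ∧-split {isConnected σ α r} t
 ... | t2 , t with ∧-split {isPlanar σ α} t
 ... | _ , t with ∧-split {isEdgeSubset α S} t
 ... | t4 , t with ∧-split {isForest σ α S} t
 ... | t5 , t with ∧-split {⌊ numCycles (λ h → σ (α h)) ℕ.≟ f ⌋} t
 ... | t6 , t7 = record
  { invol = λ h → =ᶠ-eq (proj₁ (∧-split {α (α h) =ᶠ h} (allF-sound n t1 h)))
  ; fpf = λ h e → true≢false (=ᶠ-true e) (not-true (proj₂ (∧-split {α (α h) =ᶠ h} (allF-sound n t1 h))))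
  ; linked = λ h → reach-sound (allF-sound n {reach (adjMap σ α) r} t2 h)
  ; edgeset = λ h → true-dec (S h Bool.≟ S (α h)) (allF-sound n t4 h)
  ; acyclic = λ h s p → true≢false (reach-complete p)
    (not-true (implies-split (allF-sound n {λ h → not (S h) ∨ not (reach (adjSub σ α (without α S h)) h (α h))} t5 h) s))
  ; faces = true-dec (numCycles (σ ∘ α) ℕ.≟ f) t6
  ; trees = true-dec (numComponents σ α S ℕ.≟ suc M) t7 }

 good-complete : ∀ {α S} → Good α S → good α S ≡ true
 good-complete {α} {S} G = ∧-join (allF-complete n (λ h → ∧-join (=ᶠ-true (invol h)) (not-false (=ᶠ-false (fpf h)))))
  (∧-join (allF-complete n {reach (adjMap σ α) r} (λ h → reach-complete (linked h)))
  (∧-join (dec-true (2 * numCycles σ + 2 * numCycles (λ h → σ (α h)) ℕ.≟ (n + 4)) (trans (cong (λ x → 2 * numCycles σ + 2 * x) faces) eulerF))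
  (∧-join (allF-complete n (λ h → dec-true (S h Bool.≟ S (α h)) (edgeset h)))
  (∧-join (allF-complete n {λ h → not (S h) ∨ not (reach (adjSub σ α (without α S h)) h (α h))}
    (λ h → implies-join (λ s → not-false (¬true⇒false (λ t → acyclic h s (reach-sound t)))))) (∧-join (dec-true (numCycles (σ ∘ α) ℕ.≟ f) faces)
      (dec-true (numComponents σ α S ℕ.≟ suc M) trees))))))
  where open Good G

 agreesα : (Fin n → Fin n) → (Fin n → Fin n) → Bool
 agreesα α₀ α = allF n (λ x → (α₀ x =ᶠ x) ∨ (α x =ᶠ α₀ x))

 agrees : Maybe Bool → Bool → Bool
 agrees nothing  _ = true
 agrees (just b) s = ⌊ s Bool.≟ b ⌋

 -- Fixed points of α₀ are open and entries `nothing` of S₀ are unknown; only there is a completion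
 -- free.
 query : (Fin n → Fin n) → Knowledge n → (Fin n → Fin n) → (Fin n → Bool) → Bool
 query α₀ S₀ α S = agreesα α₀ α ∧ allF n (λ x → agrees (S₀ x) (S x)) ∧ good α S

 record Extends (α₀ : Fin n → Fin n) (S₀ : Knowledge n) (α : Fin n → Fin n) (S : Fin n → Bool) : Set where
  constructor extends
  field
   extα   : ∀ x → α₀ x ≢ x → α x ≡ α₀ x
   extS   : ∀ x {b} → S₀ x ≡ just b → S x ≡ b
   isGood : Good α S
  open Good isGood public

 query-sound : ∀ {α₀ S₀ α S} → query α₀ S₀ α S ≡ true → Extends α₀ S₀ α S
 query-sound {α₀} {S₀} {α} {S} t with ∧-split {agreesα α₀ α} t
 ... | t1 , t with ∧-split {allF n (λ x → agrees (S₀ x) (S x))} t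
 ... | t2 , t3 = extends ea es (good-sound t3)
  where
  ea : ∀ x → α₀ x ≢ x → α x ≡ α₀ x
  ea x m with ∨-split {α₀ x =ᶠ x} (allF-sound n t1 x)
  ... | inj₁ e = ⊥-elim (m (=ᶠ-eq e))
  ... | inj₂ e = =ᶠ-eq e
  es : ∀ x {b} → S₀ x ≡ just b → S x ≡ b
  es x {b} e = true-dec (S x Bool.≟ b) (subst (λ m → agrees m (S x) ≡ true) e (allF-sound n {λ x → agrees (S₀ x) (S x)} t2 x))

 query-complete : ∀ {α₀ S₀ α S} → Extends α₀ S₀ α S → query α₀ S₀ α S ≡ true
 query-complete {α₀} {S₀} {α} {S} (extends ea es G) =
  ∧-join (allF-complete n each) (∧-join (allF-complete n (λ x → agree (S₀ x) refl)) (good-complete G))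
  where
  each : ∀ x → (α₀ x =ᶠ x) ∨ (α x =ᶠ α₀ x) ≡ true
  each x with same? (α₀ x) x
  ... | inj₁ e = ∨-left (=ᶠ-true e)
  ... | inj₂ m = ∨-right {α₀ x =ᶠ x} (=ᶠ-true (ea x m))
  agree : ∀ {x} m → S₀ x ≡ m → agrees m (S x) ≡ true
  agree nothing  _ = refl
  agree {x} (just b) e = dec-true (S x Bool.≟ b) (es x e)

 -- Adding the edge h-g of kind b refines the query.
 refine : ∀ {α₀ S₀ h g} b → Involutive α₀ → α₀ h ≡ h → α₀ g ≡ g → h ≢ g →
  (∀ {c} → S₀ h ≡ just c → c ≡ b) → (∀ {c} → S₀ g ≡ just c → c ≡ b) → ∀ {α S} →
  Extends (match α₀ h g) (assign S₀ h g b) α S → α h ≡ g × S h ≡ b × Extends α₀ S₀ α S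
 refine {α₀} {S₀} {h} {g} b inv αh αg h≢g Sh Sg {α} {S} E = trans (E.extα h (λ e → h≢g (trans (sym e) (match-h α₀ h g)))) (match-h α₀ h g) ,
  E.extS h (assign-h S₀ h g b) , extends ea es E.isGood
  where
  module E = Extends E
  ea : ∀ x → α₀ x ≢ x → α x ≡ α₀ x
  ea x m = trans (E.extα x (λ e → m (trans (sym o) e))) o
   where o = match-other α₀ h g (λ { refl → m αh }) (λ { refl → m αg })
  es : ∀ x {c} → S₀ x ≡ just c → S x ≡ c
  es x e with same? x h | same? x g
  ... | inj₁ refl | _ = trans (E.extS x (assign-h S₀ h g b)) (sym (Sh e))
  ... | inj₂ _ | inj₁ refl = trans (E.extS x (assign-g S₀ h g b)) (sym (Sg e))
  ... | inj₂ u | inj₂ v = E.extS x (trans (assign-other S₀ h g b u v) e)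

 coarsen : ∀ {α₀ S₀ h g} b {α S} → α h ≡ g → S h ≡ b → Extends α₀ S₀ α S → Extends (match α₀ h g) (assign S₀ h g b) α S
 coarsen {α₀} {S₀} {h} {g} b {α} {S} αh Sh E = extends ea es E.isGood
  where
  module E = Extends E
  ea : ∀ x → match α₀ h g x ≢ x → α x ≡ match α₀ h g x
  ea x m with matchView α₀ h g x
  ... | is-h refl e = trans αh (sym e)
  ... | is-g refl e = trans (trans (cong α (sym αh)) (E.invol h)) (sym e)
  ... | is-other _ _ e = trans (E.extα x (λ e' → m (trans e e'))) (sym e)
  just-inj : ∀ {b c : Bool} → just b ≡ just c → b ≡ c
  just-inj refl = refl
  es : ∀ x {c} → assign S₀ h g b x ≡ just c → S x ≡ c
  es x e with same? x h | same? x g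
  ... | inj₁ refl | _ = trans Sh (just-inj (trans (sym (assign-h S₀ h g b)) e))
  ... | inj₂ _ | inj₁ refl = trans (trans (cong S (sym αh)) (trans (sym (E.edgeset h)) Sh)) (just-inj (trans (sym (assign-g S₀ h g b)) e))
  ... | inj₂ u | inj₂ v = E.extS x (trans (sym (assign-other S₀ h g b u v)) e)

 -- If α h were already glued in α₀, its partner there would have to be h, which is open.
 partner-open : ∀ {α₀ S₀ Dsc ws e v α S h} → Partial α₀ Dsc ws e v → α₀ h ≡ h → Extends α₀ S₀ α S → Dsc (α h) ≡ true → α h ∈ concat ws
 partner-open {α₀} {α = α} {h = h} P αh E d with same? (α₀ (α h)) (α h)
 ... | inj₁ o = open-mem P _ d o
 ... | inj₂ m = ⊥-elim (E.fpf h (trans (sym (inv P (α h))) (trans (cong α₀ (trans (sym (E.extα _ m)) (E.invol h))) αh)))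
  where module E = Extends E

 length-words : ∀ (U D : List (Fin n)) st → length (concat ((U ++ D) ∷ st)) ≡ length U + length D + sum (map length st)
 length-words U D st = trans (length-++ (U ++ D)) (cong₂ _+_ (length-++ U) (lengths st))
  where
  lengths : ∀ (st : List (List (Fin n))) → length (concat st) ≡ sum (map length st)
  lengths []       = refl
  lengths (w ∷ st) = trans (length-++ w) (cong (λ z → length w + z) (lengths st))

 p : ℕ
 p = suc (suc (suc p'))

 Answer : (α₀ : Fin n → Fin n) (S₀ : Knowledge n) (v : ℕ) → ℤ → Set
 Answer α₀ S₀ v X = + total (query α₀ S₀) ≡ + choices p v ℤ.* X

 -- All v p undiscovered half-edges contribute equally, which supplies the factor between
 -- `choices p v'` and `choices p v`. For v = 0 there is nothing to enter, and the coefficient must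
 -- be zero as well.
 newVertices : ∀ (Dsc : Fin n → Bool) (t : Fin n → ℕ) v X → countF n (not ∘ Dsc) ≡ v * p →
  (∀ v' → v ≡ suc v' → ∀ g → Dsc g ≡ false → + t g ≡ + choices p v' ℤ.* X) → (v ≡ 0 → X ≡ + 0) →
  + sumFin n (λ g → indicator (not (Dsc g)) * t g) ≡ + choices p v ℤ.* X
 newVertices Dsc t zero X cnt each none = begin
  + sumFin n (λ g → indicator (not (Dsc g)) * t g)
   ≡⟨ cong +_ (sumFin-const n (not ∘ Dsc) t 0 (λ g q → ⊥-elim (true≢false q (countF-none n cnt g)))) ⟩
  + (countF n (not ∘ Dsc) * 0) ≡⟨ cong +_ (*-zeroʳ (countF n (not ∘ Dsc))) ⟩
  + 0 ≡⟨ sym (ℤP.*-zeroʳ (+ 1)) ⟩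
  + 1 ℤ.* + 0 ≡⟨ cong (+ 1 ℤ.*_) (sym (none refl)) ⟩
  + 1 ℤ.* X ∎
  where open ≡-Reasoning
 newVertices Dsc t (suc v) X cnt each none with countF-witness n _ cnt
 ... | g₀ , u = begin
  + sumFin n (λ g → indicator (not (Dsc g)) * t g) ≡⟨ cong +_ (sumFin-const n (not ∘ Dsc) t (t g₀) (λ g q → ℤP.+-injective
      (trans (each v refl g (not-true q)) (sym (each v refl g₀ (not-true u)))))) ⟩
  + (countF n (not ∘ Dsc) * t g₀) ≡⟨ cong (λ k → + (k * t g₀)) cnt ⟩
  + (suc v * p * t g₀) ≡⟨ ℤP.pos-* (suc v * p) (t g₀) ⟩
  + (suc v * p) ℤ.* + t g₀ ≡⟨ cong (+ (suc v * p) ℤ.*_) (each v refl g₀ (not-true u)) ⟩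
  + (suc v * p) ℤ.* (+ choices p v ℤ.* X) ≡⟨ sym (ℤP.*-assoc (+ (suc v * p)) (+ choices p v) X) ⟩
  + (suc v * p) ℤ.* + choices p v ℤ.* X ≡⟨ cong (ℤ._* X) (sym (ℤP.pos-* (suc v * p) (choices p v))) ⟩
  + choices p (suc v) ℤ.* X ∎
  where open ≡-Reasoning

 -- With no vertex left, Euler's relation holds before the step. The half-edges of a further vertex
 -- only enlarge its right side, and no w can compensate this.
 no-new-vertex : ∀ j k st a κ e → a + 0 ≡ suc (length st + suc e) → suc e + suc e ≡ suc (j + k + sum st) + 0 → c (suc (suc p') + j) k st a κ ≡ + 0
 no-new-vertex j k st a κ e qa qe = c-vanish _ k st a κ λ w bad → <-irrefl bad (begin-strict a + a ≡⟨ cong₂ _+_ a≡ a≡ ⟩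
  suc (length st + suc e) + suc (length st + suc e) ≡⟨ solve 2 (λ l e → (con 1 :+ (l :+ (con 1 :+ e))) :+ (con 1 :+ (l :+ (con 1 :+ e))) :=
      con 2 :+ (l :+ l) :+ ((con 1 :+ e) :+ (con 1 :+ e))) refl (length st) e ⟩
  2 + (length st + length st) + (suc e + suc e) ≡⟨ cong (λ z → 2 + (length st + length st) + z) (trans qe (+-identityʳ _)) ⟩
  2 + (length st + length st) + suc (j + k + sum st)
   <⟨ +-monoʳ-< (2 + (length st + length st)) (s≤s (s≤s (+-monoˡ-≤ (sum st) (+-monoˡ-≤ k (m≤n+m j p'))))) ⟩
  2 + (length st + length st) + (suc (suc p') + j + k + sum st) ≤⟨ m≤m+n _ (w * suc p') ⟩
  2 + (length st + length st) + (suc (suc p') + j + k + sum st) + w * suc p' ∎)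
  where
  open ≤-Reasoning
  open +-*-Solver
  a≡ : a ≡ suc (length st + suc e)
  a≡ = trans (sym (+-identityʳ a)) qa

 module Finish {α₀ S₀ Dsc κ} (P : Partial α₀ Dsc ([] ∷ []) 0 0) (T : Tree α₀ S₀ Dsc [] [] κ) where

  private
   all-discovered : ∀ x → Dsc x ≡ true
   all-discovered x with Dsc x in eq
   ... | true  = refl
   ... | false = ⊥-elim (true≢false (not-false eq) (countF-none n (count P) x))

   closed : ∀ x → α₀ x ≢ x
   closed x e with open-mem P x (all-discovered x) e
   ... | ()

   point = total-point α₀ (isTrue ∘ S₀)
   α = proj₁ point
   S = proj₁ (proj₂ point)
   α≗ : ∀ x → α x ≡ α₀ x
   α≗ = proj₁ (proj₂ (proj₂ point))
   S≗ : ∀ x → S x ≡ isTrue (S₀ x)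
   S≗ = proj₁ (proj₂ (proj₂ (proj₂ point)))

   known : ∀ x {b} → S₀ x ≡ just b → S x ≡ b
   known x e = trans (S≗ x) (cong isTrue e)

   known' : ∀ x {b} → S x ≡ b → S₀ x ≡ just b
   known' x e with glued T x (closed x)
   ... | b , p , _ = trans p (cong just (trans (sym (known x p)) e))

   total-finish : total (query α₀ S₀) ≡ indicator (query α₀ S₀ α S)
   total-finish = proj₂ (proj₂ (proj₂ (proj₂ point))) (query α₀ S₀) λ α' S' t →
    let module E = Extends (query-sound {α₀} {S₀} t) in
    (λ x → E.extα x (closed x)) ,
    (λ x → let b , p , _ = glued T x (closed x) in trans (E.extS x p) (sym (cong isTrue p)))

   E : Fin n → Fin n → Set
   E = Path (adjSub σ α S)

   same-adj : ∀ x y → adjSub σ α S x y ≡ adjKnown α₀ S₀ x y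
   same-adj x y = cong ((σ x =ᶠ y) ∨_) (cong₂ (λ s a → s ∧ (a =ᶠ y)) (S≗ x) (α≗ x))

   to : ∀ {x y} → E x y → TreePath α₀ S₀ x y
   to = path-map (λ {x} {y} a → step stop (trans (sym (same-adj x y)) a))

   from : ∀ {x y} → TreePath α₀ S₀ x y → E x y
   from = path-map (λ {x} {y} a → step stop (trans (same-adj x y) a))

   E-sym : ∀ {x y} → E x y → E y x
   E-sym p = from (treePath-sym (inv P) T (to p))

   open Equivalence E stop E-sym path-trans

   treeReps : Reps E κ
   treeReps = mkReps (reps T) (reps-size T) (distinct (label-reps T)) (λ x → Any.map (E-sym ∘ from) (covered T x (all-discovered x)))
    where
    link : ∀ {x y} → adjKnown α₀ S₀ x y ≡ true → label T y ≡ label T x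
    link {x} {y} a with ∨-split {σ x =ᶠ y} a
    ... | inj₁ s = trans (cong (label T) (sym (=ᶠ-eq s))) (label-σ T x)
    ... | inj₂ t with ∧-split {isTrue (S₀ x)} t
    ...   | i , e = trans (cong (label T) (sym (=ᶠ-eq e))) (label-S T x (isTrue-just i))
    distinct : ∀ {cs} → AllPairs (λ c d → label T c ≢ label T d) cs → AllPairs (λ c d → ¬ E c d) cs
    distinct []       = []
    distinct (r ∷ rs) = All.map (λ ne p → ne (sym (path-invariant (label T) link (to p)))) r ∷ distinct rs

   components : numComponents σ α S ≡ κ
   components = reps-unique (minimalReps _ minimal descend) treeReps
    where
    isMin : Fin n → Bool
    isMin h = allF n (λ g → not (reach (adjSub σ α S) h g) ∨ (toℕ h ℕ.≤ᵇ toℕ g))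
    below : ∀ {x y} → isMin x ≡ true → E x y → toℕ x ≤ toℕ y
    below {x} {y} q p = ≤ᵇ-sound (implies-split (allF-sound n {λ g → not (reach (adjSub σ α S) x g) ∨ (toℕ x ℕ.≤ᵇ toℕ g)} q y) (reach-complete p))
    minimal : ∀ {x y} → isMin x ≡ true → isMin y ≡ true → E x y → x ≡ y
    minimal qx qy p = toℕ-injective (≤-antisym (below qx p) (below qy (E-sym p)))
     where open import Data.Fin.Properties using (toℕ-injective)
    descend : ∀ x → isMin x ≡ false → ∃ λ y → toℕ y < toℕ x × E x y
    descend x q with allF-witness n {λ g → not (reach (adjSub σ α S) x g) ∨ (toℕ x ℕ.≤ᵇ toℕ g)} q
    ... | y , t with implies-false {reach (adjSub σ α S) x y} t
    ...   | ρ , l = y , ≤ᵇ-false l , reach-sound ρ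

   isGood : κ ≡ suc M → Good α S
   isGood κ≡ = record
    { invol = λ h → trans (trans (cong α (α≗ h)) (α≗ (α₀ h))) (inv P h)
    ; fpf = λ h e → closed h (trans (sym (α≗ h)) e)
    ; linked = λ h → path-map (λ {x} {y} a → step stop (trans (cong (λ z → (σ x =ᶠ y) ∨ (z =ᶠ y)) (α≗ x)) a)) (conn P h (all-discovered h))
    ; edgeset = λ h → let b , p , p' = glued T h (closed h) in
      trans (known h p) (sym (trans (cong S (α≗ h)) (known (α₀ h) p')))
    ; acyclic = acyc
    ; faces = trans (numCycles-cong {π = λ x → σ (α x)}
       (λ {x} {y} e → involutive⇒inj (inv P) (trans (sym (α≗ x)) (trans (inj e) (α≗ y)))) (λ x → cong σ (α≗ x)))
      (trans (sym (+-identityʳ _)) (trans (euler P) (+-identityʳ f)))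
    ; trees = trans components κ≡ }
    where
    acyc : ∀ h → S h ≡ true → ¬ Path (adjSub σ α (without α S h)) h (α h)
    acyc h s p = Cut.separates k (trans (sym (path-invariant (Cut.side k) link p)) (cong (Cut.side k) (α≗ h)))
     where
     k = cut T h (known' h s)
     link : ∀ {x y} → adjSub σ α (without α S h) x y ≡ true → Cut.side k y ≡ Cut.side k x
     link {x} {y} a with ∨-split {σ x =ᶠ y} a
     ... | inj₁ e = trans (cong (Cut.side k) (sym (=ᶠ-eq e))) (Cut.side-σ k x)
     ... | inj₂ t with ∧-split {without α S h x} t
     ...   | t1 , e with ∧-split {S x} t1
     ...     | sx , t2 with ∧-split {not (x =ᶠ h)} t2
     ...       | t3 , t4 = trans (cong (Cut.side k) (trans (sym (=ᶠ-eq e)) (α≗ x)))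
      (Cut.side-S k x (known' x sx) (λ q → true≢false (=ᶠ-true q) (not-true t3))
       (λ q → true≢false (=ᶠ-true (trans q (sym (α≗ h)))) (not-true t4)))

  -- Every half-edge is glued and decided, which leaves a single completion. It meets all
  -- requirements except possibly the number of trees, and is counted precisely when κ = M + 1.
  finish : Answer α₀ S₀ 0 (c 0 0 [] 1 κ)
  finish with κ ℕ.≟ suc M
  ... | yes refl = trans (cong +_ (trans total-finish (cong indicator (query-complete {α₀} {S₀}
      (extends (λ x _ → α≗ x) (λ x e → known x e) (isGood refl)))))) (sym (cong (+ 1 ℤ.*_) c-end))
  ... | no ne = trans (cong +_ (trans total-finish (cong indicator
      (¬true⇒false {query α₀ S₀ α S} (λ t → ne (trans (sym components) (Extends.trees (query-sound {α₀} {S₀} t))))))))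
     (sym (cong (+ 1 ℤ.*_) (c-end' κ ne)))

 answer-+ : ∀ v x y X Y → + x ≡ + choices p v ℤ.* X → + y ≡ + choices p v ℤ.* Y → + (x + y) ≡ + choices p v ℤ.* (X ℤ.+ Y)
 answer-+ v x y X Y a b = trans (ℤP.pos-+ x y) (trans (cong₂ ℤ._+_ a b) (sym (ℤP.*-distribˡ-+ (+ choices p v) X Y)))

 extends-cong : ∀ {α₀ S₀ S₁ α S} → (∀ x → S₁ x ≡ S₀ x) → Extends α₀ S₀ α S → Extends α₀ S₁ α S
 extends-cong q E = extends (Extends.extα E) (λ x e → Extends.extS E x (trans (sym (q x)) e)) (Extends.isGood E)

 mutual

  -- a is the number of faces still to be closed. All half-edges of the current tree are decided
  -- before one outside the forest is glued; in that phase no tree met so far can grow any more.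
  explore : ∀ e st U D {α₀ S₀ Dsc v κ a} → Partial α₀ Dsc ((U ++ D) ∷ st) e v → Tree α₀ S₀ Dsc U (D ++ concat st) κ → a + v ≡ suc (length st + e) →
   Answer α₀ S₀ v (c (length U) (length D) (map length st) a κ)
  explore e st (h ∷ U) D P T qa = undecided e st h U D P T qa
  explore e st [] (h ∷ D) P T qa = decide e st h D P T qa
  -- No face is left for the waiting words. Then e < v, contrary to 2 e ≥ v p ≥ 3 v.
  explore e (w ∷ st) [] [] {v = v} {a = zero} P T qa = ⊥-elim (<-irrefl refl (begin-strict
   v + v ≤⟨ +-monoʳ-≤ v (≤-trans (m≤m+n v (v + 0)) (≤-reflexive (*-comm 2 v))) ⟩
   v + v * 2 ≡⟨ sym (*-suc v 2) ⟩
   v * 3 ≤⟨ *-monoʳ-≤ v (s≤s (s≤s (s≤s z≤n))) ⟩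
   v * p ≤⟨ m≤n+m (v * p) _ ⟩
   length (concat (w ∷ st)) + v * p ≡⟨ sym (edges P) ⟩
   e + e <⟨ +-mono-< e<v e<v ⟩
   v + v ∎))
   where
   open ≤-Reasoning
   e<v : e < v
   e<v = subst (e <_) (sym qa) (s≤s (≤-trans (m≤n+m e (length st)) (n≤1+n _)))
  explore e (w ∷ st) [] [] {v = v} {κ} {suc a} P T qa = trans (explore e st [] w (pop P) T (suc-injective qa))
      (cong (+ choices p v ℤ.*_) (sym (c-pop (length w) (map length st) a κ)))
  explore zero [] [] [] {v = zero} {a = zero} P T ()
  explore zero [] [] [] {v = zero} {a = suc zero} P T qa = Finish.finish P T
  explore zero [] [] [] {v = zero} {a = suc (suc a)} P T ()
  explore (suc e) [] [] [] {v = zero} P T qa with edges P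
  ... | ()
  -- No open half-edge is left but vertices are missing, so no completion is connected. Here 2 e = v
  -- p, with v the number of missing vertices, forces a ≥ 2, where the coefficient is zero by
  -- `c-end''`.
  explore e [] [] [] {α₀} {S₀} {Dsc} {suc v} {κ} {a} P T qa = trans (cong +_ (total-zero stuck)) (trans (sym (ℤP.*-zeroʳ (+ choices p (suc v))))
    (cong (+ choices p (suc v) ℤ.*_) (sym (vanish a qa))))
   where
   many : suc v + suc v < e + e
   many = begin-strict suc v + suc v <⟨ +-monoʳ-< (suc v) (≤-trans (m≤m+n (suc (suc v)) v)
     (≤-reflexive (trans (cong suc (cong suc (sym (+-identityʳ (v + v))))) (solve 1 (λ v → con 2 :+ (v :+ v :+ con 0) := (con 1 :+ v) :* con 2) refl v)))) ⟩
    suc v + suc v * 2 ≡⟨ sym (*-suc (suc v) 2) ⟩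
    suc v * 3 ≤⟨ *-monoʳ-≤ (suc v) (s≤s (s≤s (s≤s z≤n))) ⟩
    suc v * p ≡⟨ sym (edges P) ⟩
    e + e ∎
    where
    open ≤-Reasoning
    open +-*-Solver
   vanish : ∀ a → a + suc v ≡ suc e → c 0 0 [] a κ ≡ + 0
   vanish zero q = ⊥-elim (<-irrefl refl (<-≤-trans many (+-mono-≤ (e≤ q) (e≤ q))))
    where e≤ : suc v ≡ suc e → e ≤ suc v
          e≤ q = subst (e ≤_) (sym q) (n≤1+n e)
   vanish (suc zero) q = ⊥-elim (<-irrefl (cong₂ _+_ (suc-injective q) (suc-injective q)) many)
   vanish (suc (suc a)) q = c-end'' a κ
   stuck : ∀ α S → query α₀ S₀ α S ≡ true → ⊥
   stuck α S t with countF-witness n _ (count P)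
   ... | x , u = true≢false (path-closed (λ y → Dsc y ≡ true) link (E.linked x) (root P)) (not-true u)
    where
    module E = Extends (query-sound {α₀} {S₀} t)
    link : ∀ {x y} → adjMap σ α x y ≡ true → Dsc x ≡ true → Dsc y ≡ true
    link {x} {y} a d with ∨-split {σ x =ᶠ y} a
    ... | inj₁ s = subst (λ y → Dsc y ≡ true) (=ᶠ-eq s) (trans (stable P x) d)
    ... | inj₂ s with same? (α₀ x) x
    ...   | inj₁ o with open-mem P x d o
    ...     | ()
    link {x} {y} a d | inj₂ s | inj₂ m with Dsc y in eq
    ... | true = refl
    ... | false = ⊥-elim (m (trans αx (sym (trans (sym (inv P x)) (trans (cong α₀ αx) (und P y eq))))))
     where
     αx : α₀ x ≡ y
     αx = trans (sym (E.extα x m)) (=ᶠ-eq s)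

  -- Outside the forest, h moves to the end of its word as a decided half-edge. In the forest, its
  -- partner must be undiscovered: a decided partner is known to be outside the forest, and an
  -- undecided one lies in the same tree, so that the edge would close a cycle.
  undecided : ∀ e st h U D {α₀ S₀ Dsc v κ a} → Partial α₀ Dsc ((h ∷ U ++ D) ∷ st) e v →
   Tree α₀ S₀ Dsc (h ∷ U) (D ++ concat st) κ → a + v ≡ suc (length st + e) → Answer α₀ S₀ v (c (suc (length U)) (length D) (map length st) a κ)
  undecided zero st h U D P T qa with edges P
  ... | ()
  undecided (suc e) st h U D {α₀} {S₀} {Dsc} {v} {κ} {a} P T qa = begin
   + total (query α₀ S₀) ≡⟨ cong +_ (total-split-S h (query α₀ S₀)) ⟩
   + (total (λ α S → S h ∧ query α₀ S₀ α S) + total (λ α S → not (S h) ∧ query α₀ S₀ α S))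
    ≡⟨ cong +_ (+-comm (total (λ α S → S h ∧ query α₀ S₀ α S)) _) ⟩
   + (total (λ α S → not (S h) ∧ query α₀ S₀ α S) + total (λ α S → S h ∧ query α₀ S₀ α S))
    ≡⟨ answer-+ v _ _ (c (length U) (suc (length D)) ls a κ) (c (suc (suc p') + length U) (length D) ls a κ)
       (outcome-no (explore (suc e) st U (D ++ [ h ]) P₁ T₁ qa)) outcome-yes ⟩
   + choices p v ℤ.* (c (length U) (suc (length D)) ls a κ ℤ.+ c (suc (suc p') + length U) (length D) ls a κ)
    ≡⟨ cong (+ choices p v ℤ.*_) (sym (c-undecided (length U) (length D) ls a κ)) ⟩
   + choices p v ℤ.* c (suc (length U)) (length D) ls a κ ∎
   where
   open ≡-Reasoning
   ls = map length st
   h-open : Dsc h ≡ true × α₀ h ≡ h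
   h-open = mem-open P (here refl)
   fresh : ∀ {x} → x ∈ (U ++ D) ++ concat st → h ≢ x
   fresh i = All.lookup (AllPairs.head (unique P)) i
   unknown-h : ∀ {b} → S₀ h ≡ just b → ⊥
   unknown-h e with trans (sym (unknown-U T (here refl))) e
   ... | ()

   S₁ = assign S₀ h h false
   P₁ : Partial α₀ Dsc ((U ++ (D ++ [ h ])) ∷ st) (suc e) v
   P₁ = subst (λ w → Partial α₀ Dsc (w ∷ st) (suc e) v) (++-assoc U D [ h ]) (rotate P)
   T₁ : Tree α₀ S₁ Dsc U ((D ++ [ h ]) ++ concat st) κ
   T₁ = skip T (proj₁ h-open) (proj₂ h-open) (λ i → fresh (∈-++⁺ˡ (∈-++⁺ˡ i)) refl) sub
    where
    sub : ∀ {x} → x ∈ (D ++ [ h ]) ++ concat st → x ∈ D ++ concat st ⊎ x ≡ h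
    sub i with ∈-++⁻ (D ++ [ h ]) i
    ... | inj₂ j = inj₁ (∈-++⁺ʳ D j)
    ... | inj₁ j with ∈-++⁻ D j
    ...   | inj₁ k = inj₁ (∈-++⁺ˡ k)
    ...   | inj₂ (here q) = inj₂ q
   same-no : ∀ α S → not (S h) ∧ query α₀ S₀ α S ≡ query α₀ S₁ α S
   same-no α S = bool-iff
    (λ t → let s , q = ∧-split {not (S h)} t ; E = query-sound {α₀} {S₀} q in
     query-complete {α₀} {S₁} (extends (Extends.extα E) (forth (not-true s) E) (Extends.isGood E)))
    (λ t → let E = query-sound {α₀} {S₁} t in
     ∧-join (not-false (Extends.extS E h (assign-h S₀ h h false)))
      (query-complete {α₀} {S₀} (extends (Extends.extα E) (back E) (Extends.isGood E))))
    where
    forth : S h ≡ false → Extends α₀ S₀ α S → ∀ x {b} → S₁ x ≡ just b → S x ≡ b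
    forth s E x e with same? x h
    ... | inj₂ u = Extends.extS E x (trans (sym (assign-other S₀ h h false u u)) e)
    ... | inj₁ refl with trans (sym (assign-h S₀ h h false)) e
    ...   | refl = s
    back : Extends α₀ S₁ α S → ∀ x {b} → S₀ x ≡ just b → S x ≡ b
    back E x e = Extends.extS E x (trans (assign-other S₀ h h false u u) e)
     where u : x ≢ h
           u refl = unknown-h e
   outcome-no : Answer α₀ S₁ v (c (length U) (length (D ++ [ h ])) ls a κ) →
    + total (λ α S → not (S h) ∧ query α₀ S₀ α S) ≡ + choices p v ℤ.* c (length U) (suc (length D)) ls a κ
   outcome-no ih = trans (cong +_ (total-cong same-no)) (subst (λ k → Answer α₀ S₁ v (c (length U) k ls a κ))
     (trans (length-++ D) (+-comm (length D) 1)) ih)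

   t : Fin n → ℕ
   t g = total (λ α S → (α h =ᶠ g) ∧ (S h ∧ query α₀ S₀ α S))
   cyclic-partner : ∀ g → Dsc g ≡ true → t g ≡ 0
   cyclic-partner g d = total-zero λ α S q →
    let αh , q' = ∧-split {α h =ᶠ g} q ; s , q'' = ∧-split {S h} q' in
    impossible (=ᶠ-eq αh) s (query-sound {α₀} {S₀} q'')
    where
    impossible : ∀ {α S} → α h ≡ g → S h ≡ true → Extends α₀ S₀ α S → ⊥
    impossible {α} {S} refl s E with partner-open P (proj₂ h-open) E d
    ... | here e = Extends.fpf E h e
    ... | there i with ∈-++⁻ U (subst (α h ∈_) (++-assoc U D (concat st)) i)
    ...   | inj₂ j = true≢false s (trans (Extends.edgeset E h) (Extends.extS E _ (decided T j)))
    ...   | inj₁ j = Extends.acyclic E h s (path-map link (path-trans (treePath-sym (inv P) T (hub-U T (here refl))) (hub-U T (there j))))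
     where
     link : ∀ {x y} → adjKnown α₀ S₀ x y ≡ true → Path (adjSub σ α (without α S h)) x y
     link {x} {y} a with ∨-split {σ x =ᶠ y} a
     ... | inj₁ e = step stop (∨-left e)
     ... | inj₂ u with ∧-split {isTrue (S₀ x)} u
     ...   | u1 , e = step stop (∨-right {σ x =ᶠ y} (∧-join (∧-join (Extends.extS E x x-true) (∧-join
       (not-false (=ᶠ-false {g = x} {h} (λ { refl → unknown-h x-true })))
       (not-false (=ᶠ-false {g = x} {α h} (λ { refl → x-glued (proj₂ (mem-open P (there i))) })))))
      (=ᶠ-true (trans (Extends.extα E x x-glued) (=ᶠ-eq e)))))
      where
      x-true : S₀ x ≡ just true
      x-true = isTrue-just u1
      x-glued : α₀ x ≢ x
      x-glued = true-glued T x x-true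
   new-tree-edge : ∀ v' → v ≡ suc v' → ∀ g → Dsc g ≡ false → + t g ≡ + choices p v' ℤ.* c (suc (suc p') + length U) (length D) ls a κ
   new-tree-edge v' v≡ g ug = trans (cong +_ (total-cong same-yes)) (subst (λ j → Answer α₁ S₂ v' (c j (length D) ls a κ))
     (trans (length-++ new) (cong (_+ length U) (length-orbL σ (suc (suc p')) (σ g))))
     (explore e st (new ++ U) D P₂ T₂ (suc-injective (begin
      suc (a + v') ≡⟨ sym (+-suc a v') ⟩
      a + suc v' ≡⟨ cong (λ z → a + z) (sym v≡) ⟩
      a + v ≡⟨ qa ⟩
      suc (length st + suc e) ≡⟨ cong suc (+-suc (length st) e) ⟩
      suc (suc (length st + e)) ∎))))
    where
    α₁ = match α₀ h g
    S₂ = assign S₀ h g true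
    P' : Partial α₀ Dsc ((h ∷ U ++ D) ∷ st) (suc e) (suc v')
    P' = subst (Partial α₀ Dsc ((h ∷ U ++ D) ∷ st) (suc e)) v≡ P
    open Merge P' ug using (new; merge; Dsc'; αg; h≢g)
    P₂ : Partial α₁ Dsc' (((new ++ U) ++ D) ∷ st) e v'
    P₂ = subst (λ w → Partial α₁ Dsc' (w ∷ st) e v') (sym (++-assoc new U D)) merge
    T₂ : Tree α₁ S₂ Dsc' (new ++ U) (D ++ concat st) κ
    T₂ = Grow.grow-tree T (inv P') (und P') (stable P') (proj₁ h-open) (proj₂ h-open) ug
        (suc (suc p')) (undiscovered P' ug) true refl (hub-U T (here refl))
        (λ i → there i , (λ { refl → fresh (∈-++⁺ˡ (∈-++⁺ˡ i)) refl }) , proj₁ (mem-open P (there (∈-++⁺ˡ (∈-++⁺ˡ i)))))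
        (λ i → λ { refl → fresh (subst (_ ∈_) (sym (++-assoc U D (concat st))) (∈-++⁺ʳ U i)) refl })
    unknown-g : ∀ {b} → S₀ g ≡ just b → ⊥
    unknown-g e with trans (sym (unknown-und T g ug)) e
    ... | ()
    same-yes : ∀ α S → (α h =ᶠ g) ∧ (S h ∧ query α₀ S₀ α S) ≡ query α₁ S₂ α S
    same-yes α S = bool-iff
     (λ q → let αh , q' = ∧-split {α h =ᶠ g} q ; s , q'' = ∧-split {S h} q' in
      query-complete {α₁} {S₂} (coarsen true (=ᶠ-eq αh) s (query-sound {α₀} {S₀} q'')))
     (λ q → let αh , s , E = refine true (inv P) (proj₂ h-open) αg h≢g (⊥-elim ∘ unknown-h) (⊥-elim ∘ unknown-g)
                        (query-sound {α₁} {S₂} q) in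
      ∧-join (=ᶠ-true αh) (∧-join s (query-complete {α₀} {S₀} E)))
   outcome-yes : + total (λ α S → S h ∧ query α₀ S₀ α S) ≡ + choices p v ℤ.* c (suc (suc p') + length U) (length D) ls a κ
   outcome-yes = trans (cong +_ (trans (total-split-α h (λ α S → S h ∧ query α₀ S₀ α S)) (sumOver-cong (allFin n) only-new)))
    (newVertices Dsc t v _ (count P) new-tree-edge (λ { refl → no-new-vertex (length U) (length D) ls a κ e
      (subst (λ k → a + 0 ≡ suc (k + suc e)) (sym (Data.List.Properties.length-map length st)) qa)
      (trans (edges P) (cong (_+ 0) (length-words (h ∷ U) D st))) }))
    where
    import Data.List.Properties
    only-new : ∀ g → t g ≡ indicator (not (Dsc g)) * t g
    only-new g with Dsc g in eq
    ... | true  = cyclic-partner g eq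
    ... | false = sym (+-identityʳ (t g))

  -- A discovered partner lies in the same word, by `nonplanar`, and cuts it in two. An undiscovered
  -- one belongs to a new tree, since all half-edges of the earlier trees are decided.
  decide : ∀ e st h D {α₀ S₀ Dsc v κ a} → Partial α₀ Dsc ((h ∷ D) ∷ st) e v →
   Tree α₀ S₀ Dsc [] ((h ∷ D) ++ concat st) κ → a + v ≡ suc (length st + e) → Answer α₀ S₀ v (c 0 (suc (length D)) (map length st) a κ)
  decide zero st h D P T qa with edges P
  ... | ()
  decide (suc e) st h D {α₀} {S₀} {Dsc} {v} {κ} {a} P T qa = begin
   + total (query α₀ S₀) ≡⟨ cong +_ (total-split-α h (query α₀ S₀)) ⟩
   + sumFin n t ≡⟨ cong +_ (sumOver-cong (allFin n) cases) ⟩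
   + sumFin n (λ g → indicator (member g D) * t g + indicator (not (Dsc g)) * t g) ≡⟨ cong +_ (sumOver-+ (allFin n) _ _) ⟩
   + (sumFin n (λ g → indicator (member g D) * t g) + sumFin n (λ g → indicator (not (Dsc g)) * t g))
    ≡⟨ cong (λ z → + (z + sumFin n (λ g → indicator (not (Dsc g)) * t g))) (sumFin-member n D D-unique t) ⟩
   + (sumOver D t + sumFin n (λ g → indicator (not (Dsc g)) * t g))
    ≡⟨ answer-+ v _ _ (splitSum F 0 (length D)) (c (suc (suc p')) (length D) ls a (suc κ))
       (splits [] D refl) (newVertices Dsc t v _ (count P) new-vertex no-vertex) ⟩
   + choices p v ℤ.* (splitSum F 0 (length D) ℤ.+ c (suc (suc p')) (length D) ls a (suc κ))
    ≡⟨ cong (+ choices p v ℤ.*_) (sym (c-decided (length D) ls a κ)) ⟩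
   + choices p v ℤ.* c 0 (suc (length D)) ls a κ ∎
   where
   open ≡-Reasoning
   ls = map length st
   F : ℕ → ℕ → ℤ
   F i l = c 0 i (l ∷ ls) a κ
   t : Fin n → ℕ
   t g = total (λ α S → (α h =ᶠ g) ∧ query α₀ S₀ α S)
   h-open : Dsc h ≡ true × α₀ h ≡ h
   h-open = mem-open P (here refl)
   D-unique : Unique D
   D-unique = go D (AllPairs.tail (unique P))
    where
    go : ∀ D {t} → Unique (D ++ t) → Unique D
    go []      _       = []
    go (x ∷ D) (r ∷ u) = All.tabulate (λ i → All.lookup r (∈-++⁺ˡ i)) ∷ go D u
   false-h : ∀ {b} → S₀ h ≡ just b → b ≡ false
   false-h e with trans (sym (decided T (here refl))) e
   ... | refl = refl

   cases : ∀ g → t g ≡ indicator (member g D) * t g + indicator (not (Dsc g)) * t g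
   cases g with Dsc g in eqD | member g D in eqM
   ... | true  | true  = sym (trans (+-identityʳ _) (+-identityʳ (t g)))
   ... | false | false = sym (+-identityʳ (t g))
   ... | false | true  = ⊥-elim (true≢false (proj₁ (mem-open P (there (∈-++⁺ˡ (member-sound D eqM))))) eqD)
   ... | true  | false = total-zero λ α S q → let αh , q' = ∧-split {α h =ᶠ g} q in
     impossible (=ᶠ-eq αh) (query-sound {α₀} {S₀} q')
    where
    impossible : ∀ {α S} → α h ≡ g → Extends α₀ S₀ α S → ⊥
    impossible {α} {S} refl E with partner-open P (proj₂ h-open) E eqD
    ... | here e = Extends.fpf E h e
    ... | there i with ∈-++⁻ D i
    ...   | inj₁ j = true≢false (member-complete j) eqM
    ...   | inj₂ j = nonplanar P (Extends.invol E) (Extends.fpf E) (Extends.linked E) (Extends.faces E) (Extends.extα E) j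

   split-at : ∀ l g m → D ≡ l ++ g ∷ m → + t g ≡ + choices p v ℤ.* F (length l) (length m)
   split-at l g m D≡ = trans (cong +_ (total-cong same-split)) (explore e (m ∷ st) [] l (split P')
     (split-tree T (here refl) (there (∈-++⁺ˡ g∈)) sub) (trans qa (cong suc (+-suc (length st) e))))
    where
    P' : Partial α₀ Dsc ((h ∷ l ++ g ∷ m) ∷ st) (suc e) v
    P' = subst (λ D → Partial α₀ Dsc ((h ∷ D) ∷ st) (suc e) v) D≡ P
    g∈ : g ∈ D
    g∈ = subst (g ∈_) (sym D≡) (∈-++⁺ʳ l (here refl))
    sub : ∀ {x} → x ∈ l ++ (m ++ concat st) → x ∈ (h ∷ D) ++ concat st
    sub {x} i with ∈-++⁻ l i
    ... | inj₁ j = there (∈-++⁺ˡ (subst (x ∈_) (sym D≡) (∈-++⁺ˡ j)))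
    ... | inj₂ j with ∈-++⁻ m j
    ...   | inj₁ k = there (∈-++⁺ˡ (subst (x ∈_) (sym D≡) (∈-++⁺ʳ l (there k))))
    ...   | inj₂ k = there (∈-++⁺ʳ D k)
    αg : α₀ g ≡ g
    αg = proj₂ (mem-open P (there (∈-++⁺ˡ g∈)))
    h≢g : h ≢ g
    h≢g = All.lookup (AllPairs.head (unique P)) (∈-++⁺ˡ g∈)
    false-g : S₀ g ≡ just false
    false-g = decided T (there (∈-++⁺ˡ g∈))
    unchanged : ∀ x → assign S₀ h g false x ≡ S₀ x
    unchanged x with same? x h | same? x g
    ... | inj₁ refl | _ = trans (assign-h S₀ h g false) (sym (decided T (here refl)))
    ... | inj₂ _ | inj₁ refl = trans (assign-g S₀ h g false) (sym false-g)
    ... | inj₂ u | inj₂ w = assign-other S₀ h g false u w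
    same-split : ∀ α S → (α h =ᶠ g) ∧ query α₀ S₀ α S ≡ query (match α₀ h g) S₀ α S
    same-split α S = bool-iff
     (λ q → let αh , q' = ∧-split {α h =ᶠ g} q ; E = query-sound {α₀} {S₀} q' in
      query-complete {match α₀ h g} {S₀} (extends-cong (λ x → sym (unchanged x))
       (coarsen false (=ᶠ-eq αh) (Extends.extS E h (decided T (here refl))) E)))
     (λ q → let αh , _ , E = refine false (inv P) (proj₂ h-open) αg h≢g false-h
                        (λ e → Data.Maybe.Properties.just-injective (trans (sym e) false-g))
                        (extends-cong unchanged (query-sound {match α₀ h g} {S₀} q)) in
      ∧-join (=ᶠ-true αh) (query-complete {α₀} {S₀} E))
     where import Data.Maybe.Properties

   splits : ∀ l m → D ≡ l ++ m → + sumOver m t ≡ + choices p v ℤ.* splitSum F (length l) (length m)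
   splits l []      D≡ = sym (ℤP.*-zeroʳ (+ choices p v))
   splits l (g ∷ m) D≡ = answer-+ v (t g) _ (F (length l) (length m)) _ (split-at l g m D≡)
    (subst (λ k → + sumOver m t ≡ + choices p v ℤ.* splitSum F k (length m)) (trans (length-++ l) (+-comm (length l) 1))
     (splits (l ++ [ g ]) m (trans D≡ (sym (++-assoc l [ g ] m)))))

   new-vertex : ∀ v' → v ≡ suc v' → ∀ g → Dsc g ≡ false → + t g ≡ + choices p v' ℤ.* c (suc (suc p')) (length D) ls a (suc κ)
   new-vertex v' v≡ g ug = trans (cong +_ (total-cong same-new))
    (subst (λ j → Answer α₁ S₂ v' (c j (length D) ls a (suc κ))) (length-orbL σ (suc (suc p')) (σ g))
     (explore e st new D merge T₂ (suc-injective (begin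
      suc (a + v') ≡⟨ sym (+-suc a v') ⟩
      a + suc v' ≡⟨ cong (λ z → a + z) (sym v≡) ⟩
      a + v ≡⟨ qa ⟩
      suc (length st + suc e) ≡⟨ cong suc (+-suc (length st) e) ⟩
      suc (suc (length st + e)) ∎))))
    where
    α₁ = match α₀ h g
    S₂ = assign S₀ h g false
    P' : Partial α₀ Dsc ((h ∷ D) ∷ st) (suc e) (suc v')
    P' = subst (Partial α₀ Dsc ((h ∷ D) ∷ st) (suc e)) v≡ P
    open Merge P' ug using (new; merge; Dsc'; αg; h≢g)
    unknown-g : ∀ {b} → S₀ g ≡ just b → ⊥
    unknown-g e with trans (sym (unknown-und T g ug)) e
    ... | ()
    T₂ : Tree α₁ S₂ Dsc' new (D ++ concat st) (suc κ)
    T₂ = Grow.grow-new T (inv P') (und P') (stable P') (proj₁ h-open) (proj₂ h-open) ug (suc (suc p')) (undiscovered P' ug) false refl dec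
     where
     dec : ∀ {x} → x ∈ D ++ concat st → S₂ x ≡ just false
     dec {x} i with same? x h | same? x g
     ... | inj₁ refl | _ = assign-h S₀ h g false
     ... | inj₂ _ | inj₁ refl = assign-g S₀ h g false
     ... | inj₂ u | inj₂ w = trans (assign-other S₀ h g false u w) (decided T (there i))
    same-new : ∀ α S → (α h =ᶠ g) ∧ query α₀ S₀ α S ≡ query α₁ S₂ α S
    same-new α S = bool-iff
     (λ q → let αh , q' = ∧-split {α h =ᶠ g} q ; E = query-sound {α₀} {S₀} q' in
      query-complete {α₁} {S₂} (coarsen false (=ᶠ-eq αh) (Extends.extS E h (decided T (here refl))) E))
     (λ q → let αh , _ , E = refine false (inv P) (proj₂ h-open) αg h≢g false-h (⊥-elim ∘ unknown-g)
                        (query-sound {α₁} {S₂} q) in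
      ∧-join (=ᶠ-true αh) (query-complete {α₀} {S₀} E))

   no-vertex : v ≡ 0 → c (suc (suc p')) (length D) ls a (suc κ) ≡ + 0
   no-vertex refl = subst (λ j → c j (length D) ls a (suc κ) ≡ + 0) (+-identityʳ (suc (suc p'))) (no-new-vertex 0 (length D) ls a (suc κ) e
     (subst (λ k → a + 0 ≡ suc (k + suc e)) (sym (Data.List.Properties.length-map length st)) qa)
     (trans (edges P) (cong (_+ 0) (length-words [] (h ∷ D) st))))
    where import Data.List.Properties

-- Counting rotations with prescribed vertex degrees.

surjective⇒inj : ∀ {n} (f : Fin n → Fin n) → (∀ y → ∃ λ x → f x ≡ y) → Inj f
surjective⇒inj f surj {x} {y} e = trans (sym (s-f x)) (trans (cong s e) (s-f y))
 where
 s = proj₁ ∘ surj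
 f-s : ∀ y → f (s y) ≡ y
 f-s y = proj₂ (surj y)
 s-inj : Inj s
 s-inj {a} {b} q = trans (sym (f-s a)) (trans (cong f q) (f-s b))
 s-f : ∀ x → s (f x) ≡ x
 s-f x with period s s-inj x
 ... | d , q , _ = trans (cong s (trans (cong f (sym q)) (f-s (iter s d x)))) q

module _ {n : ℕ} where

 update : Fin n → Fin n → (Fin n → Fin n) → Fin n → Fin n
 update x y f z = if z =ᶠ x then y else f z

 update-at : ∀ x y f → update x y f x ≡ y
 update-at x y f rewrite =ᶠ-refl x = refl

 update-other : ∀ x y f {z} → z ≢ x → update x y f z ≡ f z
 update-other x y f u rewrite =ᶠ-false u = refl

 setChain : Fin n → List (Fin n) → Fin n → (Fin n → Fin n) → Fin n → Fin n
 setChain x []      t f = update x t f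
 setChain x (y ∷ l) t f = update x y (setChain y l t f)

 setChain-other : ∀ x l t f {z} → ¬ (z ∈ x ∷ l) → setChain x l t f z ≡ f z
 setChain-other x []      t f z∉ = update-other x t f (z∉ ∘ here)
 setChain-other x (y ∷ l) t f z∉ = trans (update-other x y (setChain y l t f) (z∉ ∘ here)) (setChain-other y l t f (z∉ ∘ there))

 iter-orbL-cong : ∀ {f g : Fin n → Fin n} d y → (∀ {z} → z ∈ orbL f d y → g z ≡ f z) → orbL g d y ≡ orbL f d y × iter g d y ≡ iter f d y
 iter-orbL-cong zero    y q = refl , refl
 iter-orbL-cong {f} {g} (suc d) y q with iter-orbL-cong {f} {g} d (f y) (q ∘ there)
 ... | a , b = cong (y ∷_) (trans (cong (orbL g d) (q (here refl))) a) ,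
  trans (sym (iter-comm g d y)) (trans (cong (iter g d) (q (here refl))) (trans b (iter-comm f d y)))

 setChain-orbit : ∀ x l t f → Unique (x ∷ l) → orbL (setChain x l t f) (suc (length l)) x ≡ x ∷ l × iter (setChain x l t f) (suc (length l)) x ≡ t
 setChain-orbit x []      t f u = refl , update-at x t f
 setChain-orbit x (y ∷ l) t f (x∉ ∷ u) with setChain-orbit y l t f u
 ... | a , b with iter-orbL-cong {setChain y l t f} {setChain x (y ∷ l) t f} (suc (length l)) y
           (λ {z} i → update-other x y (setChain y l t f) (λ { refl → All.lookup x∉ (subst (x ∈_) a i) refl }))
 ...   | c , d = cong (x ∷_) (trans (cong (orbL (setChain x (y ∷ l) t f) (suc (length l))) (update-at x y (setChain y l t f))) (trans c a)) ,
  trans (sym (iter-comm (setChain x (y ∷ l) t f) (suc (length l)) x))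
   (trans (cong (iter (setChain x (y ∷ l) t f) (suc (length l))) (update-at x y (setChain y l t f))) (trans d b))

 orbL-snoc : ∀ (f : Fin n → Fin n) d x → orbL f (suc d) x ≡ orbL f d x ++ [ iter f d x ]
 orbL-snoc f zero    x = refl
 orbL-snoc f (suc d) x = cong (x ∷_) (trans (orbL-snoc f d (f x)) (cong (λ z → orbL f d (f x) ++ [ z ]) (iter-comm f d x)))

 setCycle : List (Fin n) → (Fin n → Fin n) → Fin n → Fin n
 setCycle []      f = f
 setCycle (x ∷ l) f = setChain x l x f

 isBlock : (Fin n → Fin n) → List (Fin n) → Bool
 isBlock σ []      = true
 isBlock σ (x ∷ l) = ⌊ ≡-dec Fin._≟_ (orbL σ (suc (length l)) x) (x ∷ l) ⌋

 module Rotation (q : ℕ) (D₀ : Fin n → Bool) (good : (Fin n → Fin n) → Bool)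
  (good-sound : ∀ {σ} → good σ ≡ true → Inj σ × (∀ x → D₀ x ≡ true → σ x ≡ x) × (∀ x → D₀ x ≡ false → hasDeg σ (suc q) x ≡ true))
  (good-complete : ∀ {σ} → Inj σ → (∀ x → D₀ x ≡ true → σ x ≡ x) →
   (∀ x → D₀ x ≡ false → hasDeg σ (suc q) x ≡ true) → good σ ≡ true) where

  σs = funs n (allFin n)

  totalσ : ((Fin n → Fin n) → Bool) → ℕ
  totalσ Q = sumOver σs (indicator ∘ Q)

  totalσ-cong : ∀ {Q Q'} → (∀ σ → Q σ ≡ Q' σ) → totalσ Q ≡ totalσ Q'
  totalσ-cong e = sumOver-cong σs (cong indicator ∘ e)

  query : List (List (Fin n)) → (Fin n → Fin n) → Bool
  query bs σ = allL (isBlock σ) bs ∧ good σ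

  seen : List (Fin n) → Fin n → Bool
  seen xs x = D₀ x ∨ member x xs

  isBlock-orbit : ∀ {σ x l} → isBlock σ (x ∷ l) ≡ true → orbL σ (suc (length l)) x ≡ x ∷ l
  isBlock-orbit t = true-dec (≡-dec Fin._≟_ _ _) t

  orbit-isBlock : ∀ {σ x l} → orbL σ (suc (length l)) x ≡ x ∷ l → isBlock σ (x ∷ l) ≡ true
  orbit-isBlock e = dec-true (≡-dec Fin._≟_ _ _) e

  Full : List (Fin n) → Set
  Full b = length b ≡ suc q

  block-closed : ∀ {σ} → good σ ≡ true → ∀ {bs} → All Full bs → (∀ {x} → x ∈ concat bs → D₀ x ≡ false) →
   allL (isBlock σ) bs ≡ true → ∀ {x} → x ∈ concat bs → σ x ∈ concat bs
  block-closed {σ} g {(y ∷ l) ∷ bs} (e ∷ es) d t {x} i with ∈-++⁻ (y ∷ l) i | ∧-split {isBlock σ (y ∷ l)} t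
  ... | inj₂ j | _ , t' = ∈-++⁺ʳ (y ∷ l) (block-closed g es (d ∘ ∈-++⁺ʳ (y ∷ l)) t' j)
  ... | inj₁ j | tb , _ with good-sound g | isBlock-orbit tb
  ...   | inj , _ , deg | o rewrite suc-injective e = ∈-++⁺ˡ (subst (σ x ∈_) o (orbL-σ σ inj q (deg y (d (here refl))) (subst (x ∈_) (sym o) j)))

  module Last {bs} (full : All Full bs) (uniq : Unique (concat bs))
        (disj : ∀ {x} → x ∈ concat bs → D₀ x ≡ false)
        (all-seen : ∀ x → seen (concat bs) x ≡ true) where

   -- The identity overwritten by the chosen cycles. As every half-edge is in a block or in `D₀`, it
   -- is the only rotation left, up to pointwise equality.
   σ* : Fin n → Fin n
   σ* = foldr setCycle id bs

   private
    outside : ∀ bs → (∀ {x} → ¬ (x ∈ concat bs) → foldr setCycle id bs x ≡ x)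
    outside []            _  = refl
    outside ([] ∷ bs)     x∉ = outside bs x∉
    outside ((y ∷ l) ∷ bs) x∉ = trans (setChain-other y l y (foldr setCycle id bs) (x∉ ∘ ∈-++⁺ˡ)) (outside bs (x∉ ∘ ∈-++⁺ʳ (y ∷ l)))

    Orbits : (Fin n → Fin n) → List (List (Fin n)) → Set
    Orbits f = All (λ b → ∃ λ y → y ∈ b × orbL f (suc q) y ≡ b × iter f (suc q) y ≡ y × isBlock f b ≡ true)

    left : ∀ b {t : List (Fin n)} → Unique (b ++ t) → Unique b
    left []      _       = []
    left (x ∷ b) (r ∷ u) = All.tabulate (λ i → All.lookup r (∈-++⁺ˡ i)) ∷ left b u

    right : ∀ b {t : List (Fin n)} → Unique (b ++ t) → Unique t
    right []      u       = u
    right (x ∷ b) (_ ∷ u) = right b u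

    apart : ∀ b {t : List (Fin n)} → Unique (b ++ t) → ∀ {x} → x ∈ b → x ∈ t → ⊥
    apart (x ∷ b) (r ∷ _) (here refl) j = All.lookup r (∈-++⁺ʳ b j) refl
    apart (x ∷ b) (_ ∷ u) (there i)   j = apart b u i j

    orbits : ∀ bs → All Full bs → Unique (concat bs) → Orbits (foldr setCycle id bs) bs
    orbits []             _        _ = []
    orbits ([] ∷ bs)      (() ∷ _) _
    orbits ((y ∷ l) ∷ bs) (e ∷ es) u with setChain-orbit y l y (foldr setCycle id bs) (left (y ∷ l) u)
    ... | a , b = (y , here refl , subst (λ k → orbL f (suc k) y ≡ y ∷ l) (suc-injective e) a ,
            subst (λ k → iter f (suc k) y ≡ y) (suc-injective e) b , orbit-isBlock a)
           ∷ keep (All.tabulate id) (orbits bs es (right (y ∷ l) u))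
     where
     f = setCycle (y ∷ l) (foldr setCycle id bs)
     keep : ∀ {bs'} → All (λ b → b ∈ bs) bs' → Orbits (foldr setCycle id bs) bs' → Orbits f bs'
     keep []       []       = []
     keep (m ∷ ms) ((z , z∈ , o , i , t) ∷ os) = rest ∷ keep ms os
      where
      untouched : ∀ {w} → w ∈ orbL (foldr setCycle id bs) (suc q) z → f w ≡ foldr setCycle id bs w
      untouched {w} j = setChain-other y l y _ (λ k → apart (y ∷ l) u k (in-concat m (subst (w ∈_) o j)))
       where
       in-concat : ∀ {b bs} {w : Fin n} → b ∈ bs → w ∈ b → w ∈ concat bs
       in-concat (here refl) j = ∈-++⁺ˡ j
       in-concat {bs = b' ∷ _} (there m) j = ∈-++⁺ʳ b' (in-concat m j)
      both = iter-orbL-cong {foldr setCycle id bs} {f} (suc q) z untouched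
      isb : ∀ b → orbL f (suc q) z ≡ b → isBlock f b ≡ true
      isb [] _ = refl
      isb (w ∷ m) e' with e'
      ... | refl = orbit-isBlock (cong (λ k → orbL f (suc k) z) (length-orbL f q (f z)))
      rest = z , z∈ , trans (proj₁ both) o , trans (proj₂ both) i , isb _ (trans (proj₁ both) o)

    os : Orbits σ* bs
    os = orbits bs full uniq

    data Place (x : Fin n) : Set where
     rooted : D₀ x ≡ true → σ* x ≡ x → Place x
     onCycle : ∀ y j → j < suc q → iter σ* j y ≡ x → iter σ* (suc q) y ≡ y → Unique (orbL σ* (suc q) y) → Place x

    place : ∀ x → Place x
    place x with ∨-split {D₀ x} (all-seen x)
    ... | inj₁ d = rooted d (outside bs (λ i → true≢false d (disj i)))
    ... | inj₂ m = find bs os uniq (member-sound (concat bs) m)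
     where
     find : ∀ bs' → Orbits σ* bs' → Unique (concat bs') → x ∈ concat bs' → Place x
     find (b ∷ bs') ((y , y∈ , o , i , _) ∷ os) u m with ∈-++⁻ b m
     ... | inj₂ m' = find bs' os (right b u) m'
     ... | inj₁ m' with ∈-orbL σ* {suc q} (subst (x ∈_) (sym o) m')
     ...   | j , l , e = onCycle y j l e i (subst Unique (sym o) (left b u))

   σ*-inj : Inj σ*
   σ*-inj = surjective⇒inj σ* λ x → pre x (place x)
    where
    pre : ∀ x → Place x → ∃ λ z → σ* z ≡ x
    pre x (rooted _ e) = x , e
    pre x (onCycle y zero    _ e p _) = iter σ* q y , trans p e
    pre x (onCycle y (suc j) _ e _ _) = iter σ* j y , e

   private
    unique-prefix : ∀ {y} → Unique (orbL σ* (suc q) y) → ∀ j → j < q → iter σ* (suc j) y ≢ y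
    unique-prefix {y} (r ∷ _) j l e = All.lookup r (subst (_∈ orbL σ* q (σ* y)) (iter-comm σ* j y) (orbL-∈ σ* j l)) (sym e)

   σ*-good : good σ* ≡ true
   σ*-good = good-complete σ*-inj fixed deg
    where
    fixed : ∀ x → D₀ x ≡ true → σ* x ≡ x
    fixed x d = outside bs (λ i → true≢false d (disj i))
    hasDeg-iter : ∀ j {y} → hasDeg σ* (suc q) y ≡ true → hasDeg σ* (suc q) (iter σ* j y) ≡ true
    hasDeg-iter zero    t = t
    hasDeg-iter (suc j) t = hasDeg-σ σ* σ*-inj q (hasDeg-iter j t)
    deg : ∀ x → D₀ x ≡ false → hasDeg σ* (suc q) x ≡ true
    deg x d with place x
    ... | rooted d' _ = ⊥-elim (true≢false d' d)
    ... | onCycle y j l e p u = subst (λ z → hasDeg σ* (suc q) z ≡ true) e (hasDeg-iter j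
     (∧-join (=ᶠ-true p) (allL-upTo-complete {λ j → not (iter σ* (suc j) y =ᶠ y)} q (λ j l → not-false (=ᶠ-false (unique-prefix u j l))))))

   blocks* : allL (isBlock σ*) bs ≡ true
   blocks* = go os
    where
    go : ∀ {bs'} → Orbits σ* bs' → allL (isBlock σ*) bs' ≡ true
    go []                            = refl
    go ((_ , _ , _ , _ , t) ∷ os) = ∧-join t (go os)

   determined : ∀ {σ} → query bs σ ≡ true → ∀ x → σ x ≡ σ* x
   determined {σ} t x with ∧-split {allL (isBlock σ) bs} t
   ... | tb , tg with good-sound tg | ∨-split {D₀ x} (all-seen x)
   ...   | inj , fix , deg | inj₁ d = trans (fix x d) (sym (outside bs (λ i → true≢false d (disj i))))
   ...   | inj , fix , deg | inj₂ m = go bs full disj tb os (member-sound (concat bs) m)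
    where
    go : ∀ bs' → All Full bs' → (∀ {x} → x ∈ concat bs' → D₀ x ≡ false) →
     allL (isBlock σ) bs' ≡ true → Orbits σ* bs' → x ∈ concat bs' → σ x ≡ σ* x
    go ([] ∷ bs')      (() ∷ _)
    go ((y ∷ l) ∷ bs') (e ∷ es) dj t ((z , _ , o , per , _) ∷ os) m with ∧-split {isBlock σ (y ∷ l)} t | ∈-++⁻ (y ∷ l) m
    ... | _ , t' | inj₂ m' = go bs' es (dj ∘ ∈-++⁺ʳ (y ∷ l)) t' os m'
    ... | tb , _ | inj₁ m' with head-eq o
     where head-eq : orbL σ* (suc q) z ≡ y ∷ l → z ≡ y
           head-eq refl = refl
    ...   | refl = same
     where
     oσ : orbL σ (suc q) y ≡ y ∷ l
     oσ = subst (λ k → orbL σ (suc k) y ≡ y ∷ l) (suc-injective e) (isBlock-orbit tb)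
     agree : ∀ d {f g : Fin n → Fin n} {w} → orbL f (suc d) w ≡ orbL g (suc d) w → ∀ j → j ≤ d → iter f j w ≡ iter g j w
     agree d       q' zero    _ = refl
     agree (suc d) {f} {g} {w} q' (suc j) (s≤s l) = trans (sym (iter-comm f j w))
      (trans (trans (agree d {f} {g} {f w} tail-eq' j l) (cong (iter g j) fw≡gw)) (iter-comm g j w))
      where
      fw≡gw : f w ≡ g w
      fw≡gw = Data.List.Properties.∷-injectiveˡ (Data.List.Properties.∷-injectiveʳ q')
       where import Data.List.Properties
      tail-eq' : orbL f (suc d) (f w) ≡ orbL g (suc d) (f w)
      tail-eq' = trans (Data.List.Properties.∷-injectiveʳ q') (cong (orbL g (suc d)) (sym fw≡gw))
       where import Data.List.Properties
     iters : ∀ j → j ≤ q → iter σ j y ≡ iter σ* j y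
     iters = agree q (trans oσ (sym o))
     same : σ x ≡ σ* x
     same with ∈-orbL σ {suc q} (subst (x ∈_) (sym oσ) m')
     ... | j , s≤s j≤ , refl with m≤n⇒m<n∨m≡n j≤
     ...   | inj₁ j<q = trans (iters (suc j) j<q) (cong σ* (sym (iters j j≤)))
     ...   | inj₂ refl = trans (hasDeg-period σ inj q (deg y (dj (here refl)))) (trans (sym per) (cong σ* (sym (iters q j≤))))

   count-one : totalσ (query bs) ≡ 1
   count-one with funs-point (allFin n) Fin._≟_ (sumFin-δ n) n σ*
   ... | σ , σ≗ , pick = trans (pick (indicator ∘ query bs) (λ g i ne → cong indicator (¬true⇒false (λ t → ne (determined t i)))))
      (cong indicator (∧-join (blk bs blocks*) good'))
    where
    good' : good σ ≡ true
    good' with good-sound σ*-good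
    ... | inj , fix , deg = good-complete (λ {x} {y} e → inj (trans (sym (σ≗ x)) (trans e (σ≗ y)))) (λ x d → trans (σ≗ x) (fix x d))
       (λ x d → trans (hasDeg-cong x) (deg x d))
     where
     iters : ∀ j x → iter σ j x ≡ iter σ* j x
     iters zero    x = refl
     iters (suc j) x = trans (σ≗ _) (cong σ* (iters j x))
     allL-cong : ∀ {P Q : ℕ → Bool} xs → (∀ j → P j ≡ Q j) → allL P xs ≡ allL Q xs
     allL-cong []       e = refl
     allL-cong (x ∷ xs) e = cong₂ _∧_ (e x) (allL-cong xs e)
     hasDeg-cong : ∀ x → hasDeg σ (suc q) x ≡ hasDeg σ* (suc q) x
     hasDeg-cong x = cong₂ _∧_ (cong (_=ᶠ x) (iters (suc q) x)) (allL-cong (List.upTo q) (λ j → cong (λ z → not (z =ᶠ x)) (iters (suc j) x)))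
    blk : ∀ bs → allL (isBlock σ*) bs ≡ true → allL (isBlock σ) bs ≡ true
    blk []             _ = refl
    blk ([] ∷ bs)      t = blk bs t
    blk ((y ∷ l) ∷ bs) t with ∧-split {isBlock σ* (y ∷ l)} t
    ... | tb , t' = ∧-join (orbit-isBlock (trans (proj₁ (iter-orbL-cong {σ*} {σ} (suc (length l)) y (λ {z} _ → σ≗ z)))
                 (isBlock-orbit tb))) (blk bs t')

  pathQuery : List (List (Fin n)) → Fin n → List (Fin n) → (Fin n → Fin n) → Bool
  pathQuery bs x l σ = isBlock σ (x ∷ l) ∧ query bs σ

  mutual

   -- Cycles are chosen one after the other. The start of a cycle is fixed and not chosen, so the
   -- first of every q + 1 factors of the factorial is missing from the count; `choices` collects
   -- exactly these factors.
   closed-count : ∀ v bs → All Full bs → Unique (concat bs) → (∀ {x} → x ∈ concat bs → D₀ x ≡ false) →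
    countF n (not ∘ seen (concat bs)) ≡ v * suc q → totalσ (query bs) * choices (suc q) v ≡ (v * suc q) !
   closed-count zero bs full u d cnt = cong (_* 1) (Last.count-one full u d (λ x → unseen-none (countF-none n cnt x)))
    where
    unseen-none : ∀ {b} → not b ≡ false → b ≡ true
    unseen-none {true} _ = refl
   closed-count (suc v) bs full u d cnt with countF-witness n _ cnt
   ... | x , ux = begin
    totalσ (query bs) * (suc v * suc q * choices (suc q) v)
     ≡⟨ cong (_* (suc v * suc q * choices (suc q) v)) (totalσ-cong (λ σ → sym (cong (_∧ query bs σ) (singleton σ)))) ⟩
    totalσ (pathQuery bs x []) * (suc v * suc q * choices (suc q) v)
     ≡⟨ solve 3 (λ a b c → a :* (b :* c) := b :* (a :* c)) refl (totalσ (pathQuery bs x [])) (suc v * suc q) (choices (suc q) v) ⟩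
    suc v * suc q * (totalσ (pathQuery bs x []) * choices (suc q) v) ≡⟨ cong (suc v * suc q *_) (path-count q v bs x [] refl full
        (All.tabulate (λ i e → true≢false (∨-right {D₀ x} (member-complete (subst (_∈ concat bs) (sym e) i))) (not-true ux)) ∷ u)
        (λ { (here refl) → ¬true⇒false (λ t → true≢false (∨-left t) (not-true ux)) ; (there i) → d i })
        (suc-injective (trans (sym (trans (countF-remove n _ (x ∷ []) ([] ∷ []) (λ { (here refl) → ux }))
         (cong suc (countF-cong n (one x))))) cnt))) ⟩
    suc v * suc q * (q + v * suc q) ! ∎
    where
    open ≡-Reasoning
    open +-*-Solver
    singleton : ∀ σ → isBlock σ (x ∷ []) ≡ true
    singleton σ = orbit-isBlock {σ} {x} {[]} refl
    one : ∀ x y → not (seen (concat bs) y) ∧ not (member y (x ∷ [])) ≡ not (seen ((x ∷ []) ++ concat bs) y)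
    one x y with D₀ y | y =ᶠ x | member y (concat bs)
    ... | true  | true  | _ = refl
    ... | true  | false | _ = refl
    ... | false | true  | true  = refl
    ... | false | true  | false = refl
    ... | false | false | true  = refl
    ... | false | false | false = refl

   -- i elements of the current cycle are still to be chosen, each among the unseen half-edges, and
   -- all choices lead to equal counts. A half-edge already seen is impossible: it would close the
   -- cycle too early, or lie on another cycle or in `D₀`.
   path-count : ∀ i v bs x l → length l + i ≡ q → All Full bs → Unique ((x ∷ l) ++ concat bs) → (∀ {y} → y ∈ (x ∷ l) ++ concat bs → D₀ y ≡ false) →
    countF n (not ∘ seen ((x ∷ l) ++ concat bs)) ≡ i + v * suc q → totalσ (pathQuery bs x l) * choices (suc q) v ≡ (i + v * suc q) !
   path-count zero v bs x l len full u d cnt = trans (cong (_* choices (suc q) v) (totalσ-cong (λ σ → sym (∧-assoc (isBlock σ (x ∷ l)) _ _))))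
     (closed-count v ((x ∷ l) ∷ bs) (cong suc (trans (sym (+-identityʳ _)) len) ∷ full) u d cnt)
    where open import Data.Bool.Properties using (∧-assoc)
   path-count (suc i) v bs x l len full u d cnt = begin
    totalσ (pathQuery bs x l) * choices (suc q) v
     ≡⟨ cong (_* choices (suc q) v) (trans (sumOver-fibres (allFin n) Fin._≟_ (sumFin-δ n) σs (λ σ → iter σ (suc (length l)) x) _)
        (trans (sumOver-cong (allFin n) (λ y → trans (sumOver-cong σs (λ σ → mul (iter σ (suc (length l)) x =ᶠ y) _)) (only y)))
         (sumFin-const n (not ∘ seen ((x ∷ l) ++ concat bs)) t (t y₀) same))) ⟩
    countF n (not ∘ seen ((x ∷ l) ++ concat bs)) * t y₀ * choices (suc q) v
     ≡⟨ *-assoc (countF n (not ∘ seen ((x ∷ l) ++ concat bs))) (t y₀) (choices (suc q) v) ⟩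
    countF n (not ∘ seen ((x ∷ l) ++ concat bs)) * (t y₀ * choices (suc q) v) ≡⟨ cong₂ _*_ cnt (t-value y₀ uy₀) ⟩
    (suc i + v * suc q) * (i + v * suc q) ! ∎
    where
    open ≡-Reasoning
    witness = countF-witness n {not ∘ seen ((x ∷ l) ++ concat bs)} (i + v * suc q) cnt
    y₀ = proj₁ witness
    uy₀ : seen ((x ∷ l) ++ concat bs) y₀ ≡ false
    uy₀ = not-true (proj₂ witness)
    t : Fin n → ℕ
    t y = totalσ (λ σ → (iter σ (suc (length l)) x =ᶠ y) ∧ pathQuery bs x l σ)
    mul : ∀ a b → indicator a * indicator b ≡ indicator (a ∧ b)
    mul true  b = +-identityʳ _
    mul false b = refl
    snoc-block : ∀ y σ → (iter σ (suc (length l)) x =ᶠ y) ∧ pathQuery bs x l σ ≡ pathQuery bs x (l ++ [ y ]) σ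
    snoc-block y σ = bool-iff
     (λ q → let a , b = ∧-split {iter σ (suc (length l)) x =ᶠ y} q ; c , e = ∧-split {isBlock σ (x ∷ l)} b in
      ∧-join (orbit-isBlock (trans (cong (λ k → orbL σ k x) (cong suc len')) (trans (orbL-snoc σ (suc (length l)) x)
       (cong₂ (λ a b → a ++ [ b ]) (isBlock-orbit c) (=ᶠ-eq a))))) e)
     (λ q → let c , e = ∧-split {isBlock σ (x ∷ (l ++ [ y ]))} q
                o = trans (sym (orbL-snoc σ (suc (length l)) x)) (trans (cong (λ k → orbL σ k x) (cong suc (sym len'))) (isBlock-orbit c))
                a , b = Data.List.Properties.∷ʳ-injective _ (x ∷ l) o in
      ∧-join (=ᶠ-true b) (∧-join (orbit-isBlock a) e))
     where
     import Data.List.Properties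
     len' : length (l ++ [ y ]) ≡ suc (length l)
     len' = trans (length-++ l) (+-comm (length l) 1)
    t-value : ∀ y → seen ((x ∷ l) ++ concat bs) y ≡ false → t y * choices (suc q) v ≡ (i + v * suc q) !
    t-value y uy = trans (cong (_* choices (suc q) v) (totalσ-cong (snoc-block y)))
     (path-count i v bs x (l ++ [ y ]) (trans (cong (_+ i) (trans (length-++ l) (+-comm (length l) 1))) (trans (sym (+-suc (length l) i)) len))
      full (Unique-resp (↭-sym perm) (All.tabulate (λ j e → true≢false (∨-right {D₀ y} (member-complete (subst (_∈ (x ∷ l) ++ concat bs) (sym e) j))) uy) ∷ u))
      (λ j → case (∈-resp-↭ perm j)) (suc-injective (trans (sym (trans (countF-remove n _ (y ∷ []) ([] ∷ []) (λ { (here refl) → not-false uy }))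
         (cong suc (countF-cong n one)))) cnt)))
     where
     open import Data.List.Relation.Binary.Permutation.Propositional.Properties using (∈-resp-↭)
     perm : (x ∷ (l ++ [ y ])) ++ concat bs ↭ y ∷ (x ∷ l) ++ concat bs
     perm = subst (_↭ y ∷ (x ∷ l) ++ concat bs) (sym (++-assoc (x ∷ l) [ y ] (concat bs))) (shift y (x ∷ l) (concat bs))
     case : ∀ {z} → z ∈ y ∷ (x ∷ l) ++ concat bs → D₀ z ≡ false
     case (here refl) = ¬true⇒false (λ t → true≢false (∨-left t) uy)
     case (there j)   = d j
     one : ∀ z → not (seen ((x ∷ l) ++ concat bs) z) ∧ not (member z (y ∷ [])) ≡ not (seen ((x ∷ (l ++ [ y ])) ++ concat bs) z)
     one z = trans (shuffle (D₀ z) (member z ((x ∷ l) ++ concat bs)) (member z (y ∷ []))) (cong (λ b → not (D₀ z ∨ b)) mem)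
      where
      shuffle : ∀ a b c → not (a ∨ b) ∧ not c ≡ not (a ∨ (c ∨ b))
      shuffle true  b     c     = refl
      shuffle false true  true  = refl
      shuffle false true  false = refl
      shuffle false false true  = refl
      shuffle false false false = refl
      mem : member z (y ∷ []) ∨ member z ((x ∷ l) ++ concat bs) ≡ member z ((x ∷ (l ++ [ y ])) ++ concat bs)
      mem = bool-iff (λ q → member-complete (∈-resp-↭ (↭-sym perm) (to (∨-split {member z (y ∷ [])} q))))
       (λ q → from (∈-resp-↭ perm (member-sound _ q)))
       where
       to : member z (y ∷ []) ≡ true ⊎ member z ((x ∷ l) ++ concat bs) ≡ true → z ∈ y ∷ (x ∷ l) ++ concat bs
       to (inj₁ a) with member-sound (y ∷ []) a
       ... | here e = here e
       to (inj₂ b) = there (member-sound _ b)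
       from : z ∈ y ∷ (x ∷ l) ++ concat bs → member z (y ∷ []) ∨ member z ((x ∷ l) ++ concat bs) ≡ true
       from (here e)  = ∨-left {member z (y ∷ [])} (member-complete {ys = y ∷ []} (here e))
       from (there j) = ∨-right {member z (y ∷ [])} (member-complete j)
    choices-nonzero : ∀ w → ∃ λ k → choices (suc q) w ≡ suc k
    choices-nonzero zero    = 0 , refl
    choices-nonzero (suc w) with choices (suc q) w | choices-nonzero w
    ... | _ | k , refl = _ , refl
    same : ∀ y → not (seen ((x ∷ l) ++ concat bs) y) ≡ true → t y ≡ t y₀
    same y uy with choices (suc q) v | choices-nonzero v | t-value y (not-true uy) | t-value y₀ uy₀
    ... | _ | k , refl | a | b = *-cancelʳ-≡ (t y) (t y₀) (suc k) (trans a (sym b))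
    only : ∀ y → t y ≡ indicator (not (seen ((x ∷ l) ++ concat bs) y)) * t y
    only y with seen ((x ∷ l) ++ concat bs) y in eq
    ... | false = sym (+-identityʳ (t y))
    ... | true = trans (totalσ-cong (λ σ → ¬true⇒false (impossible σ))) (sumOver-zero σs)
     where
     impossible : ∀ σ → (iter σ (suc (length l)) x =ᶠ y) ∧ pathQuery bs x l σ ≡ true → ⊥
     impossible σ q' with ∧-split {iter σ (suc (length l)) x =ᶠ y} q'
     ... | a , b with ∧-split {isBlock σ (x ∷ l)} b
     ...   | c , e with ∧-split {allL (isBlock σ) bs} e
     ...     | eb , eg with good-sound eg
     ...       | inj , fix , deg = decide (∨-split {D₀ y} eq)
      where
      y≡ : iter σ (suc (length l)) x ≡ y
      y≡ = =ᶠ-eq a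
      back : Orb σ y x
      back = orb-sym σ inj (suc (length l) , y≡)
      decide : D₀ y ≡ true ⊎ member y ((x ∷ l) ++ concat bs) ≡ true → ⊥
      decide (inj₁ dy) = true≢false (orb-closed σ (λ z → D₀ z ≡ true) (λ {z} dz → subst (λ w → D₀ w ≡ true) (sym (fix z dz)) dz) back dy)
                 (d (here refl))
      decide (inj₂ m) with ∈-++⁻ (x ∷ l) (member-sound ((x ∷ l) ++ concat bs) m)
      ... | inj₂ j = apart (x ∷ l) u (here refl) (orb-closed σ (_∈ concat bs) (block-closed eg full (λ i → d (∈-++⁺ʳ (x ∷ l) i)) eb) back j)
       where
       apart : ∀ b {t : List (Fin n)} → Unique (b ++ t) → ∀ {x} → x ∈ b → x ∈ t → ⊥
       apart (x ∷ b) (r ∷ _) (here refl) j = All.lookup r (∈-++⁺ʳ b j) refl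
       apart (x ∷ b) (_ ∷ u) (there i)   j = apart b u i j
      ... | inj₁ j = snoc-repeat (x ∷ l) (subst Unique
        (trans (orbL-snoc σ (suc (length l)) x) (cong₂ (λ a b → a ++ [ b ]) (isBlock-orbit c) y≡))
        (prefix (suc (length l)) i (subst (λ k → Unique (orbL σ k x)) len' (orbL-unique σ inj q (deg x (d (here refl))))))) j
       where
       len' : suc q ≡ suc (suc (length l)) + i
       len' = cong suc (trans (sym len) (+-suc (length l) i))
       prefix : ∀ k i → ∀ {w} → Unique (orbL σ (suc k + i) w) → Unique (orbL σ (suc k) w)
       prefix zero    i (_ ∷ _) = [] ∷ []
       prefix (suc k) i {w} (r ∷ u) = All.tabulate (λ j → All.lookup r (more (suc k) i j)) ∷ prefix k i u
        where
        more : ∀ k i {w z} → z ∈ orbL σ k w → z ∈ orbL σ (k + i) w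
        more (suc k) i (here e)  = here e
        more (suc k) i (there j) = there (more k i j)
       snoc-repeat : ∀ xs → Unique (xs ++ [ y ]) → y ∈ xs → ⊥
       snoc-repeat (z ∷ xs) (r ∷ _) (here refl) = All.lookup r (∈-++⁺ʳ xs (here refl)) refl
       snoc-repeat (z ∷ xs) (_ ∷ u) (there j)   = snoc-repeat xs u j

  countσ : ∀ v → countF n (not ∘ D₀) ≡ v * suc q → totalσ good * choices (suc q) v ≡ (v * suc q) !
  countσ v cnt = closed-count v [] [] [] (λ ()) (trans (countF-cong n (λ x → cong not (∨-identityʳ (D₀ x)))) cnt)
   where open import Data.Bool.Properties using (∨-identityʳ)

-- From powers of u to the number of trees met.

at : ℕ → ℕ → (ℕ → ℤ) → ℤ
at m       zero    F = F m
at zero    (suc κ) F = + 0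
at (suc m) (suc κ) F = at m κ F

at-cong : ∀ m κ {F G : ℕ → ℤ} → (∀ m → F m ≡ G m) → at m κ F ≡ at m κ G
at-cong m       zero    q = q m
at-cong zero    (suc κ) q = refl
at-cong (suc m) (suc κ) q = at-cong m κ q

at-+ : ∀ m κ (F G : ℕ → ℤ) → at m κ (λ m → F m ℤ.+ G m) ≡ at m κ F ℤ.+ at m κ G
at-+ m       zero    F G = refl
at-+ zero    (suc κ) F G = refl
at-+ (suc m) (suc κ) F G = at-+ m κ F G

at-0 : ∀ m κ {F : ℕ → ℤ} → (∀ m → F m ≡ + 0) → at m κ F ≡ + 0
at-0 m       zero    q = q m
at-0 zero    (suc κ) q = refl
at-0 (suc m) (suc κ) q = at-0 m κ q

-- A factor u amounts to one more tree among those already met.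
at-delay : ∀ m κ F → at m κ (delay F) ≡ at m (suc κ) F
at-delay zero    zero    F = refl
at-delay (suc m) zero    F = refl
at-delay zero    (suc κ) F = refl
at-delay (suc m) (suc κ) F = at-delay m κ F

at-splitSum : ∀ m κ (F : ℕ → ℕ → ℕ → ℤ) i j → at m κ (λ m → splitSum (λ i l → F i l m) i j) ≡ splitSum (λ i l → at m κ (F i l)) i j
at-splitSum m κ F i zero    = at-0 m κ (λ _ → refl)
at-splitSum m κ F i (suc j) = trans (at-+ m κ (F i j) _) (cong (λ z → at m κ (F i j) ℤ.+ z) (at-splitSum m κ F (suc i) j))

at-diag : ∀ m F → at m m F ≡ F 0
at-diag zero    F = refl
at-diag (suc m) F = at-diag m F

at-off : ∀ m κ F → (∀ m → F (suc m) ≡ + 0) → κ ≢ m → at m κ F ≡ + 0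
at-off zero    zero    F q ne = ⊥-elim (ne refl)
at-off (suc m) zero    F q ne = q m
at-off zero    (suc κ) F q ne = refl
at-off (suc m) (suc κ) F q ne = at-off m κ F q (ne ∘ cong suc)

-- Once κ trees are met, M + 1 - κ are still to come, and this is the exponent of u to be extracted.
recursion : ∀ {p' N} M → SeriesRecursion p' N → Recursion p' M (λ j k st a κ → at (suc M) κ (N j k st a))
recursion {p'} {N} M R = record
 { c-undecided = λ j k st a κ → trans (at-cong (suc M) κ (undecided j k st a)) (at-+ (suc M) κ _ _)
 ; c-decided = λ k st a κ → trans (at-cong (suc M) κ (decided k st a)) (trans (at-+ (suc M) κ _ _)
   (cong₂ ℤ._+_ (at-splitSum (suc M) κ (λ i l → N 0 i (l ∷ st) a) 0 k) (at-delay (suc M) κ (N (suc (suc p')) k st a))))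
 ; c-pop = λ k st a κ → at-cong (suc M) κ (pop k st a)
 ; c-end = trans (at-diag (suc M) (N 0 0 [] 1)) end
 ; c-end' = λ κ ne → at-off (suc M) κ (N 0 0 [] 1) end' ne
 ; c-end'' = λ a κ → at-0 (suc M) κ (end'' a)
 ; c-vanish = λ j k st a κ h → at-0 (suc M) κ (λ m → vanish j k st a m h) }
 where open SeriesRecursion R

-- The number of vertices, and the initial state of the exploration.

module _ {n} {σ : Fin n → Fin n} (inj : Inj σ) (q : ℕ) where

 -- Each vertex discovered removes q + 1 half-edges and adds one representative, so the number of
 -- half-edges determines the number of vertices. `fuel` bounds the undiscovered half-edges and
 -- makes the recursion terminate.
 count-cycles : ∀ fuel Dsc L → countF n (not ∘ Dsc) ≤ fuel → StableSet σ Dsc → (∀ x → Dsc x ≡ false → hasDeg σ (suc q) x ≡ true) →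
  AllPairs (λ x y → ¬ Orb σ x y) L → All (λ x → Dsc x ≡ true) L → (∀ x → Dsc x ≡ true → Any (Orb σ x) L) →
  ∃ λ v → countF n (not ∘ Dsc) ≡ v * suc q × numCycles σ ≡ length L + v
 count-cycles fuel Dsc L le st deg unrel inD cov with countF n (not ∘ Dsc) in eq
 ... | zero = 0 , refl , trans (numCycles-reps σ inj (mkReps L refl unrel (λ x → cov x (all x)))) (sym (+-identityʳ _))
  where
  all : ∀ x → Dsc x ≡ true
  all x with Dsc x in eqx
  ... | true  = refl
  ... | false = ⊥-elim (true≢false (not-false eqx) (countF-none n eq x))
 count-cycles zero Dsc L () st deg unrel inD cov | suc k
 count-cycles (suc fuel) Dsc L (s≤s le) st deg unrel inD cov | suc k with countF-witness n _ eq
 ... | g , ug = let v , e , c = rec in suc v , trans (trans (sym eq) discover-count) (cong (λ z → suc q + z) e) ,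
          trans c (sym (+-suc (length L) v))
  where
  u = not-true ug
  open Discover inj st q (deg g u) u
  less : countF n (not ∘ Dsc') ≤ fuel
  less = ≤-trans (≤-trans (m≤n+m _ q) (≤-reflexive (suc-injective (trans (sym discover-count) eq)))) le
  sep : ∀ {y} → Dsc y ≡ true → ¬ Orb σ g y
  sep d o = true≢false d (orb-closed σ (λ z → Dsc z ≡ false) (λ {z} f → trans (st z) f) o u)
  cov' : ∀ x → Dsc' x ≡ true → Any (Orb σ x) (g ∷ L)
  cov' x d with ∨-split {Dsc x} d
  ... | inj₁ d' = there (cov x d')
  ... | inj₂ m with ∈-orbL σ {suc q} (member-sound vs m)
  ...   | j , _ , e = here (orb-sym σ inj (j , e))
  rec = count-cycles fuel Dsc' (g ∷ L) less stable' (λ x f → deg x (discover-false f))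
   (All.map sep inD ∷ unrel) (discover-vs (here refl) ∷ All.map discover-⊇ inD) cov'

-- `D₀` holds the half-edges whose vertex may have a degree other than p: none for p-valent maps,
-- the root half-edge for quasi-p-valent ones.
module Start {n} (σ : Fin n → Fin n) (inj : Inj σ) (r : Fin n) (p' : ℕ)
 (D₀ : Fin n → Bool) (deg : ∀ x → D₀ x ≡ false → hasDeg σ (suc (suc (suc p'))) x ≡ true)
 (d : ℕ) (deg-r : hasDeg σ (suc d) r ≡ true) (D₀⊆ : ∀ x → D₀ x ≡ true → x ∈ orbL σ (suc d) r)
 (v e f M : ℕ) (size : countF n (not ∘ discover (λ _ → false) (orbL σ (suc d) r)) ≡ v * suc (suc (suc p')))
 (edges : e + e ≡ suc d + v * suc (suc (suc p'))) (cycles : numCycles σ ≡ suc v)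
 (euler : f + v ≡ suc e) (eulerF : 2 * numCycles σ + 2 * f ≡ n + 4)
 {N : ℕ → ℕ → List ℕ → ℕ → ℕ → ℤ} (R : SeriesRecursion p' N) where

 open Explore σ inj r p' D₀ deg f M eulerF _ (recursion M R) public
 open Geo σ inj r (suc p') D₀ deg f public
 open Forest σ inj public
 module Disc = Discover inj {λ _ → false} (λ _ → refl) d deg-r refl

 nothing-known : Knowledge n
 nothing-known _ = nothing

 start : Partial id Disc.Dsc' (orbL σ (suc d) r ∷ []) e v
 start = record
  { inv = λ _ → refl ; und = λ _ _ → refl ; stable = Disc.stable'
  ; root = Disc.discover-vs (here refl) ; base = λ x q → Disc.discover-vs (D₀⊆ x q)
  ; open-mem = λ x q _ → subst (x ∈_) (sym (++-identityʳ Disc.vs)) (member-sound Disc.vs q)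
  ; mem-open = λ {x} i → Disc.discover-vs (subst (x ∈_) (++-identityʳ Disc.vs) i) , refl
  ; unique = subst Unique (sym (++-identityʳ Disc.vs)) (orbL-unique σ inj d deg-r)
  ; cyclic = fresh-cyclic σ d r (λ _ → refl) (hasDeg-period σ inj d deg-r) ∷ []
  ; euler = trans (cong (λ z → z + e) cycles) (trans (sym (+-suc v e)) (trans (cong (λ z → v + z) (sym euler))
    (solve 2 (λ v f → v :+ (f :+ v) := f :+ (v :+ v)) refl v f)))
  ; edges = trans edges (cong (λ z → z + v * suc (suc (suc p'))) (sym (trans (cong length (++-identityʳ Disc.vs)) (length-orbL σ (suc d) r))))
  ; count = size
  ; conn = λ x q → let j , _ , e' = ∈-orbL σ {suc d} (member-sound Disc.vs q) in
    subst (Path (adjMap σ id) r) e' (orb-path j r) }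
  where open +-*-Solver

 start-tree : Tree id nothing-known Disc.Dsc' (orbL σ (suc d) r) [] 1
 start-tree = record
  { unknown-und = λ _ _ → refl ; unknown-U = λ _ → refl ; decided = λ ()
  ; glued = λ _ m → ⊥-elim (m refl) ; true-glued = λ _ () ; reps = r ∷ [] ; reps-size = refl
  ; reps-Dsc = Disc.discover-vs (here refl) ∷ [] ; hub = r
  ; hub-U = λ i → let j , _ , e' = ∈-orbL σ {suc d} i in treePath-orb id nothing-known (j , e')
  ; covered = λ x q → let j , _ , e' = ∈-orbL σ {suc d} (member-sound Disc.vs q) in
    here (treePath-orb id nothing-known (j , e'))
  ; label = λ _ → 0 ; label-σ = λ _ → refl ; label-S = λ _ _ → refl ; label-reps = [] ∷ []
  ; label-small = s≤s z≤n ∷ [] ; cut = λ _ () }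

 result : ℕ → ℕ → ℤ
 result j k = + choices (suc (suc (suc p'))) v ℤ.* N j k [] f M

 total-good : + total good ≡ result (suc d) 0
 total-good = trans (cong +_ (total-cong {Q = good} {query id nothing-known} (λ α S → bool-iff
   (λ t → query-complete {id} {nothing-known} (extends (λ _ m → ⊥-elim (m refl)) (λ _ ()) (good-sound t)))
   (λ t → good-complete (Extends.isGood (query-sound {id} {nothing-known} t))))))
  (subst (λ k → + total (query id nothing-known) ≡ result k 0) (length-orbL σ (suc d) r)
   (explore e [] (orbL σ (suc d) r) [] {a = f} (subst (λ w → Partial id Disc.Dsc' (w ∷ []) e v)
    (sym (++-identityʳ Disc.vs)) start) start-tree euler))

 -- The root half-edge is excluded from the forest before the exploration begins and waits as the
 -- one decided half-edge.
 total-good-root : + total (λ α S → not (S r) ∧ good α S) ≡ result d 1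
 total-good-root = trans (cong +_ (total-cong same)) (subst (λ k → + total (query id S₁) ≡ result k 1) (length-orbL σ d (σ r))
   (explore e [] (orbL σ d (σ r)) [ r ] {a = f} (rotate start) (skip start-tree (Disc.discover-vs (here refl)) refl
    (λ i → All.lookup (AllPairs.head (orbL-unique σ inj d deg-r)) i refl) (λ { (here e') → inj₂ e' })) euler))
  where
  S₁ = assign nothing-known r r false
  same : ∀ α S → not (S r) ∧ good α S ≡ query id S₁ α S
  same α S = bool-iff
   (λ t → let s , g = ∧-split {not (S r)} t in
    query-complete {id} {S₁} (extends (λ _ m → ⊥-elim (m refl)) (known (not-true s)) (good-sound g)))
   (λ t → let E = query-sound {id} {S₁} t in
    ∧-join (not-false (Extends.extS E r (assign-h nothing-known r r false))) (good-complete (Extends.isGood E)))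
   where
   known : S r ≡ false → ∀ x {b} → S₁ x ≡ just b → S x ≡ b
   known s x q with same? x r
   ... | inj₁ refl with trans (sym (assign-h nothing-known r r false)) q
   ...   | refl = s
   known s x q | inj₂ u with trans (sym (assign-other nothing-known r r false u u)) q
   ... | ()

-- From labelled to rooted counts.

module _ {n : ℕ} where

 checks : Family → (p f m : ℕ) → (Fin n → Fin n) → Fin n → (Fin n → Fin n) → (Fin n → Bool) → Bool
 checks fam p f m σ r α S = extraCond fam r S ∧ isFPFInvolution α ∧ isConnected σ α r ∧ isPlanar σ α ∧ isEdgeSubset α S ∧ isForest σ α S
  ∧ ⌊ numCycles (λ h → σ (α h)) ℕ.≟ f ⌋ ∧ ⌊ numComponents σ α S ℕ.≟ suc m ⌋

 rotationOK : Family → ℕ → Fin n → (Fin n → Fin n) → Bool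
 rotationOK fam p r σ = isPerm σ ∧ degreeCond fam p σ r

 valid-split : ∀ fam p f m σ α r S → valid fam p f m (σ , α , r , S) ≡ rotationOK fam p r σ ∧ checks fam p f m σ r α S
 valid-split fam p f m σ α r S = reorder (isPerm σ) (isFPFInvolution α) (isConnected σ α r) (isPlanar σ α)
  (degreeCond fam p σ r) (extraCond fam r S) _
  where
  reorder : ∀ a b c d e x y → a ∧ b ∧ c ∧ d ∧ e ∧ x ∧ y ≡ (a ∧ e) ∧ x ∧ b ∧ c ∧ d ∧ y
  reorder false _ _ _ _ _ _ = refl
  reorder true false _ _ true true _ = refl
  reorder true false _ _ true false _ = refl
  reorder true false _ _ false _ _ = refl
  reorder true true false _ true true _ = refl
  reorder true true false _ true false _ = refl
  reorder true true false _ false _ _ = refl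
  reorder true true true false true true _ = refl
  reorder true true true false true false _ = refl
  reorder true true true false false _ _ = refl
  reorder true true true true false _ _ = refl
  reorder true true true true true x _ = refl

 -- The number of gluings with forest is the same for every admissible rotation, so the labelled
 -- count is a product for each root.
 count-valid : ∀ fam p f m K → (∀ r σ → rotationOK fam p r σ ≡ true → total (checks fam p f m σ r) ≡ K) → countL (valid fam p f m) (allLabelled n) ≡
   sumFin n (λ r → sumOver (funs n (allFin n)) (indicator ∘ rotationOK fam p r) * K)
 count-valid fam p f m K each = begin
  countL (valid fam p f m) (allLabelled n) ≡⟨ countL-sumOver _ (allLabelled n) ⟩
  sumOver (allLabelled n) ind ≡⟨ sumOver-concatMap _ σs ind ⟩
  sumOver σs (λ σ → sumOver (concatMap (λ α → concatMap (λ r → map (λ S → (σ , α , r , S)) Ss) rs) σs) ind)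
   ≡⟨ sumOver-cong σs (λ σ → trans (sumOver-concatMap _ σs ind) (sumOver-cong σs (λ α →
      trans (sumOver-concatMap _ rs ind) (sumOver-cong rs (λ r → sumOver-map _ Ss ind))))) ⟩
  sumOver σs (λ σ → sumOver σs (λ α → sumOver rs (λ r → sumOver Ss (λ S → ind (σ , α , r , S))))) ≡⟨ sumOver-cong σs (λ σ → sumOver-swap σs rs _) ⟩
  sumOver σs (λ σ → sumOver rs (λ r → sumOver σs (λ α → sumOver Ss (λ S → ind (σ , α , r , S))))) ≡⟨ sumOver-swap σs rs _ ⟩
  sumOver rs (λ r → sumOver σs (λ σ → sumOver σs (λ α → sumOver Ss (λ S → ind (σ , α , r , S)))))
   ≡⟨ sumOver-cong rs (λ r → trans (sumOver-cong σs (λ σ → block r σ)) (sumOver-*ʳ σs _ K)) ⟩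
  sumOver rs (λ r → sumOver σs (indicator ∘ rotationOK fam p r) * K) ∎
  where
  open ≡-Reasoning
  σs = funs n (allFin n)
  rs = allFin n
  Ss = funs n bools
  ind = indicator ∘ valid fam p f m
  block : ∀ r σ → sumOver σs (λ α → sumOver Ss (λ S → ind (σ , α , r , S))) ≡ indicator (rotationOK fam p r σ) * K
  block r σ with rotationOK fam p r σ in eq
  ... | true = trans (sumOver-cong σs (λ α → sumOver-cong Ss (λ S → cong indicator
      (trans (valid-split fam p f m σ α r S) (cong (_∧ checks fam p f m σ r α S) eq))))) (trans (each r σ eq) (sym (+-identityʳ K)))
  ... | false = trans (sumOver-cong σs (λ α → trans (sumOver-cong Ss (λ S → cong indicator
      (trans (valid-split fam p f m σ α r S) (cong (_∧ checks fam p f m σ r α S) eq)))) (sumOver-zero Ss))) (sumOver-zero σs)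

 isPerm-inj : ∀ {σ : Fin n → Fin n} → isPerm σ ≡ true → Inj σ
 isPerm-inj {σ} t {x} {y} e = =ᶠ-eq (implies-split (allF-sound n {λ h → not (σ x =ᶠ σ h) ∨ (x =ᶠ h)} (allF-sound n t x) y) (=ᶠ-true e))

 inj-isPerm : ∀ {σ : Fin n → Fin n} → Inj σ → isPerm σ ≡ true
 inj-isPerm {σ} inj = allF-complete n (λ g → allF-complete n {λ h → not (σ g =ᶠ σ h) ∨ (g =ᶠ h)}
  (λ h → implies-join (λ t → =ᶠ-true (inj (=ᶠ-eq t)))))

sumOver-witness : ∀ {A : Set} xs (P : A → Bool) → sumOver xs (indicator ∘ P) ≢ 0 → ∃ λ x → P x ≡ true
sumOver-witness []       P ne = ⊥-elim (ne refl)
sumOver-witness (x ∷ xs) P ne with P x in eq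
... | true  = x , eq
... | false = sumOver-witness xs P ne

!-nonzero : ∀ k → k ! ≢ 0
!-nonzero k e = ≢-nonZero⁻¹ (k !) {{k !≢0}} e
 where open import Data.Nat.Base using (≢-nonZero⁻¹)

-- Each of the k + 1 possible roots contributes k! X. The sum is X times the factorial by which
-- labelled counts are divided.
factor : ∀ k (s : Fin (suc k) → ℕ) c X → (∀ r → s r * (suc k * c) ≡ (suc k) !) → sumFin (suc k) (λ r → s r * (c * X)) ≡ X * (suc k) !
factor k s c X e = begin
 sumFin (suc k) (λ r → s r * (c * X)) ≡⟨ sumOver-cong (allFin (suc k)) (λ r → trans (sym (*-assoc (s r) c X)) (cong (_* X) (each r))) ⟩
 sumFin (suc k) (λ r → k ! * X) ≡⟨ sumOver-const (allFin (suc k)) (k ! * X) ⟩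
 length (allFin (suc k)) * (k ! * X) ≡⟨ cong (_* (k ! * X)) (Data.List.Properties.length-tabulate {n = suc k} id) ⟩
 suc k * (k ! * X) ≡⟨ solve 3 (λ a b c → a :* (b :* c) := c :* (a :* b)) refl (suc k) (k !) X ⟩
 X * (suc k) ! ∎
 where
 open ≡-Reasoning
 open +-*-Solver
 import Data.List.Properties
 each : ∀ r → s r * c ≡ k !
 each r = *-cancelˡ-≡ _ _ (suc k) (trans (solve 3 (λ a b c → a :* (b :* c) := b :* (a :* c)) refl (suc k) (s r) c) (e r))

sum-none : ∀ xs (g : ℕ → ℕ) → (∀ x → g x ≡ 0) → sumℕ (map g xs) ≡ 0
sum-none []       g z = refl
sum-none (x ∷ xs) g z = cong₂ _+_ (z x) (sum-none xs g z)

sum-single : ∀ xs (g : ℕ → ℕ) y → Unique xs → y ∈ xs → (∀ x → x ≢ y → g x ≡ 0) → sumℕ (map g xs) ≡ g y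
sum-single (x ∷ xs) g y (x∉ ∷ u) (here refl) z = trans (cong (λ k → g x + k) (go xs x∉)) (+-identityʳ (g x))
 where
 go : ∀ xs → All (x ≢_) xs → sumℕ (map g xs) ≡ 0
 go []       []       = refl
 go (y ∷ ys) (n ∷ ns) = cong₂ _+_ (z y (n ∘ sym)) (go ys ns)
sum-single (x ∷ xs) g y (x∉ ∷ u) (there i) z = cong₂ _+_ (z x (All.lookup x∉ i)) (sum-single xs g y u i z)

-- Coefficients of the three generating functions.

module Coefficients (p' f m : ℕ) {N : ℕ → ℕ → List ℕ → ℕ → ℕ → ℤ} (R : SeriesRecursion p' N) where

 p : ℕ
 p = suc (suc (suc p'))

 choices-suc : ∀ v → ∃ λ k → choices p v ≡ suc k
 choices-suc zero = 0 , refl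
 choices-suc (suc v) with choices p v | choices-suc v
 ... | _ | k , refl = _ , refl

 -- X comes from a recursion over the integers; a positive multiple of it is a count, so it is
 -- nonnegative and equals its absolute value.
 value : ∀ v K X → + K ≡ + choices p v ℤ.* X → K ≡ choices p v * ∣ X ∣ × + ∣ X ∣ ≡ X
 value v K X e = trans (cong ∣_∣ e) (ℤP.abs-* (+ choices p v) X) , nonneg X e
  where
  nonneg : ∀ X → + K ≡ + choices p v ℤ.* X → + ∣ X ∣ ≡ X
  nonneg (+ _)    _ = refl
  nonneg -[1+ x ] e with choices p v | choices-suc v
  ... | _ | k , refl with e
  ...   | ()

 halve : ∀ n v → 2 * suc v + 2 * f ≡ n + 4 → ∃ λ e → e + e ≡ n × f + v ≡ suc e
 halve n v q = go (f + v) refl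
  where
  open +-*-Solver
  q' : 2 + (f + v + (f + v)) ≡ n + 4
  q' = trans (solve 2 (λ f v → con 2 :+ (f :+ v :+ (f :+ v)) := con 2 :* (con 1 :+ v) :+ con 2 :* f) refl f v) q
  go : ∀ s → f + v ≡ s → ∃ λ e → e + e ≡ n × f + v ≡ suc e
  go zero    e = ⊥-elim (absurd n (subst (λ s → 2 + (s + s) ≡ n + 4) e q'))
   where absurd : ∀ n → 2 ≢ n + 4
         absurd zero ()
         absurd (suc zero) ()
         absurd (suc (suc zero)) ()
         absurd (suc (suc (suc n))) ()
  go (suc s) e = s , +-cancelʳ-≡ 4 (s + s) n (trans (solve 1 (λ s → s :+ s :+ con 4 := con 2 :+ (con 1 :+ s :+ (con 1 :+ s))) refl s)
    (subst (λ s → 2 + (s + s) ≡ n + 4) e q')) , e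

 -- The number of half-edges and the degree of the root vertex determine each other through
 -- Euler's formula: with v non-root vertices, 2 (v + 1) + 2 f = n + 4.
 record Shape (fam : Family) (size : ℕ → ℕ) (j k : ℕ) : Set where
  field
   rooted  : ∀ v → 2 * suc v + 2 * f ≡ size v + 4 →
    countL (valid fam p f m) (allLabelled (size v)) ≡ ∣ N j k [] f m ∣ * (size v) ! × + ∣ N j k [] f m ∣ ≡ N j k [] f m
   none    : ∀ n → (∀ v → n ≡ size v → 2 * suc v + 2 * f ≢ n + 4) → countL (valid fam p f m) (allLabelled n) ≡ 0
   formula : ∀ v → size v ≡ j + k + v * p

 nonplanar-zero : ∀ fam {n} (σ : Fin n → Fin n) r → 2 * numCycles σ + 2 * f ≢ n + 4 → total (checks fam p f m σ r) ≡ 0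
 nonplanar-zero fam {n} σ r ne = total-zero λ α S t →
  let _ , t = ∧-split {extraCond fam r S} t ; _ , t = ∧-split {isFPFInvolution α} t
      _ , t = ∧-split {isConnected σ α r} t ; pl , t = ∧-split {isPlanar σ α} t
      _ , t = ∧-split {isEdgeSubset α S} t ; _ , t = ∧-split {isForest σ α S} t
      fc , _ = ∧-split {⌊ numCycles (λ h → σ (α h)) ℕ.≟ f ⌋} t in
  ne (subst (λ k → 2 * numCycles σ + 2 * k ≡ n + 4) (true-dec (numCycles (λ h → σ (α h)) ℕ.≟ f) fc)
   (true-dec (2 * numCycles σ + 2 * numCycles (λ h → σ (α h)) ℕ.≟ (n + 4)) pl))

 rooted-zero : ∀ fam {n} → (∀ r σ → rotationOK {n} fam p r σ ≡ true → 2 * numCycles σ + 2 * f ≢ n + 4) → countL (valid fam p f m) (allLabelled n) ≡ 0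
 rooted-zero fam {n} ne = trans (count-valid fam p f m 0 (λ r σ t → nonplanar-zero fam σ r (ne r σ t)))
  (trans (sumOver-cong (allFin n) (λ r → *-zeroʳ (sumOver (funs n (allFin n)) (indicator ∘ rotationOK fam p r)))) (sumOver-zero (allFin n)))

 rotations : Family → ∀ {n} → Fin n → ℕ
 rotations fam {n} r = sumOver (funs n (allFin n)) (indicator ∘ rotationOK fam p r)

 -- The number n of half-edges is kept a variable: the lists of functions would otherwise unfold.
 counted : ∀ fam {n} v Y → Fin n → (∀ r σ → rotationOK {n} fam p r σ ≡ true → + total (checks fam p f m σ r) ≡ + choices p v ℤ.* Y) →
  (∀ r → rotations fam {n} r * (n * choices p v) ≡ n !) → countL (valid fam p f m) (allLabelled n) ≡ ∣ Y ∣ * n ! × + ∣ Y ∣ ≡ Y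
 counted fam {suc k} v Y r₀ each e =
   trans (count-valid fam p f m (choices p v * ∣ Y ∣) (λ r σ t → proj₁ (value v _ Y (each r σ t)))) (factor k (rotations fam) (choices p v) ∣ Y ∣ e) ,
   -- Nonnegativity of Y needs one actual rotation. It exists because the number of rotations times
   -- another number is n!, which is not zero.
   positive (sumOver-witness (funs (suc k) (allFin (suc k))) (rotationOK fam p r₀)
    (λ z → !-nonzero (suc k) (trans (sym (e r₀)) (cong (_* (suc k * choices p v)) z))))
  where
  positive : (∃ λ σ → rotationOK fam p r₀ σ ≡ true) → + ∣ Y ∣ ≡ Y
  positive (σ , t) = proj₂ (value v _ Y (each r₀ σ t))

 module Regular (fam : Family) (j k : ℕ) (j+k : p ≡ j + k)
  (all-deg : ∀ {n} (σ : Fin n → Fin n) r → degreeCond fam p σ r ≡ allF n (hasDeg σ p))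
  (total-fam : ∀ {n} (σ : Fin n → Fin n) (inj : Inj σ) (r : Fin n) (deg : ∀ x → false ≡ false → hasDeg σ p x ≡ true) (v e : ℕ)
   (size : countF n (not ∘ discover (λ _ → false) (orbL σ p r)) ≡ v * p) (edges : e + e ≡ p + v * p) (cycles : numCycles σ ≡ suc v)
   (euler : f + v ≡ suc e) (eulerF : 2 * numCycles σ + 2 * f ≡ n + 4) →
   + total (checks fam p f m σ r) ≡ + choices p v ℤ.* N j k [] f m) where

  private
   sound : ∀ {n} {r : Fin n} {σ} → rotationOK fam p r σ ≡ true → Inj σ × (∀ x → hasDeg σ p x ≡ true)
   sound {n} {r} {σ} t with ∧-split {isPerm σ} t
   ... | a , b = isPerm-inj a , allF-sound n (trans (sym (all-deg σ r)) b)

   cycles : ∀ {n} {r : Fin n} {σ} → rotationOK fam p r σ ≡ true → ∃ λ v → n ≡ v * p × numCycles σ ≡ v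
   cycles {n} {r} {σ} t with sound {r = r} t
   ... | inj , deg with count-cycles inj (suc (suc p')) n (λ _ → false) [] (≤-reflexive (countF-full n)) (λ _ → refl)
               (λ x _ → deg x) [] [] (λ _ ())
   ...   | v , e , c = v , trans (sym (countF-full n)) e , c

   number : ∀ {n} v → n ≡ suc v * p → (r : Fin n) → rotations fam r * choices p (suc v) ≡ (suc v * p) !
   number {n} v n≡ r = countσ (suc v) (trans (countF-full n) n≡)
    where
    open Rotation (suc (suc p')) (λ _ → false) (rotationOK fam p r)
     (λ t → proj₁ (sound t) , (λ _ ()) , (λ x _ → proj₂ (sound t) x))
     (λ {σ} inj _ deg → ∧-join (inj-isPerm inj) (trans (all-deg σ r) (allF-complete n (λ x → deg x refl))))

   rooted : ∀ {n} v → n ≡ suc v * p → Fin n → 2 * suc v + 2 * f ≡ n + 4 →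
    countL (valid fam p f m) (allLabelled n) ≡ ∣ N j k [] f m ∣ * n ! × + ∣ N j k [] f m ∣ ≡ N j k [] f m
   rooted {n} v n≡ r₀ eu = counted fam v (N j k [] f m) r₀ each
     (λ r → trans (cong (λ x → rotations fam r * (x * choices p v)) n≡) (trans (number v n≡ r) (cong _! (sym n≡))))
    where
    h = halve n v eu
    each : ∀ r σ → rotationOK fam p r σ ≡ true → + total (checks fam p f m σ r) ≡ + choices p v ℤ.* N j k [] f m
    each r σ t = total-fam σ inj r (λ x _ → deg x) v (proj₁ h) size (trans (proj₁ (proj₂ h)) n≡) cyc (proj₂ (proj₂ h))
      (subst (λ k → 2 * k + 2 * f ≡ n + 4) (sym cyc) eu)
     where
     inj = proj₁ (sound {r = r} t)
     deg = proj₂ (sound {r = r} t)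
     V = proj₁ (cycles {r = r} t)
     cyc : numCycles σ ≡ suc v
     cyc = trans (proj₂ (proj₂ (cycles {r = r} t))) (sym (*-cancelʳ-≡ (suc v) V p (trans (sym n≡) (proj₁ (proj₂ (cycles {r = r} t))))))
     size : countF n (not ∘ discover (λ _ → false) (orbL σ p r)) ≡ v * p
     size = +-cancelˡ-≡ p _ _ (trans (sym (Discover.discover-count inj {λ _ → false} (λ _ → refl) (suc (suc p')) {r} (deg r) refl))
          (trans (countF-full n) n≡))

  shape : Shape fam (λ v → suc v * p) j k
  shape = record
   { rooted = λ v eu → rooted v refl zero eu
   ; none = λ n q → rooted-zero fam (λ r σ t → absent n q r (cycles t))
   ; formula = λ v → cong (λ z → z + v * p) j+k }
   where
   absent : ∀ n → (∀ v → n ≡ suc v * p → 2 * suc v + 2 * f ≢ n + 4) → ∀ {σ : Fin n → Fin n} (r : Fin n) →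
    (∃ λ v → n ≡ v * p × numCycles σ ≡ v) → 2 * numCycles σ + 2 * f ≢ n + 4
   absent _ q () (zero , refl , _)
   absent n q r (suc v , e , c) eu = q v e (subst (λ k → 2 * k + 2 * f ≡ n + 4) c eu)

 module Pendant where

  private
   only : ∀ {n} → Fin n → Fin n → Bool
   only r x = x =ᶠ r

   sound : ∀ {n} {r : Fin n} {σ} → rotationOK quasiPValent p r σ ≡ true →
    Inj σ × hasDeg σ 1 r ≡ true × (∀ x → only r x ≡ false → hasDeg σ p x ≡ true)
   sound {n} {r} {σ} t with ∧-split {isPerm σ} t
   ... | a , b with ∧-split {hasDeg σ 1 r} b
   ...   | b1 , b2 = isPerm-inj a , b1 , λ x q → either (only r x) q (allF-sound n {λ h → (h =ᶠ r) ∨ hasDeg σ p h} b2 x)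
    where
    either : ∀ a {b} → a ≡ false → a ∨ b ≡ true → b ≡ true
    either false _ q = q

   fixed : ∀ {n} {r : Fin n} {σ} → hasDeg σ 1 r ≡ true → σ r ≡ r
   fixed {r = r} {σ} t = =ᶠ-eq (proj₁ (∧-split {σ r =ᶠ r} t))

   cycles : ∀ {n} {r : Fin n} {σ} → rotationOK quasiPValent p r σ ≡ true → ∃ λ v → countF n (not ∘ only r) ≡ v * p × numCycles σ ≡ suc v
   cycles {n} {r} {σ} t with sound {r = r} {σ} t
   ... | inj , d1 , deg = count-cycles inj (suc (suc p')) _ (only r) (r ∷ []) ≤-refl stable deg ([] ∷ [])
       (=ᶠ-refl r ∷ []) (λ x q → here (0 , =ᶠ-eq q))
    where
    stable : StableSet σ (only r)
    stable x = bool-iff (λ q → =ᶠ-true (inj (trans (=ᶠ-eq q) (sym (fixed {σ = σ} d1)))))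
              (λ q → =ᶠ-true (trans (cong σ (=ᶠ-eq q)) (fixed {σ = σ} d1)))

   others : ∀ {n k} → n ≡ suc k → (r : Fin n) → countF n (not ∘ only r) ≡ k
   others {k = k} refl r = suc-injective (sym (trans (sym (countF-full (suc k)))
    (trans (countF-remove (suc k) (λ _ → true) (r ∷ []) ([] ∷ []) (λ _ → refl))
     (cong suc (countF-cong (suc k) (λ x → cong not (∨-identityʳ (only r x))))))))
    where open import Data.Bool.Properties using (∨-identityʳ)

   number : ∀ {n} v → n ≡ suc (v * p) → (r : Fin n) → rotations quasiPValent r * choices p v ≡ (v * p) !
   number {n} v n≡ r = countσ v (others n≡ r)
    where
    one : ∀ x a {b} → only r x ≡ a → (only r x ≡ false → b ≡ true) → only r x ∨ b ≡ true
    one x true  q g = ∨-left q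
    one x false q g = ∨-right {only r x} (g q)
    parts : ∀ {σ} → rotationOK quasiPValent p r σ ≡ true →
     Inj σ × (∀ x → only r x ≡ true → σ x ≡ x) × (∀ x → only r x ≡ false → hasDeg σ p x ≡ true)
    parts {σ} t = let inj , d1 , deg = sound {r = r} {σ} t in
     inj , (λ x q → trans (cong σ (=ᶠ-eq q)) (trans (fixed {σ = σ} d1) (sym (=ᶠ-eq q)))) , deg
    open Rotation (suc (suc p')) (only r) (rotationOK quasiPValent p r) parts
     (λ {σ} inj fix deg → ∧-join (inj-isPerm inj) (∧-join (∧-join (=ᶠ-true (fix r (=ᶠ-refl r))) refl)
      (allF-complete n {λ h → (h =ᶠ r) ∨ hasDeg σ p h} (λ x → one x (only r x) refl (deg x)))))

   rooted : ∀ {n} v → n ≡ suc (v * p) → Fin n → 2 * suc v + 2 * f ≡ n + 4 →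
    countL (valid quasiPValent p f m) (allLabelled n) ≡ ∣ N 1 0 [] f m ∣ * n ! × + ∣ N 1 0 [] f m ∣ ≡ N 1 0 [] f m
   rooted {n} v n≡ r₀ eu = counted quasiPValent v (N 1 0 [] f m) r₀ each (λ r → total-number r (number v n≡ r))
    where
    open import Data.Bool.Properties using (∨-identityʳ)
    h = halve n v eu
    factorial : ∀ {n k} → n ≡ suc k → n * k ! ≡ n !
    factorial refl = refl
    total-number : ∀ r → rotations quasiPValent {n} r * choices p v ≡ (v * p) ! → rotations quasiPValent {n} r * (n * choices p v) ≡ n !
    total-number r e = trans (solve 3 (λ a b c → a :* (b :* c) := b :* (a :* c)) refl (rotations quasiPValent r) n (choices p v))
      (trans (cong (n *_) e) (factorial n≡))
     where open +-*-Solver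
    each : ∀ r σ → rotationOK quasiPValent p r σ ≡ true → + total (checks quasiPValent p f m σ r) ≡ + choices p v ℤ.* N 1 0 [] f m
    each r σ t = Start.total-good σ inj r p' (only r) deg 0 d1 (λ x q → here (=ᶠ-eq q)) v (proj₁ h) f m
      (trans (countF-cong n (λ x → cong not (∨-identityʳ (only r x)))) (others n≡ r)) (trans (proj₁ (proj₂ h)) n≡) cyc (proj₂ (proj₂ h))
      (subst (λ k → 2 * k + 2 * f ≡ n + 4) (sym cyc) eu) R
     where
     inj = proj₁ (sound {r = r} {σ} t)
     d1 = proj₁ (proj₂ (sound {r = r} {σ} t))
     deg = proj₂ (proj₂ (sound {r = r} {σ} t))
     V = proj₁ (cycles {r = r} {σ} t)
     cyc : numCycles σ ≡ suc v
     cyc = trans (proj₂ (proj₂ (cycles {r = r} {σ} t))) (cong suc (sym (*-cancelʳ-≡ v V p (trans (sym (others n≡ r)) (proj₁ (proj₂ (cycles {r = r} {σ} t)))))))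

  shape : Shape quasiPValent (λ v → suc (v * p)) 1 0
  shape = record { rooted = λ v eu → rooted v refl zero eu ; none = none ; formula = λ v → refl }
   where
   none : ∀ n → (∀ v → n ≡ suc (v * p) → 2 * suc v + 2 * f ≢ n + 4) → countL (valid quasiPValent p f m) (allLabelled n) ≡ 0
   none zero    q = rooted-zero quasiPValent {0} (λ ())
   none (suc k) q = rooted-zero quasiPValent λ r σ t eu →
    let v , e , c = cycles {r = r} {σ} t in
    q v (cong suc (trans (sym (others refl r)) e)) (subst (λ k' → 2 * k' + 2 * f ≡ suc k + 4) c eu)

 shape-pValent : Shape pValent (λ v → suc v * p) p 0
 shape-pValent = Regular.shape pValent p 0 (sym (+-identityʳ p)) (λ _ _ → refl)
  (λ σ inj r deg v e size edges cyc eu euF → Start.total-good σ inj r p' (λ _ → false) deg (suc (suc p'))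
   (deg r refl) (λ _ ()) v e f m size edges cyc eu euF R)

 shape-rootNotInF : Shape rootNotInF (λ v → suc v * p) (suc (suc p')) 1
 shape-rootNotInF = Regular.shape rootNotInF (suc (suc p')) 1 (sym (+-comm (suc (suc p')) 1)) (λ _ _ → refl)
  (λ σ inj r deg v e size edges cyc eu euF → Start.total-good-root σ inj r p' (λ _ → false) deg (suc (suc p'))
   (deg r refl) (λ _ ()) v e f m size edges cyc eu euF R)

 module _ {fam size j k} (S : Shape fam size j k) where
  open Shape S

  private
   Euler Balanced : ℕ → Set
   Euler v = 2 * suc v + 2 * f ≡ size v + 4
   Balanced v = f + f ≡ 2 + (j + k + 0) + v * suc p'

   open +-*-Solver

   to-balanced : ∀ v → Euler v → Balanced v
   to-balanced v eu = +-cancelˡ-≡ (2 + (v + v)) _ _ (trans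
    (solve 2 (λ v f → con 2 :+ (v :+ v) :+ (f :+ f) := con 2 :* (con 1 :+ v) :+ con 2 :* f) refl v f)
    (trans eu (trans (cong (λ z → z + 4) (formula v))
     (solve 4 (λ j k v p' → j :+ k :+ v :* (con 3 :+ p') :+ con 4 := con 2 :+ (v :+ v) :+ (con 2 :+ (j :+ k :+ con 0) :+ v :* (con 1 :+ p'))) refl j k v p'))))

   from-balanced : ∀ v → Balanced v → Euler v
   from-balanced v b = trans (solve 2 (λ v f → con 2 :* (con 1 :+ v) :+ con 2 :* f := con 2 :+ (v :+ v) :+ (f :+ f)) refl v f)
    (trans (cong (λ z → 2 + (v + v) + z) b) (trans
     (solve 4 (λ j k v p' → con 2 :+ (v :+ v) :+ (con 2 :+ (j :+ k :+ con 0) :+ v :* (con 1 :+ p')) := j :+ k :+ v :* (con 3 :+ p') :+ con 4) refl j k v p')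
     (cong (λ z → z + 4) (sym (formula v)))))

   unique-v : ∀ v w → Euler v → Euler w → v ≡ w
   unique-v v w a b = *-cancelʳ-≡ v w (suc p') (+-cancelˡ-≡ (2 + (j + k + 0)) _ _ (trans (sym (to-balanced v a)) (to-balanced w b)))

   small : ∀ v → Balanced v → v < suc (f + f)
   small v b = s≤s (≤-trans (m≤m*n v (suc p')) (≤-trans (m≤n+m (v * suc p') _) (≤-reflexive (sym b))))

   -- From v ≤ 2 f and Euler's relation, the size is at most 6 f, hence at most 2 p f.
   small-size : ∀ v → Euler v → size v < suc (2 * p * f + 1)
   small-size v eu = s≤s (≤-trans (+-cancelʳ-≤ 4 (size v) (6 * f) (≤-trans (≤-reflexive (sym eu))
     (≤-trans (≤-reflexive (solve 2 (λ v f → con 2 :* (con 1 :+ v) :+ con 2 :* f := v :+ v :+ (con 2 :+ (f :+ f))) refl v f))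
      (≤-trans (+-mono-≤ (+-mono-≤ v≤ v≤) ≤-refl)
       (≤-trans (≤-reflexive (solve 1 (λ f → f :+ f :+ (f :+ f) :+ (con 2 :+ (f :+ f)) := con 6 :* f :+ con 2) refl f))
        (+-monoʳ-≤ (6 * f) (s≤s (s≤s z≤n)))))))) (≤-trans (*-monoˡ-≤ f (*-monoʳ-≤ 2 {3} {p} (s≤s (s≤s (s≤s z≤n))))) (m≤m+n _ 1)))
    where
    v≤ : v ≤ f + f
    v≤ = ≤-pred (small v (to-balanced v eu))

   g : ℕ → ℕ
   g = countRooted fam p f m

   divide : ∀ n X → countL (valid fam p f m) (allLabelled n) ≡ X * n ! → g n ≡ X
   divide n X e = trans (cong (λ c → (c / (n !)) {{n !≢0}}) e) (m*n/n≡m X (n !) {{n !≢0}})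

  -- Euler's relation reads 2 f = 2 + j + k + v (p - 2). It has at most one solution v, so at most
  -- one number of half-edges contributes, and that number is in the range of summation. Without a
  -- solution the coefficient is zero by `vanish`.
  GF-value : GF fam p f m ≡ N j k [] f m
  GF-value with anyUpTo? (λ v → (2 * suc v + 2 * f) ℕ.≟ (size v + 4)) (suc (f + f))
  ... | yes (w , _ , eu) = trans (cong +_ (trans (sum-single (upTo (suc (2 * p * f + 1))) g (size w) (UniqueP.upTo⁺ _) (∈-upTo⁺ (small-size w eu))
      (λ n ne → divide n 0 (none n (λ v e eu' → ne (trans e (cong size (unique-v v w (subst (λ k → 2 * suc v + 2 * f ≡ k + 4) e eu') eu)))))))
     (divide (size w) _ (proj₁ (rooted w eu))))) (proj₂ (rooted w eu))
  ... | no ¬w = trans (cong +_ (sum-none (upTo (suc (2 * p * f + 1))) g (λ n → divide n 0 (none n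
     (λ v e eu → let eu' = subst (λ k → 2 * suc v + 2 * f ≡ k + 4) e eu in ¬w (v , small v (to-balanced v eu') , eu'))))))
    (sym (SeriesRecursion.vanish R j k [] f m (λ w b → ¬w (w , small w b , from-balanced w b))))

theorem4p1 : (p : ℕ) → 3 ≤ p → DAlgebraic (Fgf p) × (p % 2 ≡ 1 → DAlgebraic (Ggf p)) × DAlgebraic (Hgf p)
theorem4p1 (suc (suc (suc p'))) (s≤s (s≤s (s≤s z≤n))) =
  -- The three initial words: p undecided half-edges at the root vertex, a single one at the vertex
  -- of degree 1, and p - 1 undecided ones together with the excluded root half-edge.
  power⇒DAlgebraic p' (suc (suc (suc p'))) (λ f m → GF-value p' f m R (shape-pValent p' f m R)) ,
  (λ _ → power⇒DAlgebraic p' 1 (λ f m → GF-value p' f m R (Pendant.shape p' f m R))) ,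
  power-X⇒DAlgebraic p' (suc (suc p')) (λ f m → GF-value p' f m R (shape-rootNotInF p' f m R))
 where
 open Coefficients
 R = seriesRecursion p'
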